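{- Let $q\ge 7$ be an odd prime power and let $\Sigma_\infty$ be a hyperplane of $\mathrm{PG}(4,q)$. Let $\mathcal C$ be a set of $q^2$ affine points (called $\mathcal C$-points), and suppose there exists a set of affine planes, called $\mathcal C$-planes, satisfying: (A1) each $\mathcal C$-plane meets $\mathcal C$ in a $q$-arc; further, every plane of $\mathrm{PG}(4,q)$ meeting $\mathcal C$ in more than four points is a $\mathcal C$-plane; (A2) every pair of distinct points of $\mathcal C$ lies in exactly one $\mathcal C$-plane; (A3) every affine point of $\mathrm{PG}(4,q)$ is of one of three types: a point of $\mathcal C$, a point on no $\mathcal C$-plane, or a point on exactly two $\mathcal C$-planes. Then there exists a unique spread $\mathcal S$ of $\Sigma_\infty$ such that the $\mathcal C$-points, viewed as points of the Bruck–Bose plane $\mathcal P(\mathcal S)$, form a $q^2$-arc of $\mathcal P(\mathcal S)$. Moreover, $\mathcal S$ is regular, so $\mathcal P(\mathcal S)\cong \mathrm{PG}(2,q^2)$, and this $q^2$-arc can be completed to a conic of $\mathrm{PG}(2,q^2)$.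
   Context: $\Sigma_\infty$ is called the hyperplane at infinity; points of $\mathrm{PG}(4,q)\setminus\Sigma_\infty$ are affine points, and lines/planes not contained in $\Sigma_\infty$ are affine lines/affine planes. A $k$-arc in a projective plane is a set of $k$ points no three collinear. A spread of $\Sigma_\infty\cong\mathrm{PG}(3,q)$ is a set of $q^2+1$ pairwise disjoint lines covering all points of $\Sigma_\infty$; it is regular if for any three distinct lines of the spread the regulus they determine is contained in the spread. Bruck–Bose plane $\mathcal P(\mathcal S)$: its affine points are the affine points of $\mathrm{PG}(4,q)$, its affine lines are the affine planes of $\mathrm{PG}(4,q)$ meeting $\Sigma_\infty$ in a line of $\mathcal S$, incidence being inclusion; it is completed to a projective plane of order $q^2$ by a line at infinity whose points are the elements of $\mathcal S$ (an affine plane through $s\in\mathcal S$ is incident with the point $s$). $\mathcal P(\mathcal S)$ is Desarguesian iff $\mathcal S$ is regular. -}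

module Defs where

open import Level using (0ℓ)
open import Data.Nat using (ℕ; suc; _^_; _≤_) renaming (_+_ to _+ℕ_; _*_ to _*ℕ_)
open import Data.Nat.Primality using (Prime)
open import Data.Nat.Divisibility using (_∣_)
open import Data.Fin using (Fin)
open import Data.Vec using (Vec; []; _∷_; zipWith; map; replicate)
open import Data.Product using (Σ; ∃; ∃-syntax; _×_; _,_)
open import Data.Sum using (_⊎_)
open import Data.Unit using (⊤)
open import Data.Empty using (⊥)
open import Relation.Nullary using (¬_)
open import Relation.Binary.PropositionalEquality using (_≡_; _≢_)
open import Algebra.Structures using (IsCommutativeRing)

IsPrimePower : ℕ → Set
IsPrimePower q = ∃[ p ] ∃[ k ] (Prime p × q ≡ p ^ suc k)

Odd : ℕ → Set
Odd q = ¬ (2 ∣ q)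

-- A finite field with n elements, realised on the carrier Fin n
-- (every finite field of order n is isomorphic to one of these).

record FiniteField (n : ℕ) : Set where
  infixl 6 _+_
  infixl 7 _*_
  field
    _+_ _*_ : Fin n → Fin n → Fin n
    -_      : Fin n → Fin n
    0# 1#   : Fin n
    isCommutativeRing : IsCommutativeRing _≡_ _+_ _*_ -_ 0# 1#
    0≢1     : 0# ≢ 1#
    inverse : ∀ x → x ≢ 0# → ∃[ y ] (x * y ≡ 1#)

Subset : Set → Set₁
Subset A = A → Set

SetOfSubsets : Set → Set₁
SetOfSubsets A = Subset A → Set

infix 4 _≐_
_≐_ : {A : Set} → Subset A → Subset A → Set
P ≐ Q = ∀ x → (P x → Q x) × (Q x → P x)

_∩_ : {A : Set} → Subset A → Subset A → Subset A
(P ∩ Q) x = P x × Q x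

HasSize : {A : Set} → Subset A → ℕ → Set
HasSize {A} P n =
  Σ (Fin n → A) λ f →
    (∀ i j → f i ≡ f j → i ≡ j) ×
    (∀ x → (P x → ∃[ i ] (f i ≡ x)) × (∃[ i ] (f i ≡ x) → P x))

MoreThanFour : {A : Set} → Subset A → Set
MoreThanFour {A} P =
  Σ (Fin 5 → A) λ f → (∀ i j → f i ≡ f j → i ≡ j) × (∀ i → P (f i))

-- Geometry over a finite field F of order q.
--
-- Model: PG(4,q) = AG(4,q) ∪ Σ∞ where the affine points are the vectors
-- of F^4 and Σ∞ ≅ PG(3,q) is the projective space of the vector space
-- F^4 (a point of Σ∞ is a 1-dim subspace, a line of Σ∞ is a 2-dim
-- subspace of F^4).  An affine plane of PG(4,q) is a translate p + W of
-- a 2-dim subspace W of F^4; it meets Σ∞ exactly in the line W.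

module Geometry {q : ℕ} (F : FiniteField q) where
  open FiniteField F

  K = Fin q

  Pt : Set
  Pt = Vec K 4

  infixl 6 _⊕_
  infixr 7 _·_
  _⊕_ : Pt → Pt → Pt
  _⊕_ = zipWith _+_

  _·_ : K → Pt → Pt
  a · v = map (a *_) v

  0v : Pt
  0v = replicate 4 0#

  Independent : Pt → Pt → Set
  Independent u v = ∀ a b → a · u ⊕ b · v ≡ 0v → (a ≡ 0#) × (b ≡ 0#)

  Span : Pt → Pt → Subset Pt
  Span u v x = ∃[ a ] ∃[ b ] (x ≡ a · u ⊕ b · v)

  IsLineAtInf : Subset Pt → Set
  IsLineAtInf W = ∃[ u ] ∃[ v ] (Independent u v × W ≐ Span u v)

  Meets : Subset Pt → Subset Pt → Set
  Meets W W′ = ∃[ x ] (x ≢ 0v × W x × W′ x)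

  Translate : Pt → Subset Pt → Subset Pt
  Translate p W x = ∃[ w ] (W w × x ≡ p ⊕ w)

  IsAffPlane : Subset Pt → Set₁
  IsAffPlane π = ∃[ p ] ∃[ W ] (IsLineAtInf W × π ≐ Translate p W)

  Collinear : Pt → Pt → Pt → Set
  Collinear x y z =
    ∃[ p ] ∃[ d ] (d ≢ 0v × OnL p d x × OnL p d y × OnL p d z)
    where
    OnL : Pt → Pt → Pt → Set
    OnL p d w = ∃[ t ] (w ≡ p ⊕ t · d)

  Distinct3 : Pt → Pt → Pt → Set
  Distinct3 x y z = x ≢ y × y ≢ z × x ≢ z

  IsArc : Subset Pt → ℕ → Set
  IsArc A k = HasSize A k ×
    (∀ x y z → A x → A y → A z → Distinct3 x y z → ¬ Collinear x y z)

  record CSystem (𝒞 : Subset Pt) (𝒫 : SetOfSubsets Pt) : Set₁ where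
    field
      size      : HasSize 𝒞 (q *ℕ q)
      affine    : ∀ π → 𝒫 π → IsAffPlane π
      A1-arc    : ∀ π → 𝒫 π → IsArc (𝒞 ∩ π) q
      A1-many   : ∀ π → IsAffPlane π → MoreThanFour (𝒞 ∩ π) →
                  ∃[ π′ ] (𝒫 π′ × π ≐ π′)
      A2        : ∀ x y → 𝒞 x → 𝒞 y → x ≢ y →
                  ∃[ π ] (𝒫 π × π x × π y ×
                          (∀ π′ → 𝒫 π′ → π′ x → π′ y → π′ ≐ π))
      A3        : ∀ x →
                  𝒞 x
                  ⊎ (∀ π → 𝒫 π → ¬ π x)
                  ⊎ (∃[ π₁ ] ∃[ π₂ ] (𝒫 π₁ × 𝒫 π₂ × π₁ x × π₂ x × ¬ (π₁ ≐ π₂) ×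
                       (∀ π → 𝒫 π → π x → (π ≐ π₁) ⊎ (π ≐ π₂))))

  -- Spreads of Σ∞: q²+1 pairwise disjoint lines covering Σ∞
  -- (indexed by Fin (q²+1); pairwise disjointness makes them distinct).

  N : ℕ
  N = q *ℕ q +ℕ 1

  Spread : Set₁
  Spread = Fin N → Subset Pt

  IsSpread : Spread → Set
  IsSpread S =
    (∀ i → IsLineAtInf (S i)) ×
    (∀ i j → i ≢ j → ∀ x → S i x → S j x → x ≡ 0v) ×
    (∀ x → x ≢ 0v → ∃[ i ] (S i x))

  SameSpread : Spread → Spread → Set
  SameSpread S S′ = (∀ i → ∃[ j ] (S i ≐ S′ j)) × (∀ j → ∃[ i ] (S′ j ≐ S i))

  -- regular: for distinct lines S i, S j, S k the regulus they determine
  -- (= the lines meeting every transversal of the three) is in the spread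
  Regular : Spread → Set₁
  Regular S = ∀ i j k → i ≢ j → j ≢ k → i ≢ k →
    ∀ m → IsLineAtInf m →
    (∀ t → IsLineAtInf t → Meets t (S i) → Meets t (S j) → Meets t (S k) →
       Meets m t) →
    ∃[ l ] (m ≐ S l)

  BBPt : Set
  BBPt = Pt ⊎ Fin N

  data BBLine : Set where
    ℓ∞  : BBLine
    aff : Pt → Fin N → BBLine

  module _ (S : Spread) where
    open Data.Sum using (inj₁; inj₂)

    Inc : BBPt → BBLine → Set
    Inc (inj₁ x) ℓ∞        = ⊥
    Inc (inj₂ j) ℓ∞        = ⊤
    Inc (inj₁ x) (aff p i) = Translate p (S i) x
    Inc (inj₂ j) (aff p i) = j ≡ i

    BBCollinear : BBPt → BBPt → BBPt → Set
    BBCollinear a b c = ∃[ ℓ ] (Inc a ℓ × Inc b ℓ × Inc c ℓ)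

    IsBBArc : Subset Pt → ℕ → Set
    IsBBArc A k = HasSize A k ×
      (∀ x y z → A x → A y → A z → Distinct3 x y z →
         ¬ BBCollinear (inj₁ x) (inj₁ y) (inj₁ z))

module Plane {n : ℕ} (L : FiniteField n) where
  open FiniteField L

  V3 : Set
  V3 = Vec (Fin n) 3

  0v3 : V3
  0v3 = 0# ∷ 0# ∷ 0# ∷ []

  ProjEq : V3 → V3 → Set
  ProjEq u v = ∃[ λ′ ] (λ′ ≢ 0# × u ≡ map (λ′ *_) v)

  det3 : Fin n → Fin n → Fin n → Fin n → Fin n → Fin n →
         Fin n → Fin n → Fin n → Fin n
  det3 a b c d e f g h i =
    a * (e * i + - (f * h)) + - (b * (d * i + - (f * g))) + c * (d * h + - (e * g))

  Det : V3 → V3 → V3 → Fin n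
  Det (a ∷ b ∷ c ∷ []) (d ∷ e ∷ f ∷ []) (g ∷ h ∷ i ∷ []) = det3 a b c d e f g h i

  PCollinear : V3 → V3 → V3 → Set
  PCollinear u v w = Det u v w ≡ 0#

  record QForm : Set where
    constructor qform
    field a b c d e f : Fin n

  evalQ : QForm → V3 → Fin n
  evalQ (qform a b c d e f) (x ∷ y ∷ z ∷ []) =
    a * x * x + b * y * y + c * z * z + d * x * y + e * x * z + f * y * z

  -- non-degenerate (odd characteristic): the associated symmetric
  -- matrix [[2a,d,e],[d,2b,f],[e,f,2c]] is invertible
  NonDegenerate : QForm → Set
  NonDegenerate (qform a b c d e f) =
    det3 (a + a) d e d (b + b) f e f (c + c) ≢ 0#

  OnConic : QForm → V3 → Set
  OnConic Q v = evalQ Q v ≡ 0#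

module _ {q : ℕ} (F : FiniteField q) where
  open Geometry F

  record BBIso (S : Spread) {n : ℕ} (L : FiniteField n) : Set where
    open Plane L
    field
      φ        : BBPt → V3
      nonzero  : ∀ a → φ a ≢ 0v3
      injective  : ∀ a b → ProjEq (φ a) (φ b) → a ≡ b
      surjective : ∀ v → v ≢ 0v3 → ∃[ a ] ProjEq (φ a) v
      collinear  : ∀ a b c →
        (BBCollinear S a b c → PCollinear (φ a) (φ b) (φ c)) ×
        (PCollinear (φ a) (φ b) (φ c) → BBCollinear S a b c)

  CompletesToConic : Spread → Subset Pt → Set
  CompletesToConic S 𝒞 =
    ∃[ L ] Σ (BBIso S {q *ℕ q} L) λ ι →
      let open Plane L in
      ∃[ Q ] (NonDegenerate Q × (∀ x → 𝒞 x → OnConic Q (BBIso.φ ι (Data.Sum.inj₁ x))))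

  Conclusion : Subset Pt → Set₁
  Conclusion 𝒞 =
    Σ Spread λ S →
      IsSpread S × IsBBArc S 𝒞 (q *ℕ q) ×
      (∀ S′ → IsSpread S′ → IsBBArc S′ 𝒞 (q *ℕ q) → SameSpread S S′) ×
      Regular S × CompletesToConic S 𝒞

-- Two C-planes through a C-point P can share an affine line ("P is on a
-- shared line"), and (A3) says that an affine point off 𝒞 is on exactly
-- one other C-plane.  The C-planes are the lines of an affine plane of
-- order q on 𝒞, so at most q - 1 of them are parallel to a given one π.
-- Counting the points of π by the second C-plane through them shows that
-- the shared lines of π all pass through one point V of Σ∞, and that there
-- is one through each C-point of π.  The C-planes sharing these lines with
-- π form a parallel class, and they in turn have V as their point, so two
-- parallel classes project from V to the two families of lines of a
-- hyperbolic paraboloid z = xy in AG(3,q).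
--
-- In coordinates (x , y , xy , f(x , y)) for 𝒞, a C-plane of another class
-- meets 𝒞 in y = μx + ν.  The paraboloid that belongs to its own point V′
-- expresses f as a quadratic polynomial, and f becomes x² + βy².  The
-- C-planes of slopes μ and μ′ share lines when βμμ′ = 1; since a C-plane
-- does not share lines with its parallels, β is not a square.  So with
-- θ² = β, X = x + yθ and Y = (x² + βy²) + 2xyθ, 𝒞 is the parabola Y = X²
-- of L², L = K(θ), and the L-lines through 0 are the regular spread.
--
-- If 𝒞 is an arc of the plane of another spread, each line of that spread
-- is an L-line or contains a vector (0 , e); in the latter case, unless it
-- is X = 0, some line of the spread contains the direction of a C-plane.

module Submission where

open import Defs
open import Algebra.Bundles using (AbelianGroup; CommutativeRing; RawRing)
import Algebra.Morphism.RingMonomorphism as RingMonomorphism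
open import Algebra.Morphism.Structures using (IsRingMonomorphism)
import Algebra.Properties.AbelianGroup as AbelianGroupProperties
import Algebra.Properties.CommutativeSemigroup as CommutativeSemigroupProperties
import Algebra.Properties.Ring as RingProperties
open import Algebra.Structures using (IsAbelianGroup; IsCommutativeRing)
open import Data.Bool using (Bool; true; false; not; _xor_; if_then_else_)
open import Data.Empty using (⊥; ⊥-elim)
open import Data.Fin as Fin
  using (Fin; zero; suc; _≟_; _<_; punchIn; punchOut; combine; remQuot; splitAt; inject≤; _↑ˡ_; _↑ʳ_)
open import Data.Fin.Properties
  using (any?; injective⇒≤; punchIn-injective; punchInᵢ≢i; punchOut-injective; suc-injective; <-cmp; _<?_
        ; combine-remQuot; remQuot-combine; splitAt-join; join-splitAt; inject≤-injective
        ; splitAt-↑ˡ; splitAt-↑ʳ; splitAt⁻¹-↑ˡ; splitAt⁻¹-↑ʳ)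
open import Data.List using (List; []; _∷_; foldr; length)
open import Data.List.Membership.Propositional using () renaming (_∈_ to _∈ₗ_)
open import Data.List.Properties using (≡-dec)
open import Data.List.Relation.Unary.Any using (here; there)
open import Data.Nat as ℕ using (ℕ; zero; suc; _≤_; s≤s; z≤n; _<ᵇ_)
  renaming (_+_ to _+ℕ_; _*_ to _*ℕ_; _≟_ to _≟ℕ_)
open import Data.Nat.Divisibility using (_∣_; divides)
import Data.Nat.Properties as ℕ
open import Data.Nat.Solver using (module +-*-Solver)
open import Data.Product using (Σ; ∃; ∃-syntax; _×_; _,_; proj₁; proj₂)
open import Data.Sum using (_⊎_; inj₁; inj₂; [_,_]′)
open import Data.Unit using (tt)
open import Data.Vec using (Vec; []; _∷_; zipWith) renaming (map to vmap)
open import Data.Vec.Properties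
  using (zipWith-assoc; zipWith-comm; zipWith-identityˡ; zipWith-identityʳ; zipWith-inverseˡ
        ; map-cong; map-∘; map-id; map-const)
  renaming (≡-dec to Vec-≡-dec)
open import Function using (_∘_; case_of_)
open import Relation.Binary using (tri<; tri≈; tri>)
open import Relation.Binary.PropositionalEquality
open import Relation.Nullary using (¬_; Dec; yes; no)
open import Relation.Nullary.Decidable
  using (map′; ¬?; _×-dec_; decidable-stable; False; toWitnessFalse; fromWitnessFalse)

-- Finite sets

-- Every count rests on one remark. Let x be an affine point of a C-plane π, off 𝒞 and on no shared
-- line of π. The second C-plane through x meets π in x alone, so it has no C-point on π, and
-- different x give different such planes. Hence there are at most q points x of this kind, whereas
-- each line of π has at least q - 2 points off 𝒞, and 2(q - 2) > q. This locates V but leaves room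
-- for one exceptional line of π through V. To show that no C-point is on it, a C-plane sharing a
-- line with π is compared with four further ones; that is where q ≥ 7 enters.
--
-- 𝒞 and the set of C-planes are bare predicates. C-points are named by their index in the
-- enumeration of 𝒞 and C-planes by two C-points, so that case distinctions become finite searches.
-- Dimension arguments turn into the fact that an injective map of a finite set to itself is
-- surjective. Field computations are linear consequences of hypotheses, given by cofactors and
-- checked by normalising integer polynomials.

Inj : {A B : Set} → (A → B) → Set
Inj f = ∀ {x y} → f x ≡ f y → x ≡ y

inj⇒surj : ∀ {n} (f : Fin n → Fin n) → Inj f → ∀ y → ∃ λ x → f x ≡ y
inj⇒surj {suc n} f inj y with any? (λ x → f x ≟ y)
... | yes r = r
... | no none = ⊥-elim (ℕ.1+n≰n (injective⇒≤ {f = g} (λ {x} {z} eq → inj (punchOut-injective (avoids x) (avoids z) eq))))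
  where
  avoids : ∀ x → y ≢ f x
  avoids x eq = none (x , sym eq)
  g : Fin (suc n) → Fin n
  g x = punchOut (avoids x)

inj-⊎ : ∀ {a b c} (f : Fin a ⊎ Fin b → Fin c) → Inj f → a ℕ.+ b ≤ c
inj-⊎ {a} {b} f inj = injective⇒≤ {f = f ∘ splitAt a} λ {x} {y} eq →
  trans (sym (join-splitAt a b x)) (trans (cong (Fin.join a b) (inj eq)) (join-splitAt a b y))

inj-× : ∀ {a b c} (f : Fin a → Fin b → Fin c) →
        (∀ {x y x′ y′} → f x y ≡ f x′ y′ → x ≡ x′ × y ≡ y′) → a ℕ.* b ≤ c
inj-× {a} {b} f inj = injective⇒≤ {f = λ k → f (proj₁ (remQuot {a} b k)) (proj₂ (remQuot {a} b k))} λ {k} {l} eq →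
  trans (sym (combine-remQuot {a} b k))
    (trans (cong₂ combine (proj₁ (inj eq)) (proj₂ (inj eq))) (combine-remQuot {a} b l))

-- Since `f` is injective, an entry of `xs` excludes at most one index. The recursion drops that
-- index, or an arbitrary one if the entry is no value of `f`, so the count is the same in both
-- cases.
avoid : ∀ {n} {A : Set} → ((x y : A) → Dec (x ≡ y)) → (f : Fin n → A) → Inj f →
        ∀ m (xs : List A) → m ℕ.+ length xs ≤ n →
        Σ (Fin m → Fin n) λ e → Inj e × (∀ i {x} → x ∈ₗ xs → f (e i) ≢ x)
avoid _≟′_ f f-inj m [] le = (λ i → inject≤ i le′) , (λ eq → inject≤-injective le′ le′ _ _ eq) , λ _ ()
  where le′ = subst (_≤ _) (ℕ.+-identityʳ m) le
avoid {n} _≟′_ f f-inj m (x ∷ xs) le with avoid _≟′_ f f-inj (suc m) xs (subst (_≤ n) (ℕ.+-suc m (length xs)) le)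
... | e , inj , av with any? (λ i → f (e i) ≟′ x)
...   | yes (i , eᵢ≡x) = e ∘ punchIn i , (λ eq → punchIn-injective i _ _ (inj eq)) ,
        λ { j (here refl) eq → punchInᵢ≢i i j (inj (f-inj (trans eq (sym eᵢ≡x)))) ; j (there y∈) → av _ y∈ }
...   | no none = e ∘ suc , (λ eq → suc-injective (inj eq)) ,
        λ { j (here refl) eq → none (_ , eq) ; j (there y∈) → av _ y∈ }

at-most-one : ∀ {n} {P : Fin (suc n) → Set} → (∀ i → Dec (P i)) →
              (∀ i j → P i → P j → i ≡ j) → ∃ λ t → ∀ i → P i → i ≡ t
at-most-one P? uniq with any? P?
... | yes (t , Pt) = t , λ i Pi → uniq i t Pi Pt
... | no none = zero , λ i Pi → ⊥-elim (none (i , Pi))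

-- Both witnesses may be defaults. In this form the two exceptional indices can go on a list for
-- `avoid` whether or not they occur.
at-most-two : ∀ {n} {P : Fin (suc n) → Set} → (∀ i → Dec (P i)) →
              (∀ i j k → P i → P j → P k → i ≢ j → j ≢ k → i ≢ k → ⊥) →
              ∃ λ s → ∃ λ t → ∀ i → P i → i ≢ s → i ≡ t
at-most-two {P = P} P? uniq with any? P?
... | no none = zero , zero , λ i Pi _ → ⊥-elim (none (i , Pi))
... | yes (s , Ps) with at-most-one {P = λ i → P i × i ≢ s}
        (λ i → map′ (λ (a , b) → a , b) (λ (a , b) → a , b) (P? i ×-dec ¬? (i ≟ s)))
        (λ i j (Pi , i≢s) (Pj , j≢s) → case i ≟ j of λ
          { (yes i≡j) → i≡j ; (no i≢j) → ⊥-elim (uniq i j s Pi Pj Ps i≢j j≢s i≢s) })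
...   | t , h = s , t , λ i Pi i≢s → h i (Pi , i≢s)

enumerate : ∀ {n} {P : Fin n → Set} → (∀ i → Dec (P i)) →
            ∃ λ k → Σ (Fin k → Fin n) λ e → Inj e × (∀ i → P (e i)) × (∀ x → P x → ∃ λ i → e i ≡ x)
enumerate {zero} P? = 0 , (λ ()) , (λ {}) , (λ ()) , λ ()
enumerate {suc n} {P} P? with enumerate {n} (P? ∘ suc) | P? zero
... | k , e , inj , sat , all | no ¬P0 = k , suc ∘ e , (λ eq → inj (suc-injective eq)) , sat ,
      λ { zero P0 → ⊥-elim (¬P0 P0) ; (suc x) Px → proj₁ (all x Px) , cong suc (proj₂ (all x Px)) }
... | k , e , inj , sat , all | yes P0 = suc k , e′ , inj′ , (λ { zero → P0 ; (suc i) → sat i }) ,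
      λ { zero _ → zero , refl ; (suc x) Px → suc (proj₁ (all x Px)) , cong suc (proj₂ (all x Px)) }
  where
  e′ : Fin (suc k) → Fin (suc n)
  e′ zero = zero
  e′ (suc i) = suc (e i)
  inj′ : Inj e′
  inj′ {zero} {zero} _ = refl
  inj′ {suc i} {suc j} eq = cong suc (inj (suc-injective eq))

-- The elements with `x < f x` and their images are two halves of equal size. Applied to adding 1,
-- this turns odd order into `1# + 1# ≢ 0#`.
involution⇒even : ∀ {n} (f : Fin n → Fin n) → (∀ x → f (f x) ≡ x) → (∀ x → f x ≢ x) → 2 ∣ n
involution⇒even {n} f inv nofix with enumerate (λ x → x <? f x)
... | k , e , inj , sat , all =
  divides k (trans (ℕ.≤-antisym n≤ ≤n) (trans (cong (k ℕ.+_) (sym (ℕ.+-identityʳ k))) (ℕ.*-comm 2 k)))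
  where
  f-inj : Inj f
  f-inj {x} {y} eq = trans (sym (inv x)) (trans (cong f eq) (inv y))

  g : Fin k ⊎ Fin k → Fin n
  g = [ e , f ∘ e ]′

  small≢large : ∀ i j → e i ≢ f (e j)
  small≢large i j eq = ℕ.<-asym (sat j)
    (subst₂ _<_ eq (trans (cong f eq) (inv (e j))) (sat i))

  g-inj : Inj g
  g-inj {inj₁ i} {inj₁ j} eq = cong inj₁ (inj eq)
  g-inj {inj₁ i} {inj₂ j} eq = ⊥-elim (small≢large i j eq)
  g-inj {inj₂ i} {inj₁ j} eq = ⊥-elim (small≢large j i (sym eq))
  g-inj {inj₂ i} {inj₂ j} eq = cong inj₂ (inj (f-inj eq))

  ≤n : k ℕ.+ k ≤ n
  ≤n = inj-⊎ g g-inj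

  g-surj : ∀ x → ∃ λ s → g s ≡ x
  g-surj x with <-cmp x (f x)
  ... | tri< x<fx _ _ = inj₁ (proj₁ (all x x<fx)) , proj₂ (all x x<fx)
  ... | tri≈ _ eq _ = ⊥-elim (nofix x (sym eq))
  ... | tri> _ _ fx<x with all (f x) (subst (f x <_) (sym (inv x)) fx<x)
  ...   | i , eq = inj₂ i , trans (cong f eq) (inv x)

  s : Fin n → Fin k ⊎ Fin k
  s x = proj₁ (g-surj x)

  s-inj : Inj s
  s-inj {x} {y} eq = trans (sym (proj₂ (g-surj x))) (trans (cong g eq) (proj₂ (g-surj y)))

  n≤ : n ≤ k ℕ.+ k
  n≤ = injective⇒≤ {f = λ x → Fin.join k k (s x)} λ {x} {y} eq → s-inj
    (trans (sym (splitAt-join k k (s x))) (trans (cong (splitAt k) eq) (splitAt-join k k (s y))))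

-- Search and counting for vectors over a finite set

Searchable : Set → Set₁
Searchable A = ∀ {P : A → Set} → (∀ x → Dec (P x)) → Dec (∃ P)

searchVec : ∀ {n} k → Searchable (Vec (Fin n) k)
searchVec zero P? = map′ (λ p → [] , p) (λ { ([] , p) → p }) (P? [])
searchVec (suc k) P? = map′ (λ { (x , v , p) → x ∷ v , p }) (λ { (x ∷ v , p) → x , v , p })
  (any? λ x → searchVec k (λ v → P? (x ∷ v)))

code : ∀ {n} k → Vec (Fin n) k → Fin (n ℕ.^ k)
code zero [] = zero
code (suc k) (x ∷ v) = combine x (code k v)

decode : ∀ {n} k → Fin (n ℕ.^ k) → Vec (Fin n) k
decode zero i = []
decode {n} (suc k) i = proj₁ (remQuot {n} (n ℕ.^ k) i) ∷ decode k (proj₂ (remQuot {n} (n ℕ.^ k) i))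

decode-code : ∀ {n} k (v : Vec (Fin n) k) → decode k (code k v) ≡ v
decode-code zero [] = refl
decode-code (suc k) (x ∷ v) =
  trans (cong (λ (y , i) → y ∷ decode k i) (remQuot-combine x (code k v))) (cong (x ∷_) (decode-code k v))

code-decode : ∀ {n} k (i : Fin (n ℕ.^ k)) → code k (decode {n} k i) ≡ i
code-decode zero zero = refl
code-decode {n} (suc k) i =
  trans (cong (combine (proj₁ (remQuot {n} (n ℕ.^ k) i))) (code-decode k (proj₂ (remQuot {n} (n ℕ.^ k) i))))
    (combine-remQuot {n} (n ℕ.^ k) i)

-- Applied to the linear combinations of four independent vectors, it makes them a basis of K⁴.
vec-inj⇒surj : ∀ {n k} (f : Vec (Fin n) k → Vec (Fin n) k) → Inj f → ∀ y → ∃ λ x → f x ≡ y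
vec-inj⇒surj {n} {k} f inj y with inj⇒surj (λ i → code k (f (decode k i)))
    (λ {i} {j} eq → trans (sym (code-decode {n} k i)) (trans (cong (code k)
      (inj (trans (sym (decode-code k _)) (trans (cong (decode k) eq) (decode-code k _)))))
      (code-decode {n} k j))) (code k y)
... | i , eq = decode k i , trans (sym (decode-code k _)) (trans (cong (decode k) eq) (decode-code k y))

-- For n = `suc m` the product is n² + n - 2. It will count the C-points on n + 2 blocks through one
-- C-point, with n - 1 further ones on each.
[n+2]*[n-1]≰n*n : ∀ {m} → 7 ≤ suc m → (2 ℕ.+ suc m) ℕ.* m ≤ suc m ℕ.* suc m → ⊥
[n+2]*[n-1]≰n*n {suc (suc k)} _ le = ℕ.1+n≰n (ℕ.≤-trans (ℕ.m≤m+n _ k) (ℕ.≤-trans (ℕ.≤-reflexive (eq k)) le))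
  where
  open +-*-Solver
  eq : ∀ k → suc ((3 ℕ.+ k) ℕ.* (3 ℕ.+ k)) ℕ.+ k ≡ (5 ℕ.+ k) ℕ.* (2 ℕ.+ k)
  eq = solve 1 (λ k → con 1 :+ (con 3 :+ k) :* (con 3 :+ k) :+ k := (con 5 :+ k) :* (con 2 :+ k)) refl
[n+2]*[n-1]≰n*n {suc 0} (ℕ.s≤s (ℕ.s≤s ())) _
[n+2]*[n-1]≰n*n {0} (ℕ.s≤s ()) _

-- k = n - 2 is the number of points that an arc is sure to leave free on a line of its plane; two
-- such lines together have more than n free points.
double-gap : ∀ {n} → 7 ≤ n → ∃ λ k → k ℕ.+ 2 ≤ n × suc n ≤ k ℕ.+ k
double-gap {n} 7≤n = n ℕ.∸ 2 , ℕ.≤-reflexive (ℕ.m∸n+n≡m (ℕ.≤-trans (ℕ.m≤n+m 2 5) 7≤n)) , gap 7≤n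
  where
  gap : ∀ {n} → 7 ≤ n → suc n ≤ (n ℕ.∸ 2) ℕ.+ (n ℕ.∸ 2)
  gap (ℕ.s≤s (ℕ.s≤s {n = n} 5≤n)) = ℕ.≤-trans (ℕ.≤-reflexive (ℕ.+-comm 3 n))
    (ℕ.+-monoʳ-≤ n (ℕ.≤-trans (ℕ.m≤n+m 3 2) 5≤n))

distribute : ∀ {n} a b → n ≤ a ℕ.+ b → Σ (Fin n → Fin a ⊎ Fin b) Inj
distribute a b le = (λ i → splitAt a (inject≤ i le)) , λ {i} {j} eq → inject≤-injective le le i j
  (trans (sym (join-splitAt a b _)) (trans (cong (Fin.join a b) eq) (join-splitAt a b _)))

-- Linear combinations over a field, with certificates

Mono : Set
Mono = List ℕ

-- A polynomial is a list of signed monomials; the sign true is minus.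
Poly : Set
Poly = List (Bool × Mono)

infixr 5 _✚_
_✚_ : Poly → Poly → Poly
-- An integer coefficient is the number of repetitions of a monomial, and opposite signs cancel on
-- insertion. Thus a polynomial identity over the integers normalises to the empty list.
addTerm : Bool → Mono → Poly → Poly
addTerm s m [] = (s , m) ∷ []
addTerm s m ((s′ , m′) ∷ p) with ≡-dec _≟ℕ_ m m′
... | no _  = (s′ , m′) ∷ addTerm s m p
... | yes _ = if s xor s′ then p else (s′ , m′) ∷ (s , m) ∷ p
[] ✚ q = q
((s , m) ∷ p) ✚ q = addTerm s m (p ✚ q)

negate : Poly → Poly
negate [] = []
negate ((s , m) ∷ p) = (not s , m) ∷ negate p

insert : ℕ → Mono → Mono
insert x [] = x ∷ []
insert x (y ∷ m) = if x <ᵇ y then x ∷ y ∷ m else y ∷ insert x m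

merge : Mono → Mono → Mono
merge m m′ = foldr insert m′ m

timesTerm : (Mono → Mono → Mono) → Bool → Mono → Poly → Poly
timesTerm _∙_ s m [] = []
timesTerm _∙_ s m ((s′ , m′) ∷ p) = (s xor s′ , m ∙ m′) ∷ timesTerm _∙_ s m p

times : (Mono → Mono → Mono) → Poly → Poly → Poly
times _∙_ [] q = []
times _∙_ ((s , m) ∷ p) q = timesTerm _∙_ s m q ✚ times _∙_ p q

module Evaluation {G : Set} {_+_ : G → G → G} {0# : G} { -_ : G → G}
  (isAbelianGroup : IsAbelianGroup _≡_ _+_ 0# -_) (⟦_⟧ₘ : Mono → G) where

  abelianGroup : AbelianGroup _ _
  abelianGroup = record { isAbelianGroup = isAbelianGroup }

  open AbelianGroup abelianGroup using (assoc; comm; identityˡ; identityʳ; inverseˡ; inverseʳ)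
  open AbelianGroupProperties abelianGroup using (⁻¹-∙-comm; ε⁻¹≈ε; ⁻¹-involutive)
  open CommutativeSemigroupProperties (AbelianGroup.commutativeSemigroup abelianGroup) using (x∙yz≈y∙xz)

  ⟦_⟧ₜ : Bool → Mono → G
  ⟦ false ⟧ₜ m = ⟦ m ⟧ₘ
  ⟦ true ⟧ₜ m = - ⟦ m ⟧ₘ

  ⟦_⟧ : Poly → G
  ⟦ [] ⟧ = 0#
  ⟦ (s , m) ∷ p ⟧ = ⟦ s ⟧ₜ m + ⟦ p ⟧

  addTerm-sound : ∀ s m p → ⟦ addTerm s m p ⟧ ≡ ⟦ s ⟧ₜ m + ⟦ p ⟧
  addTerm-sound s m [] = refl
  addTerm-sound s m ((s′ , m′) ∷ p) with ≡-dec _≟ℕ_ m m′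
  ... | no _ = trans (cong (⟦ s′ ⟧ₜ m′ +_) (addTerm-sound s m p)) (x∙yz≈y∙xz _ _ _)
  addTerm-sound false m ((false , .m) ∷ p) | yes refl = refl
  addTerm-sound true m ((true , .m) ∷ p) | yes refl = refl
  addTerm-sound false m ((true , .m) ∷ p) | yes refl =
    sym (trans (sym (assoc _ _ _)) (trans (cong (_+ ⟦ p ⟧) (inverseʳ _)) (identityˡ _)))
  addTerm-sound true m ((false , .m) ∷ p) | yes refl =
    sym (trans (sym (assoc _ _ _)) (trans (cong (_+ ⟦ p ⟧) (inverseˡ _)) (identityˡ _)))

  ✚-sound : ∀ p q → ⟦ p ✚ q ⟧ ≡ ⟦ p ⟧ + ⟦ q ⟧
  ✚-sound [] q = sym (identityˡ _)
  ✚-sound ((s , m) ∷ p) q = trans (addTerm-sound s m (p ✚ q))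
    (trans (cong (⟦ s ⟧ₜ m +_) (✚-sound p q)) (sym (assoc _ _ _)))

  not-sound : ∀ s m → ⟦ not s ⟧ₜ m ≡ - ⟦ s ⟧ₜ m
  not-sound false m = refl
  not-sound true m = sym (⁻¹-involutive _)

  negate-sound : ∀ p → ⟦ negate p ⟧ ≡ - ⟦ p ⟧
  negate-sound [] = sym ε⁻¹≈ε
  negate-sound ((s , m) ∷ p) = trans (cong₂ _+_ (not-sound s m) (negate-sound p)) (⁻¹-∙-comm _ _)

module RingLaws {n} (F : FiniteField n) where
  open FiniteField F
  open IsCommutativeRing isCommutativeRing public
    using (+-isAbelianGroup; +-assoc; +-comm; +-identityˡ; +-identityʳ; *-assoc; *-comm
          ; *-identityˡ; *-identityʳ; distribˡ; distribʳ; zeroˡ; zeroʳ)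
    renaming (-‿inverseˡ to +-inverseˡ; -‿inverseʳ to +-inverseʳ)

  commutativeRing : CommutativeRing _ _
  commutativeRing = record { isCommutativeRing = isCommutativeRing }

  open RingProperties (CommutativeRing.ring commutativeRing) public
    using (-‿distribˡ-*; -‿distribʳ-*; -‿involutive; -1*x≈-x; -0#≈0#)
  open CommutativeSemigroupProperties (CommutativeRing.*-commutativeSemigroup commutativeRing) public
    using (x∙yz≈y∙xz)

-- Expressions, hypotheses and claims

infixl 6 _:+_ _:-_ _:⊕_ _:⊖_
infixl 7 _:*_
infixr 7 _:·_
infix 8 :-_

data Expr : Set where
  var : ℕ → Expr
  :0 :1 : Expr
  _:+_ _:*_ : Expr → Expr → Expr
  :-_ : Expr → Expr

_:-_ : Expr → Expr → Expr
x :- y = x :+ :- y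

normal : Expr → Poly
normal (var i) = (false , i ∷ []) ∷ []
normal :0 = []
normal :1 = (false , []) ∷ []
normal (x :+ y) = normal x ✚ normal y
normal (x :* y) = times merge (normal x) (normal y)
normal (:- x) = negate (normal x)

data VExpr : Set where
  vvar : ℕ → VExpr
  :0v : VExpr
  _:⊕_ : VExpr → VExpr → VExpr
  _:·_ : Expr → VExpr → VExpr

_:⊖_ : VExpr → VExpr → VExpr
u :⊖ v = u :⊕ (:- :1) :· v

-- In a vector polynomial the head of each monomial names the vector.
onTail : Mono → Mono → Mono
onTail m [] = []
onTail m (j ∷ m′) = j ∷ merge m m′

vnormal : VExpr → Poly
vnormal (vvar j) = (false , j ∷ []) ∷ []
vnormal :0v = []
vnormal (u :⊕ v) = vnormal u ✚ vnormal v
vnormal (a :· v) = times onTail (normal a) (vnormal v)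

infix 4 _:=_ _:≈_
infix 3 _∙_ _∙ˢ_ _∙ᵛ_
data Eqn : Set where
  _:=_ : Expr → Expr → Eqn

data VEqn : Set where
  _:≈_ : VExpr → VExpr → VEqn

-- A hypothesis comes with its cofactor in the certificate of the claim.
infix 2 _given_
data Hyp : Set where
  _∙_ : Expr → Eqn → Hyp

data Claim : Set where
  _given_ : Eqn → List Hyp → Claim

data VHyp : Set where
  _∙ˢ_ : VExpr → Eqn → VHyp
  _∙ᵛ_ : Expr → VEqn → VHyp

infix 2 _givenᵛ_
data VClaim : Set where
  _givenᵛ_ : VEqn → List VHyp → VClaim

-- Membership in the ideal of the hypotheses, witnessed by cofactors: what remains should vanish as
-- an integer polynomial, so that one computation settles the claim in every field.
certificate : Expr → List Hyp → Expr
certificate e [] = e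
certificate e ((a ∙ l := r) ∷ hs) = certificate (e :- a :* (l :- r)) hs

vcertificate : VExpr → List VHyp → VExpr
vcertificate e [] = e
vcertificate e ((v ∙ˢ l := r) ∷ hs) = vcertificate (e :⊖ (l :- r) :· v) hs
vcertificate e ((a ∙ᵛ l :≈ r) ∷ hs) = vcertificate (e :⊖ a :· (l :⊖ r)) hs

residue : Claim → Poly
residue ((l := r) given hs) = normal (certificate (l :- r) hs)

vresidue : VClaim → Poly
vresidue ((l :≈ r) givenᵛ hs) = vnormal (vcertificate (l :⊖ r) hs)

N-ary : ℕ → Set → Set → Set
N-ary zero A B = B
N-ary (suc n) A B = A → N-ary n A B

∀ⁿ : ∀ n {A : Set} → (Vec A n → Set) → Set
∀ⁿ zero P = P []
∀ⁿ (suc n) P = ∀ x → ∀ⁿ n (λ xs → P (x ∷ xs))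

λⁿ : ∀ n {A : Set} {P : Vec A n → Set} → (∀ xs → P xs) → ∀ⁿ n P
λⁿ zero f = f []
λⁿ (suc n) f x = λⁿ n (λ xs → f (x ∷ xs))

close : ∀ n {E B : Set} → (ℕ → E) → ℕ → N-ary n E B → B
close zero v k f = f
close (suc n) v k f = close n v (suc k) (f (v k))

-- Soundness of the certificates for scalars

module Solve {n} (F : FiniteField n) where
  open FiniteField F
  open RingLaws F

  ix : ∀ {k} → Vec (Fin n) k → ℕ → Fin n
  ix [] i = 0#
  ix (x ∷ ρ) zero = x
  ix (x ∷ ρ) (suc i) = ix ρ i

  eval : ∀ {k} → Vec (Fin n) k → Expr → Fin n
  eval ρ (var i) = ix ρ i
  eval ρ :0 = 0#
  eval ρ :1 = 1#
  eval ρ (x :+ y) = eval ρ x + eval ρ y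
  eval ρ (x :* y) = eval ρ x * eval ρ y
  eval ρ (:- x) = - eval ρ x

  evalMono : ∀ {k} → Vec (Fin n) k → Mono → Fin n
  evalMono ρ [] = 1#
  evalMono ρ (i ∷ m) = ix ρ i * evalMono ρ m

  insert-sound : ∀ {k} (ρ : Vec (Fin n) k) x m → evalMono ρ (insert x m) ≡ ix ρ x * evalMono ρ m
  insert-sound ρ x [] = refl
  insert-sound ρ x (y ∷ m) with x <ᵇ y
  ... | true = refl
  ... | false = trans (cong (ix ρ y *_) (insert-sound ρ x m)) (x∙yz≈y∙xz _ _ _)

  merge-sound : ∀ {k} (ρ : Vec (Fin n) k) m m′ → evalMono ρ (merge m m′) ≡ evalMono ρ m * evalMono ρ m′
  merge-sound ρ [] m′ = sym (*-identityˡ _)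
  merge-sound ρ (x ∷ m) m′ = trans (insert-sound ρ x (merge m m′))
    (trans (cong (ix ρ x *_) (merge-sound ρ m m′)) (sym (*-assoc _ _ _)))

  -- One soundness proof serves both kinds of polynomials: the field acts on itself for scalars and
  -- on K⁴ for vectors.
  module Action {k} (ρ : Vec (Fin n) k)
    {G : Set} {_⊞_ : G → G → G} {ε : G} {⊟_ : G → G}
    (isAbelianGroup : IsAbelianGroup _≡_ _⊞_ ε ⊟_) (_∙_ : Fin n → G → G)
    (∙-⊞ : ∀ a g h → a ∙ (g ⊞ h) ≡ (a ∙ g) ⊞ (a ∙ h))
    (+-∙ : ∀ a b g → (a + b) ∙ g ≡ (a ∙ g) ⊞ (b ∙ g))
    (0-∙ : ∀ g → 0# ∙ g ≡ ε) (∙-ε : ∀ a → a ∙ ε ≡ ε)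
    (neg-∙ : ∀ a g → (- a) ∙ g ≡ ⊟ (a ∙ g)) (∙-neg : ∀ a g → a ∙ (⊟ g) ≡ ⊟ (a ∙ g))
    (⟦_⟧ₘ : Mono → G) (_∘_ : Mono → Mono → Mono)
    (∘-sound : ∀ m m′ → ⟦ m ∘ m′ ⟧ₘ ≡ evalMono ρ m ∙ ⟦ m′ ⟧ₘ) where

    private
      module S = Evaluation +-isAbelianGroup (evalMono ρ)
    open Evaluation isAbelianGroup ⟦_⟧ₘ public
    open AbelianGroupProperties abelianGroup using (⁻¹-involutive)

    term-sound : ∀ s m s′ m′ → ⟦ s xor s′ ⟧ₜ (m ∘ m′) ≡ S.⟦ s ⟧ₜ m ∙ ⟦ s′ ⟧ₜ m′
    term-sound false m false m′ = ∘-sound m m′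
    term-sound false m true m′ = trans (cong ⊟_ (∘-sound m m′)) (sym (∙-neg _ _))
    term-sound true m false m′ = trans (cong ⊟_ (∘-sound m m′)) (sym (neg-∙ _ _))
    term-sound true m true m′ = trans (∘-sound m m′) (trans (sym (⁻¹-involutive _))
      (trans (cong ⊟_ (sym (∙-neg _ _))) (sym (neg-∙ _ _))))

    timesTerm-sound : ∀ s m p → ⟦ timesTerm _∘_ s m p ⟧ ≡ S.⟦ s ⟧ₜ m ∙ ⟦ p ⟧
    timesTerm-sound s m [] = sym (∙-ε _)
    timesTerm-sound s m ((s′ , m′) ∷ p) =
      trans (cong₂ _⊞_ (term-sound s m s′ m′) (timesTerm-sound s m p)) (sym (∙-⊞ _ _ _))

    times-sound : ∀ p q → ⟦ times _∘_ p q ⟧ ≡ S.⟦ p ⟧ ∙ ⟦ q ⟧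
    times-sound [] q = sym (0-∙ _)
    times-sound ((s , m) ∷ p) q = trans (✚-sound (timesTerm _∘_ s m q) (times _∘_ p q))
      (trans (cong₂ _⊞_ (timesTerm-sound s m q) (times-sound p q)) (sym (+-∙ _ _ _)))

  module Ring {k} (ρ : Vec (Fin n) k) =
    Action ρ +-isAbelianGroup _*_ distribˡ (λ a b g → distribʳ g a b) zeroˡ zeroʳ
      (λ a b → sym (-‿distribˡ-* a b)) (λ a b → sym (-‿distribʳ-* a b))
      (evalMono ρ) merge (merge-sound ρ)

  normal-sound : ∀ {k} (ρ : Vec (Fin n) k) e → Ring.⟦_⟧ ρ (normal e) ≡ eval ρ e
  normal-sound ρ (var i) = trans (+-identityʳ _) (*-identityʳ _)
  normal-sound ρ :0 = refl
  normal-sound ρ :1 = +-identityʳ _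
  normal-sound ρ (x :+ y) = trans (Ring.✚-sound ρ (normal x) (normal y))
    (cong₂ _+_ (normal-sound ρ x) (normal-sound ρ y))
  normal-sound ρ (x :* y) = trans (Ring.times-sound ρ (normal x) (normal y))
    (cong₂ _*_ (normal-sound ρ x) (normal-sound ρ y))
  normal-sound ρ (:- x) = trans (Ring.negate-sound ρ (normal x)) (cong -_ (normal-sound ρ x))

  x-y≡0⇒x≡y : ∀ x y → x + - y ≡ 0# → x ≡ y
  x-y≡0⇒x≡y x y eq = trans (sym (+-identityʳ x)) (trans (cong (x +_) (sym (+-inverseˡ y)))
    (trans (sym (+-assoc _ _ _)) (trans (cong (_+ y) eq) (+-identityˡ y))))

  Implies : ∀ {k} → Vec (Fin n) k → List Hyp → Set → Set
  Implies ρ [] G = G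
  Implies ρ ((a ∙ l := r) ∷ hs) G = eval ρ l ≡ eval ρ r → Implies ρ hs G

  Holds : ∀ {k} → Vec (Fin n) k → Claim → Set
  Holds ρ ((l := r) given hs) = Implies ρ hs (eval ρ l ≡ eval ρ r)

  discharge : ∀ {k} (ρ : Vec (Fin n) k) hs e {G} → (eval ρ e ≡ 0# → G) →
              eval ρ (certificate e hs) ≡ 0# → Implies ρ hs G
  discharge ρ [] e f eq = f eq
  discharge ρ ((a ∙ l := r) ∷ hs) e f eq l≡r =
    discharge ρ hs (e :- a :* (l :- r)) (λ z → f (trans (sym (cancel _ _ _ _ l≡r)) z)) eq
    where
    cancel : ∀ e a x y → x ≡ y → e + - (a * (x + - y)) ≡ e
    cancel e a x .x refl = trans (cong (λ z → e + - z) (trans (cong (a *_) (+-inverseʳ x)) (zeroʳ a)))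
      (trans (cong (e +_) -0#≈0#) (+-identityʳ e))

  certify : ∀ {k} (ρ : Vec (Fin n) k) c → residue c ≡ [] → Holds ρ c
  certify ρ ((l := r) given hs) eq = discharge ρ hs (l :- r) (x-y≡0⇒x≡y _ _)
    (trans (sym (normal-sound ρ (certificate (l :- r) hs))) (cong (Ring.⟦_⟧ ρ) eq))

  opaque
    solve : ∀ k (f : N-ary k Expr Claim) → residue (close k var 0 f) ≡ [] →
            ∀ⁿ k (λ ρ → Holds ρ (close k var 0 f))
    solve k f eq = λⁿ k (λ ρ → certify ρ (close k var 0 f) eq)

-- Soundness of the certificates for vectors

module VSolve {n} (F : FiniteField n) where
  open FiniteField F
  open RingLaws F
  open Solve F
  open Geometry F

  ⊟_ : Pt → Pt
  ⊟ v = (- 1#) · v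

  ⊕-inverseˡ : ∀ u → ⊟ u ⊕ u ≡ 0v
  ⊕-inverseˡ u = trans (cong (_⊕ u) (map-cong -1*x≈-x u)) (zipWith-inverseˡ +-inverseˡ u)

  ⊕-isAbelianGroup : IsAbelianGroup _≡_ _⊕_ 0v ⊟_
  ⊕-isAbelianGroup = record
    { isGroup = record
      { isMonoid = record
        { isSemigroup = record
          { isMagma = record { isEquivalence = isEquivalence ; ∙-cong = cong₂ _⊕_ }
          ; assoc = zipWith-assoc +-assoc }
        ; identity = zipWith-identityˡ +-identityˡ , zipWith-identityʳ +-identityʳ }
      ; inverse = ⊕-inverseˡ , λ u → trans (zipWith-comm +-comm u (⊟ u)) (⊕-inverseˡ u)
      ; ⁻¹-cong = cong ⊟_ }
    ; comm = zipWith-comm +-comm }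

  private
    map-⊕ : ∀ a {k} (u v : Vec K k) →
            vmap (a *_) (zipWith _+_ u v) ≡ zipWith _+_ (vmap (a *_) u) (vmap (a *_) v)
    map-⊕ a [] [] = refl
    map-⊕ a (x ∷ u) (y ∷ v) = cong₂ _∷_ (distribˡ a x y) (map-⊕ a u v)

    map-+ : ∀ a b {k} (u : Vec K k) →
            vmap ((a + b) *_) u ≡ zipWith _+_ (vmap (a *_) u) (vmap (b *_) u)
    map-+ a b [] = refl
    map-+ a b (x ∷ u) = cong₂ _∷_ (distribʳ x a b) (map-+ a b u)

  ·-assoc : ∀ a b v → a · b · v ≡ (a * b) · v
  ·-assoc a b v = trans (sym (map-∘ (a *_) (b *_) v)) (map-cong (λ x → sym (*-assoc a b x)) v)

  ·-⊟ : ∀ a v → a · ⊟ v ≡ ⊟ (a · v)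
  ·-⊟ a v = trans (·-assoc a (- 1#) v)
    (trans (cong (_· v) (*-comm a (- 1#))) (sym (·-assoc (- 1#) a v)))

  -·≡⊟ : ∀ a v → (- a) · v ≡ ⊟ (a · v)
  -·≡⊟ a v = trans (cong (_· v) (sym (-1*x≈-x a))) (sym (·-assoc (- 1#) a v))

  0·v≡0v : ∀ v → 0# · v ≡ 0v
  0·v≡0v v = trans (map-cong zeroˡ v) (map-const v 0#)

  a·0v≡0v : ∀ a → a · 0v ≡ 0v
  a·0v≡0v a = cong₂ _∷_ z (cong₂ _∷_ z (cong₂ _∷_ z (cong₂ _∷_ z refl)))
    where z = zeroʳ a

  module _ {k l} (ρ : Vec K k) (σ : Vec Pt l) where
    vix : ∀ {l} → Vec Pt l → ℕ → Pt
    vix [] i = 0v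
    vix (x ∷ σ) zero = x
    vix (x ∷ σ) (suc i) = vix σ i

    veval : VExpr → Pt
    veval (vvar j) = vix σ j
    veval :0v = 0v
    veval (u :⊕ v) = veval u ⊕ veval v
    veval (a :· v) = eval ρ a · veval v

    vevalMono : Mono → Pt
    vevalMono [] = 0v
    vevalMono (j ∷ m) = evalMono ρ m · vix σ j

    onTail-sound : ∀ m m′ → vevalMono (onTail m m′) ≡ evalMono ρ m · vevalMono m′
    onTail-sound m [] = sym (a·0v≡0v _)
    onTail-sound m (j ∷ m′) = trans (cong (_· vix σ j) (merge-sound ρ m m′)) (sym (·-assoc _ _ _))

    module V = Action ρ ⊕-isAbelianGroup _·_ (λ a → map-⊕ a) (λ a b → map-+ a b)
      0·v≡0v a·0v≡0v -·≡⊟ ·-⊟ vevalMono onTail onTail-sound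

    vnormal-sound : ∀ e → V.⟦ vnormal e ⟧ ≡ veval e
    vnormal-sound (vvar j) = trans (zipWith-identityʳ +-identityʳ _)
      (trans (map-cong *-identityˡ _) (map-id _))
    vnormal-sound :0v = refl
    vnormal-sound (u :⊕ v) = trans (V.✚-sound (vnormal u) (vnormal v))
      (cong₂ _⊕_ (vnormal-sound u) (vnormal-sound v))
    vnormal-sound (a :· v) = trans (V.times-sound (normal a) (vnormal v))
      (cong₂ _·_ (normal-sound ρ a) (vnormal-sound v))

    VImplies : List VHyp → Set → Set
    VImplies [] G = G
    VImplies ((v ∙ˢ l := r) ∷ hs) G = eval ρ l ≡ eval ρ r → VImplies hs G
    VImplies ((a ∙ᵛ l :≈ r) ∷ hs) G = veval l ≡ veval r → VImplies hs G

    VHolds : VClaim → Set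
    VHolds ((l :≈ r) givenᵛ hs) = VImplies hs (veval l ≡ veval r)

    vdischarge : ∀ hs e {G} → (veval e ≡ 0v → G) → veval (vcertificate e hs) ≡ 0v → VImplies hs G
    vdischarge [] e f eq = f eq
    vdischarge ((v ∙ˢ l := r) ∷ hs) e f eq l≡r =
      vdischarge hs (e :⊖ (l :- r) :· v) (λ z → f (trans (sym (cancel _ _ _ l≡r)) z)) eq
      where
      cancel : ∀ x y z → x ≡ y → veval e ⊕ ⊟ ((x + - y) · z) ≡ veval e
      cancel x .x z refl = trans (cong (λ a → veval e ⊕ ⊟ (a · z)) (+-inverseʳ x))
        (trans (cong (λ w → veval e ⊕ ⊟ w) (0·v≡0v z))
        (trans (cong (veval e ⊕_) (a·0v≡0v _)) (zipWith-identityʳ +-identityʳ _)))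
    vdischarge ((a ∙ᵛ l :≈ r) ∷ hs) e f eq l≡r =
      vdischarge hs (e :⊖ a :· (l :⊖ r)) (λ z → f (trans (sym (cancel _ _ _ l≡r)) z)) eq
      where
      cancel : ∀ b x y → x ≡ y → veval e ⊕ ⊟ (b · (x ⊕ ⊟ y)) ≡ veval e
      cancel b x .x refl = trans (cong (λ z → veval e ⊕ ⊟ (b · z)) (trans (zipWith-comm +-comm x (⊟ x)) (⊕-inverseˡ x)))
        (trans (cong (λ z → veval e ⊕ ⊟ z) (a·0v≡0v b))
        (trans (cong (veval e ⊕_) (a·0v≡0v _)) (zipWith-identityʳ +-identityʳ _)))

    vcertify : ∀ c → vresidue c ≡ [] → VHolds c
    vcertify ((l :≈ r) givenᵛ hs) eq = vdischarge hs (l :⊖ r) u⊖v≡0⇒u≡v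
      (trans (sym (vnormal-sound (vcertificate (l :⊖ r) hs))) (cong V.⟦_⟧ eq))
      where
      u⊖v≡0⇒u≡v : ∀ {u v} → u ⊕ ⊟ v ≡ 0v → u ≡ v
      u⊖v≡0⇒u≡v {u} {v} eq = trans (sym (zipWith-identityʳ +-identityʳ u))
        (trans (cong (u ⊕_) (sym (⊕-inverseˡ v)))
        (trans (sym (zipWith-assoc +-assoc u (⊟ v) v))
        (trans (cong (_⊕ v) eq) (zipWith-identityˡ +-identityˡ v))))

  opaque
    vsolve : ∀ k l (f : N-ary k Expr (N-ary l VExpr VClaim)) →
             vresidue (close l vvar 0 (close k var 0 f)) ≡ [] →
             ∀ⁿ k (λ ρ → ∀ⁿ l (λ σ → VHolds ρ σ (close l vvar 0 (close k var 0 f))))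
    vsolve k l f eq = λⁿ k (λ ρ → λⁿ l (λ σ → vcertify ρ σ (close l vvar 0 (close k var 0 f)) eq))

-- Fields and vectors

module FieldLemmas {n} (F : FiniteField n) where
  open FiniteField F
  open RingLaws F public
  open Solve F public

  1≢0 : 1# ≢ 0#
  1≢0 eq = 0≢1 (sym eq)

  inv : ∀ x → x ≢ 0# → Fin n
  inv x x≢0 = proj₁ (inverse x x≢0)

  x*inv≡1 : ∀ x (x≢0 : x ≢ 0#) → x * inv x x≢0 ≡ 1#
  x*inv≡1 x x≢0 = proj₂ (inverse x x≢0)

  cancel : ∀ {a x} → a ≢ 0# → a * x ≡ 0# → x ≡ 0#
  cancel {a} {x} a≢0 eq = solve 3 (λ a x b → x := :0 given (b ∙ a :* x := :0) ∷ (:- x ∙ a :* b := :1) ∷ [])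
    refl a x (inv a a≢0) eq (x*inv≡1 a a≢0)

  cancelˡ : ∀ {a x y} → a ≢ 0# → a * x ≡ a * y → x ≡ y
  cancelˡ {a} {x} {y} a≢0 eq = x-y≡0⇒x≡y x y (cancel a≢0
    (solve 3 (λ a x y → a :* (x :- y) := :0 given (:1 ∙ a :* x := a :* y) ∷ []) refl a x y eq))

  *-nonzero : ∀ {a b} → a ≢ 0# → b ≢ 0# → a * b ≢ 0#
  *-nonzero a≢0 b≢0 eq = b≢0 (cancel a≢0 eq)

  inv≢0 : ∀ x x≢0 → inv x x≢0 ≢ 0#
  inv≢0 x x≢0 eq = 1≢0 (solve 2 (λ x y → :1 := :0 given (:- :1 ∙ x :* y := :1) ∷ (x ∙ y := :0) ∷ [])
    refl x (inv x x≢0) (x*inv≡1 x x≢0) eq)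

  neg≢0 : ∀ {x} → x ≢ 0# → - x ≢ 0#
  neg≢0 {x} x≢0 eq = x≢0 (solve 1 (λ x → x := :0 given (:- :1 ∙ :- x := :0) ∷ []) refl x eq)

  x≢y⇒x-y≢0 : ∀ {x y} → x ≢ y → x + - y ≢ 0#
  x≢y⇒x-y≢0 {x} {y} x≢y eq = x≢y (x-y≡0⇒x≡y x y eq)

  2# : Fin n
  2# = 1# + 1#

  odd⇒2≢0 : Odd n → 2# ≢ 0#
  odd⇒2≢0 odd 2≡0 = odd (involution⇒even (_+ 1#)
    (λ x → solve 1 (λ x → x :+ :1 :+ :1 := x given (:1 ∙ :1 :+ :1 := :0) ∷ []) refl x 2≡0)
    (λ x eq → 1≢0 (solve 1 (λ x → :1 := :0 given (:1 ∙ x :+ :1 := x) ∷ []) refl x eq)))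

module Vectors {n} (F : FiniteField n) where
  open FiniteField F
  open FieldLemmas F
  open VSolve F public using (vsolve; ⊟_)
  open Geometry F

  infix 4 _≟ᵛ_
  infixl 6 _⊖_
  opaque
    _≟ᵛ_ : (u v : Pt) → Dec (u ≡ v)
    _≟ᵛ_ = Vec-≡-dec _≟_

  opaque
    searchPt : Searchable Pt
    searchPt = searchVec 4

  _⊖_ : Pt → Pt → Pt
  u ⊖ v = u ⊕ ⊟ v

  ·-cancel : ∀ {a v} → v ≢ 0v → a · v ≡ 0v → a ≡ 0#
  ·-cancel {a} {v} v≢0 eq with a ≟ 0#
  ... | yes a≡0 = a≡0
  ... | no a≢0 = ⊥-elim (v≢0 (vsolve 2 1 (λ a b v → v :≈ :0v givenᵛ (b ∙ᵛ a :· v :≈ :0v) ∷ (:0v :⊖ v ∙ˢ a :* b := :1) ∷ [])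
    refl a (inv a a≢0) v eq (x*inv≡1 a a≢0)))

  ·≢0 : ∀ {a v} → a ≢ 0# → v ≢ 0v → a · v ≢ 0v
  ·≢0 a≢0 v≢0 eq = a≢0 (·-cancel v≢0 eq)

  infix 4 _∥_
  _∥_ : Pt → Pt → Set
  w ∥ v = ∃[ a ] w ≡ a · v

  opaque
    ∥? : ∀ w v → Dec (w ∥ v)
    ∥? w v = any? λ a → w ≟ᵛ a · v

  ∥-sym : ∀ {w v} → w ≢ 0v → w ∥ v → v ∥ w
  ∥-sym {w} {v} w≢0 (a , eq) with a ≟ 0#
  ... | yes refl = ⊥-elim (w≢0 (vsolve 0 2 (λ w v → w :≈ :0v givenᵛ (:1 ∙ᵛ w :≈ :0 :· v) ∷ []) refl w v eq))
  ... | no a≢0 = inv a a≢0 , vsolve 2 2 (λ a b w v → v :≈ b :· w givenᵛ (:- b ∙ᵛ w :≈ a :· v) ∷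
    (:0v :⊖ v ∙ˢ a :* b := :1) ∷ []) refl a (inv a a≢0) w v eq (x*inv≡1 a a≢0)

  ∥-trans : ∀ {u v w} → u ∥ v → v ∥ w → u ∥ w
  ∥-trans {u} {v} {w} (a , p) (b , r) = a * b , vsolve 2 3 (λ a b u v w → u :≈ (a :* b) :· w givenᵛ (:1 ∙ᵛ u :≈ a :· v) ∷
    (a ∙ᵛ v :≈ b :· w) ∷ []) refl a b u v w p r

  ∦⇒independent : ∀ {v w} → v ≢ 0v → ¬ (w ∥ v) → Independent v w
  ∦⇒independent {v} {w} v≢0 ∦ a b eq with b ≟ 0#
  ... | no b≢0 = ⊥-elim (∦ (- (a * inv b b≢0) , vsolve 3 2 (λ a b c v w → w :≈ :- (a :* c) :· v givenᵛ
        (c ∙ᵛ a :· v :⊕ b :· w :≈ :0v) ∷ (:0v :⊖ w ∙ˢ b :* c := :1) ∷ []) refl a b (inv b b≢0) v w eq (x*inv≡1 b b≢0)))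
  ... | yes refl = ·-cancel v≢0 (vsolve 1 2 (λ a v w → a :· v :≈ :0v givenᵛ (:1 ∙ᵛ a :· v :⊕ :0 :· w :≈ :0v) ∷ [])
    refl a v w eq) , refl

  independent⇒≢0ˡ : ∀ {v w} → Independent v w → v ≢ 0v
  independent⇒≢0ˡ {v} {w} ind refl = 1≢0 (proj₁ (ind 1# 0# (vsolve 0 1 (λ w → :1 :· :0v :⊕ :0 :· w :≈ :0v givenᵛ []) refl w)))

  independent⇒≢0ʳ : ∀ {v w} → Independent v w → w ≢ 0v
  independent⇒≢0ʳ {v} {w} ind refl = 1≢0 (proj₂ (ind 0# 1# (vsolve 0 1 (λ v → :0 :· v :⊕ :1 :· :0v :≈ :0v givenᵛ []) refl v)))

  independent⇒∦ : ∀ {v w} → Independent v w → ¬ (w ∥ v)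
  independent⇒∦ {v} {w} ind (a , eq) = neg≢0 1≢0 (proj₂ (ind a (- 1#)
    (vsolve 1 2 (λ a v w → a :· v :⊕ :- :1 :· w :≈ :0v givenᵛ (:- :1 ∙ᵛ w :≈ a :· v) ∷ []) refl a v w eq)))

  opaque
    -- Cramer's rule with the determinant of the coordinates of `x` and `y`. If it vanished, so
    -- would y₂ x - x₂ y and y₁ x - x₁ y, and independence would kill both coordinates of `x`.
    span₂ : ∀ {u v x y w} → Independent x y → Span u v x → Span u v y → Span u v w → Span x y w
    span₂ {u} {v} {x} {y} {w} ind (x₁ , x₂ , ex) (y₁ , y₂ , ey) (w₁ , w₂ , ew) with x₁ * y₂ + - (x₂ * y₁) ≟ 0#
    ... | no D≢0 = E * (w₁ * y₂ + - (w₂ * y₁)) , E * (x₁ * w₂ + - (x₂ * w₁)) ,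
      vsolve 7 5 (λ x₁ x₂ y₁ y₂ w₁ w₂ E u v x y w →
        w :≈ (E :* (w₁ :* y₂ :- w₂ :* y₁)) :· x :⊕ (E :* (x₁ :* w₂ :- x₂ :* w₁)) :· y givenᵛ
        (:1 ∙ᵛ w :≈ w₁ :· u :⊕ w₂ :· v) ∷
        (:- E :* (w₁ :* y₂ :- w₂ :* y₁) ∙ᵛ x :≈ x₁ :· u :⊕ x₂ :· v) ∷
        (:- E :* (x₁ :* w₂ :- x₂ :* w₁) ∙ᵛ y :≈ y₁ :· u :⊕ y₂ :· v) ∷
        (:0v :⊖ (w₁ :· u :⊕ w₂ :· v) ∙ˢ (x₁ :* y₂ :- x₂ :* y₁) :* E := :1) ∷ [])
        refl x₁ x₂ y₁ y₂ w₁ w₂ E u v x y w ew ex ey (x*inv≡1 _ D≢0)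
      where
      E : K
      E = inv _ D≢0
    ... | yes D≡0 = ⊥-elim (independent⇒≢0ˡ ind x≡0)
      where
      h₁ : y₂ ≡ 0# × - x₂ ≡ 0#
      h₁ = ind y₂ (- x₂) (vsolve 4 4 (λ x₁ x₂ y₁ y₂ u v x y → y₂ :· x :⊕ :- x₂ :· y :≈ :0v givenᵛ
        (y₂ ∙ᵛ x :≈ x₁ :· u :⊕ x₂ :· v) ∷ (:- x₂ ∙ᵛ y :≈ y₁ :· u :⊕ y₂ :· v) ∷ (u ∙ˢ x₁ :* y₂ :- x₂ :* y₁ := :0) ∷ [])
        refl x₁ x₂ y₁ y₂ u v x y ex ey D≡0)
      h₂ : y₁ ≡ 0# × - x₁ ≡ 0#
      h₂ = ind y₁ (- x₁) (vsolve 4 4 (λ x₁ x₂ y₁ y₂ u v x y → y₁ :· x :⊕ :- x₁ :· y :≈ :0v givenᵛ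
        (y₁ ∙ᵛ x :≈ x₁ :· u :⊕ x₂ :· v) ∷ (:- x₁ ∙ᵛ y :≈ y₁ :· u :⊕ y₂ :· v) ∷ (:0v :⊖ v ∙ˢ x₁ :* y₂ :- x₂ :* y₁ := :0) ∷ [])
        refl x₁ x₂ y₁ y₂ u v x y ex ey D≡0)
      x≡0 : x ≡ 0v
      x≡0 = vsolve 2 3 (λ x₁ x₂ u v x → x :≈ :0v givenᵛ (:1 ∙ᵛ x :≈ x₁ :· u :⊕ x₂ :· v) ∷
        (:0v :⊖ u ∙ˢ :- x₁ := :0) ∷ (:0v :⊖ v ∙ˢ :- x₂ := :0) ∷ []) refl x₁ x₂ u v x ex (proj₂ h₂) (proj₂ h₁)

  comb : Pt → Pt → Pt → Pt → K → K → K → K → Pt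
  comb a b e d x y z w = x · a ⊕ y · b ⊕ z · e ⊕ w · d

  Independent₄ : Pt → Pt → Pt → Pt → Set
  Independent₄ a b e d = ∀ x y z w → comb a b e d x y z w ≡ 0v → x ≡ 0# × y ≡ 0# × z ≡ 0# × w ≡ 0#

  comb-inj : ∀ {a b e d} → Independent₄ a b e d → ∀ {x y z w x′ y′ z′ w′} →
             comb a b e d x y z w ≡ comb a b e d x′ y′ z′ w′ → x ≡ x′ × y ≡ y′ × z ≡ z′ × w ≡ w′
  comb-inj {a} {b} {e} {d} ind {x} {y} {z} {w} {x′} {y′} {z′} {w′} eq =
    let x≡ , y≡ , z≡ , w≡ = ind (x + - x′) (y + - y′) (z + - z′) (w + - w′)
          (vsolve 8 4 (λ x y z w x' y' z' w' a b e d →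
            (x :+ :- x') :· a :⊕ (y :+ :- y') :· b :⊕ (z :+ :- z') :· e :⊕ (w :+ :- w') :· d :≈ :0v givenᵛ
            (:1 ∙ᵛ x :· a :⊕ y :· b :⊕ z :· e :⊕ w :· d :≈ x' :· a :⊕ y' :· b :⊕ z' :· e :⊕ w' :· d) ∷ [])
            refl x y z w x′ y′ z′ w′ a b e d eq)
    in x-y≡0⇒x≡y _ _ x≡ , x-y≡0⇒x≡y _ _ y≡ , x-y≡0⇒x≡y _ _ z≡ , x-y≡0⇒x≡y _ _ w≡

  opaque
    -- Independence makes the map from coefficients to points injective, hence surjective by
    -- counting.
    coordinates : ∀ {a b e d} → Independent₄ a b e d → ∀ p →
                  ∃[ x ] ∃[ y ] ∃[ z ] ∃[ w ] p ≡ comb a b e d x y z w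
    coordinates {a} {b} {e} {d} ind p = unpack (vec-inj⇒surj toPt (λ {u} {v} → toPt-inj u v) p)
      where
      toPt : Vec K 4 → Pt
      toPt (x ∷ y ∷ z ∷ w ∷ []) = comb a b e d x y z w
      toPt-inj : ∀ u v → toPt u ≡ toPt v → u ≡ v
      toPt-inj (x ∷ y ∷ z ∷ w ∷ []) (x′ ∷ y′ ∷ z′ ∷ w′ ∷ []) eq with comb-inj ind eq
      ... | refl , refl , refl , refl = refl
      unpack : (∃ λ u → toPt u ≡ p) → ∃[ x ] ∃[ y ] ∃[ z ] ∃[ w ] p ≡ comb a b e d x y z w
      unpack ((x ∷ y ∷ z ∷ w ∷ []) , eq) = x , y , z , w , sym eq

-- With θ² = β, X = x + yθ and Y = (x² + βy²) + 2xyθ this is Y = X².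
record NormalForm {n} (F : FiniteField n) (𝒞 : Subset (Geometry.Pt F)) : Set where
  open FiniteField F
  open Vectors F
  open Geometry F
  field
    origin e₁ e₂ e₃ e₄ : Pt
    β                  : K
    independent        : Independent₄ e₁ e₂ e₃ e₄

  point : K → K → Pt
  point x y = origin ⊕ comb e₁ e₂ e₃ e₄ x y (x * y) (x * x + β * (y * y))

  field
    point∈    : ∀ x y → 𝒞 (point x y)
    onto      : ∀ {p} → 𝒞 p → ∃[ x ] ∃[ y ] p ≡ point x y
    nonsquare : ∀ κ → κ * κ ≢ β

-- C-planes

≐-sym : {A : Set} {P Q : Subset A} → P ≐ Q → Q ≐ P
≐-sym e x = proj₂ (e x) , proj₁ (e x)

≐-trans : {A : Set} {P Q R : Subset A} → P ≐ Q → Q ≐ R → P ≐ R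
≐-trans e f x = (λ p → proj₁ (f x) (proj₁ (e x) p)) , (λ r → proj₂ (e x) (proj₂ (f x) r))

module Configuration {m} (F : FiniteField (suc m)) (7≤q : 7 ≤ suc m)
  (𝒞 : Subset (Geometry.Pt F)) (𝒫 : SetOfSubsets (Geometry.Pt F))
  (sys : Geometry.CSystem F 𝒞 𝒫) where

  open FiniteField F
  open FieldLemmas F
  open Vectors F
  open Geometry F
  open CSystem sys

  q : ℕ
  q = suc m

  I : Set
  I = Fin (q *ℕ q)

  opaque
    c : I → Pt
    c = proj₁ size

    c-inj : Inj c
    c-inj = proj₁ (proj₂ size) _ _

    c∈𝒞 : ∀ i → 𝒞 (c i)
    c∈𝒞 i = proj₂ (proj₂ (proj₂ size) (c i)) (i , refl)

  IsC : Pt → Set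
  IsC x = ∃[ i ] c i ≡ x

  opaque
    isC? : ∀ x → Dec (IsC x)
    isC? x = any? λ i → c i ≟ᵛ x

  opaque
    unfolding c
    toIsC : ∀ {x} → 𝒞 x → IsC x
    toIsC = proj₁ (proj₂ (proj₂ size) _)

  -- A block is a C-plane, named by two of its C-points.
  record Block : Set where
    constructor block
    field
      i j : I
      distinct : False (i ≟ j)

  searchBlock : Searchable Block
  searchBlock {P} P? = map′ (λ { (i , j , d , p) → block i j d , p }) (λ { (block i j d , p) → i , j , d , p })
    (any? λ i → any? λ j → searchFalse (i ≟ j) (λ d → P? (block i j d)))
    where
    searchFalse : ∀ {A : Set} (d : Dec A) {Q : False d → Set} → (∀ x → Dec (Q x)) → Dec (∃ Q)
    searchFalse (yes _) Q? = no λ ()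
    searchFalse (no _) Q? = map′ (λ p → _ , p) proj₂ (Q? _)

  join : ∀ i j → i ≢ j → Block
  join i j i≢j = block i j (fromWitnessFalse i≢j)

  i≢j : ∀ B → Block.i B ≢ Block.j B
  i≢j B = toWitnessFalse (Block.distinct B)

  private
    plane = λ B → A2 (c (Block.i B)) (c (Block.j B)) (c∈𝒞 (Block.i B)) (c∈𝒞 (Block.j B)) (i≢j B ∘ c-inj)

  opaque
    points : Block → Subset Pt
    points B = proj₁ (plane B)

    points∈𝒫 : ∀ B → 𝒫 (points B)
    points∈𝒫 B = proj₁ (proj₂ (plane B))

    i∈ : ∀ B → points B (c (Block.i B))
    i∈ B = proj₁ (proj₂ (proj₂ (plane B)))

    j∈ : ∀ B → points B (c (Block.j B))
    j∈ B = proj₁ (proj₂ (proj₂ (proj₂ (plane B))))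

    base u v : Block → Pt
    base B = proj₁ (affine (points B) (points∈𝒫 B))
    u B = proj₁ (proj₁ (proj₂ (proj₂ (affine (points B) (points∈𝒫 B)))))
    v B = proj₁ (proj₂ (proj₁ (proj₂ (proj₂ (affine (points B) (points∈𝒫 B))))))

    u-v-independent : ∀ B → Independent (u B) (v B)
    u-v-independent B = proj₁ (proj₂ (proj₂ (proj₁ (proj₂ (proj₂ (affine (points B) (points∈𝒫 B)))))))

  Dir : Block → Subset Pt
  Dir B = Span (u B) (v B)

  opaque
    unfolding points
    points≐ : ∀ B → points B ≐ Translate (base B) (Dir B)
    points≐ B x =
      let e = proj₂ (proj₂ (proj₂ (affine (points B) (points∈𝒫 B))))
          s = proj₂ (proj₂ (proj₂ (proj₁ (proj₂ (proj₂ (affine (points B) (points∈𝒫 B)))))))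
      in (λ x∈ → let w , Ww , eq = proj₁ (e x) x∈ in w , proj₁ (s w) Ww , eq) ,
         λ (w , Dw , eq) → proj₂ (e x) (w , proj₂ (s w) Dw , eq)

  infix 4 _∈_ _∈?_ _≋_ _≋?_
  _∈_ : Pt → Block → Set
  x ∈ B = points B x

  _≋_ : Block → Block → Set
  B ≋ B′ = points B ≐ points B′

  module _ {B : Block} where
    Dir-lin : ∀ a b {w z} → Dir B w → Dir B z → Dir B (a · w ⊕ b · z)
    Dir-lin a b {w} {z} (w₁ , w₂ , ew) (z₁ , z₂ , ez) = a * w₁ + b * z₁ , a * w₂ + b * z₂ ,
      vsolve 6 4 (λ a b w₁ w₂ z₁ z₂ u v w z → a :· w :⊕ b :· z :≈ (a :* w₁ :+ b :* z₁) :· u :⊕ (a :* w₂ :+ b :* z₂) :· v givenᵛ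
        (a ∙ᵛ w :≈ w₁ :· u :⊕ w₂ :· v) ∷ (b ∙ᵛ z :≈ z₁ :· u :⊕ z₂ :· v) ∷ []) refl a b w₁ w₂ z₁ z₂ (u B) (v B) w z ew ez

    Dir-· : ∀ a {w} → Dir B w → Dir B (a · w)
    Dir-· a {w} Dw = subst (Dir B) (vsolve 1 1 (λ a w → a :· w :⊕ :0 :· w :≈ a :· w givenᵛ []) refl a w) (Dir-lin a 0# Dw Dw)

    Dir-∥ : ∀ {w z} → w ∥ z → Dir B z → Dir B w
    Dir-∥ (a , refl) Dz = Dir-· a Dz

    difference : ∀ {x y} → x ∈ B → y ∈ B → Dir B (y ⊖ x)
    difference {x} {y} x∈ y∈ with proj₁ (points≐ B x) x∈ | proj₁ (points≐ B y) y∈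
    ... | w , Dw , ex | z , Dz , ey = subst (Dir B)
      (vsolve 0 5 (λ p x y w z → :1 :· z :⊕ :- :1 :· w :≈ y :⊖ x givenᵛ (:1 ∙ᵛ x :≈ p :⊕ w) ∷ (:- :1 ∙ᵛ y :≈ p :⊕ z) ∷ [])
        refl (base B) x y w z ex ey)
      (Dir-lin 1# (- 1#) Dz Dw)

    shift : ∀ {x w} → x ∈ B → Dir B w → x ⊕ w ∈ B
    shift {x} {w} x∈ Dw with proj₁ (points≐ B x) x∈
    ... | z , Dz , ex = proj₂ (points≐ B _) (1# · z ⊕ 1# · w , Dir-lin 1# 1# Dz Dw ,
      vsolve 0 4 (λ p x w z → x :⊕ w :≈ p :⊕ (:1 :· z :⊕ :1 :· w) givenᵛ (:1 ∙ᵛ x :≈ p :⊕ z) ∷ []) refl (base B) x w z ex)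

    shift-· : ∀ {x w} a → x ∈ B → Dir B w → x ⊕ a · w ∈ B
    shift-· a x∈ Dw = shift x∈ (Dir-· a Dw)

    shiftTo : ∀ {x y} → x ∈ B → Dir B (y ⊖ x) → y ∈ B
    shiftTo {x} {y} x∈ D = subst (_∈ B) (vsolve 0 2 (λ x y → x :⊕ (y :⊖ x) :≈ y givenᵛ []) refl x y) (shift {w = y ⊖ x} x∈ D)

    basis₂ : ∀ {x y w} → Independent x y → Dir B x → Dir B y → Dir B w → Span x y w
    basis₂ = span₂

    base∈ : base B ∈ B
    base∈ = proj₂ (points≐ B _) (0# · u B ⊕ 0# · v B , (0# , 0# , refl) ,
      (vsolve 0 3 (λ p u v → p :≈ p :⊕ (:0 :· u :⊕ :0 :· v) givenᵛ []) refl (base B) (u B) (v B)))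

    opaque
      complement : ∀ {w} → w ≢ 0v → Dir B w → ∃[ z ] (Independent w z × Dir B z)
      complement {w} w≢0 Dw with ∥? (u B) w
      ... | no ∦ = u B , ∦⇒independent w≢0 ∦ , 1# , 0# , vsolve 0 2 (λ u v → u :≈ :1 :· u :⊕ :0 :· v givenᵛ []) refl (u B) (v B)
      ... | yes u∥w with ∥? (v B) w
      ...   | no ∦ = v B , ∦⇒independent w≢0 ∦ , 0# , 1# , vsolve 0 2 (λ u v → v :≈ :0 :· u :⊕ :1 :· v givenᵛ []) refl (u B) (v B)
      ...   | yes v∥w = ⊥-elim (independent⇒∦ (u-v-independent B)
        (∥-trans v∥w (∥-sym (independent⇒≢0ˡ (u-v-independent B)) u∥w)))

  Dir-of-≋ : ∀ {B B′ w} → B ≋ B′ → Dir B w → Dir B′ w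
  Dir-of-≋ {B} {B′} {w} e Dw = subst (Dir B′) (vsolve 0 2 (λ p w → p :⊕ w :⊖ p :≈ w givenᵛ []) refl (base B) w)
    (difference {B′} (proj₁ (e _) (base∈ {B})) (proj₁ (e _) (shift {B} (base∈ {B}) Dw)))

  opaque
    Dir? : ∀ B w → Dec (Dir B w)
    Dir? B w = any? λ a → any? λ b → w ≟ᵛ a · u B ⊕ b · v B

    _∈?_ : ∀ x B → Dec (x ∈ B)
    x ∈? B = map′ (shiftTo {B} base∈) (difference {B} base∈) (Dir? B (x ⊖ base B))

  plane-unique : ∀ {i j} → i ≢ j → ∀ {π π′} → 𝒫 π → 𝒫 π′ → π (c i) → π (c j) → π′ (c i) → π′ (c j) → π ≐ π′
  plane-unique {i} {j} i≢j Pπ Pπ′ a b a′ b′ with A2 (c i) (c j) (c∈𝒞 i) (c∈𝒞 j) (i≢j ∘ c-inj)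
  ... | _ , _ , _ , _ , uniq = ≐-trans (uniq _ Pπ a b) (≐-sym (uniq _ Pπ′ a′ b′))

  unique : ∀ {B B′ i j} → i ≢ j → c i ∈ B → c j ∈ B → c i ∈ B′ → c j ∈ B′ → B ≋ B′
  unique {B} {B′} i≢j = plane-unique i≢j (points∈𝒫 B) (points∈𝒫 B′)

  meet-once : ∀ {B B′ i j} → ¬ B ≋ B′ → c i ∈ B → c j ∈ B → c i ∈ B′ → c j ∈ B′ → i ≡ j
  meet-once {i = i} {j} ≉ a b a′ b′ with i ≟ j
  ... | yes i≡j = i≡j
  ... | no i≢j = ⊥-elim (≉ (unique i≢j a b a′ b′))

  opaque
    _≋?_ : ∀ B B′ → Dec (B ≋ B′)
    B ≋? B′ = map′ (λ (a , b) → unique (i≢j B) (i∈ B) (j∈ B) a b)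
      (λ e → proj₁ (e _) (i∈ B) , proj₁ (e _) (j∈ B)) ((c (Block.i B) ∈? B′) ×-dec (c (Block.j B) ∈? B′))

  module _ {π : Subset Pt} (Pπ : 𝒫 π) where
    private
      arc = A1-arc π Pπ
      f = proj₁ (proj₁ arc)
      onArc = λ t → proj₂ (proj₂ (proj₂ (proj₁ arc)) (f t)) (t , refl)

    opaque
      arcIndex : Fin q → I
      arcIndex t = proj₁ (toIsC (proj₁ (onArc t)))

      arcIndex-eq : ∀ t → c (arcIndex t) ≡ f t
      arcIndex-eq t = proj₂ (toIsC (proj₁ (onArc t)))

      arcIndex-inj : Inj arcIndex
      arcIndex-inj {s} {t} eq = proj₁ (proj₂ (proj₁ arc)) s t
        (trans (sym (arcIndex-eq s)) (trans (cong c eq) (arcIndex-eq t)))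

      arcIndex∈ : ∀ t → π (c (arcIndex t))
      arcIndex∈ t = subst π (sym (arcIndex-eq t)) (proj₂ (onArc t))

      arcIndex-onto : ∀ {i} → π (c i) → ∃[ t ] arcIndex t ≡ i
      arcIndex-onto {i} i∈ with proj₁ (proj₂ (proj₂ (proj₁ arc)) (c i)) (c∈𝒞 i , i∈)
      ... | t , eq = t , c-inj (trans (arcIndex-eq t) eq)

  opaque
    pts : (B : Block) → Fin q → I
    pts B = arcIndex (points∈𝒫 B)

    pts-inj : (B : Block) → Inj (pts B)
    pts-inj B = arcIndex-inj (points∈𝒫 B)

    pts∈ : (B : Block) → ∀ t → c (pts B t) ∈ B
    pts∈ B = arcIndex∈ (points∈𝒫 B)

    pts-onto : (B : Block) → ∀ {i} → c i ∈ B → ∃[ t ] pts B t ≡ i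
    pts-onto B = arcIndex-onto (points∈𝒫 B)

  otherPts : (B : Block) → ∀ k (xs : List I) → k +ℕ length xs ≤ q →
             Σ (Fin k → I) λ e → Inj e × (∀ t → c (e t) ∈ B) × (∀ t {i} → i ∈ₗ xs → e t ≢ i)
  otherPts B k xs le with avoid _≟_ (pts B) (pts-inj B) k xs le
  ... | e , inj , av = (λ t → pts B (e t)) , (λ eq → inj (pts-inj B eq)) , (λ t → pts∈ B (e t)) , av

  k≤q : ∀ {k} → k ≤ 7 → k ≤ q
  k≤q k≤7 = ℕ.≤-trans k≤7 7≤q

  -- Two of the q C-points of π name it. This lets (A3), which speaks of planes, be used for blocks.
  toBlock : ∀ {π} → 𝒫 π → ∃[ B ] points B ≐ π
  toBlock {π} Pπ = B , plane-unique ≢ (points∈𝒫 B) Pπ (i∈ B) (j∈ B) (arcIndex∈ Pπ _) (arcIndex∈ Pπ _)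
    where
    2≤q : 2 ≤ q
    2≤q = k≤q (s≤s (s≤s z≤n))
    two : Fin 2 → Fin q
    two t = inject≤ t 2≤q

    ≢ : arcIndex Pπ (two zero) ≢ arcIndex Pπ (two (suc zero))
    ≢ eq with inject≤-injective 2≤q 2≤q zero (suc zero) (arcIndex-inj Pπ eq)
    ... | ()
    B = join _ _ ≢

  opaque
    second : ∀ {x} {B : Block} → ¬ IsC x → x ∈ B → ∃[ B′ ] (¬ B′ ≋ B × x ∈ B′)
    second {x} {B} nonC x∈ with A3 x
    ... | inj₁ Cx = ⊥-elim (nonC (toIsC Cx))
    ... | inj₂ (inj₁ none) = ⊥-elim (none _ (points∈𝒫 B) x∈)
    ... | inj₂ (inj₂ (π₁ , π₂ , P₁ , P₂ , x∈₁ , x∈₂ , ≉ , only)) with only _ (points∈𝒫 B) x∈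
    ...   | inj₁ e with toBlock P₂
    ...     | B′ , e′ = B′ , (λ B′≋B → ≉ (≐-trans (≐-sym e) (≐-trans (≐-sym B′≋B) e′))) , proj₂ (e′ x) x∈₂
    second {x} {B} nonC x∈ | inj₂ (inj₂ (π₁ , π₂ , P₁ , P₂ , x∈₁ , x∈₂ , ≉ , only)) | inj₂ e with toBlock P₁
    ...     | B′ , e′ = B′ , (λ B′≋B → ≉ (≐-trans (≐-sym e′) (≐-trans B′≋B e))) , proj₂ (e′ x) x∈₁

  -- (A3) offers only two planes through `x`, and `B` takes one of them.
  third : ∀ {x B B′ B″} → ¬ IsC x → x ∈ B → x ∈ B′ → x ∈ B″ → ¬ B ≋ B′ → ¬ B ≋ B″ → B′ ≋ B″
  third {x} {B} {B′} {B″} nonC x∈ x∈′ x∈″ ≉′ ≉″ with A3 x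
  ... | inj₁ Cx = ⊥-elim (nonC (toIsC Cx))
  ... | inj₂ (inj₁ none) = ⊥-elim (none _ (points∈𝒫 B) x∈)
  ... | inj₂ (inj₂ (π₁ , π₂ , _ , _ , _ , _ , _ , only))
    with only _ (points∈𝒫 B) x∈ | only _ (points∈𝒫 B′) x∈′ | only _ (points∈𝒫 B″) x∈″
  ...   | _ | inj₁ e | inj₁ e′ = ≐-trans e (≐-sym e′)
  ...   | _ | inj₂ e | inj₂ e′ = ≐-trans e (≐-sym e′)
  ...   | inj₁ e | inj₁ e′ | inj₂ _ = ⊥-elim (≉′ (≐-trans e (≐-sym e′)))
  ...   | inj₂ e | inj₁ _ | inj₂ e″ = ⊥-elim (≉″ (≐-trans e (≐-sym e″)))
  ...   | inj₁ e | inj₂ _ | inj₁ e″ = ⊥-elim (≉″ (≐-trans e (≐-sym e″)))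
  ...   | inj₂ e | inj₂ e′ | inj₁ _ = ⊥-elim (≉′ (≐-trans e (≐-sym e′)))

  -- Parallel C-planes

  Disjoint : Block → Block → Set
  Disjoint B B′ = ∀ i → c i ∈ B → c i ∈ B′ → ⊥

  Meet : Block → Block → Set
  Meet B B′ = ∃[ i ] (c i ∈ B × c i ∈ B′)

  meet? : ∀ B B′ → Meet B B′ ⊎ Disjoint B B′
  meet? B B′ with any? (λ i → (c i ∈? B) ×-dec (c i ∈? B′))
  ... | yes p = inj₁ p
  ... | no none = inj₂ λ i a b → none (i , a , b)

  Disjoint-sym : ∀ {B B′} → Disjoint B B′ → Disjoint B′ B
  Disjoint-sym d i a b = d i b a

  -- Otherwise `B₁`, `B₂` and the joins of `c r` to the q C-points of `B` would be q + 2 different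
  -- blocks through `c r`. Off `c r` they would have (q + 2)(q - 1) different C-points, more than
  -- q².
  parallel-unique : ∀ {r B B₁ B₂} → c r ∈ B₁ → c r ∈ B₂ → Disjoint B₁ B → Disjoint B₂ B → B₁ ≋ B₂
  parallel-unique {r} {B} {B₁} {B₂} r∈₁ r∈₂ d₁ d₂ with B₁ ≋? B₂
  ... | yes e = e
  ... | no B₁≉B₂ = ⊥-elim ([n+2]*[n-1]≰n*n 7≤q (inj-× point point-inj))
    where
    r∉B : ¬ c r ∈ B
    r∉B = d₁ r r∈₁

    r≢ : ∀ t → r ≢ pts B t
    r≢ t refl = r∉B (pts∈ B t)

    pencil : Fin (2 +ℕ q) → Block
    pencil zero = B₁
    pencil (suc zero) = B₂
    pencil (suc (suc t)) = join r (pts B t) (r≢ t)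

    r∈ : ∀ k → c r ∈ pencil k
    r∈ zero = r∈₁
    r∈ (suc zero) = r∈₂
    r∈ (suc (suc t)) = i∈ (pencil (suc (suc t)))

    t∈ : ∀ t → c (pts B t) ∈ pencil (suc (suc t))
    t∈ t = j∈ (pencil (suc (suc t)))

    pencil-inj : ∀ k l → pencil k ≋ pencil l → k ≡ l
    pencil-inj zero zero _ = refl
    pencil-inj zero (suc zero) e = ⊥-elim (B₁≉B₂ e)
    pencil-inj (suc zero) zero e = ⊥-elim (B₁≉B₂ (≐-sym e))
    pencil-inj (suc zero) (suc zero) _ = refl
    pencil-inj zero (suc (suc t)) e = ⊥-elim (d₁ _ (proj₂ (e _) (t∈ t)) (pts∈ B t))
    pencil-inj (suc zero) (suc (suc t)) e = ⊥-elim (d₂ _ (proj₂ (e _) (t∈ t)) (pts∈ B t))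
    pencil-inj (suc (suc t)) zero e = ⊥-elim (d₁ _ (proj₁ (e _) (t∈ t)) (pts∈ B t))
    pencil-inj (suc (suc t)) (suc zero) e = ⊥-elim (d₂ _ (proj₁ (e _) (t∈ t)) (pts∈ B t))
    pencil-inj (suc (suc s)) (suc (suc t)) e with s ≟ t
    ... | yes refl = refl
    ... | no s≢t = ⊥-elim (r∉B (proj₁ (unique (s≢t ∘ pts-inj B) (proj₁ (e _) (t∈ s)) (t∈ t) (pts∈ B s) (pts∈ B t) _) (r∈ (suc (suc t)))))

    others = λ k → otherPts (pencil k) m (r ∷ []) (ℕ.≤-reflexive (ℕ.+-comm m 1))

    point : Fin (2 +ℕ q) → Fin m → I
    point k = proj₁ (others k)

    point-inj : ∀ {k s l t} → point k s ≡ point l t → k ≡ l × s ≡ t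
    point-inj {k} {s} {l} {t} eq with k ≟ l
    ... | yes refl = refl , proj₁ (proj₂ (others k)) eq
    ... | no k≢l = ⊥-elim (proj₂ (proj₂ (proj₂ (others k))) s (here refl)
      (meet-once (k≢l ∘ pencil-inj k l) (proj₁ (proj₂ (proj₂ (others k))) s) (r∈ k)
        (subst (λ i → c i ∈ pencil l) (sym eq) (proj₁ (proj₂ (proj₂ (others l))) t)) (r∈ l)))

  -- Two blocks together have at most 2q C-points, fewer than q².
  outside′ : ∀ B B′ → ∃[ i ] (¬ c i ∈ B × ¬ c i ∈ B′)
  outside′ B B′ with any? (λ i → ¬? (c i ∈? B) ×-dec ¬? (c i ∈? B′))
  ... | yes p = p
  ... | no none = ⊥-elim (ℕ.<⇒≱ q+q<q*q (injective⇒≤ {f = Fin.join q q ∘ place} (λ {i} {j} eq → place-inj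
    (trans (sym (splitAt-join q q (place i))) (trans (cong (splitAt q) eq)
      (splitAt-join q q (place j)))))))
    where
    q+q<q*q : q +ℕ q ℕ.< q *ℕ q
    q+q<q*q = ℕ.<-≤-trans (ℕ.m<n+m (q +ℕ q) {q} (s≤s z≤n))
      (ℕ.≤-trans (ℕ.≤-reflexive (sym (cong (λ x → q +ℕ (q +ℕ x)) (ℕ.+-identityʳ q)))) (ℕ.*-monoˡ-≤ q (k≤q {3} (s≤s (s≤s (s≤s z≤n))))))
    place : I → Fin q ⊎ Fin q
    place i with c i ∈? B
    ... | yes i∈ = inj₁ (proj₁ (pts-onto B i∈))
    ... | no i∉ with c i ∈? B′
    ...   | yes i∈ = inj₂ (proj₁ (pts-onto B′ i∈))
    ...   | no i∉′ = ⊥-elim (none (i , i∉ , i∉′))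
    place-eq : ∀ i → [ pts B , pts B′ ]′ (place i) ≡ i
    place-eq i with c i ∈? B
    ... | yes i∈ = proj₂ (pts-onto B i∈)
    ... | no i∉ with c i ∈? B′
    ...   | yes i∈ = proj₂ (pts-onto B′ i∈)
    ...   | no i∉′ = ⊥-elim (none (i , i∉ , i∉′))
    place-inj : Inj place
    place-inj {i} {j} eq = trans (sym (place-eq i)) (trans (cong [ pts B , pts B′ ]′ eq) (place-eq j))

  opaque
    outside : (B B′ : Block) → ∃[ i ] (¬ c i ∈ B × ¬ c i ∈ B′)
    outside = outside′

  -- A block through a C-point of B and one outside of B meets each block
  -- that is disjoint from B, and in different C-points for different ones.
  parallels-bound : ∀ B (τ : Fin (suc q) → Block) → (∀ k → Disjoint (τ k) B) →
                    (∀ {k l} → τ k ≋ τ l → k ≡ l) → ⊥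
  parallels-bound B τ disj τ-inj with outside B B
  ... | r , r∉ , _ = ℕ.1+n≰n (injective⇒≤ {f = λ k → proj₁ (index k)} index-inj)
    where
    p = Block.i B
    p≢r : p ≢ r
    p≢r refl = r∉ (i∈ B)
    ρ = join p r p≢r
    meets : ∀ k → Meet ρ (τ k)
    meets k with meet? ρ (τ k)
    ... | inj₁ met = met
    -- If ρ missed `τ k`, then ρ and `B` would be two blocks through `c p` disjoint from `τ k`.
    ... | inj₂ d = ⊥-elim (r∉ (proj₁ (parallel-unique {p} {τ k} {ρ} {B} (i∈ ρ) (i∈ B) d (Disjoint-sym {τ k} {B} (disj k)) _) (j∈ ρ)))
    index : ∀ k → ∃[ t ] pts ρ t ≡ proj₁ (meets k)
    index k = pts-onto ρ (proj₁ (proj₂ (meets k)))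
    index-inj : ∀ {k l} → proj₁ (index k) ≡ proj₁ (index l) → k ≡ l
    index-inj {k} {l} eq = τ-inj (parallel-unique {proj₁ (meets k)} {B} (proj₂ (proj₂ (meets k)))
      (subst (λ i → c i ∈ τ l) (trans (sym (proj₂ (index l))) (trans (cong (pts ρ) (sym eq)) (proj₂ (index k))))
        (proj₂ (proj₂ (meets l)))) (disj k) (disj l))

  -- Lines in the plane of a block, shared and unshared

  ⊖≢0 : ∀ {i j} → i ≢ j → c j ⊖ c i ≢ 0v
  ⊖≢0 {i} {j} i≢j eq = i≢j (c-inj (vsolve 0 2 (λ x y → x :≈ y givenᵛ (:- :1 ∙ᵛ y :⊖ x :≈ :0v) ∷ []) refl (c i) (c j) eq))

  line-inj : ∀ {x w s t} → w ≢ 0v → x ⊕ s · w ≡ x ⊕ t · w → s ≡ t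
  line-inj {x} {w} {s} {t} w≢0 eq = x-y≡0⇒x≡y s t (·-cancel w≢0
    (vsolve 2 2 (λ s t x w → (s :+ :- t) :· w :≈ :0v givenᵛ (:1 ∙ᵛ x :⊕ s :· w :≈ x :⊕ t :· w) ∷ []) refl s t x w eq))

  not-three-on-line : ∀ {B x w i j k} r s t → w ≢ 0v → c i ∈ B → c j ∈ B → c k ∈ B →
    c i ≡ x ⊕ r · w → c j ≡ x ⊕ s · w → c k ≡ x ⊕ t · w → i ≢ j → j ≢ k → i ≢ k → ⊥
  not-three-on-line {B} {x} {w} {i} {j} {k} r s t w≢0 i∈ j∈ k∈ ei ej ek i≢j j≢k i≢k =
    proj₂ (A1-arc _ (points∈𝒫 B)) (c i) (c j) (c k) (c∈𝒞 i , i∈) (c∈𝒞 j , j∈) (c∈𝒞 k , k∈)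
      (i≢j ∘ c-inj , j≢k ∘ c-inj , i≢k ∘ c-inj) (x , w , w≢0 , (r , ei) , (s , ej) , (t , ek))

  arc-independent : ∀ {B i j k} → c i ∈ B → c j ∈ B → c k ∈ B → i ≢ j → j ≢ k → i ≢ k →
                    Independent (c j ⊖ c i) (c k ⊖ c i)
  arc-independent {B} {i} {j} {k} i∈ j∈ k∈ i≢j j≢k i≢k = ∦⇒independent (⊖≢0 i≢j) λ (a , eq) →
    not-three-on-line {B} {c i} {c j ⊖ c i} 0# 1# a (⊖≢0 i≢j) i∈ j∈ k∈
      (vsolve 0 2 (λ x y → x :≈ x :⊕ :0 :· (y :⊖ x) givenᵛ []) refl (c i) (c j)) (vsolve 0 2 (λ x y →
        y :≈ x :⊕ :1 :· (y :⊖ x) givenᵛ []) refl (c i) (c j))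
      (vsolve 1 3 (λ a x y z → z :≈ x :⊕ a :· (y :⊖ x) givenᵛ (:1 ∙ᵛ z :⊖ x :≈ a :· (y :⊖ x)) ∷ [])
        refl a (c i) (c j) (c k) eq) i≢j j≢k i≢k

  -- At most two parameters give C-points, because the line lies in the plane of an arc.
  freeParams : ∀ {B x w} → x ∈ B → Dir B w → w ≢ 0v → ∀ k → k +ℕ 2 ≤ q →
               Σ (Fin k → K) λ e → Inj e × (∀ t → ¬ IsC (x ⊕ e t · w))
  freeParams {B} {x} {w} x∈ Dw w≢0 k le = proj₁ a , proj₁ (proj₂ a) , λ i isC →
    proj₂ (proj₂ a) i (there (here refl)) (cover (proj₁ a i) isC (proj₂ (proj₂ a) i (here refl)))
    where
    on : ∀ i {t} → c i ≡ x ⊕ t · w → c i ∈ B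
    on i {t} eq = subst (_∈ B) (sym eq) (shift-· {B} t x∈ Dw)
    apart : ∀ {i j s t} → s ≢ t → c i ≡ x ⊕ s · w → c j ≡ x ⊕ t · w → i ≢ j
    apart s≢t ei ej refl = s≢t (line-inj w≢0 (trans (sym ei) ej))
    two : ∃ λ s → ∃ λ t → ∀ i → IsC (x ⊕ i · w) → i ≢ s → i ≡ t
    two = at-most-two {P = λ t → IsC (x ⊕ t · w)} (λ t → isC? (x ⊕ t · w))
      (λ r s t (i , ei) (j , ej) (l , el) r≢s s≢t r≢t → not-three-on-line {B} {x} {w} {i} {j} {l} r s t w≢0
        (on i ei) (on j ej) (on l el) ei ej el (apart r≢s ei ej) (apart s≢t ej el) (apart r≢t ei el))
    cover = proj₂ (proj₂ two)
    a = avoid _≟_ (λ (x : Fin q) → x) (λ eq → eq) k (proj₁ two ∷ proj₁ (proj₂ two) ∷ []) le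

  -- To be read for `x` on `B` and `v` a direction of `B`: then the line through `x` in direction
  -- `v` lies in both blocks.
  Shared : Block → Pt → Pt → Set
  Shared B x v = ∃[ B′ ] (¬ B′ ≋ B × x ∈ B′ × Dir B′ v)

  opaque
    shared? : ∀ B x v → Dec (Shared B x v)
    shared? B x v = searchBlock λ B′ → ¬? (B′ ≋? B) ×-dec ((x ∈? B′) ×-dec Dir? B′ v)

  Unshared : Block → Pt → Set
  Unshared B x = ∀ w → w ≢ 0v → Dir B w → ¬ Shared B x w

  module _ {B : Block} where
    shared-shift : ∀ {x v} t → Shared B x v → Shared B (x ⊕ t · v) v
    shared-shift t (B′ , ≉ , x∈ , Dv) = B′ , ≉ , shift-· {B′} t x∈ Dv , Dv

    shared-unshift : ∀ {x v} t → Shared B (x ⊕ t · v) v → Shared B x v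
    shared-unshift {x} {v} t sh = subst (λ y → Shared B y v)
      (vsolve 1 2 (λ t x v → x :⊕ t :· v :⊕ :- t :· v :≈ x givenᵛ []) refl t x v) (shared-shift (- t) sh)

    shared-∥ : ∀ {x v w} → w ∥ v → Shared B x v → Shared B x w
    shared-∥ w∥v (B′ , ≉ , x∈ , Dv) = B′ , ≉ , x∈ , Dir-∥ {B′} w∥v Dv

    -- Two C-points on a shared line would lie in two different blocks.
    shared-one : ∀ {i j v} t → c i ∈ B → c j ∈ B → Shared B (c i) v → c j ≡ c i ⊕ t · v → i ≡ j
    shared-one t i∈ j∈ (B′ , ≉ , i∈′ , Dv) eq =
      meet-once ≉ i∈′ (subst (_∈ B′) (sym eq) (shift-· {B′} t i∈′ Dv)) i∈ j∈

    shared-nonC : ∀ {i v t} → c i ∈ B → v ≢ 0v → Dir B v → t ≢ 0# → Shared B (c i) v → ¬ IsC (c i ⊕ t · v)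
    shared-nonC {i} {v} {t} i∈ v≢0 Dv t≢0 sh (j , eq) =
      ·≢0 t≢0 v≢0 (vsolve 1 2 (λ t x v → t :· v :≈ :0v givenᵛ (:- :1 ∙ᵛ x :≈ x :⊕ t :· v) ∷ [])
        refl t (c i) v (trans (cong c i≡j) eq))
      where
      i≡j : i ≡ j
      i≡j = shared-one t i∈ (subst (_∈ B) (sym eq) (shift-· {B} t i∈ Dv)) sh eq

    ⊖-Dir-≢0 : ∀ {x i} → ¬ IsC x → c i ⊖ x ≢ 0v
    ⊖-Dir-≢0 {x} {i} nonC eq = nonC (i , vsolve 0 2 (λ x y → y :≈ x givenᵛ (:1 ∙ᵛ y :⊖ x :≈ :0v) ∷ []) refl x (c i) eq)

    -- The line from `x` to a common C-point would be in both planes, a shared line through `x`.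
    single-disjoint : ∀ {x τ} → x ∈ B → ¬ IsC x → Unshared B x → ¬ τ ≋ B → x ∈ τ → Disjoint τ B
    single-disjoint {x} {τ} x∈ nonC un ≉ x∈τ i i∈τ i∈ =
      un _ (⊖-Dir-≢0 {x} {i} nonC) (difference {B} x∈ i∈) (τ , ≉ , x∈τ , difference {τ} x∈τ i∈τ)

    single-inj : ∀ {x y τ} → x ∈ B → y ∈ B → Unshared B x → ¬ τ ≋ B → x ∈ τ → y ∈ τ → x ≡ y
    single-inj {x} {y} {τ} x∈ y∈ un ≉ x∈τ y∈τ with y ⊖ x ≟ᵛ 0v
    ... | yes eq = vsolve 0 2 (λ x y → x :≈ y givenᵛ (:- :1 ∙ᵛ y :⊖ x :≈ :0v) ∷ []) refl x y eq
    ... | no ≢0 = ⊥-elim (un _ ≢0 (difference {B} x∈ y∈) (τ , ≉ , x∈τ , difference {τ} x∈τ y∈τ))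

  same-plane : ∀ {B B′ x v w} → x ∈ B → x ∈ B′ → Independent v w → Dir B v → Dir B w → Dir B′ v → Dir B′ w → B ≋ B′
  same-plane {B} {B′} {x} {v} {w} x∈ x∈′ ind Dv Dw Dv′ Dw′ y =
    (λ y∈ → shiftTo {B′} x∈′ (sub {B} {B′} Dv Dw Dv′ Dw′ (difference {B} x∈ y∈))) ,
    (λ y∈ → shiftTo {B} x∈ (sub {B′} {B} Dv′ Dw′ Dv Dw (difference {B′} x∈′ y∈)))
    where
    sub : ∀ {B B′ z} → Dir B v → Dir B w → Dir B′ v → Dir B′ w → Dir B z → Dir B′ z
    sub {B} {B′} Dv Dw Dv′ Dw′ Dz with basis₂ {B} ind Dv Dw Dz
    ... | a , b , refl = Dir-lin {B′} a b Dv′ Dw′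

  -- By (A3) both lines lie in the same second block; if they were different, this block would be
  -- `B`.
  shared-meet : ∀ {B x v w} → ¬ IsC x → x ∈ B → v ≢ 0v → Dir B v → Dir B w → Shared B x v → Shared B x w → w ∥ v
  shared-meet {B} {x} {v} {w} nonC x∈ v≢0 Dv Dw (B₁ , ≉₁ , x∈₁ , Dv₁) (B₂ , ≉₂ , x∈₂ , Dw₂) with ∥? w v
  ... | yes w∥v = w∥v
  ... | no ∦ = ⊥-elim (≉₁ (≐-sym (same-plane {B} {B₁} x∈ x∈₁ (∦⇒independent v≢0 ∦) Dv Dw Dv₁
    (Dir-of-≋ {B₂} {B₁} (third {B = B} nonC x∈ x∈₂ x∈₁ (≉₂ ∘ ≐-sym) (≉₁ ∘ ≐-sym)) Dw₂))))

  -- The second blocks through the points `X k` are disjoint from `B` on 𝒞 and pairwise different,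
  -- so `parallels-bound` applies.
  few-unshared : ∀ {B} (X : Fin (suc q) → Pt) → Inj X → (∀ k → X k ∈ B) → (∀ k → ¬ IsC (X k)) →
                 (∀ k → Unshared B (X k)) → ⊥
  few-unshared {B} X X-inj X∈ nonC un = parallels-bound B τ
    (λ k → single-disjoint {B} {τ = τ k} (X∈ k) (nonC k) (un k) (≉ k) (∈τ k))
    (λ {k} {l} e → X-inj (single-inj {B} {τ = τ l} (X∈ k) (X∈ l) (un k) (≉ l) (proj₁ (e _) (∈τ k)) (∈τ l)))
    where
    σ : ∀ k → ∃[ B′ ] (¬ B′ ≋ B × X k ∈ B′)
    σ k = second (nonC k) (X∈ k)
    τ = λ k → proj₁ (σ k)
    ≉ : ∀ k → ¬ τ k ≋ B
    ≉ k = proj₁ (proj₂ (σ k))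
    ∈τ : ∀ k → X k ∈ τ k
    ∈τ k = proj₂ (proj₂ (σ k))

  -- The two lines hold at least 2(q - 2) > q points off 𝒞, none on a shared line of `B`. They are
  -- only required not to meet off 𝒞, so secants through one C-point qualify.
  two-lines : ∀ {B x v y w} → x ∈ B → y ∈ B → Dir B v → Dir B w → v ≢ 0v → w ≢ 0v →
              (∀ t → ¬ IsC (x ⊕ t · v) → Unshared B (x ⊕ t · v)) →
              (∀ t → ¬ IsC (y ⊕ t · w) → Unshared B (y ⊕ t · w)) →
              (∀ s t → ¬ IsC (x ⊕ s · v) → x ⊕ s · v ≢ y ⊕ t · w) → ⊥
  two-lines {B} {x} {v} {y} {w} x∈ y∈ Dv Dw v≢0 w≢0 unx uny apart =
    few-unshared {B} (λ i → X (place i)) (λ eq → place-inj (X-inj eq)) (λ i → X∈ (place i)) (λ i → nonC (place i)) (λ i → un (place i))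
    where
    k = proj₁ (double-gap 7≤q)
    e₁ = freeParams {B} x∈ Dv v≢0 k (proj₁ (proj₂ (double-gap 7≤q)))
    e₂ = freeParams {B} y∈ Dw w≢0 k (proj₁ (proj₂ (double-gap 7≤q)))
    le = proj₂ (proj₂ (double-gap 7≤q))
    place : Fin (suc q) → Fin k ⊎ Fin k
    place i = splitAt k (inject≤ i le)
    place-inj : Inj place
    place-inj {i} {j} eq = inject≤-injective le le i j
      (trans (sym (join-splitAt k k _)) (trans (cong (Fin.join k k) eq) (join-splitAt k k _)))
    X : Fin k ⊎ Fin k → Pt
    X (inj₁ i) = x ⊕ proj₁ e₁ i · v
    X (inj₂ i) = y ⊕ proj₁ e₂ i · w
    nonC : ∀ s → ¬ IsC (X s)
    nonC (inj₁ i) = proj₂ (proj₂ e₁) i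
    nonC (inj₂ i) = proj₂ (proj₂ e₂) i
    X-inj : Inj X
    X-inj {inj₁ i} {inj₁ j} eq = cong inj₁ (proj₁ (proj₂ e₁) (line-inj v≢0 eq))
    X-inj {inj₁ i} {inj₂ j} eq = ⊥-elim (apart _ _ (nonC (inj₁ i)) eq)
    X-inj {inj₂ i} {inj₁ j} eq = ⊥-elim (apart _ _ (nonC (inj₁ j)) (sym eq))
    X-inj {inj₂ i} {inj₂ j} eq = cong inj₂ (proj₁ (proj₂ e₂) (line-inj w≢0 eq))
    X∈ : ∀ s → X s ∈ B
    X∈ (inj₁ i) = shift-· {B} _ x∈ Dv
    X∈ (inj₂ i) = shift-· {B} _ y∈ Dw
    un : ∀ s → Unshared B (X s)
    un (inj₁ i) = unx _ (nonC (inj₁ i))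
    un (inj₂ i) = uny _ (nonC (inj₂ i))

  -- The common direction of the shared lines of a block

  record IsAxis (B : Block) (V : Pt) : Set where
    field
      V≢0   : V ≢ 0v
      V∈    : Dir B V
      only  : ∀ {x v} → x ∈ B → v ≢ 0v → Dir B v → Shared B x v → v ∥ V
      -- The counts still allow one line of direction V without shared points; `good` later finds
      -- that no C-point is on it.
      lines : ∀ {x y} → x ∈ B → y ∈ B → ¬ Shared B x V → ¬ Shared B y V → ∃[ t ] y ≡ x ⊕ t · V

  -- Otherwise two parallel lines of the plane would contradict `two-lines`.
  exists-shared : ∀ B → ∃[ x ] ∃[ v ] (x ∈ B × v ≢ 0v × Dir B v × Shared B x v)
  exists-shared B = decidable-stable (searchPt (λ x → searchPt λ v → (x ∈? B) ×-dec (¬? (v ≟ᵛ 0v) ×-dec (Dir? B v ×-dec shared? B x v))))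
    λ none → two-lines {B} {base B} {u B} {base B ⊕ v B} {u B} (base∈ {B}) (shift {B} (base∈ {B}) Dv) Du Du u≢0 u≢0
      (λ t _ → un none (shift-· {B} t (base∈ {B}) Du)) (λ t _ → un none (shift-· {B} t (shift {B} (base∈ {B}) Dv) Du))
      λ s t _ eq → neg≢0 1≢0 (proj₂ (u-v-independent B (s + - t) (- 1#)
      (vsolve 2 3 (λ s t p u v → (s :+ :- t) :· u :⊕ :- :1 :· v :≈ :0v givenᵛ (:1 ∙ᵛ p :⊕ s :· u :≈ p :⊕ v :⊕ t :· u) ∷ [])
        refl s t (base B) (u B) (v B) eq)))
    where
    u≢0 = independent⇒≢0ˡ (u-v-independent B)
    Du : Dir B (u B)
    Du = 1# , 0# , vsolve 0 2 (λ u v → u :≈ :1 :· u :⊕ :0 :· v givenᵛ []) refl (u B) (v B)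
    Dv : Dir B (v B)
    Dv = 0# , 1# , vsolve 0 2 (λ u v → v :≈ :0 :· u :⊕ :1 :· v givenᵛ []) refl (u B) (v B)
    un : ∀ {x} → ¬ (∃[ x ] ∃[ v ] (x ∈ B × v ≢ 0v × Dir B v × Shared B x v)) → x ∈ B → Unshared B x
    un none x∈ w w≢0 Dw sh = none (_ , w , x∈ , w≢0 , Dw , sh)

  crossing : ∀ {B x y v w} → x ∈ B → y ∈ B → v ≢ 0v → ¬ w ∥ v → Dir B v → Dir B w → ∃[ s ] ∃[ t ] x ⊕ s · v ≡ y ⊕ t · w
  crossing {B} {x} {y} {v} {w} x∈ y∈ v≢0 ∦ Dv Dw with basis₂ {B} (∦⇒independent v≢0 ∦) Dv Dw (difference {B} x∈ y∈)
  ... | a , b , eq = a , - b , vsolve 2 4 (λ a b x y v w → x :⊕ a :· v :≈ y :⊕ :- b :· w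
    givenᵛ (:- :1 ∙ᵛ y :⊖ x :≈ a :· v :⊕ b :· w) ∷ []) refl a b x y v w eq

  -- Suppose that two shared lines cross at the C-point z. Then all shared lines of `B` pass through
  -- z, so no point off 𝒞 on a secant through z is on a shared line, and two secants through z
  -- contradict `two-lines`.
  module Concurrent {B V v z} (z∈ : c z ∈ B) (V≢0 : V ≢ 0v) (v≢0 : v ≢ 0v) (DV : Dir B V) (Dv : Dir B v)
    (∦ : ¬ v ∥ V) (shV : Shared B (c z) V) (shv : Shared B (c z) v) where

    -- The two lines cross either off 𝒞, where shared lines coincide, or at a C-point of the line of
    -- direction `d`, whose only C-point is z.
    through′ : ∀ {d y w} → d ≢ 0v → Dir B d → Shared B (c z) d → ¬ w ∥ d →
               y ∈ B → Dir B w → Shared B y w → ∃[ t ] c z ≡ y ⊕ t · w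
    through′ {d} {y} {w} d≢0 Dd shd w∦d y∈ Dw shw = t , (case isC? Z of λ where
      (no nonC) → ⊥-elim (w∦d (shared-meet {B} nonC Z∈ d≢0 Dd Dw shZd shZw))
      (yes (i , ei)) → trans (cong c (shared-one {B} s z∈ (subst (_∈ B) (sym ei) Z∈) shd ei)) (trans ei eq))
      where
      cr = crossing {B} z∈ y∈ d≢0 w∦d Dd Dw
      s = proj₁ cr
      t = proj₁ (proj₂ cr)
      Z = c z ⊕ s · d
      eq : Z ≡ y ⊕ t · w
      eq = proj₂ (proj₂ cr)
      Z∈ : Z ∈ B
      Z∈ = shift-· {B} s z∈ Dd
      shZd : Shared B Z d
      shZd = shared-shift {B} s shd
      shZw : Shared B Z w
      shZw = subst (λ p → Shared B p w) (sym eq) (shared-shift {B} t shw)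

    through : ∀ {y w} → y ∈ B → w ≢ 0v → Dir B w → Shared B y w → ∃[ t ] c z ≡ y ⊕ t · w
    through {y} {w} y∈ w≢0 Dw shw with ∥? w V
    ... | no w∦V = through′ V≢0 DV shV w∦V y∈ Dw shw
    ... | yes w∥V = through′ v≢0 Dv shv (λ w∥v → ∦ (∥-trans (∥-sym w≢0 w∥v) w∥V)) y∈ Dw shw

    module Secant {p} (p∈ : c p ∈ B) (p≢z : p ≢ z) where
      d : Pt
      d = c p ⊖ c z
      d≢0 : d ≢ 0v
      d≢0 = ⊖≢0 (p≢z ∘ sym)
      Dd : Dir B d
      Dd = difference {B} z∈ p∈

      nonC⇒t≢0 : ∀ {t} → ¬ IsC (c z ⊕ t · d) → t ≢ 0#
      nonC⇒t≢0 nonC refl = nonC (z , vsolve 0 2 (λ x d → x :≈ x :⊕ :0 :· d givenᵛ []) refl (c z) d)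

      -- A shared line through this point passes through z too, so it would be the secant, which has
      -- two C-points.
      unshared : ∀ t → ¬ IsC (c z ⊕ t · d) → Unshared B (c z ⊕ t · d)
      unshared t nonC w w≢0 Dw shw = p≢z (sym (shared-one {B} 1# z∈ p∈
        (shared-unshift {B} t (shared-∥ {B} d∥w shw)) (vsolve 0 2 (λ x y → y :≈ x :⊕ :1 :· (y :⊖ x) givenᵛ []) refl (c z) (c p))))
        where
        th = through (shift-· {B} t z∈ Dd) w≢0 Dw shw
        r = proj₁ th
        i = inv t (nonC⇒t≢0 nonC)
        d∥w : d ∥ w
        d∥w = - (i * r) , vsolve 3 3 (λ t i r x d w → d :≈ :- (i :* r) :· w givenᵛ (:- i ∙ᵛ x :≈ x :⊕ t :· d :⊕ r :· w) ∷
          (:0v :⊖ d ∙ˢ t :* i := :1) ∷ []) refl t i r (c z) d w (proj₂ th) (x*inv≡1 t _)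

    impossible : ⊥
    impossible = two-lines {B} {c z} {d P} {c z} {d Q} z∈ z∈ (Dd P) (Dd Q) (d≢0 P) (d≢0 Q)
      (unshared P) (unshared Q) apart
      where
      others = otherPts B 2 (z ∷ []) (k≤q (s≤s (s≤s (s≤s z≤n))))
      P Q : Fin 2
      P = zero
      Q = suc zero
      open module S (k : Fin 2) = Secant {proj₁ others k} (proj₁ (proj₂ (proj₂ others)) k) (proj₂ (proj₂ (proj₂ others)) k (here refl))
      ind : Independent (d P) (d Q)
      ind = arc-independent {B} z∈ (proj₁ (proj₂ (proj₂ others)) P) (proj₁ (proj₂ (proj₂ others)) Q)
        (λ eq → proj₂ (proj₂ (proj₂ others)) P (here refl) (sym eq)) (λ eq → case proj₁ (proj₂ others) eq of λ ())
        (λ eq → proj₂ (proj₂ (proj₂ others)) Q (here refl) (sym eq))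
      apart : ∀ s t → ¬ IsC (c z ⊕ s · d P) → c z ⊕ s · d P ≢ c z ⊕ t · d Q
      apart s t nonC eq = nonC⇒t≢0 P nonC (proj₁ (ind s (- t)
        (vsolve 2 3 (λ s t x d e → s :· d :⊕ :- t :· e :≈ :0v givenᵛ (:1 ∙ᵛ x :⊕ s :· d :≈ x :⊕ t :· e) ∷ [])
          refl s t (c z) (d P) (d Q) eq)))

  module Axis-of {B V x₀} (x₀∈ : x₀ ∈ B) (V≢0 : V ≢ 0v) (DV : Dir B V) (shV : Shared B x₀ V) where

    -- A shared line of another direction would cross the given one: off 𝒞 against `shared-meet`, or
    -- at a C-point against `Concurrent`.
    only : ∀ {x v} → x ∈ B → v ≢ 0v → Dir B v → Shared B x v → v ∥ V
    only {x} {v} x∈ v≢0 Dv shv with ∥? v V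
    ... | yes v∥V = v∥V
    ... | no v∦V with crossing {B} x₀∈ x∈ V≢0 v∦V DV Dv
    ...   | s , t , eq with isC? (x₀ ⊕ s · V)
    ...     | no nonC = shared-meet {B} nonC (shift-· {B} s x₀∈ DV) V≢0 DV Dv (shared-shift {B} s shV)
      (subst (λ p → Shared B p v) (sym eq) (shared-shift {B} t shv))
    ...     | yes (z , ez) = ⊥-elim (Concurrent.impossible {B} {V} {v} {z} (subst (_∈ B) (sym ez) (shift-· {B} s x₀∈ DV))
      V≢0 v≢0 DV Dv v∦V (subst (λ p → Shared B p V) (sym ez) (shared-shift {B} s shV))
      (subst (λ p → Shared B p v) (sym (trans ez eq)) (shared-shift {B} t shv)))

    -- Otherwise the lines of direction V through `x` and `y` would be different parallels whose
    -- points off 𝒞 are on no shared line, against `two-lines`.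
    lines : ∀ {x y} → x ∈ B → y ∈ B → ¬ Shared B x V → ¬ Shared B y V → ∃[ t ] y ≡ x ⊕ t · V
    lines {x} {y} x∈ y∈ ¬x ¬y with any? (λ t → y ≟ᵛ x ⊕ t · V)
    ... | yes r = r
    ... | no none = ⊥-elim (two-lines {B} {x} {V} {y} {V} x∈ y∈ DV DV V≢0 V≢0 (un x∈ ¬x) (un y∈ ¬y)
      λ s t _ eq → none (s + - t , vsolve 2 3 (λ s t x y V → y :≈ x :⊕ (s :+ :- t) :· V
        givenᵛ (:- :1 ∙ᵛ x :⊕ s :· V :≈ y :⊕ t :· V) ∷ []) refl s t x y V eq))
      where
      un : ∀ {x} → x ∈ B → ¬ Shared B x V → ∀ t → ¬ IsC (x ⊕ t · V) → Unshared B (x ⊕ t · V)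
      un x∈ ¬x t _ w w≢0 Dw sh = ¬x (shared-unshift {B} t
        (shared-∥ {B} (∥-sym w≢0 (only (shift-· {B} t x∈ DV) w≢0 Dw sh)) sh))

    isAxis : IsAxis B V
    isAxis = record { V≢0 = V≢0 ; V∈ = DV ; only = only ; lines = lines }

  opaque
    axis : (B : Block) → ∃[ V ] IsAxis B V
    axis B = let x₀ , V , x₀∈ , V≢0 , DV , shV = exists-shared B in V , Axis-of.isAxis x₀∈ V≢0 DV shV

  -- σ and σ′ share lines of direction V with `B` and are supposed to meet in `c r`, so the three
  -- planes lie in one 3-space. A block that joins z on `B` to x on σ and meets σ′ is in that
  -- 3-space too; hence it shares a line with `B` and contains V. Among three such joins through z,
  -- two meet σ′ and coincide by (A3), or two miss σ′ and coincide as parallels.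
  module Triangle {B V} (ax : IsAxis B V) {σ σ′ p p′ r}
    (σ≉B : ¬ σ ≋ B) (σ′≉B : ¬ σ′ ≋ B) (DV : Dir σ V) (DV′ : Dir σ′ V) (p≢p′ : p ≢ p′)
    (p∈ : c p ∈ B) (p′∈ : c p′ ∈ B) (p∈σ : c p ∈ σ) (p′∈σ′ : c p′ ∈ σ′) (r∈σ : c r ∈ σ) (r∈σ′ : c r ∈ σ′) where
    open IsAxis ax

    r∉B : ¬ c r ∈ B
    r∉B r∈ = p≢p′ (trans (meet-once σ≉B p∈σ r∈σ p∈ r∈) (meet-once σ′≉B r∈σ′ p′∈σ′ r∈ p′∈))

    σ≉σ′ : ¬ σ ≋ σ′
    σ≉σ′ e = p≢p′ (meet-once σ≉B p∈σ (proj₂ (e _) p′∈σ′) p∈ p′∈)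

    module _ {z x} (z∈ : c z ∈ B) (z≢p : z ≢ p) (z≢p′ : z ≢ p′) (x∈σ : c x ∈ σ) (x≢p : x ≢ p) (x≢r : x ≢ r) where

      z∉σ : ¬ c z ∈ σ
      z∉σ z∈σ = z≢p (meet-once σ≉B z∈σ p∈σ z∈ p∈)

      z≢x : z ≢ x
      z≢x refl = z∉σ x∈σ

      ρ : Block
      ρ = join z x z≢x

      ρ≉B : ¬ ρ ≋ B
      ρ≉B e = x≢p (meet-once σ≉B x∈σ p∈σ (proj₁ (e _) (j∈ ρ)) p∈)

      module _ {y} (y∈ρ : c y ∈ ρ) (y∈σ′ : c y ∈ σ′) where
        x≢y : x ≢ y
        x≢y refl = σ≉σ′ (unique x≢r x∈σ r∈σ y∈σ′ r∈σ′)

        y≢z : y ≢ z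
        y≢z refl = z≢p′ (meet-once σ′≉B y∈σ′ p′∈σ′ z∈ p′∈)

        indA : Independent V (c z ⊖ c p)
        indA = ∦⇒independent V≢0 λ (t , eq) → z≢p (sym (shared-one {B} t p∈ z∈ (σ , σ≉B , p∈σ , DV)
          (vsolve 1 3 (λ t x z V → z :≈ x :⊕ t :· V givenᵛ (:1 ∙ᵛ z :⊖ x :≈ t :· V) ∷ []) refl t (c p) (c z) V eq)))

        indB : Independent V (c x ⊖ c p)
        indB = ∦⇒independent V≢0 λ (t , eq) → x≢p (sym (shared-one {σ} t p∈σ x∈σ (B , (σ≉B ∘ ≐-sym) , p∈ , V∈)
          (vsolve 1 3 (λ t x z V → z :≈ x :⊕ t :· V givenᵛ (:1 ∙ᵛ z :⊖ x :≈ t :· V) ∷ []) refl t (c p) (c x) V eq)))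

        p′≢r : p′ ≢ r
        p′≢r refl = r∉B p′∈

        indR : Independent V (c r ⊖ c p′)
        indR = ∦⇒independent V≢0 λ (t , eq) → p′≢r (shared-one {σ′} t p′∈σ′ r∈σ′ (B , (σ′≉B ∘ ≐-sym) , p′∈ , V∈)
          (vsolve 1 3 (λ t x z V → z :≈ x :⊕ t :· V givenᵛ (:1 ∙ᵛ z :⊖ x :≈ t :· V) ∷ []) refl t (c p′) (c r) V eq))

        -- ρ and B lie in the 3-space of B and σ, so their directions meet.
        common : Span V (c x ⊖ c p) (c r ⊖ c p) → Span V (c z ⊖ c p) (c p′ ⊖ c p) →
                 Span V (c r ⊖ c p′) (c y ⊖ c p′) →
                 ∃[ g ] Span V (c z ⊖ c p) (1# · (c y ⊖ c x) ⊕ g · (c z ⊖ c x))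
        common (r₁ , r₂ , er) (p₁ , p₂ , ep) (y₁ , y₂ , ey) = y₂ * r₂ + - 1# ,
          p₁ + y₁ + y₂ * (r₁ + - p₁) , p₂ + - (y₂ * p₂) + (y₂ * r₂ + - 1#) ,
          (vsolve 6 7 (λ r₁ r₂ p₁ p₂ y₁ y₂ V P P' R X Y Z →
            :1 :· (Y :⊖ X) :⊕ (y₂ :* r₂ :+ :- :1) :· (Z :⊖ X) :≈ (p₁ :+ y₁ :+ y₂ :* (r₁ :+ :- p₁)) :· V :⊕ (p₂ :+ :- (y₂ :* p₂) :+ (y₂ :* r₂ :+ :- :1)) :· (Z :⊖ P) givenᵛ
            (:1 ∙ᵛ Y :⊖ P' :≈ y₁ :· V :⊕ y₂ :· (R :⊖ P')) ∷
            (y₂ ∙ᵛ R :⊖ P :≈ r₁ :· V :⊕ r₂ :· (X :⊖ P)) ∷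
            (:1 :- y₂ ∙ᵛ P' :⊖ P :≈ p₁ :· V :⊕ p₂ :· (Z :⊖ P)) ∷ [])
            refl r₁ r₂ p₁ p₂ y₁ y₂ V (c p) (c p′) (c r) (c x) (c y) (c z) ey er ep)

        ρ∋V : Dir ρ V
        ρ∋V = Dir-∥ {ρ} (∥-sym w≢0 (only z∈ w≢0 (Dw (proj₂ g)) (ρ , ρ≉B , i∈ ρ , Dρ))) Dρ
          where
          g = common (basis₂ {σ} indB DV (difference {σ} p∈σ x∈σ) (difference {σ} p∈σ r∈σ))
                     (basis₂ {B} indA V∈ (difference {B} p∈ z∈) (difference {B} p∈ p′∈))
                     (basis₂ {σ′} indR DV′ (difference {σ′} p′∈σ′ r∈σ′) (difference {σ′} p′∈σ′ y∈σ′))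
          w : Pt
          w = 1# · (c y ⊖ c x) ⊕ proj₁ g · (c z ⊖ c x)
          Dρ : Dir ρ w
          Dρ = Dir-lin {ρ} 1# (proj₁ g) (difference {ρ} (j∈ ρ) y∈ρ) (difference {ρ} (j∈ ρ) (i∈ ρ))
          Dw : ∀ {w} → Span V (c z ⊖ c p) w → Dir B w
          Dw (a , b , refl) = Dir-lin {B} a b V∈ (difference {B} p∈ z∈)
          w≢0 : w ≢ 0v
          w≢0 eq = 1≢0 (proj₁ (arc-independent {ρ} (j∈ ρ) y∈ρ (i∈ ρ) x≢y y≢z (z≢x ∘ sym) 1# (proj₁ g) eq))

    module _ {z} (z∈ : c z ∈ B) (z≢p : z ≢ p) (z≢p′ : z ≢ p′)
      (x : Fin 3 → I) (x-inj : Inj x) (x∈σ : ∀ k → c (x k) ∈ σ) (x≢p : ∀ k → x k ≢ p) (x≢r : ∀ k → x k ≢ r) where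

      ρ# : Fin 3 → Block
      ρ# k = ρ z∈ z≢p z≢p′ (x∈σ k) (x≢p k) (x≢r k)

      ρ-inj : ∀ {k l} → k ≢ l → ¬ ρ# k ≋ ρ# l
      ρ-inj {k} {l} k≢l e = z∉σ z∈ z≢p z≢p′ (x∈σ k) (x≢p k) (x≢r k)
        (proj₁ (unique (k≢l ∘ x-inj) (proj₁ (e _) (j∈ (ρ# k))) (j∈ (ρ# l)) (x∈σ k) (x∈σ l) _) (i∈ (ρ# l)))

      both-meet : ∀ {k l} → k ≢ l → Meet (ρ# k) σ′ → Meet (ρ# l) σ′ → ⊥
      both-meet {k} {l} k≢l (y , y∈ρ , y∈σ′) (y′ , y′∈ρ , y′∈σ′) = ρ-inj k≢l
        (third {B = B} (shared-nonC {B} z∈ V≢0 V∈ 1≢0 (ρ# k , ≉ k , i∈ (ρ# k) , Vk))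
          (shift-· {B} 1# z∈ V∈) (shift-· {ρ# k} 1# (i∈ (ρ# k)) Vk) (shift-· {ρ# l} 1# (i∈ (ρ# l)) Vl) (≉ k ∘ ≐-sym) (≉ l ∘ ≐-sym))
        where
        ≉ : ∀ k → ¬ ρ# k ≋ B
        ≉ k = ρ≉B z∈ z≢p z≢p′ (x∈σ k) (x≢p k) (x≢r k)
        Vk = ρ∋V z∈ z≢p z≢p′ (x∈σ k) (x≢p k) (x≢r k) y∈ρ y∈σ′
        Vl = ρ∋V z∈ z≢p z≢p′ (x∈σ l) (x≢p l) (x≢r l) y′∈ρ y′∈σ′

      both-disjoint : ∀ {k l} → k ≢ l → Disjoint (ρ# k) σ′ → Disjoint (ρ# l) σ′ → ⊥
      both-disjoint {k} {l} k≢l d d′ = ρ-inj k≢l (parallel-unique {z} {σ′} (i∈ (ρ# k)) (i∈ (ρ# l)) d d′)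

      no-triangle : ⊥
      no-triangle with meet? (ρ# zero) σ′ | meet? (ρ# (suc zero)) σ′ | meet? (ρ# (suc (suc zero))) σ′
      ... | inj₁ a | inj₁ b | _ = both-meet (λ ()) a b
      ... | inj₂ a | inj₂ b | _ = both-disjoint (λ ()) a b
      ... | inj₁ a | _ | inj₁ b = both-meet (λ ()) a b
      ... | inj₂ a | _ | inj₂ b = both-disjoint (λ ()) a b
      ... | _ | inj₁ a | inj₁ b = both-meet (λ ()) a b
      ... | _ | inj₂ a | inj₂ b = both-disjoint (λ ()) a b

    contradictory : ⊥
    contradictory = no-triangle (proj₁ (proj₂ (proj₂ zs)) zero) (proj₂ (proj₂ (proj₂ zs)) zero (here refl))
      (proj₂ (proj₂ (proj₂ zs)) zero (there (here refl))) (proj₁ xs) (proj₁ (proj₂ xs)) (proj₁ (proj₂ (proj₂ xs)))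
      (λ k → proj₂ (proj₂ (proj₂ xs)) k (here refl)) (λ k → proj₂ (proj₂ (proj₂ xs)) k (there (here refl)))
      where
      zs = otherPts B 1 (p ∷ p′ ∷ []) (k≤q (s≤s (s≤s (s≤s z≤n))))
      xs = otherPts σ 3 (p ∷ r ∷ []) (k≤q (s≤s (s≤s (s≤s (s≤s (s≤s z≤n))))))

  opaque
   neighbours-disjoint : ∀ {B V} → IsAxis B V → ∀ {σ σ′ p p′} → ¬ σ ≋ B → ¬ σ′ ≋ B → Dir σ V → Dir σ′ V →
    p ≢ p′ → c p ∈ B → c p′ ∈ B → c p ∈ σ → c p′ ∈ σ′ → Disjoint σ σ′
   neighbours-disjoint ax σ≉ σ′≉ D D′ p≢p′ p∈ p′∈ p∈σ p′∈σ′ r r∈σ r∈σ′ =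
    Triangle.contradictory ax σ≉ σ′≉ D D′ p≢p′ p∈ p′∈ p∈σ p′∈σ′ r∈σ r∈σ′

  -- Every C-point of a block is on a shared line

  neighbour-axis : ∀ {B V σ x} → IsAxis B V → ¬ σ ≋ B → x ∈ B → x ∈ σ → Dir σ V → IsAxis σ V
  neighbour-axis {B} {V} {σ} {x} ax σ≉B x∈ x∈σ DV = record
    { V≢0 = V≢0 ; V∈ = DV
    ; only = λ x∈ v≢0 Dv sh → ∥-trans (A.only x∈ v≢0 Dv sh) V′∥V
    ; lines = λ {x} {y} x∈ y∈ ¬x ¬y → on-line V′∥V (A.lines x∈ y∈ (¬x ∘ shared-∥ {σ} V∥V′) (¬y ∘ shared-∥ {σ} V∥V′)) }
    where
    open IsAxis ax
    V′ = proj₁ (axis σ)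
    module A = IsAxis (proj₂ (axis σ))
    -- From the side of σ the line through `x` is shared as well, so `only` for σ applies to V.
    V∥V′ : V ∥ V′
    V∥V′ = A.only x∈σ V≢0 DV (B , (σ≉B ∘ ≐-sym) , x∈ , V∈)
    V′∥V : V′ ∥ V
    V′∥V = ∥-sym V≢0 V∥V′
    on-line : V′ ∥ V → ∀ {x y} → ∃[ t ] y ≡ x ⊕ t · V′ → ∃[ t ] y ≡ x ⊕ t · V
    on-line (a , eV) {x} {y} (t , eq) = t * a ,
      vsolve 2 4 (λ a t x y V V' → y :≈ x :⊕ (t :* a) :· V givenᵛ (:1 ∙ᵛ y :≈ x :⊕ t :· V') ∷ (t ∙ᵛ V' :≈ a :· V) ∷ [])
        refl a t x y V V′ eq eV

  -- The C-points of `B` on no shared line are collinear by `lines`, so there are at most two of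
  -- them; `p` is the third point to avoid.
  sharedPts : ∀ {B V} → IsAxis B V → ∀ k p → k +ℕ 3 ≤ q →
              Σ (Fin k → I) λ e → Inj e × (∀ t → c (e t) ∈ B) × (∀ t → Shared B (c (e t)) V) × (∀ t → e t ≢ p)
  sharedPts {B} {V} ax k p le = e , (λ eq → proj₁ (proj₂ a) (pts-inj B eq)) , (λ t → pts∈ B _) , shared ,
    λ t → proj₂ (proj₂ a) t (there (there (here refl)))
    where
    open IsAxis ax
    bad : Fin q → Set
    bad t = ¬ Shared B (c (pts B t)) V
    collinear : ∀ r s t → bad r → bad s → bad t → r ≢ s → s ≢ t → r ≢ t → ⊥
    collinear r s t br bs bt r≢s s≢t r≢t = not-three-on-line {B} {c (pts B r)} {V} 0# (proj₁ l₁) (proj₁ l₂) V≢0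
      (pts∈ B r) (pts∈ B s) (pts∈ B t) (vsolve 0 2 (λ x V → x :≈ x :⊕ :0 :· V givenᵛ [])
        refl (c (pts B r)) V) (proj₂ l₁) (proj₂ l₂)
      (r≢s ∘ pts-inj B) (s≢t ∘ pts-inj B) (r≢t ∘ pts-inj B)
      where
      l₁ = lines (pts∈ B r) (pts∈ B s) br bs
      l₂ = lines (pts∈ B r) (pts∈ B t) br bt
    two : ∃ λ s → ∃ λ t → ∀ i → bad i → ¬ i ≡ s → i ≡ t
    two = at-most-two (λ t → ¬? (shared? B (c (pts B t)) V)) collinear
    a = avoid _≟_ (pts B) (pts-inj B) k (pts B (proj₁ two) ∷ pts B (proj₁ (proj₂ two)) ∷ p ∷ []) le
    e : Fin k → I
    e t = pts B (proj₁ a t)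
    shared : ∀ t → Shared B (c (e t)) V
    shared t = decidable-stable (shared? B (c (e t)) V) λ b →
      proj₂ (proj₂ a) t (there (here refl)) (cong (pts B) (proj₂ (proj₂ two) _ b
        (λ eq → proj₂ (proj₂ a) t (here refl) (cong (pts B) eq))))

  module _ {σ V} (axσ : IsAxis σ V) {p₀} (p₀∈σ : c p₀ ∈ σ) (unshared : ¬ Shared σ (c p₀) V) where
    open IsAxis axσ

    -- Two blocks through V disjoint from σ that meet σ in affine points
    -- would leave too few lines of σ through V for the C-points of σ.
    two-empty-lines : (π : Fin 2 → Block) → (∀ k → ¬ π k ≋ σ) → (∀ k → Disjoint (π k) σ) → ¬ π zero ≋ π (suc zero) →
      (∀ k → Dir (π k) V) → (x : Fin 2 → Pt) → (∀ k → x k ∈ σ) → (∀ k → x k ∈ π k) → ⊥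
    two-empty-lines π π≉σ disj π≉π π∋V x x∈σ x∈π =
      ℕ.1+n≰n (injective⇒≤ {f = λ i → height (proj₁ place i)} λ {i} {l} eq → proj₂ place (same-line {proj₁ place i} {proj₁ place l} (level {proj₁ place i} {proj₁ place l} eq)))
      where
      a = complement {σ} V≢0 V∈
      others = otherPts σ m (p₀ ∷ []) (ℕ.≤-reflexive (ℕ.+-comm m 1))
      j = proj₁ others
      -- The q - 1 C-points other than `c p₀` and the two points `x k` will be on q + 1 different
      -- lines of direction V, but the plane has only q.
      place : Σ (Fin (suc q) → Fin m ⊎ Fin 2) Inj
      place = distribute m 2 (ℕ.≤-reflexive (ℕ.+-comm 2 m))
      Z : Fin m ⊎ Fin 2 → Pt
      Z (inj₁ i) = c (j i)
      Z (inj₂ k) = x k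
      Z∈ : ∀ s → Z s ∈ σ
      Z∈ (inj₁ i) = proj₁ (proj₂ (proj₂ others)) i
      Z∈ (inj₂ k) = x∈σ k
      coords : ∀ s → Span V (proj₁ a) (Z s ⊖ c p₀)
      coords s = basis₂ {σ} (proj₁ (proj₂ a)) V∈ (proj₂ (proj₂ a)) (difference {σ} p₀∈σ (Z∈ s))
      height : Fin m ⊎ Fin 2 → K
      height s = proj₁ (proj₂ (coords s))
      level : ∀ {s t} → height s ≡ height t → ∃[ r ] Z t ≡ Z s ⊕ r · V
      level {s} {t} = level′ (coords s) (coords t)
        where
        level′ : (cs : Span V (proj₁ a) (Z s ⊖ c p₀)) (ct : Span V (proj₁ a) (Z t ⊖ c p₀)) →
                 proj₁ (proj₂ cs) ≡ proj₁ (proj₂ ct) → ∃[ r ] Z t ≡ Z s ⊕ r · V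
        level′ (s₁ , h , es) (t₁ , h′ , et) eq = t₁ + - s₁ ,
          vsolve 4 5 (λ s₁ h t₁ h' P S T V A → T :≈ S :⊕ (t₁ :+ :- s₁) :· V givenᵛ
            (:- :1 ∙ᵛ S :⊖ P :≈ s₁ :· V :⊕ h :· A) ∷ (:1 ∙ᵛ T :⊖ P :≈ t₁ :· V :⊕ h' :· A) ∷ (:0v :⊖ A ∙ˢ h := h') ∷ [])
            refl s₁ h t₁ h′ (c p₀) (Z s) (Z t) V (proj₁ a) es et eq
      no-C : ∀ {i} k → c i ∈ σ → ∀ r → c i ≡ x k ⊕ r · V → ⊥
      no-C k i∈ r eq = disj k _ (subst (_∈ π k) (sym eq) (shift-· {π k} r (x∈π k) (π∋V k))) i∈
      x-apart : ∀ r → x (suc zero) ≢ x zero ⊕ r · V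
      x-apart r eq = π≉π (third {B = σ}
        (λ (i , ei) → no-C {i} zero (subst (_∈ σ) (sym ei) (x∈σ (suc zero))) r (trans ei eq)) (x∈σ (suc zero))
        (subst (_∈ π zero) (sym eq) (shift-· {π zero} r (x∈π zero) (π∋V zero))) (x∈π (suc zero))
        (π≉σ zero ∘ ≐-sym) (π≉σ (suc zero) ∘ ≐-sym))
      flip : ∀ {x y} r → y ≡ x ⊕ r · V → x ≡ y ⊕ (- r) · V
      flip {x} {y} r eq = vsolve 1 3 (λ r x y V → x :≈ y :⊕ :- r :· V givenᵛ (:- :1 ∙ᵛ y :≈ x :⊕ r :· V) ∷ []) refl r x y V eq
      same-line : ∀ {s t} → ∃[ r ] Z t ≡ Z s ⊕ r · V → s ≡ t
      same-line {inj₁ i} {inj₁ l} (r , eq) with i ≟ l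
      ... | yes i≡l = cong inj₁ i≡l
      ... | no i≢l with shared? σ (c (j i)) V
      ...   | yes sh = cong inj₁ (proj₁ (proj₂ others) (shared-one {σ} r (Z∈ (inj₁ i)) (Z∈ (inj₁ l)) sh eq))
      -- Neither these two C-points nor `c p₀` are on a shared line, so `lines` makes three points
      -- of an arc collinear.
      ...   | no ¬sh = ⊥-elim (not-three-on-line {σ} {c p₀} {V} 0# (proj₁ l₁) (proj₁ l₁ + r) V≢0
        p₀∈σ (Z∈ (inj₁ i)) (Z∈ (inj₁ l)) (vsolve 0 2 (λ x V → x :≈ x :⊕ :0 :· V givenᵛ []) refl (c p₀) V) (proj₂ l₁)
        (vsolve 2 4 (λ r s P S T V → T :≈ P :⊕ (s :+ r) :· V givenᵛ
          (:1 ∙ᵛ T :≈ S :⊕ r :· V) ∷ (:1 ∙ᵛ S :≈ P :⊕ s :· V) ∷ []) refl r (proj₁ l₁) (c p₀) (c (j i)) (c (j l)) V eq (proj₂ l₁))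
        (λ eq → proj₂ (proj₂ (proj₂ others)) i (here refl) (sym eq)) (i≢l ∘ proj₁ (proj₂ others))
        (λ eq → proj₂ (proj₂ (proj₂ others)) l (here refl) (sym eq)))
        where l₁ = lines p₀∈σ (Z∈ (inj₁ i)) unshared ¬sh
      same-line {inj₁ i} {inj₂ k} (r , eq) = ⊥-elim (no-C k (Z∈ (inj₁ i)) (- r) (flip r eq))
      same-line {inj₂ k} {inj₁ i} (r , eq) = ⊥-elim (no-C k (Z∈ (inj₁ i)) r eq)
      same-line {inj₂ zero} {inj₂ zero} _ = refl
      same-line {inj₂ zero} {inj₂ (suc zero)} (r , eq) = ⊥-elim (x-apart r eq)
      same-line {inj₂ (suc zero)} {inj₂ zero} (r , eq) = ⊥-elim (x-apart (- r) (flip r eq))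
      same-line {inj₂ (suc zero)} {inj₂ (suc zero)} _ = refl

    -- The line through `c p₀` in direction V has at least q - 2 points off 𝒞, none on a shared
    -- line. Their second blocks are disjoint from σ, and the three given ones would bring the
    -- number to q + 1.
    three-missing : (π : Fin 3 → Block) → (∀ k → Disjoint (π k) σ) → (∀ {k l} → π k ≋ π l → k ≡ l) →
      (∀ k x → x ∈ σ → ¬ x ∈ π k) → ⊥
    three-missing π disj π-inj miss = parallels-bound σ (λ i → τ (proj₁ place i)) (λ i → τ-disj (proj₁ place i))
      (λ {i} {l} e → proj₂ place (τ-inj {proj₁ place i} {proj₁ place l} e))
      where
      k = m ℕ.∸ 1
      1≤m : 1 ≤ m
      1≤m = ℕ.≤-trans (s≤s z≤n) (ℕ.≤-pred 7≤q)
      k+2≡q : k +ℕ 2 ≡ q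
      k+2≡q = trans (ℕ.+-suc k 1) (cong suc (ℕ.m∸n+n≡m 1≤m))
      place : Σ (Fin (suc q) → Fin k ⊎ Fin 3) Inj
      place = distribute k 3 (ℕ.≤-reflexive (sym (trans (ℕ.+-suc k 2) (cong suc k+2≡q))))
      free = freeParams {σ} p₀∈σ V∈ V≢0 k (ℕ.≤-reflexive k+2≡q)
      X : Fin k → Pt
      X t = c p₀ ⊕ proj₁ free t · V
      X∈ : ∀ t → X t ∈ σ
      X∈ t = shift-· {σ} _ p₀∈σ V∈
      un : ∀ t → Unshared σ (X t)
      un t w w≢0 Dw sh = unshared (shared-unshift {σ} _ (shared-∥ {σ} (∥-sym w≢0 (only (X∈ t) w≢0 Dw sh)) sh))
      s = λ t → second (proj₂ (proj₂ free) t) (X∈ t)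
      τ : Fin k ⊎ Fin 3 → Block
      τ (inj₁ t) = proj₁ (s t)
      τ (inj₂ k) = π k
      τ-disj : ∀ i → Disjoint (τ i) σ
      τ-disj (inj₁ t) = single-disjoint {σ} {τ = proj₁ (s t)} (X∈ t) (proj₂ (proj₂ free) t) (un t) (proj₁ (proj₂ (s t))) (proj₂ (proj₂ (s t)))
      τ-disj (inj₂ k) = disj k
      τ-inj : ∀ {i l} → τ i ≋ τ l → i ≡ l
      τ-inj {inj₁ t} {inj₁ l} e = cong inj₁ (proj₁ (proj₂ free) (line-inj V≢0
        (single-inj {σ} {τ = proj₁ (s l)} (X∈ t) (X∈ l) (un t) (proj₁ (proj₂ (s l))) (proj₁ (e _) (proj₂ (proj₂ (s t)))) (proj₂ (proj₂ (s l))))))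
      τ-inj {inj₁ t} {inj₂ k} e = ⊥-elim (miss k (X t) (X∈ t) (proj₁ (e _) (proj₂ (proj₂ (s t)))))
      τ-inj {inj₂ k} {inj₁ t} e = ⊥-elim (miss k (X t) (X∈ t) (proj₂ (e _) (proj₂ (proj₂ (s t)))))
      τ-inj {inj₂ k} {inj₂ l} e = cong inj₂ (π-inj e)

  -- If a C-point of σ were on no shared line, the neighbours of `B` at four C-points other than
  -- `c p` would be considered. They are disjoint from σ on 𝒞; at most one has an affine point on σ
  -- by `two-empty-lines`, and the other three contradict `three-missing`.
  neighbour-good : ∀ {B V σ p} → IsAxis B V → ¬ σ ≋ B → c p ∈ B → c p ∈ σ → Dir σ V →
                   ∀ {i} → c i ∈ σ → Shared σ (c i) V
  neighbour-good {B} {V} {σ} {p} ax σ≉B p∈ p∈σ DV {i} i∈ = decidable-stable (shared? σ (c i) V) contradictory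
    where
    axσ = neighbour-axis {B} {V} {σ} ax σ≉B p∈ p∈σ DV
    -- Here 7 ≤ q is used in full: four points besides two possible exceptions and `p`.
    ps = sharedPts ax 4 p 7≤q
    pt = proj₁ ps
    pt∈ = proj₁ (proj₂ (proj₂ ps))
    shared = proj₁ (proj₂ (proj₂ (proj₂ ps)))
    pt≢p = proj₂ (proj₂ (proj₂ (proj₂ ps)))
    π : Fin 4 → Block
    π k = proj₁ (shared k)
    π≉B : ∀ k → ¬ π k ≋ B
    π≉B k = proj₁ (proj₂ (shared k))
    pt∈π : ∀ k → c (pt k) ∈ π k
    pt∈π k = proj₁ (proj₂ (proj₂ (shared k)))
    π∋V : ∀ k → Dir (π k) V
    π∋V k = proj₂ (proj₂ (proj₂ (shared k)))
    π-disj : ∀ k → Disjoint (π k) σ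
    π-disj k = neighbours-disjoint ax (π≉B k) σ≉B (π∋V k) DV (pt≢p k) (pt∈ k) p∈ (pt∈π k) p∈σ
    π-inj : ∀ {k l} → π k ≋ π l → k ≡ l
    π-inj {k} {l} e = decidable-stable (k ≟ l) λ k≢l →
      neighbours-disjoint ax (π≉B k) (π≉B l) (π∋V k) (π∋V l) (k≢l ∘ proj₁ (proj₂ ps)) (pt∈ k) (pt∈ l) (pt∈π k) (pt∈π l)
        (pt l) (proj₂ (e _) (pt∈π l)) (pt∈π l)
    π≉σ : ∀ k → ¬ π k ≋ σ
    π≉σ k e = π-disj k (pt k) (pt∈π k) (proj₁ (e _) (pt∈π k))
    touch : Fin 4 → Set
    touch k = ∃[ x ] (x ∈ σ × x ∈ π k)
    touch? : ∀ k → Dec (touch k)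
    touch? k = searchPt λ x → (x ∈? σ) ×-dec (x ∈? π k)
    contradictory : ¬ ¬ Shared σ (c i) V
    contradictory un = three-missing axσ i∈ un (λ k → π (punchIn (proj₁ one) k)) (λ k → π-disj _)
      (λ e → punchIn-injective (proj₁ one) _ _ (π-inj e))
      λ k x x∈σ x∈π → punchInᵢ≢i (proj₁ one) k (proj₂ one _ (x , x∈σ , x∈π))
      where
      pair : Fin 4 → Fin 4 → Fin 2 → Fin 4
      pair k l zero = k
      pair k l (suc zero) = l
      one : ∃ λ t → ∀ k → touch k → k ≡ t
      one = at-most-one touch? λ k l tk tl → decidable-stable (k ≟ l) λ k≢l →
        two-empty-lines axσ i∈ un (λ s → π (pair k l s)) (λ s → π≉σ _) (λ s → π-disj _) (k≢l ∘ π-inj) (λ s → π∋V _)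
          (λ { zero → proj₁ tk ; (suc zero) → proj₁ tl })
          (λ { zero → proj₁ (proj₂ tk) ; (suc zero) → proj₁ (proj₂ tl) })
          (λ { zero → proj₂ (proj₂ tk) ; (suc zero) → proj₂ (proj₂ tl) })

  -- Sharing is symmetric: `B` is a neighbour of its neighbour σ.
  good-from : ∀ {B V p} → IsAxis B V → Shared B (c p) V → c p ∈ B → ∀ {i} → c i ∈ B → Shared B (c i) V
  good-from {B} {V} ax (σ , σ≉B , p∈σ , DV) p∈ = neighbour-good {σ} {V} {B} (neighbour-axis {B} {V} {σ} ax σ≉B p∈ p∈σ DV)
    (σ≉B ∘ ≐-sym) p∈σ p∈ (IsAxis.V∈ ax)

  opaque
    good : ∀ {B V} → IsAxis B V → ∀ {i} → c i ∈ B → Shared B (c i) V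
    good {B} {V} ax =
      let _ , _ , p∈ , shared , _ = sharedPts ax 1 (Block.i B) (k≤q (s≤s (s≤s (s≤s (s≤s z≤n)))))
      in good-from ax (shared zero) (p∈ zero)

  -- Neighbours of a block along its axis

  record Neighbour (B : Block) (V : Pt) (i : I) (σ : Block) : Set where
    field
      ≉B : ¬ σ ≋ B
      i∈σ : c i ∈ σ
      V∈σ : Dir σ V

  neighbour : ∀ {B V} → IsAxis B V → ∀ {i} → c i ∈ B → ∃[ σ ] Neighbour B V i σ
  neighbour ax i∈ with good ax i∈
  ... | σ , ≉ , i∈σ , D = σ , record { ≉B = ≉ ; i∈σ = i∈σ ; V∈σ = D }

  module _ {B V} (ax : IsAxis B V) where
    open IsAxis ax

    axis-line-one : ∀ {i j t} → c i ∈ B → c j ∈ B → c j ≡ c i ⊕ t · V → i ≡ j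
    axis-line-one {t = t} i∈ j∈ = shared-one {B} t i∈ j∈ (good ax i∈)

    axis-independent : ∀ {i j} → c i ∈ B → c j ∈ B → i ≢ j → Independent V (c j ⊖ c i)
    axis-independent {i} {j} i∈ j∈ i≢j = ∦⇒independent V≢0 λ (t , eq) → i≢j (axis-line-one {t = t} i∈ j∈
      (vsolve 1 3 (λ t x z V → z :≈ x :⊕ t :· V givenᵛ (:1 ∙ᵛ z :⊖ x :≈ t :· V) ∷ []) refl t (c i) (c j) V eq))

    plane-coords : ∀ {i j k} → c i ∈ B → c j ∈ B → i ≢ j → c k ∈ B → Span V (c j ⊖ c i) (c k ⊖ c i)
    plane-coords i∈ j∈ i≢j k∈ = basis₂ {B} (axis-independent i∈ j∈ i≢j) V∈ (difference {B} i∈ j∈) (difference {B} i∈ k∈)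

    -- The q C-points of `B` are on different lines of direction V, and the plane has only q such
    -- lines.
    axis-line : ∀ {p} → p ∈ B → ∃[ i ] (c i ∈ B × ∃[ t ] c i ≡ p ⊕ t · V)
    axis-line {p} p∈ = found (inj⇒surj height height-inj 0#)
      where
      a = complement {B} V≢0 V∈
      coords : ∀ t → Span V (proj₁ a) (c (pts B t) ⊖ p)
      coords t = basis₂ {B} (proj₁ (proj₂ a)) V∈ (proj₂ (proj₂ a)) (difference {B} p∈ (pts∈ B t))
      height : Fin q → Fin q
      height t = proj₁ (proj₂ (coords t))
      height-inj : Inj height
      height-inj {s} {t} eq = pts-inj B (level (coords s) (coords t) eq)
        where
        level : (cs : Span V (proj₁ a) (c (pts B s) ⊖ p)) (ct : Span V (proj₁ a) (c (pts B t) ⊖ p)) →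
                proj₁ (proj₂ cs) ≡ proj₁ (proj₂ ct) → pts B s ≡ pts B t
        level (s₁ , h , es) (t₁ , h′ , et) eq = axis-line-one {t = t₁ + - s₁} (pts∈ B s) (pts∈ B t)
          (vsolve 4 5 (λ s₁ h t₁ h' P S T V A → T :≈ S :⊕ (t₁ :+ :- s₁) :· V givenᵛ
            (:- :1 ∙ᵛ S :⊖ P :≈ s₁ :· V :⊕ h :· A) ∷ (:1 ∙ᵛ T :⊖ P :≈ t₁ :· V :⊕ h' :· A) ∷ (:0v :⊖ A ∙ˢ h := h') ∷ [])
            refl s₁ h t₁ h′ p (c (pts B s)) (c (pts B t)) V (proj₁ a) es et eq)
      found : (∃ λ t → height t ≡ 0#) → ∃[ i ] (c i ∈ B × ∃[ t ] c i ≡ p ⊕ t · V)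
      found (t , h≡0) = pts B t , pts∈ B t , proj₁ (coords t) ,
        vsolve 2 4 (λ s h p x V A → x :≈ p :⊕ s :· V givenᵛ
          (:1 ∙ᵛ x :⊖ p :≈ s :· V :⊕ h :· A) ∷ (A ∙ˢ h := :0) ∷ [])
          refl (proj₁ (coords t)) (height t) p (c (pts B t)) V (proj₁ a) (proj₂ (proj₂ (coords t))) h≡0

    neighbour-nonC : ∀ {i σ} → c i ∈ B → Neighbour B V i σ → ¬ IsC (c i ⊕ 1# · V)
    neighbour-nonC i∈ n = shared-nonC {B} i∈ V≢0 V∈ 1≢0 (_ , Neighbour.≉B n , Neighbour.i∈σ n , Neighbour.V∈σ n)

    -- (A3) says nothing at a C-point, so it is applied one step further along the shared line.
    neighbour-unique : ∀ {i σ τ} → c i ∈ B → Neighbour B V i σ → c i ∈ τ → Dir τ V → ¬ τ ≋ B → τ ≋ σ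
    neighbour-unique {i} {σ} {τ} i∈ n i∈τ Vτ τ≉B = third {B = B} (neighbour-nonC i∈ n) (shift-· {B} 1# i∈ V∈)
      (shift-· {τ} 1# i∈τ Vτ) (shift-· {σ} 1# i∈σ V∈σ) (τ≉B ∘ ≐-sym) (≉B ∘ ≐-sym)
      where open Neighbour n

    neighbour-isAxis : ∀ {i σ} → c i ∈ B → Neighbour B V i σ → IsAxis σ V
    neighbour-isAxis {σ = σ} i∈ n = neighbour-axis {B} {V} {σ} ax ≉B i∈ i∈σ V∈σ
      where open Neighbour n

    neighbour-sym : ∀ {i σ} → c i ∈ B → Neighbour B V i σ → Neighbour σ V i B
    neighbour-sym i∈ n = record { ≉B = Neighbour.≉B n ∘ ≐-sym ; i∈σ = i∈ ; V∈σ = V∈ }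

    neighbours-apart : ∀ {i j σ τ} → c i ∈ B → c j ∈ B → i ≢ j → Neighbour B V i σ → Neighbour B V j τ → Disjoint σ τ
    neighbours-apart i∈ j∈ i≢j n n′ = neighbours-disjoint ax (Neighbour.≉B n) (Neighbour.≉B n′)
      (Neighbour.V∈σ n) (Neighbour.V∈σ n′) i≢j i∈ j∈ (Neighbour.i∈σ n) (Neighbour.i∈σ n′)

  -- Two transversal families of blocks with a common axis

  module Grid {B₀ V} (ax : IsAxis B₀ V) {o} (o∈ : c o ∈ B₀) where
    open IsAxis ax

    n₀ = neighbour ax o∈
    σ₀ = proj₁ n₀
    module N₀ = Neighbour (proj₂ n₀)
    axσ₀ : IsAxis σ₀ V
    axσ₀ = neighbour-isAxis ax o∈ (proj₂ n₀)

    cA = complement {B₀} V≢0 V∈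
    a = proj₁ cA
    indA : Independent V a
    indA = proj₁ (proj₂ cA)
    Da : Dir B₀ a
    Da = proj₂ (proj₂ cA)
    cB = complement {σ₀} V≢0 N₀.V∈σ
    b = proj₁ cB
    indB : Independent V b
    indB = proj₁ (proj₂ cB)
    Db : Dir σ₀ b
    Db = proj₂ (proj₂ cB)

    opaque
      point₁ : ∀ t → ∃[ i ] (c i ∈ B₀ × ∃[ w ] c i ≡ (c o ⊕ t · a) ⊕ w · V)
      point₁ t = axis-line ax (shift-· {B₀} t o∈ Da)
      point₂ : ∀ s → ∃[ i ] (c i ∈ σ₀ × ∃[ w ] c i ≡ (c o ⊕ s · b) ⊕ w · V)
      point₂ s = axis-line axσ₀ (shift-· {σ₀} s N₀.i∈σ Db)

    P R : K → I
    P t = proj₁ (point₁ t)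
    R s = proj₁ (point₂ s)
    P∈ : ∀ t → c (P t) ∈ B₀
    P∈ t = proj₁ (proj₂ (point₁ t))
    R∈ : ∀ s → c (R s) ∈ σ₀
    R∈ s = proj₁ (proj₂ (point₂ s))

    private
      heights : ∀ {i j d} s t → Independent V d → (∃[ w ] c i ≡ (c o ⊕ s · d) ⊕ w · V) →
                (∃[ w ] c j ≡ (c o ⊕ t · d) ⊕ w · V) → i ≡ j → s ≡ t
      heights {i} {j} {d} s t ind (w , e) (w′ , e′) i≡j = x-y≡0⇒x≡y s t (proj₂ (ind (w + - w′) (s + - t)
        (vsolve 4 5 (λ s t w w' o x y V d → (w :+ :- w') :· V :⊕ (s :+ :- t) :· d :≈ :0v givenᵛ
          (:- :1 ∙ᵛ x :≈ o :⊕ s :· d :⊕ w :· V) ∷ (:1 ∙ᵛ y :≈ o :⊕ t :· d :⊕ w' :· V) ∷ (:1 ∙ᵛ x :≈ y) ∷ [])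
          refl s t w w′ (c o) (c i) (c j) V d e e′ (cong c i≡j))))

    P-inj : Inj P
    P-inj {s} {t} = heights s t indA (proj₂ (proj₂ (point₁ s))) (proj₂ (proj₂ (point₁ t)))
    R-inj : Inj R
    R-inj {s} {t} = heights s t indB (proj₂ (proj₂ (point₂ s))) (proj₂ (proj₂ (point₂ t)))

    P0≡o : P 0# ≡ o
    P0≡o = sym (axis-line-one ax {t = proj₁ (proj₂ (proj₂ (point₁ 0#)))} o∈ (P∈ 0#)
      (vsolve 1 4 (λ w o x a V → x :≈ o :⊕ w :· V givenᵛ
        (:1 ∙ᵛ x :≈ o :⊕ :0 :· a :⊕ w :· V) ∷ [])
        refl (proj₁ (proj₂ (proj₂ (point₁ 0#)))) (c o) (c (P 0#)) a V (proj₂ (proj₂ (proj₂ (point₁ 0#))))))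
    R0≡o : R 0# ≡ o
    R0≡o = sym (axis-line-one axσ₀ {t = proj₁ (proj₂ (proj₂ (point₂ 0#)))} N₀.i∈σ (R∈ 0#)
      (vsolve 1 4 (λ w o x a V → x :≈ o :⊕ w :· V givenᵛ
        (:1 ∙ᵛ x :≈ o :⊕ :0 :· a :⊕ w :· V) ∷ [])
        refl (proj₁ (proj₂ (proj₂ (point₂ 0#)))) (c o) (c (R 0#)) b V (proj₂ (proj₂ (proj₂ (point₂ 0#))))))

    opaque
      neighbour₁ : ∀ t → ∃[ σ ] Neighbour B₀ V (P t) σ
      neighbour₁ t = neighbour ax (P∈ t)
      neighbour₂ : ∀ s → ∃[ π ] Neighbour σ₀ V (R s) π
      neighbour₂ s = neighbour axσ₀ (R∈ s)

    σ π : K → Block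
    σ t = proj₁ (neighbour₁ t)
    π s = proj₁ (neighbour₂ s)
    nσ : ∀ t → Neighbour B₀ V (P t) (σ t)
    nσ t = proj₂ (neighbour₁ t)
    nπ : ∀ s → Neighbour σ₀ V (R s) (π s)
    nπ s = proj₂ (neighbour₂ s)
    axσ : ∀ t → IsAxis (σ t) V
    axσ t = neighbour-isAxis ax (P∈ t) (nσ t)
    axπ : ∀ s → IsAxis (π s) V
    axπ s = neighbour-isAxis axσ₀ (R∈ s) (nπ s)

    σ-apart : ∀ {s t} → s ≢ t → Disjoint (σ s) (σ t)
    σ-apart {s} {t} s≢t = neighbours-apart ax (P∈ s) (P∈ t) (s≢t ∘ P-inj) (nσ s) (nσ t)
    π-apart : ∀ {s t} → s ≢ t → Disjoint (π s) (π t)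
    π-apart {s} {t} s≢t = neighbours-apart axσ₀ (R∈ s) (R∈ t) (s≢t ∘ R-inj) (nπ s) (nπ t)

    σ0≋σ₀ : σ 0# ≋ σ₀
    σ0≋σ₀ = neighbour-unique ax o∈ (proj₂ n₀) (subst (λ i → c i ∈ σ 0#) P0≡o (Neighbour.i∈σ (nσ 0#)))
      (Neighbour.V∈σ (nσ 0#)) (Neighbour.≉B (nσ 0#))
    π0≋B₀ : π 0# ≋ B₀
    π0≋B₀ = neighbour-unique axσ₀ N₀.i∈σ (neighbour-sym ax o∈ (proj₂ n₀))
      (subst (λ i → c i ∈ π 0#) R0≡o (Neighbour.i∈σ (nπ 0#))) (Neighbour.V∈σ (nπ 0#)) (Neighbour.≉B (nπ 0#))

    -- If `σ t` missed `π s`, then `σ₀` and `π s` would be two blocks through `c (R s)` disjoint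
    -- from `σ t`.
    cross : ∀ t s → Meet (σ t) (π s)
    cross t s with t ≟ 0#
    ... | yes refl = R s , proj₂ (σ0≋σ₀ _) (R∈ s) , Neighbour.i∈σ (nπ s)
    ... | no t≢0 with meet? (σ t) (π s)
    ...   | inj₁ met = met
    ...   | inj₂ d = ⊥-elim (Neighbour.≉B (nπ s) (parallel-unique {R s} {σ t} (Neighbour.i∈σ (nπ s)) (R∈ s)
      (Disjoint-sym {σ t} {π s} d) (λ i i∈ i∈σ → σ-apart (t≢0 ∘ sym) i (proj₂ (σ0≋σ₀ _) i∈) i∈σ)))

    X : K → K → I
    X t s = proj₁ (cross t s)
    X∈σ : ∀ t s → c (X t s) ∈ σ t
    X∈σ t s = proj₁ (proj₂ (cross t s))
    X∈π : ∀ t s → c (X t s) ∈ π s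
    X∈π t s = proj₂ (proj₂ (cross t s))

    X∉σ₀ : ∀ {t s} → t ≢ 0# → ¬ c (X t s) ∈ σ₀
    X∉σ₀ {t} {s} t≢0 ∈σ₀ = σ-apart t≢0 _ (X∈σ t s) (proj₂ (σ0≋σ₀ _) ∈σ₀)
    X∉B₀ : ∀ {t s} → s ≢ 0# → ¬ c (X t s) ∈ B₀
    X∉B₀ {t} {s} s≢0 ∈B₀ = π-apart s≢0 _ (X∈π t s) (proj₂ (π0≋B₀ _) ∈B₀)

    X-inj : ∀ {t s t′ s′} → X t s ≡ X t′ s′ → t ≡ t′ × s ≡ s′
    X-inj {t} {s} {t′} {s′} eq =
      decidable-stable (t ≟ t′) (λ ne → σ-apart ne _ (X∈σ t s) (subst (λ i → c i ∈ σ t′) (sym eq) (X∈σ t′ s′))) ,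
      decidable-stable (s ≟ s′) (λ ne → π-apart ne _ (X∈π t s) (subst (λ i → c i ∈ π s′) (sym eq) (X∈π t′ s′)))

    opaque
      -- The q² crossing points are different, and 𝒞 has no more points.
      X-onto : ∀ i → ∃[ t ] ∃[ s ] X t s ≡ i
      X-onto i = unpack (inj⇒surj f f-inj i)
        where
        f : Fin (q *ℕ q) → I
        f k = X (proj₁ (remQuot {q} q k)) (proj₂ (remQuot {q} q k))
        f-inj : Inj f
        f-inj {k} {l} eq = trans (sym (combine-remQuot {q} q k))
          (trans (cong₂ combine (proj₁ (inj eq)) (proj₂ (inj eq))) (combine-remQuot {q} q l))
          where
          inj : f k ≡ f l → proj₁ (remQuot {q} q k) ≡ proj₁ (remQuot {q} q l) × proj₂ (remQuot {q} q k) ≡ proj₂ (remQuot {q} q l)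
          inj = X-inj {proj₁ (remQuot {q} q k)} {proj₂ (remQuot {q} q k)}
                      {proj₁ (remQuot {q} q l)} {proj₂ (remQuot {q} q l)}
        unpack : (∃ λ k → f k ≡ i) → ∃[ t ] ∃[ s ] X t s ≡ i
        unpack (k , eq) = proj₁ (remQuot {q} q k) , proj₂ (remQuot {q} q k) , eq

    -- Chosen to give `X 1# 1#` the coordinates (1, 1, 1, 0) with respect to a, b, e, V.
    e : Pt
    e = ((c (X 1# 1#) ⊖ c o) ⊖ a) ⊖ b

    private
      other = avoid _≟_ (λ (x : K) → x) (λ eq → eq) 1 (0# ∷ 1# ∷ []) (k≤q (s≤s (s≤s (s≤s z≤n))))

    new : K
    new = proj₁ other zero
    new≢0 : new ≢ 0#
    new≢0 = proj₂ (proj₂ other) zero (here refl)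
    new≢1 : new ≢ 1#
    new≢1 = proj₂ (proj₂ other) zero (there (here refl))

    opaque
      P-coords : ∀ t → ∃[ w ] c (P t) ≡ (c o ⊕ t · a) ⊕ w · V
      P-coords t = proj₂ (proj₂ (point₁ t))
      R-coords : ∀ s → ∃[ w ] c (R s) ≡ (c o ⊕ s · b) ⊕ w · V
      R-coords s = proj₂ (proj₂ (point₂ s))

      P≢X : ∀ t {s} → s ≢ 0# → P t ≢ X t s
      P≢X t {s} s≢0 eq = X∉B₀ {t} {s} s≢0 (subst (λ i → c i ∈ B₀) eq (P∈ t))
      R≢X : ∀ {t} s → t ≢ 0# → R s ≢ X t s
      R≢X {t} s t≢0 eq = X∉σ₀ {t} {s} t≢0 (subst (λ i → c i ∈ σ₀) eq (R∈ s))

      on-σ : ∀ t {r s} → r ≢ 0# → Span V (c (X t r) ⊖ c (P t)) (c (X t s) ⊖ c (P t))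
      on-σ t {r} {s} r≢0 = plane-coords (axσ t) (Neighbour.i∈σ (nσ t)) (X∈σ t r) (P≢X t r≢0) (X∈σ t s)
      on-π : ∀ s {r t} → r ≢ 0# → Span V (c (X r s) ⊖ c (R s)) (c (X t s) ⊖ c (R s))
      on-π s {r} {t} r≢0 = plane-coords (axπ s) (Neighbour.i∈σ (nπ s)) (X∈π r s) (R≢X s r≢0) (X∈π t s)

    Span₃ : Pt → Set
    Span₃ p = ∃[ x ] ∃[ y ] ∃[ w ] p ≡ (x · a ⊕ y · b) ⊕ w · V

    -- Otherwise a third block through o lies in the 3-space of B₀ and σ₀.
    not-coplanar : ¬ Span₃ (c (X 1# 1#) ⊖ c o)
    not-coplanar span = contradictory (meet? ρ (π 1#))
      where
      -- The index `new` differs from 0, which keeps x off `B₀`, and from 1, which keeps it off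
      -- `π 1#`, where the second point of ρ will be taken.
      x = X 1# new
      x∉B₀ : ¬ c x ∈ B₀
      x∉B₀ = X∉B₀ {1#} {new} new≢0
      o≢x : o ≢ x
      o≢x eq = x∉B₀ (subst (λ i → c i ∈ B₀) eq o∈)
      ρ = join o x o≢x
      ρ≉B₀ : ¬ ρ ≋ B₀
      ρ≉B₀ e = x∉B₀ (proj₁ (e _) (j∈ ρ))
      ρ≉σ₀ : ¬ ρ ≋ σ₀
      ρ≉σ₀ e = X∉σ₀ {1#} {new} 1≢0 (proj₁ (e _) (j∈ ρ))
      o∉π1 : ¬ c o ∈ π 1#
      o∉π1 = π-apart (λ eq → 1≢0 (sym eq)) o (proj₂ (π0≋B₀ _) o∈)
      span-x : Span₃ (c (X 1# 1#) ⊖ c o) → (∃[ w ] c (P 1#) ≡ (c o ⊕ 1# · a) ⊕ w · V) →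
               Span V (c (X 1# 1#) ⊖ c (P 1#)) (c x ⊖ c (P 1#)) → Span₃ (c x ⊖ c o)
      span-x (x₁ , y₁ , w₁ , e₁) (w , eP) (k , l , ex) = 1# + l * (x₁ + - 1#) , l * y₁ , w + k + l * (w₁ + - w) ,
        vsolve 6 7 (λ x₁ y₁ w₁ w k l o E P X a b V →
          X :⊖ o :≈ (:1 :+ l :* (x₁ :+ :- :1)) :· a :⊕ (l :* y₁) :· b :⊕ (w :+ k :+ l :* (w₁ :+ :- w)) :· V givenᵛ
          (:1 ∙ᵛ X :⊖ P :≈ k :· V :⊕ l :· (E :⊖ P)) ∷ (:1 :- l ∙ᵛ P :≈ o :⊕ :1 :· a :⊕ w :· V) ∷
          (l ∙ᵛ E :⊖ o :≈ x₁ :· a :⊕ y₁ :· b :⊕ w₁ :· V) ∷ [])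
          refl x₁ y₁ w₁ w k l (c o) (c (X 1# 1#)) (c (P 1#)) (c x) a b V ex eP e₁
      span-y : ∀ {y} → Span₃ (c (X 1# 1#) ⊖ c o) → (∃[ w ] c (R 1#) ≡ (c o ⊕ 1# · b) ⊕ w · V) →
               Span V (c (X 1# 1#) ⊖ c (R 1#)) (c y ⊖ c (R 1#)) → Span₃ (c y ⊖ c o)
      span-y {y} (x₁ , y₁ , w₁ , e₁) (w , eR) (k , l , ey) = l * x₁ , 1# + l * (y₁ + - 1#) , w + k + l * (w₁ + - w) ,
        vsolve 6 7 (λ x₁ y₁ w₁ w k l o E P X a b V →
          X :⊖ o :≈ (l :* x₁) :· a :⊕ (:1 :+ l :* (y₁ :+ :- :1)) :· b :⊕ (w :+ k :+ l :* (w₁ :+ :- w)) :· V givenᵛ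
          (:1 ∙ᵛ X :⊖ P :≈ k :· V :⊕ l :· (E :⊖ P)) ∷ (:1 :- l ∙ᵛ P :≈ o :⊕ :1 :· b :⊕ w :· V) ∷
          (l ∙ᵛ E :⊖ o :≈ x₁ :· a :⊕ y₁ :· b :⊕ w₁ :· V) ∷ [])
          refl x₁ y₁ w₁ w k l (c o) (c (X 1# 1#)) (c (R 1#)) (c y) a b V ey eR e₁
      Dir₀ : ∀ x w {p} → p ≡ x · a ⊕ w · V → Dir B₀ p
      Dir₀ x w refl = Dir-lin {B₀} x w Da V∈
      finish : ∀ {y} → c y ∈ ρ → c y ∈ π 1# → Span₃ (c x ⊖ c o) → Span₃ (c y ⊖ c o) → ⊥
      finish {y} y∈ρ y∈π (x₁ , y₁ , w₁ , e₁) (x₂ , y₂ , w₂ , e₂) =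
        ρ≉σ₀ (neighbour-unique ax o∈ (proj₂ n₀) (i∈ ρ) ρ∋V ρ≉B₀)
        where
        d : Pt
        d = y₁ · (c y ⊖ c o) ⊕ (- y₂) · (c x ⊖ c o)
        y₁≢0 : y₁ ≢ 0#
        y₁≢0 y₁≡0 = x∉B₀ (shiftTo {B₀} o∈ (Dir₀ x₁ w₁
          (vsolve 3 4 (λ x₁ y₁ w₁ D a b V → D :≈ x₁ :· a :⊕ w₁ :· V givenᵛ (:1 ∙ᵛ D :≈ x₁ :· a :⊕ y₁ :· b :⊕ w₁ :· V) ∷
            (b ∙ˢ y₁ := :0) ∷ []) refl x₁ y₁ w₁ (c x ⊖ c o) a b V e₁ y₁≡0)))
        Dρ : Dir ρ d
        Dρ = Dir-lin {ρ} y₁ (- y₂) (difference {ρ} (i∈ ρ) y∈ρ) (difference {ρ} (i∈ ρ) (j∈ ρ))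
        DB₀ : Dir B₀ d
        DB₀ = Dir₀ (y₁ * x₂ + - (y₂ * x₁)) (y₁ * w₂ + - (y₂ * w₁))
          (vsolve 6 5 (λ x₁ y₁ w₁ x₂ y₂ w₂ D E a b V →
            y₁ :· E :⊕ :- y₂ :· D :≈ (y₁ :* x₂ :+ :- (y₂ :* x₁)) :· a :⊕ (y₁ :* w₂ :+ :- (y₂ :* w₁)) :· V givenᵛ
            (y₁ ∙ᵛ E :≈ x₂ :· a :⊕ y₂ :· b :⊕ w₂ :· V) ∷ (:- y₂ ∙ᵛ D :≈ x₁ :· a :⊕ y₁ :· b :⊕ w₁ :· V) ∷ [])
            refl x₁ y₁ w₁ x₂ y₂ w₂ (c x ⊖ c o) (c y ⊖ c o) a b V e₂ e₁)
        o≢y : o ≢ y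
        o≢y eq = o∉π1 (subst (λ i → c i ∈ π 1#) (sym eq) y∈π)
        y≢x : y ≢ x
        y≢x eq = π-apart (λ e → new≢1 (sym e)) y y∈π (subst (λ i → c i ∈ π new) (sym eq) (X∈π 1# new))
        d≢0 : d ≢ 0v
        d≢0 eq = y₁≢0 (proj₁ (arc-independent {ρ} (i∈ ρ) y∈ρ (j∈ ρ) o≢y y≢x o≢x y₁ (- y₂) eq))
        ρ∋V : Dir ρ V
        ρ∋V = Dir-∥ {ρ} (∥-sym d≢0 (only o∈ d≢0 DB₀ (ρ , ρ≉B₀ , i∈ ρ , Dρ))) Dρ
      contradictory : Meet ρ (π 1#) ⊎ Disjoint ρ (π 1#) → ⊥
      contradictory (inj₂ d) = ρ≉B₀ (parallel-unique {o} {π 1#} (i∈ ρ) o∈ d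
        (λ i i∈ → π-apart (λ eq → 1≢0 (sym eq)) i (proj₂ (π0≋B₀ _) i∈)))
      contradictory (inj₁ (y , y∈ρ , y∈π)) = finish y∈ρ y∈π
        (span-x span (P-coords 1#) (on-σ 1# 1≢0))
        (span-y span (R-coords 1#) (plane-coords (axπ 1#) (Neighbour.i∈σ (nπ 1#)) (X∈π 1# 1#) (R≢X 1# 1≢0) y∈π))

    independent : Independent₄ a b e V
    independent x y z w eq with z ≟ 0#
    ... | no z≢0 = ⊥-elim (not-coplanar (1# + - (i * x) , 1# + - (i * y) , - (i * w) ,
      (vsolve 5 5 (λ x y z w i o E a b V →
        E :⊖ o :≈ (:1 :+ :- (i :* x)) :· a :⊕ (:1 :+ :- (i :* y)) :· b :⊕ :- (i :* w) :· V givenᵛ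
        (i ∙ᵛ x :· a :⊕ y :· b :⊕ z :· (E :⊖ o :⊖ a :⊖ b) :⊕ w :· V :≈ :0v) ∷
        (:0v :⊖ (E :⊖ o :⊖ a :⊖ b) ∙ˢ z :* i := :1) ∷ []) refl x y z w i (c o) (c (X 1# 1#)) a b V eq (x*inv≡1 z z≢0))))
      where i = inv z z≢0
    ... | yes refl with y ≟ 0#
    ...   | no y≢0 = ⊥-elim (N₀.≉B (same-plane {σ₀} {B₀} N₀.i∈σ o∈ indB N₀.V∈σ Db V∈ (subst (Dir B₀)
      (vsolve 4 4 (λ x y w i a b e V → :- (i :* x) :· a :⊕ :- (i :* w) :· V :≈ b givenᵛ
        (:- i ∙ᵛ x :· a :⊕ y :· b :⊕ :0 :· e :⊕ w :· V :≈ :0v) ∷ (b ∙ˢ y :* i := :1) ∷ [])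
        refl x y w i a b e V eq (x*inv≡1 y y≢0)) (Dir-lin {B₀} _ _ Da V∈))))
      where i = inv y y≢0
    ...   | yes refl with indA w x (vsolve 2 4 (λ x w a b e V → w :· V :⊕ x :· a :≈ :0v
      givenᵛ (:1 ∙ᵛ x :· a :⊕ :0 :· b :⊕ :0 :· e :⊕ w :· V :≈ :0v) ∷ []) refl x w a b e V eq)
    ...     | w≡0 , x≡0 = x≡0 , refl , refl , w≡0

  -- Coordinates in which the projection of 𝒞 from V is the paraboloid z = xy.
  record Coordinates (o : I) (V : Pt) : Set where
    field
      a b e      : Pt
      ind        : Independent₄ a b e V
      X          : K → K → I
      f          : K → K → K
      X-eq       : ∀ t s → c (X t s) ≡ c o ⊕ comb a b e V t s (t * s) (f t s)
      X-onto     : ∀ i → ∃[ t ] ∃[ s ] X t s ≡ i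
      X-origin   : X 0# 0# ≡ o
      σ π        : K → Block
      X∈σ        : ∀ t s → c (X t s) ∈ σ t
      X∈π        : ∀ t s → c (X t s) ∈ π s
      V∈σ        : ∀ t → Dir (σ t) V
      V∈π        : ∀ s → Dir (π s) V
      axis₀      : IsAxis (π 0#) V
      off-σ      : ∀ {t s} → t ≢ 0# → ¬ c (X t s) ∈ σ 0#
      off-π      : ∀ {t s} → s ≢ 0# → ¬ c (X t s) ∈ π 0#
      only-two   : ∀ {τ} → c o ∈ τ → Dir τ V → ¬ τ ≋ π 0# → τ ≋ σ 0#

  -- Modulo V the blocks become lines of a 3-space: `σ t` joins (t, 0, 0) to (κ t, 1, κ t), and
  -- `π s` joins (0, s, 0) to (1, μ s, μ s). The equation z = xy comes down to κ and μ being the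
  -- identity.
  module Parametrise {B₀ V} (ax : IsAxis B₀ V) {o} (o∈ : c o ∈ B₀) where
    open Grid ax o∈

    private
      Xπ₁ : ∀ t → ∃[ k ] ∃[ w ] c (X t 1#) ≡ c o ⊕ comb a b e V k 1# k w
      Xπ₁ t = go (on-π 1# {1#} {t} 1≢0) (R-coords 1#)
        where
        go : Span V (c (X 1# 1#) ⊖ c (R 1#)) (c (X t 1#) ⊖ c (R 1#)) → (∃[ w ] c (R 1#) ≡ (c o ⊕ 1# · b) ⊕ w · V) →
             ∃[ k ] ∃[ w ] c (X t 1#) ≡ c o ⊕ comb a b e V k 1# k w
        go (u , k , eX) (w , eR) = k , w + u + - (k * w) ,
          vsolve 3 7 (λ u k w o a b V E R X →
            X :≈ o :⊕ (k :· a :⊕ :1 :· b :⊕ k :· (E :⊖ o :⊖ a :⊖ b) :⊕ (w :+ u :+ :- (k :* w)) :· V) givenᵛ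
            (:1 ∙ᵛ X :⊖ R :≈ u :· V :⊕ k :· (E :⊖ R)) ∷ (:1 :- k ∙ᵛ R :≈ o :⊕ :1 :· b :⊕ w :· V) ∷ [])
            refl u k w (c o) a b V (c (X 1# 1#)) (c (R 1#)) (c (X t 1#)) eX eR

      Xσ₁ : ∀ s → ∃[ k ] ∃[ w ] c (X 1# s) ≡ c o ⊕ comb a b e V 1# k k w
      Xσ₁ s = go (on-σ 1# {1#} {s} 1≢0) (P-coords 1#)
        where
        go : Span V (c (X 1# 1#) ⊖ c (P 1#)) (c (X 1# s) ⊖ c (P 1#)) → (∃[ w ] c (P 1#) ≡ (c o ⊕ 1# · a) ⊕ w · V) →
             ∃[ k ] ∃[ w ] c (X 1# s) ≡ c o ⊕ comb a b e V 1# k k w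
        go (u , k , eX) (w , eR) = k , w + u + - (k * w) ,
          vsolve 3 7 (λ u k w o a b V E R X →
            X :≈ o :⊕ (:1 :· a :⊕ k :· b :⊕ k :· (E :⊖ o :⊖ a :⊖ b) :⊕ (w :+ u :+ :- (k :* w)) :· V) givenᵛ
            (:1 ∙ᵛ X :⊖ R :≈ u :· V :⊕ k :· (E :⊖ R)) ∷ (:1 :- k ∙ᵛ R :≈ o :⊕ :1 :· a :⊕ w :· V) ∷ [])
            refl u k w (c o) a b V (c (X 1# 1#)) (c (P 1#)) (c (X 1# s)) eX eR

    κ μ : K → K
    κ t = proj₁ (Xπ₁ t)
    μ s = proj₁ (Xσ₁ s)

    private
      Xσ : ∀ t s → ∃[ l ] ∃[ w ] c (X t s) ≡ c o ⊕ comb a b e V (t + l * (κ t + - t)) l (l * κ t) w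
      Xσ t s = go (on-σ t {1#} {s} 1≢0) (P-coords t) (proj₂ (Xπ₁ t))
        where
        go : Span V (c (X t 1#) ⊖ c (P t)) (c (X t s) ⊖ c (P t)) → (∃[ w ] c (P t) ≡ (c o ⊕ t · a) ⊕ w · V) →
             (∃[ w ] c (X t 1#) ≡ c o ⊕ comb a b e V (κ t) 1# (κ t) w) →
             ∃[ l ] ∃[ w ] c (X t s) ≡ c o ⊕ comb a b e V (t + l * (κ t + - t)) l (l * κ t) w
        go (u , l , eX) (w , eP) (w′ , eE) = l , w + u + l * (w′ + - w) ,
          vsolve 6 8 (λ t κ u l w w' o a b e V E P X →
            X :≈ o :⊕ ((t :+ l :* (κ :+ :- t)) :· a :⊕ l :· b :⊕ (l :* κ) :· e :⊕ (w :+ u :+ l :* (w' :+ :- w)) :· V) givenᵛ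
            (:1 ∙ᵛ X :⊖ P :≈ u :· V :⊕ l :· (E :⊖ P)) ∷ (:1 :- l ∙ᵛ P :≈ o :⊕ t :· a :⊕ w :· V) ∷
            (l ∙ᵛ E :≈ o :⊕ (κ :· a :⊕ :1 :· b :⊕ κ :· e :⊕ w' :· V)) ∷ [])
            refl t (κ t) u l w w′ (c o) a b e V (c (X t 1#)) (c (P t)) (c (X t s)) eX eP eE

      Xπ : ∀ t s → ∃[ k ] ∃[ w ] c (X t s) ≡ c o ⊕ comb a b e V k (s + k * (μ s + - s)) (k * μ s) w
      Xπ t s = go (on-π s {1#} {t} 1≢0) (R-coords s) (proj₂ (Xσ₁ s))
        where
        go : Span V (c (X 1# s) ⊖ c (R s)) (c (X t s) ⊖ c (R s)) → (∃[ w ] c (R s) ≡ (c o ⊕ s · b) ⊕ w · V) →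
             (∃[ w ] c (X 1# s) ≡ c o ⊕ comb a b e V 1# (μ s) (μ s) w) →
             ∃[ k ] ∃[ w ] c (X t s) ≡ c o ⊕ comb a b e V k (s + k * (μ s + - s)) (k * μ s) w
        go (u , l , eX) (w , eP) (w′ , eE) = l , w + u + l * (w′ + - w) ,
          vsolve 6 8 (λ s μ u l w w' o a b e V E P X →
            X :≈ o :⊕ (l :· a :⊕ (s :+ l :* (μ :+ :- s)) :· b :⊕ (l :* μ) :· e :⊕ (w :+ u :+ l :* (w' :+ :- w)) :· V) givenᵛ
            (:1 ∙ᵛ X :⊖ P :≈ u :· V :⊕ l :· (E :⊖ P)) ∷ (:1 :- l ∙ᵛ P :≈ o :⊕ s :· b :⊕ w :· V) ∷
            (l ∙ᵛ E :≈ o :⊕ (:1 :· a :⊕ μ :· b :⊕ μ :· e :⊕ w' :· V)) ∷ [])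
            refl s (μ s) u l w w′ (c o) a b e V (c (X 1# s)) (c (R s)) (c (X t s)) eX eP eE

      ⊕-cancelˡ : ∀ {p u v} → p ⊕ u ≡ p ⊕ v → u ≡ v
      ⊕-cancelˡ {p} {u} {v} eq = vsolve 0 3 (λ p u v → u :≈ v givenᵛ (:1 ∙ᵛ p :⊕ u :≈ p :⊕ v) ∷ []) refl p u v eq

    opaque
      match : ∀ t s → ∃[ k ] ∃[ l ] (k ≡ t + l * (κ t + - t) × l ≡ s + k * (μ s + - s) × l * κ t ≡ k * μ s
              × ∃[ w ] c (X t s) ≡ c o ⊕ comb a b e V (t + l * (κ t + - t)) l (l * κ t) w)
      match t s = go (Xσ t s) (Xπ t s)
        where
        go : (∃[ l ] ∃[ w ] c (X t s) ≡ c o ⊕ comb a b e V (t + l * (κ t + - t)) l (l * κ t) w) →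
             (∃[ k ] ∃[ w ] c (X t s) ≡ c o ⊕ comb a b e V k (s + k * (μ s + - s)) (k * μ s) w) →
             ∃[ k ] ∃[ l ] (k ≡ t + l * (κ t + - t) × l ≡ s + k * (μ s + - s) × l * κ t ≡ k * μ s
               × ∃[ w ] c (X t s) ≡ c o ⊕ comb a b e V (t + l * (κ t + - t)) l (l * κ t) w)
        go (l , w , eσ) (k , w′ , eπ) =
          let e₁ , e₂ , e₃ , _ = comb-inj independent (⊕-cancelˡ (trans (sym eσ) eπ))
          in k , l , sym e₁ , e₂ , e₃ , w , eσ

    -- Obtained by eliminating k and l from the two parametrisations of the crossing point. For
    -- fixed t it makes `μ s` a fractional linear function of s, as on any ruled quadric. A pole
    -- would mean two parallel lines of different families; `κnew` excludes it, and with it the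
    -- hyperboloid.
    relation : ∀ t s → μ s * (t * (1# + - κ t) + s * (κ t + - t)) ≡ κ t * (1# + - t) * s
    relation t s = go (match t s)
      where
      go : _ → μ s * (t * (1# + - κ t) + s * (κ t + - t)) ≡ κ t * (1# + - t) * s
      go (k , l , e₁ , e₂ , e₃ , _) = solve 6 (λ t s κ m k l →
        m :* (t :* (:1 :+ :- κ) :+ s :* (κ :+ :- t)) := κ :* (:1 :+ :- t) :* s given
        (:- ((:1 :- (m :- s) :* (κ :- t)) :* m) :+ (κ :- m :* (κ :- t)) :* (m :- s) ∙ k := t :+ l :* (κ :+ :- t)) ∷
        (κ :- m :* (κ :- t) ∙ l := s :+ k :* (m :+ :- s)) ∷
        (:- (:1 :- (m :- s) :* (κ :- t)) ∙ l :* κ := k :* m) ∷ []) refl t s (κ t) (μ s) k l e₁ e₂ e₃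

    κnew≢0 : κ new ≢ 0#
    κnew≢0 κ≡0 = R≢X 1# new≢0 (go (proj₂ (Xπ₁ new)) (R-coords 1#))
      where
      go : (∃[ w ] c (X new 1#) ≡ c o ⊕ comb a b e V (κ new) 1# (κ new) w) → (∃[ w ] c (R 1#) ≡ (c o ⊕ 1# · b) ⊕ w · V) →
           R 1# ≡ X new 1#
      go (w , eX) (w′ , eR) = axis-line-one (axπ 1#) {t = w + - w′} (Neighbour.i∈σ (nπ 1#)) (X∈π new 1#)
        (vsolve 3 7 (λ κ w w' o a b e V X R → X :≈ R :⊕ (w :+ :- w') :· V givenᵛ
          (:1 ∙ᵛ X :≈ o :⊕ (κ :· a :⊕ :1 :· b :⊕ κ :· e :⊕ w :· V)) ∷ (:- :1 ∙ᵛ R :≈ o :⊕ :1 :· b :⊕ w' :· V) ∷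
          (a :⊕ e ∙ˢ κ := :0) ∷ []) refl (κ new) w w′ (c o) a b e V (c (X new 1#)) (c (R 1#)) eX eR κ≡0)

    κnew≢1 : κ new ≢ 1#
    κnew≢1 κ≡1 = new≢1 (sym (proj₁ (X-inj {1#} {1#} {new} {1#} (go (proj₂ (Xπ₁ new))))))
      where
      go : (∃[ w ] c (X new 1#) ≡ c o ⊕ comb a b e V (κ new) 1# (κ new) w) → X 1# 1# ≡ X new 1#
      go (w , eX) = axis-line-one (axπ 1#) {t = w} (X∈π 1# 1#) (X∈π new 1#)
        (vsolve 2 6 (λ κ w o a b V X E → X :≈ E :⊕ w :· V givenᵛ
          (:1 ∙ᵛ X :≈ o :⊕ (κ :· a :⊕ :1 :· b :⊕ κ :· (E :⊖ o :⊖ a :⊖ b) :⊕ w :· V)) ∷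
          (a :⊕ (E :⊖ o :⊖ a :⊖ b) ∙ˢ κ := :1) ∷ []) refl (κ new) w (c o) a b V (c (X new 1#)) (c (X 1# 1#)) eX κ≡1)

    -- Otherwise the line of the points X new _ has no point on some line
    -- of the other family.
    κnew : κ new ≡ new
    κnew = decidable-stable (κ new ≟ new) λ κ≢t →
      let i = inv _ (x≢y⇒x-y≢0 κ≢t)
          s = - (new * (1# + - κ new) * i)
          i-inv = x*inv≡1 _ (x≢y⇒x-y≢0 κ≢t)
          1-κ≢0 = x≢y⇒x-y≢0 (κnew≢1 ∘ sym)
          s≢0 = neg≢0 (*-nonzero (*-nonzero new≢0 1-κ≢0) (inv≢0 _ (x≢y⇒x-y≢0 κ≢t)))
      in *-nonzero (*-nonzero κnew≢0 (x≢y⇒x-y≢0 (new≢1 ∘ sym))) s≢0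
        (solve 4 (λ t κ i m → κ :* (:1 :+ :- t) :* :- (t :* (:1 :+ :- κ) :* i) := :0 given
          (:- :1 ∙ m :* (t :* (:1 :+ :- κ) :+ :- (t :* (:1 :+ :- κ) :* i) :* (κ :+ :- t)) := κ :* (:1 :+ :- t) :* :- (t :* (:1 :+ :- κ) :* i)) ∷
          (:- (m :* t :* (:1 :- κ)) ∙ (κ :+ :- t) :* i := :1) ∷ []) refl new (κ new) i (μ s) (relation new s) i-inv)

    μ≡ : ∀ s → μ s ≡ s
    μ≡ s = cancelˡ (*-nonzero new≢0 (x≢y⇒x-y≢0 (new≢1 ∘ sym)))
      (solve 4 (λ t κ m s → t :* (:1 :+ :- t) :* m := t :* (:1 :+ :- t) :* s given
        (:1 ∙ m :* (t :* (:1 :+ :- κ) :+ s :* (κ :+ :- t)) := κ :* (:1 :+ :- t) :* s) ∷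
        (m :* t :- m :* s :+ (:1 :- t) :* s ∙ κ := t) ∷ []) refl new (κ new) (μ s) s (relation new s) κnew)

    κ≡ : ∀ t → κ t ≡ t
    κ≡ t = go (match t new)
      where
      go : _ → κ t ≡ t
      go (k , l , e₁ , e₂ , e₃ , _) = x-y≡0⇒x≡y _ _ (cancel (*-nonzero new≢0 (x≢y⇒x-y≢0 (new≢1 ∘ sym)))
        (solve 6 (λ t n κ k l m → n :* (:1 :+ :- n) :* (κ :+ :- t) := :0 given
          (n ∙ k := t :+ l :* (κ :+ :- t)) ∷ (n :* (κ :- t) :- κ ∙ l := n :+ k :* (m :+ :- n)) ∷ (:1 ∙ l :* κ := k :* m) ∷
          (k :+ n :* (κ :- t) :* k :- κ :* k ∙ m := n) ∷ []) refl t new (κ t) k l (μ new) e₁ e₂ e₃ (μ≡ new)))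

    height : ∀ t s → ∃[ w ] c (X t s) ≡ c o ⊕ comb a b e V t s (t * s) w
    height t s = go (match t s)
      where
      go : _ → ∃[ w ] c (X t s) ≡ c o ⊕ comb a b e V t s (t * s) w
      go (k , l , e₁ , e₂ , e₃ , w , eq) = w ,
        vsolve 7 6 (λ t s κ m k l w o a b e V X →
          X :≈ o :⊕ (t :· a :⊕ s :· b :⊕ (t :* s) :· e :⊕ w :· V) givenᵛ
          (:1 ∙ᵛ X :≈ o :⊕ ((t :+ l :* (κ :+ :- t)) :· a :⊕ l :· b :⊕ (l :* κ) :· e :⊕ w :· V)) ∷
          (l :· a :⊕ l :· e ∙ˢ κ := t) ∷ (b :⊕ t :· e ∙ˢ l := s :+ k :* (m :+ :- s)) ∷
          (k :· b :⊕ (t :* k) :· e ∙ˢ m := s) ∷ []) refl t s (κ t) (μ s) k l w (c o) a b e V (c (X t s)) eq (κ≡ t) e₂ (μ≡ s)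

    opaque
      paraboloid : Coordinates o V
      paraboloid = record
        { a = a ; b = b ; e = e ; ind = independent ; X = X ; f = λ t s → proj₁ (height t s)
        ; X-eq = λ t s → proj₂ (height t s) ; X-onto = X-onto ; X-origin = origin
        ; σ = σ ; π = π ; X∈σ = X∈σ ; X∈π = X∈π ; V∈σ = λ t → Neighbour.V∈σ (nσ t) ; V∈π = λ s → Neighbour.V∈σ (nπ s)
        ; axis₀ = axπ 0#
        ; off-σ = λ {t} {s} t≢0 X∈ → X∉σ₀ {t} {s} t≢0 (proj₁ (σ0≋σ₀ _) X∈)
        ; off-π = λ {t} {s} s≢0 X∈ → X∉B₀ {t} {s} s≢0 (proj₁ (π0≋B₀ _) X∈)
        ; only-two = λ o∈τ Vτ τ≉ → ≐-trans (neighbour-unique ax o∈ (proj₂ n₀) o∈τ Vτ (λ e → τ≉ (≐-trans e (≐-sym π0≋B₀)))) (≐-sym σ0≋σ₀) }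
        where
        origin : X 0# 0# ≡ o
        origin = sym (axis-line-one ax {t = proj₁ (height 0# 0#)} o∈ (proj₁ (π0≋B₀ _) (X∈π 0# 0#))
          (vsolve 1 6 (λ w o a b e V X → X :≈ o :⊕ w :· V givenᵛ
            (:1 ∙ᵛ X :≈ o :⊕ (:0 :· a :⊕ :0 :· b :⊕ (:0 :* :0) :· e :⊕ w :· V)) ∷ [])
            refl (proj₁ (height 0# 0#)) (c o) a b e V (c (X 0# 0#)) (proj₂ (height 0# 0#))))

  -- Blocks through the origin of a chart

  module Chart {o V} (fr : Coordinates o V) where
    open Coordinates fr public

    private
      drop : ∀ {p u v} → p ⊕ u ≡ p ⊕ v → u ≡ v
      drop {p} {u} {v} eq = vsolve 0 3 (λ p u v → u :≈ v givenᵛ (:1 ∙ᵛ p :⊕ u :≈ p :⊕ v) ∷ []) refl p u v eq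

    X-inj : ∀ {t s t′ s′} → X t s ≡ X t′ s′ → t ≡ t′ × s ≡ s′
    X-inj {t} {s} {t′} {s′} eq =
      let t≡ , s≡ , _ = comb-inj ind (drop (trans (sym (X-eq t s)) (trans (cong c eq) (X-eq t′ s′)))) in t≡ , s≡

    X-diff : ∀ t s → c (X t s) ⊖ c o ≡ comb a b e V t s (t * s) (f t s)
    X-diff t s = vsolve 0 3 (λ x o d → x :⊖ o :≈ d givenᵛ (:1 ∙ᵛ x :≈ o :⊕ d) ∷ [])
      refl (c (X t s)) (c o) (comb a b e V t s (t * s) (f t s)) (X-eq t s)

    o∈σ : c o ∈ σ 0#
    o∈σ = subst (λ i → c i ∈ σ 0#) X-origin (X∈σ 0# 0#)
    o∈π : c o ∈ π 0#
    o∈π = subst (λ i → c i ∈ π 0#) X-origin (X∈π 0# 0#)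
    σ≉π : ¬ σ 0# ≋ π 0#
    σ≉π eq = off-π {0#} {1#} 1≢0 (proj₁ (eq _) (X∈σ 0# 1#))
    V≢0 : V ≢ 0v
    V≢0 = IsAxis.V≢0 axis₀
    axisσ : IsAxis (σ 0#) V
    axisσ = neighbour-axis {π 0#} {V} {σ 0#} axis₀ σ≉π o∈π o∈σ (V∈σ 0#)

    through-V : ∀ {τ} → c o ∈ τ → Dir τ V → τ ≋ π 0# ⊎ τ ≋ σ 0#
    through-V {τ} o∈ Vτ with τ ≋? π 0#
    ... | yes eq = inj₁ eq
    ... | no τ≉ = inj₂ (only-two o∈ Vτ τ≉)

    -- `proportional` is about all directions of ρ and not only its C-points, so that it also
    -- restricts the axis of ρ.
    record Slope (ρ : Block) : Set where
      field
        μ      : K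
        μ≢0    : μ ≢ 0#
        proportional : ∀ x y z w → Dir ρ (comb a b e V x y z w) → y ≡ μ * x
        on     : ∀ t → c (X t (μ * t)) ∈ ρ

    module _ {ρ} (o∈ : c o ∈ ρ) (V∉ : ¬ Dir ρ V) where

      -- As V is not a direction of ρ, the directions of ρ project from V onto a plane in the
      -- 3-space modulo V; (α, β, γ) is a normal vector of it.
      record Functional : Set where
        field
          α β γ  : K
          proper : α ≡ 0# → β ≡ 0# → γ ≡ 0# → ⊥
          zero-on : ∀ x y z w → Dir ρ (comb a b e V x y z w) → α * x + β * y + γ * z ≡ 0#

      private
        not-V : ∀ {k l w} → k ≢ 0# → k · v ρ ⊕ l · u ρ ≡ w · V → ⊥
        not-V {k} {l} {w} k≢0 eq with w ≟ 0#
        ... | yes refl = k≢0 (proj₂ (u-v-independent ρ l k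
          (vsolve 2 3 (λ k l u v V → l :· u :⊕ k :· v :≈ :0v givenᵛ (:1 ∙ᵛ k :· v :⊕ l :· u :≈ :0 :· V) ∷ [])
            refl k l (u ρ) (v ρ) V eq)))
        ... | no w≢0 = V∉ (inv w w≢0 * l , inv w w≢0 * k , vsolve 4 3 (λ k l w i u v V →
          V :≈ (i :* l) :· u :⊕ (i :* k) :· v givenᵛ
          (:- i ∙ᵛ k :· v :⊕ l :· u :≈ w :· V) ∷ (:0v :⊖ V ∙ˢ w :* i := :1) ∷ [])
          refl k l w (inv w w≢0) (u ρ) (v ρ) V eq (x*inv≡1 w w≢0))

        not-V′ : ∀ {w} → u ρ ≡ w · V → ⊥
        not-V′ {w} eq = V∉ (Dir-∥ {ρ} (∥-sym (independent⇒≢0ˡ (u-v-independent ρ)) (w , eq))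
          (1# , 0# , vsolve 0 2 (λ u v → u :≈ :1 :· u :⊕ :0 :· v givenᵛ []) refl (u ρ) (v ρ)))

        Coords : Pt → Set
        Coords p = ∃[ x ] ∃[ y ] ∃[ z ] ∃[ w ] p ≡ comb a b e V x y z w

        functional′ : Coords (u ρ) → Coords (v ρ) → Functional
        functional′ (x₁ , y₁ , z₁ , w₁ , eu) (x₂ , y₂ , z₂ , w₂ , ev) = record
          -- The cross product of the projections of the two basis directions.
          { α = y₁ * z₂ + - (z₁ * y₂) ; β = z₁ * x₂ + - (x₁ * z₂) ; γ = x₁ * y₂ + - (y₁ * x₂)
          ; proper = proper ; zero-on = zero-on }
          where
          -- If the cross product vanished, the projections would be proportional, and some
          -- nontrivial combination of `u ρ` and `v ρ` would be a multiple of V.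
          proper : y₁ * z₂ + - (z₁ * y₂) ≡ 0# → z₁ * x₂ + - (x₁ * z₂) ≡ 0# → x₁ * y₂ + - (y₁ * x₂) ≡ 0# → ⊥
          proper h₁ h₂ h₃ with x₁ ≟ 0# | y₁ ≟ 0# | z₁ ≟ 0#
          ... | no x₁≢0 | _ | _ = not-V {x₁} { - x₂} {x₁ * w₂ + - (x₂ * w₁)} x₁≢0
            (vsolve 8 6 (λ x₁ y₁ z₁ w₁ x₂ y₂ z₂ w₂ a b e V u v → x₁ :· v :⊕ :- x₂ :· u :≈ (x₁ :* w₂ :+ :- (x₂ :* w₁)) :· V givenᵛ
              (:- x₂ ∙ᵛ u :≈ x₁ :· a :⊕ y₁ :· b :⊕ z₁ :· e :⊕ w₁ :· V) ∷ (x₁ ∙ᵛ v :≈ x₂ :· a :⊕ y₂ :· b :⊕ z₂ :· e :⊕ w₂ :· V) ∷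
              (:- :1 :· e ∙ˢ z₁ :* x₂ :+ :- (x₁ :* z₂) := :0) ∷ (b ∙ˢ x₁ :* y₂ :+ :- (y₁ :* x₂) := :0) ∷ [])
              refl x₁ y₁ z₁ w₁ x₂ y₂ z₂ w₂ a b e V (u ρ) (v ρ) eu ev h₂ h₃)
          ... | yes refl | no y₁≢0 | _ = not-V {y₁} { - y₂} {y₁ * w₂ + - (y₂ * w₁)} y₁≢0
            (vsolve 7 6 (λ y₁ z₁ w₁ x₂ y₂ z₂ w₂ a b e V u v → y₁ :· v :⊕ :- y₂ :· u :≈ (y₁ :* w₂ :+ :- (y₂ :* w₁)) :· V givenᵛ
              (:- y₂ ∙ᵛ u :≈ :0 :· a :⊕ y₁ :· b :⊕ z₁ :· e :⊕ w₁ :· V) ∷ (y₁ ∙ᵛ v :≈ x₂ :· a :⊕ y₂ :· b :⊕ z₂ :· e :⊕ w₂ :· V) ∷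
              (e ∙ˢ y₁ :* z₂ :+ :- (z₁ :* y₂) := :0) ∷ (:- :1 :· a ∙ˢ :0 :* y₂ :+ :- (y₁ :* x₂) := :0) ∷ [])
              refl y₁ z₁ w₁ x₂ y₂ z₂ w₂ a b e V (u ρ) (v ρ) eu ev h₁ h₃)
          ... | yes refl | yes refl | no z₁≢0 = not-V {z₁} { - z₂} {z₁ * w₂ + - (z₂ * w₁)} z₁≢0
            (vsolve 6 6 (λ z₁ w₁ x₂ y₂ z₂ w₂ a b e V u v → z₁ :· v :⊕ :- z₂ :· u :≈ (z₁ :* w₂ :+ :- (z₂ :* w₁)) :· V givenᵛ
              (:- z₂ ∙ᵛ u :≈ :0 :· a :⊕ :0 :· b :⊕ z₁ :· e :⊕ w₁ :· V) ∷ (z₁ ∙ᵛ v :≈ x₂ :· a :⊕ y₂ :· b :⊕ z₂ :· e :⊕ w₂ :· V) ∷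
              (:- :1 :· b ∙ˢ :0 :* z₂ :+ :- (z₁ :* y₂) := :0) ∷ (a ∙ˢ z₁ :* x₂ :+ :- (:0 :* z₂) := :0) ∷ [])
              refl z₁ w₁ x₂ y₂ z₂ w₂ a b e V (u ρ) (v ρ) eu ev h₁ h₂)
          ... | yes refl | yes refl | yes refl = not-V′ {w₁}
            (vsolve 1 5 (λ w₁ a b e V u → u :≈ w₁ :· V givenᵛ (:1 ∙ᵛ u :≈ :0 :· a :⊕ :0 :· b :⊕ :0 :· e :⊕ w₁ :· V) ∷ [])
              refl w₁ a b e V (u ρ) eu)

          zero-on : ∀ x y z w → Dir ρ (comb a b e V x y z w) →
            (y₁ * z₂ + - (z₁ * y₂)) * x + (z₁ * x₂ + - (x₁ * z₂)) * y + (x₁ * y₂ + - (y₁ * x₂)) * z ≡ 0#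
          zero-on x y z w (k , l , eq) =
            let x≡ , y≡ , z≡ , _ = comb-inj ind {x} {y} {z} {w} {k * x₁ + l * x₂} {k * y₁ + l * y₂} {k * z₁ + l * z₂} {k * w₁ + l * w₂} (trans eq
                  (vsolve 10 6 (λ k l x₁ y₁ z₁ w₁ x₂ y₂ z₂ w₂ a b e V u v →
                    k :· u :⊕ l :· v :≈ (k :* x₁ :+ l :* x₂) :· a :⊕ (k :* y₁ :+ l :* y₂) :· b :⊕ (k :* z₁ :+ l :* z₂) :· e :⊕ (k :* w₁ :+ l :* w₂) :· V givenᵛ
                    (k ∙ᵛ u :≈ x₁ :· a :⊕ y₁ :· b :⊕ z₁ :· e :⊕ w₁ :· V) ∷
                    (l ∙ᵛ v :≈ x₂ :· a :⊕ y₂ :· b :⊕ z₂ :· e :⊕ w₂ :· V) ∷ [])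
                    refl k l x₁ y₁ z₁ w₁ x₂ y₂ z₂ w₂ a b e V (u ρ) (v ρ) eu ev))
            in solve 11 (λ k l x₁ y₁ z₁ x₂ y₂ z₂ x y z →
                 (y₁ :* z₂ :+ :- (z₁ :* y₂)) :* x :+ (z₁ :* x₂ :+ :- (x₁ :* z₂)) :* y :+ (x₁ :* y₂ :+ :- (y₁ :* x₂)) :* z := :0 given
                 (y₁ :* z₂ :- z₁ :* y₂ ∙ x := k :* x₁ :+ l :* x₂) ∷ (z₁ :* x₂ :- x₁ :* z₂ ∙ y := k :* y₁ :+ l :* y₂) ∷
                 (x₁ :* y₂ :- y₁ :* x₂ ∙ z := k :* z₁ :+ l :* z₂) ∷ []) refl k l x₁ y₁ z₁ x₂ y₂ z₂ x y z x≡ y≡ z≡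

      opaque
        functional : Functional
        functional = functional′ (coordinates ind (u ρ)) (coordinates ind (v ρ))

        place : ∀ j → ∃[ t ] ∃[ s ] X t s ≡ pts ρ j
        place j = X-onto (pts ρ j)

      open Functional functional

      T S : Fin q → K
      T j = proj₁ (place j)
      S j = proj₁ (proj₂ (place j))
      X-place : ∀ j → X (T j) (S j) ≡ pts ρ j
      X-place j = proj₂ (proj₂ (place j))

      on-block : ∀ {B j} t s → X t s ≡ pts ρ j → c (X t s) ∈ B → c (pts ρ j) ∈ B
      on-block {B} t s eq = subst (λ i → c i ∈ B) eq

      -- Two C-points of ρ on the same `σ t` would make ρ equal to `σ t`, which contains V.
      T-inj : Inj T
      T-inj {i} {j} eq = pts-inj ρ (decidable-stable (pts ρ i ≟ pts ρ j) λ i≢j → V∉ (Dir-of-≋ {σ (T i)} {ρ}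
        (unique i≢j (on-block _ _ (X-place i) (X∈σ (T i) (S i)))
          (on-block _ _ (X-place j) (subst (λ t → c (X (T j) (S j)) ∈ σ t) (sym eq) (X∈σ (T j) (S j)))) (pts∈ ρ i) (pts∈ ρ j)) (V∈σ (T i))))
      S-inj : Inj S
      S-inj {i} {j} eq = pts-inj ρ (decidable-stable (pts ρ i ≟ pts ρ j) λ i≢j → V∉ (Dir-of-≋ {π (S i)} {ρ}
        (unique i≢j (on-block _ _ (X-place i) (X∈π (T i) (S i)))
          (on-block _ _ (X-place j) (subst (λ s → c (X (T j) (S j)) ∈ π s) (sym eq) (X∈π (T j) (S j)))) (pts∈ ρ i) (pts∈ ρ j)) (V∈π (S i))))

      equation : ∀ j → α * T j + β * S j + γ * (T j * S j) ≡ 0#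
      equation j = zero-on (T j) (S j) (T j * S j) (f (T j) (S j)) (subst (Dir ρ) (X-diff (T j) (S j))
        (difference {ρ} o∈ (subst (λ i → c i ∈ ρ) (sym (X-place j)) (pts∈ ρ j))))

      private
        idx : Fin 3 → Fin q
        idx k = inject≤ k (k≤q (s≤s (s≤s (s≤s z≤n))))
        idx-≢ : ∀ {k l} → k ≢ l → idx k ≢ idx l
        idx-≢ {k} {l} k≢l eq = k≢l (inject≤-injective _ _ k l eq)

      -- For γ ≢ 0 the points of ρ would lie on the hyperbola
      -- (γt + β)(γs + α) = αβ, and the one with γt = - β shows αβ = 0.
      γ≡0 : γ ≡ 0#
      γ≡0 = decidable-stable (γ ≟ 0#) contradictory
        where
        module _ (γ≢0 : γ ≢ 0#) where
          i = inv γ γ≢0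
          αβ≡0 : α * β ≡ 0#
          αβ≡0 = from (inj⇒surj T T-inj (- (β * i)))
            where
            from : (∃ λ j → T j ≡ - (β * i)) → α * β ≡ 0#
            from (j , eq) = solve 6 (λ α β γ i t s → α :* β := :0 given
              (:- γ ∙ α :* t :+ β :* s :+ γ :* (t :* s) := :0) ∷ (γ :* (γ :* s :+ α) ∙ t := :- (β :* i)) ∷
              (:- (β :* (γ :* s :+ α)) ∙ γ :* i := :1) ∷ []) refl α β γ i (T j) (S j) (equation j) eq (x*inv≡1 γ γ≢0)
          class : ∀ j → γ * T j + β ≡ 0# ⊎ γ * S j + α ≡ 0#
          class j with γ * T j + β ≟ 0#
          ... | yes eq = inj₁ eq
          ... | no ≢0 = inj₂ (cancel ≢0 (solve 5 (λ α β γ t s → (γ :* t :+ β) :* (γ :* s :+ α) := :0 given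
              (γ ∙ α :* t :+ β :* s :+ γ :* (t :* s) := :0) ∷ (:1 ∙ α :* β := :0) ∷ []) refl α β γ (T j) (S j) (equation j) αβ≡0))
          same : ∀ {k l} → k ≢ l → (γ * T (idx k) + β ≡ 0# × γ * T (idx l) + β ≡ 0#)
                 ⊎ (γ * S (idx k) + α ≡ 0# × γ * S (idx l) + α ≡ 0#) → ⊥
          same {k} {l} k≢l (inj₁ (e₁ , e₂)) = idx-≢ k≢l (T-inj (cancelˡ γ≢0
            (solve 4 (λ β γ t s → γ :* t := γ :* s given (:1 ∙ γ :* t :+ β := :0) ∷ (:- :1 ∙ γ :* s :+ β := :0) ∷ [])
              refl β γ (T (idx k)) (T (idx l)) e₁ e₂)))
          same {k} {l} k≢l (inj₂ (e₁ , e₂)) = idx-≢ k≢l (S-inj (cancelˡ γ≢0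
            (solve 4 (λ β γ t s → γ :* t := γ :* s given (:1 ∙ γ :* t :+ β := :0) ∷ (:- :1 ∙ γ :* s :+ β := :0) ∷ [])
              refl α γ (S (idx k)) (S (idx l)) e₁ e₂)))
          three : (∀ (k : Fin 3) → γ * T (idx k) + β ≡ 0# ⊎ γ * S (idx k) + α ≡ 0#) → ⊥
          three h with h zero | h (suc zero) | h (suc (suc zero))
          ... | inj₁ x | inj₁ y | _ = same {zero} {suc zero} (λ ()) (inj₁ (x , y))
          ... | inj₂ x | inj₂ y | _ = same {zero} {suc zero} (λ ()) (inj₂ (x , y))
          ... | inj₁ x | _ | inj₁ y = same {zero} {suc (suc zero)} (λ ()) (inj₁ (x , y))
          ... | inj₂ x | _ | inj₂ y = same {zero} {suc (suc zero)} (λ ()) (inj₂ (x , y))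
          ... | _ | inj₁ x | inj₁ y = same {suc zero} {suc (suc zero)} (λ ()) (inj₁ (x , y))
          ... | _ | inj₂ x | inj₂ y = same {suc zero} {suc (suc zero)} (λ ()) (inj₂ (x , y))
          contradictory : ⊥
          contradictory = three (λ k → class (idx k))

      line : ∀ j → α * T j + β * S j ≡ 0#
      line j = solve 5 (λ α β γ t s → α :* t :+ β :* s := :0 given
        (:1 ∙ α :* t :+ β :* s :+ γ :* (t :* s) := :0) ∷ (:- (t :* s) ∙ γ := :0) ∷ []) refl α β γ (T j) (S j) (equation j) γ≡0

      β≢0 : β ≢ 0#
      β≢0 β≡0 = idx-≢ {zero} {suc zero} (λ ()) (T-inj (cancelˡ (λ α≡0 → proper α≡0 β≡0 γ≡0)
        (solve 6 (λ α β t s t' s' → α :* t := α :* t' given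
          (:1 ∙ α :* t :+ β :* s := :0) ∷ (:- :1 ∙ α :* t' :+ β :* s' := :0) ∷ (s' :- s ∙ β := :0) ∷ [])
          refl α β (T (idx zero)) (S (idx zero)) (T (idx (suc zero))) (S (idx (suc zero))) (line _) (line _) β≡0)))

      α≢0 : α ≢ 0#
      α≢0 α≡0 = idx-≢ {zero} {suc zero} (λ ()) (S-inj (cancelˡ (λ β≡0 → proper α≡0 β≡0 γ≡0)
        (solve 6 (λ α β t s t' s' → β :* s := β :* s' given
          (:1 ∙ α :* t :+ β :* s := :0) ∷ (:- :1 ∙ α :* t' :+ β :* s' := :0) ∷ (t' :- t ∙ α := :0) ∷ [])
          refl α β (T (idx zero)) (S (idx zero)) (T (idx (suc zero))) (S (idx (suc zero))) (line _) (line _) α≡0)))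

      opaque
        slope : Slope ρ
        slope = record
          { μ = - (α * inv β β≢0) ; μ≢0 = neg≢0 (*-nonzero α≢0 (inv≢0 β β≢0))
          ; proportional = λ x y z w D → solved x y (solve 6 (λ α β γ x y z → α :* x :+ β :* y := :0 given
              (:1 ∙ α :* x :+ β :* y :+ γ :* z := :0) ∷ (:- z ∙ γ := :0) ∷ []) refl α β γ x y z (zero-on x y z w D) γ≡0)
          ; on = λ t → found t (inj⇒surj T T-inj t) }
          where
          solved : ∀ x y → α * x + β * y ≡ 0# → y ≡ - (α * inv β β≢0) * x
          solved x y eq = solve 5 (λ α β i x y → y := :- (α :* i) :* x given
            (i ∙ α :* x :+ β :* y := :0) ∷ (:- y ∙ β :* i := :1) ∷ []) refl α β (inv β β≢0) x y eq (x*inv≡1 β β≢0)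
          found : ∀ t → (∃ λ j → T j ≡ t) → c (X t (- (α * inv β β≢0) * t)) ∈ ρ
          found t (j , refl) = subst (λ s → c (X (T j) s) ∈ ρ) (solved (T j) (S j) (line j))
            (subst (λ i → c i ∈ ρ) (sym (X-place j)) (pts∈ ρ j))

    -- Two blocks through `c o` of the same slope μ would have the C-point with coordinates (1, μ)
    -- in common as well.
    slopes-apart : ∀ {ρ ρ′} → c o ∈ ρ → c o ∈ ρ′ → ¬ ρ ≋ ρ′ → (s : Slope ρ) (s′ : Slope ρ′) → Slope.μ s ≢ Slope.μ s′
    slopes-apart {ρ} {ρ′} o∈ o∈′ ≉ s s′ eq = 1≢0 (proj₁ (X-inj (trans
      (meet-once ≉ (Slope.on s 1#) o∈ (subst (λ μ → c (X 1# (μ * 1#)) ∈ ρ′) (sym eq) (Slope.on s′ 1#)) o∈′) (sym X-origin))))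

    common-direction : ∀ {ρ ρ′ W} → c o ∈ ρ → c o ∈ ρ′ → ¬ ρ ≋ ρ′ → Slope ρ → Slope ρ′ → Dir ρ W → Dir ρ′ W →
                       ∃[ z ] ∃[ w ] W ≡ comb a b e V 0# 0# z w
    common-direction {ρ} {ρ′} {W} o∈ o∈′ ≉ s s′ DW DW′ = go (coordinates ind W)
      where
      go : (∃[ x ] ∃[ y ] ∃[ z ] ∃[ w ] W ≡ comb a b e V x y z w) → ∃[ z ] ∃[ w ] W ≡ comb a b e V 0# 0# z w
      go (x , y , z , w , eq) = z , w , trans eq (cong₂ (λ x y → comb a b e V x y z w) x≡0
          (solve 3 (λ x y μ → y := :0 given (:1 ∙ y := μ :* x) ∷ (μ ∙ x := :0) ∷ []) refl x y μ n x≡0))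
        where
        μ = Slope.μ s
        n = Slope.proportional s x y z w (subst (Dir ρ) eq DW)
        n′ = Slope.proportional s′ x y z w (subst (Dir ρ′) eq DW′)
        x≡0 : x ≡ 0#
        x≡0 = cancel (x≢y⇒x-y≢0 (slopes-apart {ρ} {ρ′} o∈ o∈′ ≉ s s′)) (solve 4 (λ x y μ μ' → (μ :+ :- μ') :* x := :0 given
          (:- :1 ∙ y := μ :* x) ∷ (:1 ∙ y := μ' :* x) ∷ []) refl x y μ (Slope.μ s′) n n′)

    -- The axis V′ of a block ρ that misses V is a second point from which 𝒞 projects to a
    -- paraboloid; ρ′ is the other block through `c o` that contains V′.
    module Second {ρ} (o∈ : c o ∈ ρ) (V∉ : ¬ Dir ρ V) where
      V′ : Pt
      V′ = proj₁ (axis ρ)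
      axρ : IsAxis ρ V′
      axρ = proj₂ (axis ρ)
      open IsAxis axρ using () renaming (V≢0 to V′≢0; V∈ to V′∈) public
      ρ′ : Block
      ρ′ = proj₁ (neighbour axρ o∈)
      nρ : Neighbour ρ V′ o ρ′
      nρ = proj₂ (neighbour axρ o∈)
      module N = Neighbour nρ

      V′∉ : ∀ {τ} → IsAxis τ V → c o ∈ τ → ¬ Dir τ V′
      V′∉ {τ} ax o∈τ V′∈τ = V∉ (Dir-∥ {ρ} (∥-sym V′≢0 (IsAxis.only ax o∈τ V′≢0 V′∈τ
        (ρ , (λ eq → V∉ (Dir-of-≋ {τ} {ρ} (≐-sym eq) (IsAxis.V∈ ax))) , o∈ , V′∈))) V′∈)

      -- Only two blocks through `c o` contain V, and neither of them contains V′.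
      V∉′ : ¬ Dir ρ′ V
      V∉′ V∈ρ′ = [ (λ eq → V′∉ axis₀ o∈π (Dir-of-≋ {ρ′} {π 0#} eq N.V∈σ)) , (λ eq → V′∉ axisσ o∈σ (Dir-of-≋ {ρ′} {σ 0#} eq N.V∈σ)) ]′
        (through-V N.i∈σ V∈ρ′)

      s : Slope ρ
      s = slope o∈ V∉
      s′ : Slope ρ′
      s′ = slope N.i∈σ V∉′

  -- The last coordinate as a quadratic polynomial

  Quadratic : (K → K → K) → Set
  Quadratic f = ∃[ A ] ∃[ B ] ∃[ D ] ∃[ E ] ∃[ G ] ∀ t s → f t s ≡ A * (t * t) + B * (t * s) + D * (s * s) + E * t + G * s

  -- In the chart of the second pair of blocks the third coordinate is a
  -- product of two linear forms; comparing the charts expresses f by it.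
  module _ {o V} (fr : Coordinates o V) {ρ} (o∈ : c o ∈ ρ) (V∉ : ¬ Dir ρ V) where
    private
      module C₁ = Chart fr
      module S = C₁.Second o∈ V∉
      fr₂ : Coordinates o S.V′
      fr₂ = Parametrise.paraboloid S.axρ o∈
      module C₂ = Chart fr₂
      comb₂ : K → K → K → K → Pt
      comb₂ = comb C₂.a C₂.b C₂.e S.V′

    quadratic : Quadratic C₁.f
    quadratic = go (C₁.common-direction {ρ} {S.ρ′} o∈ S.N.i∈σ (S.N.≉B ∘ ≐-sym) S.s S.s′ S.V′∈ S.N.V∈σ)
      (C₂.common-direction {C₁.π 0#} {C₁.σ 0#} C₁.o∈π C₁.o∈σ (C₁.σ≉π ∘ ≐-sym)
        (C₂.slope C₁.o∈π (S.V′∉ C₁.axis₀ C₁.o∈π)) (C₂.slope C₁.o∈σ (S.V′∉ C₁.axisσ C₁.o∈σ)) (C₁.V∈π 0#) (C₁.V∈σ 0#))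
      (coordinates C₂.ind C₁.a) (coordinates C₂.ind C₁.b)
      where
      go : (∃[ z ] ∃[ w ] S.V′ ≡ comb C₁.a C₁.b C₁.e V 0# 0# z w) → (∃[ z ] ∃[ w ] V ≡ comb₂ 0# 0# z w) →
           (∃[ x ] ∃[ y ] ∃[ z ] ∃[ w ] C₁.a ≡ comb₂ x y z w) → (∃[ x ] ∃[ y ] ∃[ z ] ∃[ w ] C₁.b ≡ comb₂ x y z w) → Quadratic C₁.f
      go (z , w , eV′) (z′ , w′ , eV) (a₁ , a₂ , a₃ , a₄ , ea) (b₁ , b₂ , b₃ , b₄ , eb) =
        -- In the second chart the first two coordinates of the point are t a₁ + s b₁ and t a₂ + s
        -- b₂, and the third is t a₃ + s b₃ + t s e₃ + f z′. The third is the product of the first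
        -- two; solving for f gives these coefficients.
        i′ * (a₁ * a₂) , i′ * (a₁ * b₂ + a₂ * b₁ + - e₃) , i′ * (b₁ * b₂) , - (i′ * a₃) , - (i′ * b₃) , λ t s → value t s (C₂.X-onto (C₁.X t s))
        where
        z≢0 : z ≢ 0#
        z≢0 refl = V∉ (Dir-∥ {ρ} (∥-sym S.V′≢0 (w , (vsolve 1 5 (λ w a b e V V' → V' :≈ w :· V givenᵛ
          (:1 ∙ᵛ V' :≈ :0 :· a :⊕ :0 :· b :⊕ :0 :· e :⊕ w :· V) ∷ []) refl w C₁.a C₁.b C₁.e V S.V′ eV′))) S.V′∈)
        z′≢0 : z′ ≢ 0#
        z′≢0 refl = V∉ (Dir-∥ {ρ} (w′ , (vsolve 1 5 (λ w a b e V V' → V :≈ w :· V' givenᵛ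
          (:1 ∙ᵛ V :≈ :0 :· a :⊕ :0 :· b :⊕ :0 :· e :⊕ w :· V') ∷ []) refl w′ C₂.a C₂.b C₂.e V S.V′ eV)) S.V′∈)
        i = inv z z≢0
        i′ = inv z′ z′≢0
        -- From V′ = z e + w V and V = z′ e′ + w′ V′, solved for e in terms of e′ and V′.
        e₃ e₄ : K
        e₃ = - (i * w * z′)
        e₄ = i * (1# + - (w * w′))
        ee : C₁.e ≡ comb₂ 0# 0# e₃ e₄
        ee = vsolve 5 8 (λ z w z' w' i a b e V a' b' e' V' →
          e :≈ :0 :· a' :⊕ :0 :· b' :⊕ :- (i :* w :* z') :· e' :⊕ (i :* (:1 :+ :- (w :* w'))) :· V' givenᵛ
          (:- i ∙ᵛ V' :≈ :0 :· a :⊕ :0 :· b :⊕ z :· e :⊕ w :· V) ∷ (:- (i :* w) ∙ᵛ V :≈ :0 :· a' :⊕ :0 :· b' :⊕ z' :· e' :⊕ w' :· V') ∷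
          (:0v :⊖ e ∙ˢ z :* i := :1) ∷ []) refl z w z′ w′ i C₁.a C₁.b C₁.e V C₂.a C₂.b C₂.e S.V′ eV′ eV (x*inv≡1 z z≢0)
        value : ∀ t s → (∃[ t′ ] ∃[ s′ ] C₂.X t′ s′ ≡ C₁.X t s) →
          C₁.f t s ≡ i′ * (a₁ * a₂) * (t * t) + i′ * (a₁ * b₂ + a₂ * b₁ + - e₃) * (t * s) + i′ * (b₁ * b₂) * (s * s) + - (i′ * a₃) * t + - (i′ * b₃) * s
        value t s (t′ , s′ , same) =
          let f = C₁.f t s
              x≡ , y≡ , z≡ , _ = comb-inj C₂.ind {t * a₁ + s * b₁} {t * a₂ + s * b₂} {t * a₃ + s * b₃ + t * s * e₃ + f * z′}
                {t * a₄ + s * b₄ + t * s * e₄ + f * w′} {t′} {s′} {t′ * s′} {C₂.f t′ s′}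
                (vsolve 18 11 (λ t s f a₁ a₂ a₃ a₄ b₁ b₂ b₃ b₄ e₃ e₄ z' w' t' s' f' o a b e V a' b' e' V' X Y →
                  (t :* a₁ :+ s :* b₁) :· a' :⊕ (t :* a₂ :+ s :* b₂) :· b' :⊕ (t :* a₃ :+ s :* b₃ :+ t :* s :* e₃ :+ f :* z') :· e' :⊕ (t :* a₄ :+ s :* b₄ :+ t :* s :* e₄ :+ f :* w') :· V' :≈ t' :· a' :⊕ s' :· b' :⊕ (t' :* s') :· e' :⊕ f' :· V' givenᵛ
                  (:1 ∙ᵛ Y :≈ o :⊕ (t' :· a' :⊕ s' :· b' :⊕ (t' :* s') :· e' :⊕ f' :· V')) ∷
                  (:- :1 ∙ᵛ X :≈ o :⊕ (t :· a :⊕ s :· b :⊕ (t :* s) :· e :⊕ f :· V)) ∷ (:- :1 ∙ᵛ Y :≈ X) ∷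
                  (:- t ∙ᵛ a :≈ a₁ :· a' :⊕ a₂ :· b' :⊕ a₃ :· e' :⊕ a₄ :· V') ∷ (:- s ∙ᵛ b :≈ b₁ :· a' :⊕ b₂ :· b' :⊕ b₃ :· e' :⊕ b₄ :· V') ∷
                  (:- (t :* s) ∙ᵛ e :≈ :0 :· a' :⊕ :0 :· b' :⊕ e₃ :· e' :⊕ e₄ :· V') ∷
                  (:- f ∙ᵛ V :≈ :0 :· a' :⊕ :0 :· b' :⊕ z' :· e' :⊕ w' :· V') ∷ [])
                  refl t s f a₁ a₂ a₃ a₄ b₁ b₂ b₃ b₄ e₃ e₄ z′ w′ t′ s′ (C₂.f t′ s′) (c o) C₁.a C₁.b C₁.e V C₂.a C₂.b C₂.e S.V′ (c (C₁.X t s)) (c (C₂.X t′ s′)) (C₂.X-eq t′ s′) (C₁.X-eq t s) (cong c same) ea eb ee eV)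
          in solve 14 (λ t s f a₁ a₂ a₃ b₁ b₂ b₃ e₃ z' i' t' s' →
               f := i' :* (a₁ :* a₂) :* (t :* t) :+ i' :* (a₁ :* b₂ :+ a₂ :* b₁ :+ :- e₃) :* (t :* s) :+ i' :* (b₁ :* b₂) :* (s :* s) :+ :- (i' :* a₃) :* t :+ :- (i' :* b₃) :* s given
               (i' ∙ t :* a₃ :+ s :* b₃ :+ t :* s :* e₃ :+ f :* z' := t' :* s') ∷ (:- (i' :* s') ∙ t :* a₁ :+ s :* b₁ := t') ∷
               (:- (i' :* (t :* a₁ :+ s :* b₁)) ∙ t :* a₂ :+ s :* b₂ := s') ∷ (:- f ∙ z' :* i' := :1) ∷ [])
               refl t s f a₁ a₂ a₃ b₁ b₂ b₃ e₃ z′ i′ t′ s′ z≡ x≡ y≡ (x*inv≡1 z′ z′≢0)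

  -- Reduction of the polynomial to x² + βy²

  module Normalise (2≢0 : 2# ≢ 0#) {o V} (fr : Coordinates o V)
    (A B D E G : K) (f≡ : ∀ t s → Coordinates.f fr t s ≡ A * (t * t) + B * (t * s) + D * (s * s) + E * t + G * s) where
    open Chart fr

    -- A shear along V absorbs the linear terms and the mixed term of f, leaving A t² + D s².
    a′ b′ e′ : Pt
    a′ = a ⊕ E · V
    b′ = b ⊕ G · V
    e′ = e ⊕ B · V

    -- Otherwise the C-points `X t 0#` of the block `π 0#` would be collinear.
    A≢0 : A ≢ 0#
    A≢0 A≡0 = not-three-on-line {π 0#} {c o} {a′} {X 0# 0#} {X 1# 0#} {X new 0#} 0# 1# new a′≢0
      (X∈π 0# 0#) (X∈π 1# 0#) (X∈π new 0#) (collinear 0#) (collinear 1#) (collinear new)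
      (λ eq → 1≢0 (sym (proj₁ (X-inj eq)))) (λ eq → new≢1 (sym (proj₁ (X-inj eq)))) (λ eq → new≢0 (sym (proj₁ (X-inj eq))))
      where
      third-element = avoid _≟_ (λ (x : K) → x) (λ eq → eq) 1 (0# ∷ 1# ∷ []) (k≤q (s≤s (s≤s (s≤s z≤n))))
      new = proj₁ third-element zero
      new≢0 : new ≢ 0#
      new≢0 = proj₂ (proj₂ third-element) zero (here refl)
      new≢1 : new ≢ 1#
      new≢1 = proj₂ (proj₂ third-element) zero (there (here refl))
      a′≢0 : a′ ≢ 0v
      a′≢0 eq = 1≢0 (proj₁ (ind 1# 0# 0# E (vsolve 1 4 (λ E a b e V → :1 :· a :⊕ :0 :· b :⊕ :0 :· e :⊕ E :· V :≈ :0v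
        givenᵛ (:1 ∙ᵛ a :⊕ E :· V :≈ :0v) ∷ []) refl E a b e V eq)))
      collinear : ∀ t → c (X t 0#) ≡ c o ⊕ t · a′
      collinear t = vsolve 7 6 (λ t A B D E G f o X a b e V → X :≈ o :⊕ t :· (a :⊕ E :· V) givenᵛ
        (:1 ∙ᵛ X :≈ o :⊕ (t :· a :⊕ :0 :· b :⊕ (t :* :0) :· e :⊕ f :· V)) ∷
        (V ∙ˢ f := A :* (t :* t) :+ B :* (t :* :0) :+ D :* (:0 :* :0) :+ E :* t :+ G :* :0) ∷
        ((t :* t) :· V ∙ˢ A := :0) ∷ []) refl t A B D E G (f t 0#) (c o) (c (X t 0#)) a b e V (X-eq t 0#) (f≡ t 0#) A≡0

    i = inv A A≢0
    β : K
    β = i * D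

    independent′ : Independent₄ a′ b′ e′ (A · V)
    independent′ x y z w eq =
      let x≡0 , y≡0 , z≡0 , w≡0 = ind x y z (x * E + y * G + z * B + w * A)
            (vsolve 8 4 (λ x y z w A B E G a b e V →
              x :· a :⊕ y :· b :⊕ z :· e :⊕ (x :* E :+ y :* G :+ z :* B :+ w :* A) :· V :≈ :0v givenᵛ
              (:1 ∙ᵛ x :· (a :⊕ E :· V) :⊕ y :· (b :⊕ G :· V) :⊕ z :· (e :⊕ B :· V) :⊕ w :· A :· V :≈ :0v) ∷ [])
              refl x y z w A B E G a b e V eq)
      in x≡0 , y≡0 , z≡0 , cancel A≢0 (solve 8 (λ x y z w A B E G → A :* w := :0
        given (:1 ∙ x :* E :+ y :* G :+ z :* B :+ w :* A := :0) ∷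
           (:- E ∙ x := :0) ∷ (:- G ∙ y := :0) ∷ (:- B ∙ z := :0) ∷ []) refl x y z w A B E G w≡0 x≡0 y≡0 z≡0)

    X-eq′ : ∀ t s → c (X t s) ≡ c o ⊕ comb a′ b′ e′ (A · V) t s (t * s) (t * t + β * (s * s))
    X-eq′ t s = vsolve 9 6 (λ t s A B D E G i f o X a b e V →
      X :≈ o :⊕ (t :· (a :⊕ E :· V) :⊕ s :· (b :⊕ G :· V) :⊕ (t :* s) :· (e :⊕ B :· V) :⊕ (t :* t :+ i :* D :* (s :* s)) :· A :· V) givenᵛ
      (:1 ∙ᵛ X :≈ o :⊕ (t :· a :⊕ s :· b :⊕ (t :* s) :· e :⊕ f :· V)) ∷
      (V ∙ˢ f := A :* (t :* t) :+ B :* (t :* s) :+ D :* (s :* s) :+ E :* t :+ G :* s) ∷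
      (:- (D :* (s :* s)) :· V ∙ˢ A :* i := :1) ∷ [])
      refl t s A B D E G i (f t s) (c o) (c (X t s)) a b e V (X-eq t s) (f≡ t s) (x*inv≡1 A A≢0)

    X-diff′ : ∀ t s → c (X t s) ⊖ c o ≡ comb a′ b′ e′ (A · V) t s (t * s) (t * t + β * (s * s))
    X-diff′ t s = vsolve 0 3 (λ x o d → x :⊖ o :≈ d givenᵛ
      (:1 ∙ᵛ x :≈ o :⊕ d) ∷ []) refl (c (X t s)) (c o) (comb a′ b′ e′ (A · V) t s (t * s) (t * t + β * (s * s))) (X-eq′ t s)

    -- The C-points of a block of slope μ through `c o` are `c o` + t d₁ + t² d₂, so d₁ and d₂ span
    -- its directions.
    d₁ d₂ : K → Pt
    d₁ μ = a′ ⊕ μ · b′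
    d₂ μ = μ · e′ ⊕ (1# + β * (μ * μ)) · (A · V)

    d₁-d₂-independent : ∀ μ → μ ≢ 0# → Independent (d₁ μ) (d₂ μ)
    d₁-d₂-independent μ μ≢0 x y eq =
      let x≡0 , _ , yμ≡0 , _ = independent′ x (x * μ) (y * μ) (y * (1# + β * (μ * μ)))
            (vsolve 4 4 (λ x y μ β a b e V →
              x :· a :⊕ (x :* μ) :· b :⊕ (y :* μ) :· e :⊕ (y :* (:1 :+ β :* (μ :* μ))) :· V :≈ :0v givenᵛ
              (:1 ∙ᵛ x :· (a :⊕ μ :· b) :⊕ y :· (μ :· e :⊕ (:1 :+ β :* (μ :* μ)) :· V) :≈ :0v) ∷ [])
              refl x y μ β a′ b′ e′ (A · V) eq)
      in x≡0 , cancel μ≢0 (trans (*-comm μ y) yμ≡0)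

    module _ {ρ} (o∈ : c o ∈ ρ) (s : Slope ρ) where
      open Slope s
      half = inv 2# 2≢0
      private
        diff : ∀ t → Dir ρ (c (X t (μ * t)) ⊖ c o)
        diff t = difference {ρ} o∈ (on t)

      -- The secants to the points t = 1 and t = - 1 are d₂ + d₁ and d₂ - d₁; since 2 is invertible,
      -- d₁ and d₂ can be recovered from them.
      Dir-d₁ : Dir ρ (d₁ μ)
      Dir-d₁ = subst (Dir ρ) (vsolve 3 6 (λ h μ β P N a b e V →
        h :· P :⊕ :- h :· N :≈ a :⊕ μ :· b givenᵛ
        (h ∙ᵛ P :≈ :1 :· a :⊕ (μ :* :1) :· b :⊕ (:1 :* (μ :* :1)) :· e :⊕ (:1 :* :1 :+ β :* (μ :* :1 :* (μ :* :1))) :· V) ∷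
        (:- h ∙ᵛ N :≈ :- :1 :· a :⊕ (μ :* :- :1) :· b :⊕ (:- :1 :* (μ :* :- :1)) :· e :⊕ (:- :1 :* :- :1 :+ β :* (μ :* :- :1 :* (μ :* :- :1))) :· V) ∷
        (a :⊕ μ :· b ∙ˢ (:1 :+ :1) :* h := :1) ∷ [])
        refl half μ β (c (X 1# (μ * 1#)) ⊖ c o) (c (X (- 1#) (μ * - 1#)) ⊖ c o) a′ b′ e′ (A · V) (X-diff′ 1# _) (X-diff′ (- 1#) _) (x*inv≡1 2# 2≢0)) (Dir-lin {ρ} half (- half) (diff 1#) (diff (- 1#)))

      Dir-d₂ : Dir ρ (d₂ μ)
      Dir-d₂ = subst (Dir ρ) (vsolve 3 6 (λ h μ β P N a b e V →
        h :· P :⊕ h :· N :≈ μ :· e :⊕ (:1 :+ β :* (μ :* μ)) :· V givenᵛ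
        (h ∙ᵛ P :≈ :1 :· a :⊕ (μ :* :1) :· b :⊕ (:1 :* (μ :* :1)) :· e :⊕ (:1 :* :1 :+ β :* (μ :* :1 :* (μ :* :1))) :· V) ∷
        (h ∙ᵛ N :≈ :- :1 :· a :⊕ (μ :* :- :1) :· b :⊕ (:- :1 :* (μ :* :- :1)) :· e :⊕ (:- :1 :* :- :1 :+ β :* (μ :* :- :1 :* (μ :* :- :1))) :· V) ∷
        (μ :· e :⊕ (:1 :+ β :* (μ :* μ)) :· V ∙ˢ (:1 :+ :1) :* h := :1) ∷ [])
        refl half μ β (c (X 1# (μ * 1#)) ⊖ c o) (c (X (- 1#) (μ * - 1#)) ⊖ c o) a′ b′ e′ (A · V) (X-diff′ 1# _) (X-diff′ (- 1#) _) (x*inv≡1 2# 2≢0)) (Dir-lin {ρ} half half (diff 1#) (diff (- 1#)))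

      in-basis : ∀ {w} → Dir ρ w → Span (d₁ μ) (d₂ μ) w
      in-basis = basis₂ {ρ} (d₁-d₂-independent μ μ≢0) Dir-d₁ Dir-d₂

    -- A block of slope μ and its neighbour of slope μ′ have the axis direction V′ in common. As μ
    -- and μ′ differ, V′ has no d₁ part. The d₂ parts give yμ = y′μ′ and y(1 + βμ²) = y′(1 + βμ′²),
    -- hence βμμ′ = 1.
    conjugate : ∀ {μ} → μ ≢ 0# → ∃[ μ′ ] (μ′ ≢ μ × β * (μ * μ′) ≡ 1#)
    conjugate {μ} μ≢0 = μ′ , (λ eq → slopes-apart {ρ} {S.ρ′} (i∈ ρ) S.N.i∈σ (S.N.≉B ∘ ≐-sym) S.s S.s′ (trans (sym μ≡) (sym eq))) ,
      go (in-basis {ρ} (i∈ ρ) S.s S.V′∈) (in-basis {S.ρ′} S.N.i∈σ S.s′ S.N.V∈σ)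
      where
      o≢X : o ≢ X 1# μ
      o≢X eq = off-σ {1#} {μ} 1≢0 (subst (λ i → c i ∈ σ 0#) eq o∈σ)
      ρ : Block
      ρ = join o (X 1# μ) o≢X
      V∉ : ¬ Dir ρ V
      V∉ V∈ρ = [ (λ eq → off-π {1#} {μ} μ≢0 (proj₁ (eq _) (j∈ ρ))) , (λ eq → off-σ {1#} {μ} 1≢0 (proj₁ (eq _) (j∈ ρ))) ]′ (through-V (i∈ ρ) V∈ρ)
      module S = Second (i∈ ρ) V∉
      μ′ = Slope.μ S.s′
      μ≡ : μ ≡ Slope.μ S.s
      μ≡ = trans (Slope.proportional S.s 1# μ (1# * μ) (f 1# μ) (subst (Dir ρ) (X-diff 1# μ) (difference {ρ} (i∈ ρ) (j∈ ρ)))) (*-identityʳ _)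
      go : Span (d₁ (Slope.μ S.s)) (d₂ (Slope.μ S.s)) S.V′ → Span (d₁ μ′) (d₂ μ′) S.V′ → β * (μ * μ′) ≡ 1#
      go (x , y , eV) (x′ , y′ , eV′) = trans (cong (λ μ → β * (μ * μ′)) μ≡)
        (sym (x-y≡0⇒x≡y _ _ (cancel y≢0 (cancel μ-μ′≢0
          (solve 5 (λ y y' ν μ' β → (ν :+ :- μ') :* (y :* (:1 :+ :- (β :* (ν :* μ')))) := :0 given
            (:1 :+ β :* μ' :* μ' ∙ y :* ν := y' :* μ') ∷
            (:- μ' ∙ y :* (:1 :+ β :* (ν :* ν)) := y' :* (:1 :+ β :* (μ' :* μ'))) ∷ []) refl y y′ ν μ′ β z≡ w≡)))))
        where
        ν = Slope.μ S.s
        μ-μ′≢0 : ν + - μ′ ≢ 0#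
        μ-μ′≢0 = x≢y⇒x-y≢0 (slopes-apart {ρ} {S.ρ′} (i∈ ρ) S.N.i∈σ (S.N.≉B ∘ ≐-sym) S.s S.s′)
        eqs = comb-inj independent′ {x} {x * ν} {y * ν} {y * (1# + β * (ν * ν))} {x′} {x′ * μ′} {y′ * μ′} {y′ * (1# + β * (μ′ * μ′))}
          (vsolve 7 5 (λ x y x' y' ν μ' β a b e W V' →
            x :· a :⊕ (x :* ν) :· b :⊕ (y :* ν) :· e :⊕ (y :* (:1 :+ β :* (ν :* ν))) :· W :≈ x' :· a :⊕ (x' :* μ') :· b :⊕ (y' :* μ') :· e :⊕ (y' :* (:1 :+ β :* (μ' :* μ'))) :· W givenᵛ
            (:- :1 ∙ᵛ V' :≈ x :· (a :⊕ ν :· b) :⊕ y :· (ν :· e :⊕ (:1 :+ β :* (ν :* ν)) :· W)) ∷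
            (:1 ∙ᵛ V' :≈ x' :· (a :⊕ μ' :· b) :⊕ y' :· (μ' :· e :⊕ (:1 :+ β :* (μ' :* μ')) :· W)) ∷ [])
            refl x y x′ y′ ν μ′ β a′ b′ e′ (A · V) S.V′ eV eV′)
        z≡ = proj₁ (proj₂ (proj₂ eqs))
        w≡ = proj₂ (proj₂ (proj₂ eqs))
        x≡0 : x ≡ 0#
        x≡0 = cancel μ-μ′≢0 (solve 4 (λ x x' ν μ' → (ν :+ :- μ') :* x := :0 given
          (:1 ∙ x :* ν := x' :* μ') ∷ (:- μ' ∙ x := x') ∷ []) refl x x′ ν μ′ (proj₁ (proj₂ eqs)) (proj₁ eqs))
        y≢0 : y ≢ 0#
        y≢0 y≡0 = S.V′≢0 (vsolve 2 3 (λ x y V' p r → V' :≈ :0v givenᵛ (:1 ∙ᵛ V' :≈ x :· p :⊕ y :· r) ∷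
          (p ∙ˢ x := :0) ∷ (r ∙ˢ y := :0) ∷ []) refl x y S.V′ (d₁ ν) (d₂ ν) eV x≡0 y≡0)

    -- If κ² = β ≢ 0, the slope 1/κ would be its own conjugate; if β = 0, there would be no
    -- conjugates at all.
    nonsquare : ∀ κ → κ * κ ≢ β
    nonsquare κ κ²≡β = case κ ≟ 0# of λ where
        (yes κ≡0) → zero-root κ≡0 (conjugate 1≢0)
        (no κ≢0) → nonzero-root κ≢0 (conjugate (inv≢0 κ κ≢0))
      where
      zero-root : κ ≡ 0# → (∃[ μ′ ] (μ′ ≢ 1# × β * (1# * μ′) ≡ 1#)) → ⊥
      zero-root κ≡0 (μ′ , _ , eq) = 1≢0 (solve 3 (λ β κ μ' → :1 := :0 given (:- :1 ∙ β :* (:1 :* μ') := :1) ∷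
        (:- μ' ∙ κ :* κ := β) ∷
        (κ :* μ' ∙ κ := :0) ∷ []) refl β κ μ′ eq κ²≡β κ≡0)
      nonzero-root : ∀ κ≢0 → (∃[ μ′ ] (μ′ ≢ inv κ κ≢0 × β * (inv κ κ≢0 * μ′) ≡ 1#)) → ⊥
      nonzero-root κ≢0 (μ′ , ≢ν , eq) = ≢ν (solve 4 (λ β κ ν μ' → μ' := ν given
        (ν ∙ β :* (ν :* μ') := :1) ∷ (ν :* ν :* μ' ∙ κ :* κ := β) ∷ (:- (μ' :* (κ :* ν :+ :1)) ∙ κ :* ν := :1) ∷ [])
        refl β κ (inv κ κ≢0) μ′ eq κ²≡β (x*inv≡1 κ κ≢0))

    form : NormalForm F 𝒞
    form = record
      { origin = c o ; e₁ = a′ ; e₂ = b′ ; e₃ = e′ ; e₄ = A · V ; β = β ; independent = independent′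
      ; point∈ = λ x y → subst 𝒞 (X-eq′ x y) (c∈𝒞 _)
      ; onto = λ p∈ → found (toIsC p∈)
      ; nonsquare = nonsquare }
      where
      found : ∀ {p} → IsC p → ∃[ x ] ∃[ y ] p ≡ c o ⊕ comb a′ b′ e′ (A · V) x y (x * y) (x * x + β * (y * y))
      found (i , refl) = let t , s , eq = X-onto i in t , s , trans (cong c (sym eq)) (X-eq′ t s)

  normalForm : 2# ≢ 0# → NormalForm F 𝒞
  normalForm 2≢0 = let A , B , D , E , G , f≡ = quadratic fr (i∈ ρ) V∉ in Normalise.form 2≢0 fr A B D E G f≡
    where
    2≤q² : 2 ≤ q *ℕ q
    2≤q² = ℕ.≤-trans (k≤q (s≤s (s≤s z≤n))) (ℕ.m≤m*n q q)
    two : Fin 2 → I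
    two k = inject≤ k 2≤q²
    apart : two zero ≢ two (suc zero)
    apart eq = case inject≤-injective 2≤q² 2≤q² zero (suc zero) eq of λ ()
    B₀ : Block
    B₀ = join (two zero) (two (suc zero)) apart
    fr : Coordinates (two zero) (proj₁ (axis B₀))
    fr = Parametrise.paraboloid (proj₂ (axis B₀)) (i∈ B₀)
    open Chart fr
    o≢X : two zero ≢ X 1# 1#
    o≢X eq = off-σ {1#} {1#} 1≢0 (subst (λ i → c i ∈ σ 0#) eq o∈σ)
    ρ : Block
    ρ = join (two zero) (X 1# 1#) o≢X
    V∉ : ¬ Dir ρ (proj₁ (axis B₀))
    V∉ V∈ρ = [ (λ eq → off-π {1#} {1#} 1≢0 (proj₁ (eq _) (j∈ ρ))) , (λ eq → off-σ {1#} {1#} 1≢0 (proj₁ (eq _) (j∈ ρ))) ]′ (through-V (i∈ ρ) V∈ρ)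

-- The quadratic extension of the field

record QuadraticExtension {n} (F : FiniteField n) (β : Fin n) : Set where
  open FiniteField F
  field
    L : FiniteField (n *ℕ n)
  module L = FiniteField L
  field
    ι     : Fin n → Fin (n *ℕ n)
    ι-+   : ∀ x y → ι (x + y) ≡ ι x L.+ ι y
    ι-*   : ∀ x y → ι (x * y) ≡ ι x L.* ι y
    ι-neg : ∀ x → ι (- x) ≡ L.- ι x
    ι-1   : ι 1# ≡ L.1#
    θ     : Fin (n *ℕ n)
    θ²    : θ L.* θ ≡ ι β
    split : ∀ z → ∃[ x ] ∃[ y ] z ≡ ι x L.+ ι y L.* θ
    free  : ∀ x y → ι x L.+ ι y L.* θ ≡ L.0# → x ≡ 0# × y ≡ 0#

module Construction {n} (F : FiniteField n) (β : Fin n)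
  (nonsquare : ∀ κ → FiniteField._*_ F κ κ ≢ β) where
  open FiniteField F
  open FieldLemmas F

  private
    K² : Set
    K² = Fin n × Fin n

    _+²_ _*²_ : K² → K² → K²
    (x , y) +² (x′ , y′) = x + x′ , y + y′
    (x , y) *² (x′ , y′) = x * x′ + β * (y * y′) , x * y′ + y * x′

    -²_ : K² → K²
    -² (x , y) = - x , - y

    isCommutativeRing² : IsCommutativeRing _≡_ _+²_ _*²_ -²_ (0# , 0#) (1# , 0#)
    isCommutativeRing² = record
      { isRing = record
        { +-isAbelianGroup = record
          { isGroup = record
            { isMonoid = record
              { isSemigroup = record
                { isMagma = record { isEquivalence = isEquivalence ; ∙-cong = cong₂ _+²_ }
                ; assoc = λ (x , y) (z , w) (u , v) → cong₂ _,_ (+-assoc x z u) (+-assoc y w v) }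
              ; identity = (λ (x , y) → cong₂ _,_ (+-identityˡ x) (+-identityˡ y)) ,
                           (λ (x , y) → cong₂ _,_ (+-identityʳ x) (+-identityʳ y)) }
            ; inverse = (λ (x , y) → cong₂ _,_ (+-inverseˡ x) (+-inverseˡ y)) ,
                        (λ (x , y) → cong₂ _,_ (+-inverseʳ x) (+-inverseʳ y))
            ; ⁻¹-cong = cong -²_ }
          ; comm = λ (x , y) (z , w) → cong₂ _,_ (+-comm x z) (+-comm y w) }
        ; *-cong = cong₂ _*²_
        ; *-assoc = λ (x , y) (z , w) (u , v) → cong₂ _,_
            (solve 7 (λ β x y z w u v →
              (x :* z :+ β :* (y :* w)) :* u :+ β :* ((x :* w :+ y :* z) :* v) := x :* (z :* u :+ β :* (w :* v)) :+ β :* (y :* (z :* v :+ w :* u)) given []) refl β x y z w u v)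
            (solve 7 (λ β x y z w u v →
              (x :* z :+ β :* (y :* w)) :* v :+ (x :* w :+ y :* z) :* u := x :* (z :* v :+ w :* u) :+ y :* (z :* u :+ β :* (w :* v)) given []) refl β x y z w u v)
        ; *-identity = (λ (x , y) → cong₂ _,_ (solve 3 (λ β x y → :1 :* x :+ β :* (:0 :* y) := x given [])
          refl β x y) (solve 2 (λ x y → :1 :* y :+ :0 :* x := y given []) refl x y)) ,
                       (λ (x , y) → cong₂ _,_ (solve 3 (λ β x y → x :* :1 :+ β :* (y :* :0) := x given [])
                         refl β x y) (solve 2 (λ x y → x :* :0 :+ y :* :1 := y given []) refl x y))
        ; distrib = (λ (x , y) (z , w) (u , v) → cong₂ _,_
              (solve 7 (λ β x y z w u v →
                x :* (z :+ u) :+ β :* (y :* (w :+ v)) := x :* z :+ β :* (y :* w) :+ (x :* u :+ β :* (y :* v)) given [])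
                refl β x y z w u v)
              (solve 6 (λ x y z w u v → x :* (w :+ v) :+ y :* (z :+ u) := x :* w :+ y :* z :+ (x :* v :+ y :* u) given [])
                refl x y z w u v)) ,
            (λ (x , y) (z , w) (u , v) → cong₂ _,_
              (solve 7 (λ β x y z w u v →
                (z :+ u) :* x :+ β :* ((w :+ v) :* y) := z :* x :+ β :* (w :* y) :+ (u :* x :+ β :* (v :* y)) given [])
                refl β x y z w u v)
              (solve 6 (λ x y z w u v → (z :+ u) :* y :+ (w :+ v) :* x := z :* y :+ w :* x :+ (u :* y :+ v :* x) given [])
                refl x y z w u v)) }
      ; *-comm = λ (x , y) (z , w) → cong₂ _,_
          (solve 5 (λ β x y z w → x :* z :+ β :* (y :* w) := z :* x :+ β :* (w :* y) given [])
            refl β x y z w) (solve 4 (λ x y z w → x :* w :+ y :* z := z :* y :+ w :* x given []) refl x y z w) }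

    -- A zero of x² - βy² with y ≢ 0 would make β the square of x/y.
    norm≢0 : ∀ x y → (x , y) ≢ (0# , 0#) → x * x + - (β * (y * y)) ≢ 0#
    norm≢0 x y ≢0 eq with y ≟ 0#
    ... | no y≢0 = nonsquare (x * inv y y≢0) (solve 4 (λ β x y i → x :* i :* (x :* i) := β given
      (i :* i ∙ x :* x :+ :- (β :* (y :* y)) := :0) ∷ (β :* (y :* i :+ :1) ∙ y :* i := :1) ∷ [])
      refl β x y (inv y y≢0) eq (x*inv≡1 y y≢0))
    ... | yes refl with x ≟ 0#
    ...   | yes refl = ≢0 refl
    ...   | no x≢0 = *-nonzero x≢0 x≢0 (solve 2 (λ β x → x :* x := :0 given (:1 ∙ x :* x :+ :- (β :* (:0 :* :0)) := :0) ∷ [])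
      refl β x eq)

    inverse² : ∀ z → z ≢ (0# , 0#) → ∃[ w ] z *² w ≡ (1# , 0#)
    inverse² (x , y) ≢0 = (x * i , - (y * i)) , cong₂ _,_
        (solve 4 (λ β x y i → x :* (x :* i) :+ β :* (y :* :- (y :* i)) := :1
          given (:1 ∙ (x :* x :+ :- (β :* (y :* y))) :* i := :1) ∷ []) refl β x y i (x*inv≡1 _ (norm≢0 x y ≢0)))
        (solve 3 (λ x y i → x :* :- (y :* i) :+ y :* (x :* i) := :0 given []) refl x y i)
      where i = inv _ (norm≢0 x y ≢0)

    enc : K² → Fin (n *ℕ n)
    enc (x , y) = combine x y

    dec : Fin (n *ℕ n) → K²
    dec = remQuot {n} n

    dec-enc : ∀ z → dec (enc z) ≡ z
    dec-enc (x , y) = remQuot-combine x y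

    enc-dec : ∀ z → enc (dec z) ≡ z
    enc-dec z = combine-remQuot {n} n z

    dec-inj : ∀ {z w} → dec z ≡ dec w → z ≡ w
    dec-inj {z} {w} eq = trans (sym (enc-dec z)) (trans (cong enc eq) (enc-dec w))

    raw : RawRing _ _
    raw = record
      { Carrier = Fin (n *ℕ n) ; _≈_ = _≡_ ; _+_ = λ z w → enc (dec z +² dec w) ; _*_ = λ z w → enc (dec z *² dec w)
      ; -_ = λ z → enc (-² dec z) ; 0# = enc (0# , 0#) ; 1# = enc (1# , 0#) }

    raw² : RawRing _ _
    raw² = record { Carrier = K² ; _≈_ = _≡_ ; _+_ = _+²_ ; _*_ = _*²_ ; -_ = -²_ ; 0# = 0# , 0# ; 1# = 1# , 0# }

    -- `FiniteField` fixes the carrier, so the ring laws proved for pairs are pulled back along the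
    -- decoding.
    isRingMonomorphism : IsRingMonomorphism raw raw² dec
    isRingMonomorphism = record
      { isRingHomomorphism = record
        { isSemiringHomomorphism = record
          { isNearSemiringHomomorphism = record
            { +-isMonoidHomomorphism = record
              { isMagmaHomomorphism = record { isRelHomomorphism = record { cong = cong dec } ; homo = λ z w → dec-enc _ }
              ; ε-homo = dec-enc _ }
            ; *-homo = λ z w → dec-enc _ }
          ; 1#-homo = dec-enc _ }
        ; -‿homo = λ z → dec-enc _ }
      ; injective = dec-inj }

  opaque
    quadraticExtension : QuadraticExtension F β
    quadraticExtension = record
      { L = record
        { _+_ = λ z w → enc (dec z +² dec w) ; _*_ = λ z w → enc (dec z *² dec w)
        ; -_ = λ z → enc (-² dec z) ; 0# = enc (0# , 0#) ; 1# = enc (1# , 0#)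
        ; isCommutativeRing = RingMonomorphism.isCommutativeRing isRingMonomorphism isCommutativeRing²
        ; 0≢1 = λ eq → 0≢1 (cong proj₁ (trans (sym (dec-enc _)) (trans (cong dec eq) (dec-enc _))))
        ; inverse = λ z z≢0 → let w , eq = inverse² (dec z) (λ e → z≢0 (trans (sym (enc-dec z)) (cong enc e)))
            in enc w , cong enc (trans (cong (dec z *²_) (dec-enc w)) eq) }
      ; ι = λ x → enc (x , 0#)
      ; ι-+ = λ x y → cong enc (trans (cong (x + y ,_) (sym (+-identityʳ 0#))) (sym (cong₂ _+²_ (dec-enc (x , 0#)) (dec-enc (y , 0#)))))
      ; ι-* = λ x y → cong enc (trans (cong₂ _,_ (solve 3 (λ β x y → x :* y := x :* y :+ β :* (:0 :* :0) given [])
        refl β x y) (solve 2 (λ x y → :0 := x :* :0 :+ :0 :* y given []) refl x y))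
          (sym (cong₂ _*²_ (dec-enc (x , 0#)) (dec-enc (y , 0#)))))
      ; ι-neg = λ x → cong enc (trans (cong (- x ,_) (sym -0#≈0#)) (sym (cong -²_ (dec-enc (x , 0#)))))
      ; ι-1 = refl
      ; θ = enc (0# , 1#)
      ; θ² = cong enc (trans (cong₂ _*²_ (dec-enc (0# , 1#)) (dec-enc (0# , 1#)))
          (cong₂ _,_ (solve 1 (λ β → :0 :* :0 :+ β :* (:1 :* :1) := β given []) refl β) (solve 0 (:0 :* :1 :+ :1 :* :0 := :0
            given []) refl)))
      ; split = λ z → proj₁ (dec z) , proj₂ (dec z) , trans (sym (enc-dec z)) (cong enc (sym (value (proj₁ (dec z)) (proj₂ (dec z)))))
      ; free = λ x y eq → let e = trans (sym (value x y)) (trans (sym (dec-enc _)) (trans (cong dec eq) (dec-enc _)))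
          in cong proj₁ e , cong proj₂ e }
      where
      value : ∀ x y → dec (enc (x , 0#)) +² dec (enc (dec (enc (y , 0#)) *² dec (enc (0# , 1#)))) ≡ (x , y)
      value x y = trans (cong₂ _+²_ (dec-enc (x , 0#)) (trans (dec-enc _) (cong₂ _*²_ (dec-enc (y , 0#)) (dec-enc (0# , 1#)))))
        (cong₂ _,_ (solve 3 (λ β x y → x :+ (y :* :0 :+ β :* (:0 :* :1)) := x given []) refl β x y) (solve 1 (λ y →
          :0 :+ (y :* :1 :+ :0 :* :0) := y given []) refl y))

-- K⁴ as the plane L², with 𝒞 the parabola Y = X² about O
record LinearModel {n} (F : FiniteField n) {β : Fin n} (E : QuadraticExtension F β) (𝒞 : Subset (Geometry.Pt F)) : Set where
  open FiniteField F using (-_; 1#)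
  open Vectors F using (_⊖_)
  open Geometry F
  open QuadraticExtension E
  field
    X Y     : Pt → Fin (n *ℕ n)
    X-⊕     : ∀ u v → X (u ⊕ v) ≡ X u L.+ X v
    X-·     : ∀ a v → X (a · v) ≡ ι a L.* X v
    Y-⊕     : ∀ u v → Y (u ⊕ v) ≡ Y u L.+ Y v
    Y-·     : ∀ a v → Y (a · v) ≡ ι a L.* Y v
    ext     : ∀ {u v} → X u ≡ X v → Y u ≡ Y v → u ≡ v
    vec     : Fin (n *ℕ n) → Fin (n *ℕ n) → Pt
    X-vec   : ∀ x y → X (vec x y) ≡ x
    Y-vec   : ∀ x y → Y (vec x y) ≡ y
    O       : Pt
    on-𝒞    : ∀ x → 𝒞 (O ⊕ vec x (x L.* x))
    𝒞⇒Y≡X²  : ∀ {p} → 𝒞 p → Y (p ⊖ O) ≡ X (p ⊖ O) L.* X (p ⊖ O)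

module Linearise {n} (F : FiniteField n) {𝒞 : Subset (Geometry.Pt F)} (nf : NormalForm F 𝒞)
  (2≢0 : FieldLemmas.2# F ≢ FiniteField.0# F) (E : QuadraticExtension F (NormalForm.β nf)) where
  open FiniteField F
  open FieldLemmas F
  open Vectors F
  open Geometry F
  open NormalForm nf
  open QuadraticExtension E
  open L using () renaming (_+_ to infixl 6 _+ᴸ_; _*_ to infixl 7 _*ᴸ_; -_ to infix 8 -ᴸ_; 0# to 0ᴸ)
  private
    module SL = Solve L
    module RL = RingLaws L

    e : K → K → K → K → Pt
    e = comb e₁ e₂ e₃ e₄

    z⟨_,_⟩ : K → K → Fin (n *ℕ n)
    z⟨ x , y ⟩ = ι x +ᴸ ι y *ᴸ θ

    z-inj : ∀ {x y x′ y′} → z⟨ x , y ⟩ ≡ z⟨ x′ , y′ ⟩ → x ≡ x′ × y ≡ y′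
    z-inj {x} {y} {x′} {y′} eq =
      let p , r = free (x + - x′) (y + - y′) (trans (cong₂ _+ᴸ_ (trans (ι-+ x (- x′)) (cong (ι x +ᴸ_) (ι-neg x′)))
                    (cong (_*ᴸ θ) (trans (ι-+ y (- y′)) (cong (ι y +ᴸ_) (ι-neg y′)))))
                    (SL.solve 5 (λ x y x' y' θ → x :+ :- x' :+ (y :+ :- y') :* θ := :0
                      given (:1 ∙ x :+ y :* θ := x' :+ y' :* θ) ∷ []) refl (ι x) (ι y) (ι x′) (ι y′) θ eq))
      in x-y≡0⇒x≡y _ _ p , x-y≡0⇒x≡y _ _ r

    z-+ : ∀ x y x′ y′ → z⟨ x + x′ , y + y′ ⟩ ≡ z⟨ x , y ⟩ +ᴸ z⟨ x′ , y′ ⟩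
    z-+ x y x′ y′ = trans (cong₂ (λ s t → s +ᴸ t *ᴸ θ) (ι-+ x x′) (ι-+ y y′))
      (SL.solve 5 (λ x y x' y' θ → x :+ x' :+ (y :+ y') :* θ := x :+ y :* θ :+ (x' :+ y' :* θ) given [])
        refl (ι x) (ι y) (ι x′) (ι y′) θ)

    z-· : ∀ a x y → z⟨ a * x , a * y ⟩ ≡ ι a *ᴸ z⟨ x , y ⟩
    z-· a x y = trans (cong₂ (λ s t → s +ᴸ t *ᴸ θ) (ι-* a x) (ι-* a y))
      (SL.solve 4 (λ a x y θ → a :* x :+ a :* y :* θ := a :* (x :+ y :* θ) given []) refl (ι a) (ι x) (ι y) θ)

    square : ∀ x y → z⟨ x * x + β * (y * y) , x * y + x * y ⟩ ≡ z⟨ x , y ⟩ *ᴸ z⟨ x , y ⟩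
    square x y = trans (cong₂ (λ s t → s +ᴸ t *ᴸ θ)
        (trans (ι-+ _ _) (cong₂ _+ᴸ_ (ι-* x x) (trans (ι-* β _) (cong (ι β *ᴸ_) (ι-* y y)))))
        (trans (ι-+ _ _) (cong₂ _+ᴸ_ (ι-* x y) (ι-* x y))))
      (SL.solve 4 (λ x y β θ → x :* x :+ β :* (y :* y) :+ (x :* y :+ x :* y) :* θ := (x :+ y :* θ) :* (x :+ y :* θ)
        given (:- (y :* y) ∙ θ :* θ := β) ∷ []) refl (ι x) (ι y) (ι β) θ θ²)

    opaque
      co : ∀ p → ∃[ x ] ∃[ y ] ∃[ z ] ∃[ w ] p ≡ e x y z w
      co = coordinates independent

    -- The third coordinate is doubled because it is xy on 𝒞, while the θ-part of X² is 2xy.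
    X′ Y′ : Pt → Fin (n *ℕ n)
    X′ p = let x , y , z , w , _ = co p in z⟨ x , y ⟩
    Y′ p = let x , y , z , w , _ = co p in z⟨ w , z + z ⟩

    co-eq : ∀ p → p ≡ e (proj₁ (co p)) (proj₁ (proj₂ (co p))) (proj₁ (proj₂ (proj₂ (co p)))) (proj₁ (proj₂ (proj₂ (proj₂ (co p)))))
    co-eq p = proj₂ (proj₂ (proj₂ (proj₂ (co p))))

    X-e : ∀ {p} x y z w → p ≡ e x y z w → X′ p ≡ z⟨ x , y ⟩
    X-e {p} x y z w eq = let p , r , _ = comb-inj independent (trans (sym (co-eq p)) eq) in cong₂ z⟨_,_⟩ p r

    Y-e : ∀ {p} x y z w → p ≡ e x y z w → Y′ p ≡ z⟨ w , z + z ⟩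
    Y-e {p} x y z w eq = let _ , _ , p , r = comb-inj independent (trans (sym (co-eq p)) eq) in cong₂ z⟨_,_⟩ r (cong₂ _+_ p p)

    e-⊕ : ∀ x y z w x′ y′ z′ w′ → e x y z w ⊕ e x′ y′ z′ w′ ≡ e (x + x′) (y + y′) (z + z′) (w + w′)
    e-⊕ x y z w x′ y′ z′ w′ = vsolve 8 4 (λ x y z w x' y' z' w' a b e d →
      x :· a :⊕ y :· b :⊕ z :· e :⊕ w :· d :⊕ (x' :· a :⊕ y' :· b :⊕ z' :· e :⊕ w' :· d) :≈ (x :+ x') :· a :⊕ (y :+ y') :· b :⊕ (z :+ z') :· e :⊕ (w :+ w') :· d givenᵛ []) refl x y z w x′ y′ z′ w′ e₁ e₂ e₃ e₄

    e-· : ∀ k x y z w → k · e x y z w ≡ e (k * x) (k * y) (k * z) (k * w)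
    e-· k x y z w = vsolve 5 4 (λ k x y z w a b e d →
      k :· (x :· a :⊕ y :· b :⊕ z :· e :⊕ w :· d) :≈ (k :* x) :· a :⊕ (k :* y) :· b :⊕ (k :* z) :· e :⊕ (k :* w) :· d
      givenᵛ []) refl k x y z w e₁ e₂ e₃ e₄

    half : K
    half = inv 2# 2≢0

    half-double : ∀ z → half * z + half * z ≡ z
    half-double z = solve 2 (λ h z → h :* z :+ h :* z := z given (z ∙ (:1 :+ :1) :* h := :1) ∷ []) refl half z (x*inv≡1 2# 2≢0)

    double-inj : ∀ {z z′} → z + z ≡ z′ + z′ → z ≡ z′
    double-inj {z} {z′} eq = cancelˡ 2≢0 (solve 2 (λ z z' → (:1 :+ :1) :* z := (:1 :+ :1) :* z'
      given (:1 ∙ z :+ z := z' :+ z') ∷ []) refl z z′ eq)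

    vec′ : Fin (n *ℕ n) → Fin (n *ℕ n) → Pt
    vec′ s t = let x , y , _ = split s ; w , z , _ = split t in e x y (half * z) w

    ext′ : ∀ {u v} → X′ u ≡ X′ v → Y′ u ≡ Y′ v → u ≡ v
    ext′ {u} {v} ex ey =
      let x , y = z-inj ex ; w , z = z-inj ey
      in trans (co-eq u) (trans (same x y (double-inj z) w) (sym (co-eq v)))
      where
      same : ∀ {x y z w x′ y′ z′ w′} → x ≡ x′ → y ≡ y′ → z ≡ z′ → w ≡ w′ → e x y z w ≡ e x′ y′ z′ w′
      same refl refl refl refl = refl

    X-vec′ : ∀ s t → X′ (vec′ s t) ≡ s
    X-vec′ s t = trans (X-e _ _ _ _ refl) (sym (proj₂ (proj₂ (split s))))

    Y-vec′ : ∀ s t → Y′ (vec′ s t) ≡ t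
    Y-vec′ s t = trans (Y-e _ _ _ _ refl) (trans (cong z⟨ _ ,_⟩ (half-double _)) (sym (proj₂ (proj₂ (split t)))))

    parabola : K → K → Pt
    parabola x y = e x y (x * y) (x * x + β * (y * y))

    Y≡X² : ∀ x y → Y′ (parabola x y) ≡ X′ (parabola x y) *ᴸ X′ (parabola x y)
    Y≡X² x y = trans (Y-e _ _ _ _ refl) (trans (square x y) (sym (cong₂ _*ᴸ_ (X-e _ _ _ _ refl) (X-e _ _ _ _ refl))))

    vec-parabola : ∀ s → vec′ s (s *ᴸ s) ≡ parabola (proj₁ (split s)) (proj₁ (proj₂ (split s)))
    vec-parabola s = ext′ same (trans (Y-vec′ s (s *ᴸ s)) (trans (cong₂ _*ᴸ_ s≡ s≡) (sym (Y≡X² _ _))))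
      where
      s≡ : s ≡ X′ (parabola (proj₁ (split s)) (proj₁ (proj₂ (split s))))
      s≡ = trans (proj₂ (proj₂ (split s))) (sym (X-e _ _ _ _ refl))
      same = trans (X-vec′ s (s *ᴸ s)) s≡

    found : ∀ {p} → (∃[ x ] ∃[ y ] p ≡ point x y) → Y′ (p ⊖ origin) ≡ X′ (p ⊖ origin) *ᴸ X′ (p ⊖ origin)
    found {p} (x , y , eq) = subst (λ d → Y′ d ≡ X′ d *ᴸ X′ d)
      (vsolve 0 3 (λ p o d → d :≈ p :⊖ o givenᵛ (:- :1 ∙ᵛ p :≈ o :⊕ d) ∷ []) refl p origin (parabola x y) eq) (Y≡X² x y)

  opaque
    linearModel : LinearModel F E 𝒞
    linearModel = record
      { X = X′ ; Y = Y′
      ; X-⊕ = λ u v → trans (X-e _ _ _ _ (trans (cong₂ _⊕_ (co-eq u) (co-eq v)) (e-⊕ _ _ _ _ _ _ _ _))) (z-+ _ _ _ _)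
      ; X-· = λ a v → trans (X-e _ _ _ _ (trans (cong (a ·_) (co-eq v)) (e-· a _ _ _ _))) (z-· a _ _)
      ; Y-⊕ = λ u v → trans (Y-e _ _ _ _ (trans (cong₂ _⊕_ (co-eq u) (co-eq v)) (e-⊕ _ _ _ _ _ _ _ _)))
          (trans (cong (λ t → z⟨ w u + w v , t ⟩) (solve 2 (λ z z' → z :+ z' :+ (z :+ z') := z :+ z :+ (z' :+ z') given [])
            refl (proj₁ (proj₂ (proj₂ (co u)))) (proj₁ (proj₂ (proj₂ (co v)))))) (z-+ _ _ _ _))
      ; Y-· = λ a v → trans (Y-e _ _ _ _ (trans (cong (a ·_) (co-eq v)) (e-· a _ _ _ _)))
          (trans (cong (λ t → z⟨ a * w v , t ⟩) (sym (distribˡ a _ _))) (z-· a _ _))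
      ; ext = ext′ ; vec = vec′ ; X-vec = X-vec′ ; Y-vec = Y-vec′ ; O = origin
      ; on-𝒞 = λ s → subst (λ d → 𝒞 (origin ⊕ d)) (sym (vec-parabola s)) (point∈ _ _)
      ; 𝒞⇒Y≡X² = λ p∈ → found (onto p∈) }
      where
      w : Pt → K
      w p = proj₁ (proj₂ (proj₂ (proj₂ (co p))))

-- Lines and collinear points in PG(2,n)

module Projective {n} (L : FiniteField n) where
  open FiniteField L
  open FieldLemmas L
  open Plane L

  dot : V3 → V3 → Fin n
  dot (a ∷ b ∷ c ∷ []) (x ∷ y ∷ z ∷ []) = a * x + b * y + c * z

  Concurrent : V3 → V3 → V3 → V3 → Set
  Concurrent l u v w = dot l u ≡ 0# × dot l v ≡ 0# × dot l w ≡ 0#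

  ≢0v3 : ∀ a b c → a ∷ b ∷ c ∷ [] ≢ 0v3 → a ≢ 0# ⊎ b ≢ 0# ⊎ c ≢ 0#
  ≢0v3 a b c ≢0 with a ≟ 0# | b ≟ 0# | c ≟ 0#
  ... | no a≢0 | _ | _ = inj₁ a≢0
  ... | yes _ | no b≢0 | _ = inj₂ (inj₁ b≢0)
  ... | yes _ | yes _ | no c≢0 = inj₂ (inj₂ c≢0)
  ... | yes refl | yes refl | yes refl = ⊥-elim (≢0 refl)

  -- Combining the three equations with the cofactors of one column gives the determinant times a
  -- coordinate of `l`; the column is chosen so that this coordinate is nonzero.
  concurrent⇒Det≡0 : ∀ l u v w → l ≢ 0v3 → Concurrent l u v w → Det u v w ≡ 0#
  concurrent⇒Det≡0 (l₁ ∷ l₂ ∷ l₃ ∷ []) (a ∷ b ∷ c ∷ []) (d ∷ e ∷ f ∷ []) (g ∷ h ∷ i ∷ []) l≢0 (p , r , s)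
    with ≢0v3 l₁ l₂ l₃ l≢0
  ... | inj₁ l₁≢0 = cancel l₁≢0 (solve 12 (λ l₁ l₂ l₃ a b c d e f g h i →
    l₁ :* (a :* (e :* i :+ :- (f :* h)) :+ :- (b :* (d :* i :+ :- (f :* g))) :+ c :* (d :* h :+ :- (e :* g))) := :0 given
    (e :* i :- f :* h ∙ l₁ :* a :+ l₂ :* b :+ l₃ :* c := :0) ∷
    (:- (b :* i :- c :* h) ∙ l₁ :* d :+ l₂ :* e :+ l₃ :* f := :0) ∷
    (b :* f :- c :* e ∙ l₁ :* g :+ l₂ :* h :+ l₃ :* i := :0) ∷ []) refl l₁ l₂ l₃ a b c d e f g h i p r s)
  ... | inj₂ (inj₁ l₂≢0) = cancel l₂≢0 (solve 12 (λ l₁ l₂ l₃ a b c d e f g h i →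
    l₂ :* (a :* (e :* i :+ :- (f :* h)) :+ :- (b :* (d :* i :+ :- (f :* g))) :+ c :* (d :* h :+ :- (e :* g))) := :0 given
    (:- (d :* i :- f :* g) ∙ l₁ :* a :+ l₂ :* b :+ l₃ :* c := :0) ∷
    (a :* i :- c :* g ∙ l₁ :* d :+ l₂ :* e :+ l₃ :* f := :0) ∷
    (:- (a :* f :- c :* d) ∙ l₁ :* g :+ l₂ :* h :+ l₃ :* i := :0) ∷ []) refl l₁ l₂ l₃ a b c d e f g h i p r s)
  ... | inj₂ (inj₂ l₃≢0) = cancel l₃≢0 (solve 12 (λ l₁ l₂ l₃ a b c d e f g h i →
    l₃ :* (a :* (e :* i :+ :- (f :* h)) :+ :- (b :* (d :* i :+ :- (f :* g))) :+ c :* (d :* h :+ :- (e :* g))) := :0 given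
    (d :* h :- e :* g ∙ l₁ :* a :+ l₂ :* b :+ l₃ :* c := :0) ∷
    (:- (a :* h :- b :* g) ∙ l₁ :* d :+ l₂ :* e :+ l₃ :* f := :0) ∷
    (a :* e :- b :* d ∙ l₁ :* g :+ l₂ :* h :+ l₃ :* i := :0) ∷ []) refl l₁ l₂ l₃ a b c d e f g h i p r s)

  cross : V3 → V3 → V3
  cross (a ∷ b ∷ c ∷ []) (d ∷ e ∷ f ∷ []) = b * f + - (c * e) ∷ c * d + - (a * f) ∷ a * e + - (b * d) ∷ []

  zero? : ∀ (v : V3) → (v ≡ 0v3) ⊎ (v ≢ 0v3)
  zero? (a ∷ b ∷ c ∷ []) with a ≟ 0# | b ≟ 0# | c ≟ 0#
  ... | no a≢0 | _ | _ = inj₂ λ { refl → a≢0 refl }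
  ... | yes _ | no b≢0 | _ = inj₂ λ { refl → b≢0 refl }
  ... | yes _ | yes _ | no c≢0 = inj₂ λ { refl → c≢0 refl }
  ... | yes refl | yes refl | yes refl = inj₁ refl

  private
    components : ∀ {a b c : Fin n} → a ∷ b ∷ c ∷ [] ≡ 0v3 → a ≡ 0# × b ≡ 0# × c ≡ 0#
    components refl = refl , refl , refl

  -- Here `v` and `w` are multiples of `u`, so any line through `u` will do.
  perpendicular : ∀ u v w → u ≢ 0v3 → cross u v ≡ 0v3 → cross u w ≡ 0v3 → ∃[ l ] (l ≢ 0v3 × Concurrent l u v w)
  perpendicular (a ∷ b ∷ c ∷ []) (d ∷ e ∷ f ∷ []) (g ∷ h ∷ i ∷ []) u≢0 uv uw with components uv | components uw
  ... | v₁ , v₂ , v₃ | w₁ , w₂ , w₃ with ≢0v3 a b c u≢0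
  ...   | inj₁ a≢0 = b ∷ - a ∷ 0# ∷ [] , (λ eq → neg≢0 a≢0 (proj₁ (proj₂ (components eq)))) ,
    solve 3 (λ a b c → b :* a :+ :- a :* b :+ :0 :* c := :0 given []) refl a b c , solve 5 (λ a b d e f →
      b :* d :+ :- a :* e :+ :0 :* f := :0 given (:- :1 ∙ a :* e :+ :- (b :* d) := :0) ∷ []) refl a b d e f v₃ ,
    solve 5 (λ a b d e f → b :* d :+ :- a :* e :+ :0 :* f := :0 given (:- :1 ∙ a :* e :+ :- (b :* d) := :0) ∷ [])
      refl a b g h i w₃
  ...   | inj₂ (inj₁ b≢0) = b ∷ - a ∷ 0# ∷ [] , (λ eq → b≢0 (proj₁ (components eq))) ,
    solve 3 (λ a b c → b :* a :+ :- a :* b :+ :0 :* c := :0 given []) refl a b c , solve 5 (λ a b d e f →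
      b :* d :+ :- a :* e :+ :0 :* f := :0 given (:- :1 ∙ a :* e :+ :- (b :* d) := :0) ∷ []) refl a b d e f v₃ ,
    solve 5 (λ a b d e f → b :* d :+ :- a :* e :+ :0 :* f := :0 given (:- :1 ∙ a :* e :+ :- (b :* d) := :0) ∷ [])
      refl a b g h i w₃
  ...   | inj₂ (inj₂ c≢0) = 0# ∷ c ∷ - b ∷ [] , (λ eq → c≢0 (proj₁ (proj₂ (components eq)))) ,
    solve 3 (λ a b c → :0 :* a :+ c :* b :+ :- b :* c := :0 given []) refl a b c , solve 5 (λ b c d e f →
      :0 :* d :+ c :* e :+ :- b :* f := :0 given (:- :1 ∙ b :* f :+ :- (c :* e) := :0) ∷ []) refl b c d e f v₁ ,
    solve 5 (λ b c d e f → :0 :* d :+ c :* e :+ :- b :* f := :0 given (:- :1 ∙ b :* f :+ :- (c :* e) := :0) ∷ [])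
      refl b c g h i w₁

  -- The line is u × v or u × w, whichever is nonzero; its value at the remaining point is the
  -- determinant up to sign.
  Det≡0⇒concurrent : ∀ u v w → u ≢ 0v3 → Det u v w ≡ 0# → ∃[ l ] (l ≢ 0v3 × Concurrent l u v w)
  Det≡0⇒concurrent u v w u≢0 eq with zero? (cross u v) | zero? (cross u w)
  ... | inj₁ uv | inj₁ uw = perpendicular u v w u≢0 uv uw
  Det≡0⇒concurrent (a ∷ b ∷ c ∷ []) (d ∷ e ∷ f ∷ []) (g ∷ h ∷ i ∷ []) u≢0 eq | inj₂ ≢0 | _ = _ , ≢0 ,
    solve 6 (λ a b c d e f →
      (b :* f :+ :- (c :* e)) :* a :+ (c :* d :+ :- (a :* f)) :* b :+ (a :* e :+ :- (b :* d)) :* c := :0 given [])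
      refl a b c d e f ,
    solve 6 (λ a b c d e f →
      (b :* f :+ :- (c :* e)) :* d :+ (c :* d :+ :- (a :* f)) :* e :+ (a :* e :+ :- (b :* d)) :* f := :0 given [])
      refl a b c d e f ,
    solve 9 (λ a b c d e f g h i →
      (b :* f :+ :- (c :* e)) :* g :+ (c :* d :+ :- (a :* f)) :* h :+ (a :* e :+ :- (b :* d)) :* i := :0 given
      (:1 ∙ a :* (e :* i :+ :- (f :* h)) :+ :- (b :* (d :* i :+ :- (f :* g))) :+ c :* (d :* h :+ :- (e :* g)) := :0) ∷ [])
      refl a b c d e f g h i eq
  Det≡0⇒concurrent (a ∷ b ∷ c ∷ []) (d ∷ e ∷ f ∷ []) (g ∷ h ∷ i ∷ []) u≢0 eq | inj₁ _ | inj₂ ≢0 = _ , ≢0 ,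
    solve 6 (λ a b c d e f →
      (b :* f :+ :- (c :* e)) :* a :+ (c :* d :+ :- (a :* f)) :* b :+ (a :* e :+ :- (b :* d)) :* c := :0 given [])
      refl a b c g h i ,
    solve 9 (λ a b c d e f g h i →
      (b :* i :+ :- (c :* h)) :* d :+ (c :* g :+ :- (a :* i)) :* e :+ (a :* h :+ :- (b :* g)) :* f := :0 given
      (:- :1 ∙ a :* (e :* i :+ :- (f :* h)) :+ :- (b :* (d :* i :+ :- (f :* g))) :+ c :* (d :* h :+ :- (e :* g)) := :0) ∷ [])
      refl a b c d e f g h i eq ,
    solve 6 (λ a b c d e f →
      (b :* f :+ :- (c :* e)) :* d :+ (c :* d :+ :- (a :* f)) :* e :+ (a :* e :+ :- (b :* d)) :* f := :0 given [])
      refl a b c g h i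

-- The Bruck-Bose plane of the regular spread

module Bruck {n} (F : FiniteField n) {β : Fin n} (E : QuadraticExtension F β) {𝒞 : Subset (Geometry.Pt F)}
  (M : LinearModel F E 𝒞) (2≢0 : FieldLemmas.2# F ≢ FiniteField.0# F) where
  open FiniteField F
  open FieldLemmas F
  open Vectors F
  open Geometry F
  open QuadraticExtension E
  open LinearModel M
  open L using () renaming (_+_ to infixl 6 _+ᴸ_; _*_ to infixl 7 _*ᴸ_; -_ to infix 8 -ᴸ_; 0# to 0ᴸ; 1# to 1ᴸ)
  module SL = Solve L
  module FL = FieldLemmas L

  E₀ : Set
  E₀ = Fin (n *ℕ n)

  z⟨_,_⟩ : K → K → E₀
  z⟨ x , y ⟩ = ι x +ᴸ ι y *ᴸ θ

  ι-0 : ι 0# ≡ 0ᴸ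
  ι-0 = trans (cong ι (sym (+-inverseʳ 0#))) (trans (ι-+ 0# (- 0#)) (trans (cong (ι 0# +ᴸ_) (ι-neg 0#)) (FL.+-inverseʳ _)))

  ι≢0 : ∀ {x} → x ≢ 0# → ι x ≢ 0ᴸ
  ι≢0 {x} x≢0 eq = x≢0 (proj₁ (free x 0# (SL.solve 3 (λ x z θ → x :+ z :* θ := :0 given (:1 ∙ x := :0) ∷ (θ ∙ z := :0) ∷ [])
    refl (ι x) (ι 0#) θ eq ι-0)))

  2ᴸ≢0 : 1ᴸ +ᴸ 1ᴸ ≢ 0ᴸ
  2ᴸ≢0 eq = ι≢0 2≢0 (trans (ι-+ 1# 1#) (trans (cong₂ _+ᴸ_ ι-1 ι-1) eq))

  X-⊖ : ∀ u v → X (u ⊖ v) ≡ X u +ᴸ -ᴸ X v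
  X-⊖ u v = trans (X-⊕ u (⊟ v)) (cong (X u +ᴸ_) (trans (X-· (- 1#) v)
    (SL.solve 3 (λ x m o → m :* x := :- x given (x ∙ m := :- o) ∷ (:- x ∙ o := :1) ∷ [])
      refl (X v) (ι (- 1#)) (ι 1#) (ι-neg 1#) ι-1)))
  Y-⊖ : ∀ u v → Y (u ⊖ v) ≡ Y u +ᴸ -ᴸ Y v
  Y-⊖ u v = trans (Y-⊕ u (⊟ v)) (cong (Y u +ᴸ_) (trans (Y-· (- 1#) v)
    (SL.solve 3 (λ x m o → m :* x := :- x given (x ∙ m := :- o) ∷ (:- x ∙ o := :1) ∷ [])
      refl (Y v) (ι (- 1#)) (ι 1#) (ι-neg 1#) ι-1)))

  X-lin : ∀ a b u v → X (a · u ⊕ b · v) ≡ ι a *ᴸ X u +ᴸ ι b *ᴸ X v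
  X-lin a b u v = trans (X-⊕ _ _) (cong₂ _+ᴸ_ (X-· a u) (X-· b v))
  Y-lin : ∀ a b u v → Y (a · u ⊕ b · v) ≡ ι a *ᴸ Y u +ᴸ ι b *ᴸ Y v
  Y-lin a b u v = trans (Y-⊕ _ _) (cong₂ _+ᴸ_ (Y-· a u) (Y-· b v))

  X-0 : X 0v ≡ 0ᴸ
  X-0 = trans (cong X (vsolve 0 1 (λ z → :0v :≈ z :⊖ z givenᵛ []) refl 0v)) (trans (X-⊖ 0v 0v) (FL.+-inverseʳ _))
  Y-0 : Y 0v ≡ 0ᴸ
  Y-0 = trans (cong Y (vsolve 0 1 (λ z → :0v :≈ z :⊖ z givenᵛ []) refl 0v)) (trans (Y-⊖ 0v 0v) (FL.+-inverseʳ _))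

  zero-vec : ∀ {v} → X v ≡ 0ᴸ → Y v ≡ 0ᴸ → v ≡ 0v
  zero-vec ex ey = ext (trans ex (sym X-0)) (trans ey (sym Y-0))

  data Slope : Set where
    finite   : E₀ → Slope
    infinite : Slope

  slope : Fin N → Slope
  slope j with splitAt (n *ℕ n) j
  ... | inj₁ a = finite a
  ... | inj₂ _ = infinite

  index : Slope → Fin N
  index (finite a) = a ↑ˡ 1
  index infinite   = (n *ℕ n) ↑ʳ zero

  slope-index : ∀ s → slope (index s) ≡ s
  slope-index (finite a) rewrite splitAt-↑ˡ (n *ℕ n) a 1 = refl
  slope-index infinite rewrite splitAt-↑ʳ (n *ℕ n) 1 zero = refl

  index-slope : ∀ j → index (slope j) ≡ j
  index-slope j with splitAt (n *ℕ n) j in eq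
  ... | inj₁ a = splitAt⁻¹-↑ˡ eq
  ... | inj₂ zero = splitAt⁻¹-↑ʳ eq

  -- (dx , dy) spans the line of L² with the given slope, and (px , py)
  -- is a functional with value 1 there.
  dxˢ dyˢ pxˢ pyˢ : Slope → E₀
  dxˢ (finite a) = 1ᴸ
  dxˢ infinite = 0ᴸ
  dyˢ (finite a) = a
  dyˢ infinite = 1ᴸ
  pxˢ (finite a) = 1ᴸ
  pxˢ infinite = 0ᴸ
  pyˢ (finite a) = 0ᴸ
  pyˢ infinite = 1ᴸ

  pdˢ : ∀ s → pxˢ s *ᴸ dxˢ s +ᴸ pyˢ s *ᴸ dyˢ s ≡ 1ᴸ
  pdˢ (finite a) = SL.solve 1 (λ a → :1 :* :1 :+ :0 :* a := :1 given []) refl a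
  pdˢ infinite = SL.solve 0 (:0 :* :0 :+ :1 :* :1 := :1 given []) refl

  det-inj : ∀ s t → dxˢ s *ᴸ dyˢ t ≡ dyˢ s *ᴸ dxˢ t → s ≡ t
  det-inj (finite a) (finite b) eq = cong finite (SL.solve 2 (λ a b → a := b given (:- :1 ∙ :1 :* b := a :* :1) ∷ []) refl a b eq)
  det-inj (finite a) infinite eq = ⊥-elim (FL.1≢0 (SL.solve 1 (λ a → :1 := :0 given (:1 ∙ :1 :* :1 := a :* :0) ∷ []) refl a eq))
  det-inj infinite (finite b) eq = ⊥-elim (FL.1≢0 (SL.solve 1 (λ b → :1 := :0 given (:- :1 ∙ :0 :* b := :1 :* :1) ∷ [])
    refl b eq))
  det-inj infinite infinite _ = refl

  opaque
    dx dy px py : Fin N → E₀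
    dx j = dxˢ (slope j)
    dy j = dyˢ (slope j)
    px j = pxˢ (slope j)
    py j = pyˢ (slope j)

    pd≡1 : ∀ j → px j *ᴸ dx j +ᴸ py j *ᴸ dy j ≡ 1ᴸ
    pd≡1 j = pdˢ (slope j)

    direction-inj : ∀ {i j} → dx i *ᴸ dy j ≡ dy i *ᴸ dx j → i ≡ j
    direction-inj {i} {j} eq = trans (sym (index-slope i)) (trans (cong index (det-inj (slope i) (slope j) eq)) (index-slope j))

    direction : ∀ x y → ¬ (x ≡ 0ᴸ × y ≡ 0ᴸ) → ∃[ j ] dx j *ᴸ y ≡ dy j *ᴸ x
    direction x y ≢0 with x ≟ 0ᴸ
    ... | yes refl = index infinite , subst (λ s → dxˢ s *ᴸ y ≡ dyˢ s *ᴸ 0ᴸ) (sym (slope-index infinite)) (SL.solve 1 (λ y →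
      :0 :* y := :1 :* :0 given []) refl y)
    ... | no x≢0 = index (finite (y *ᴸ FL.inv x x≢0)) ,
      subst (λ s → dxˢ s *ᴸ y ≡ dyˢ s *ᴸ x) (sym (slope-index (finite _)))
        (SL.solve 3 (λ x y i → :1 :* y := y :* i :* x given (:- y ∙ x :* i := :1) ∷ [])
          refl x y (FL.inv x x≢0) (FL.x*inv≡1 x x≢0))

    slope-one : ∀ a → ∃[ j ] (dx j ≡ 1ᴸ × dy j ≡ a)
    slope-one a = index (finite a) , cong dxˢ (slope-index (finite a)) , cong dyˢ (slope-index (finite a))

    vertical : ∃[ j ] (dx j ≡ 0ᴸ × dy j ≡ 1ᴸ)
    vertical = index infinite , cong dxˢ (slope-index infinite) , cong dyˢ (slope-index infinite)

  d≢0 : ∀ j → ¬ (dx j ≡ 0ᴸ × dy j ≡ 0ᴸ)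
  d≢0 j (x≡0 , y≡0) = FL.1≢0 (SL.solve 4 (λ x y p r → :1 := :0 given
    (:- :1 ∙ p :* x :+ r :* y := :1) ∷ (p ∙ x := :0) ∷ (r ∙ y := :0) ∷ []) refl (dx j) (dy j) (px j) (py j) (pd≡1 j) x≡0 y≡0)

  det≢0 : ∀ {i j} → i ≢ j → dx i *ᴸ dy j +ᴸ -ᴸ (dy i *ᴸ dx j) ≢ 0ᴸ
  det≢0 i≢j eq = i≢j (direction-inj (FL.x-y≡0⇒x≡y _ _ eq))

  S : Spread
  S j v = dx j *ᴸ Y v ≡ dy j *ᴸ X v

  factor : Fin N → Pt → E₀
  factor j v = px j *ᴸ X v +ᴸ py j *ᴸ Y v

  factor-X : ∀ {j v} → S j v → factor j v *ᴸ dx j ≡ X v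
  factor-X {j} {v} Sv = SL.solve 6 (λ x y p r X Y → (p :* X :+ r :* Y) :* x := X given
    (r ∙ x :* Y := y :* X) ∷ (X ∙ p :* x :+ r :* y := :1) ∷ []) refl (dx j) (dy j) (px j) (py j) (X v) (Y v) Sv (pd≡1 j)
  factor-Y : ∀ {j v} → S j v → factor j v *ᴸ dy j ≡ Y v
  factor-Y {j} {v} Sv = SL.solve 6 (λ x y p r X Y → (p :* X :+ r :* Y) :* y := Y given
    (:- p ∙ x :* Y := y :* X) ∷ (Y ∙ p :* x :+ r :* y := :1) ∷ []) refl (dx j) (dy j) (px j) (py j) (X v) (Y v) Sv (pd≡1 j)

  S-lin : ∀ {j u v} a b → S j u → S j v → S j (a · u ⊕ b · v)
  S-lin {j} {u} {v} a b Su Sv = trans (cong (dx j *ᴸ_) (Y-lin a b u v)) (trans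
    (SL.solve 8 (λ x y a b X Y X' Y' → x :* (a :* Y :+ b :* Y') := y :* (a :* X :+ b :* X') given
      (a ∙ x :* Y := y :* X) ∷ (b ∙ x :* Y' := y :* X') ∷ [])
      refl (dx j) (dy j) (ι a) (ι b) (X u) (Y u) (X v) (Y v) Su Sv) (sym (cong (dy j *ᴸ_) (X-lin a b u v))))

  S-vec : ∀ j k → S j (vec (k *ᴸ dx j) (k *ᴸ dy j))
  S-vec j k = trans (cong (dx j *ᴸ_) (Y-vec _ _)) (trans (SL.solve 3 (λ x y k → x :* (k :* y) := y :* (k :* x) given [])
    refl (dx j) (dy j) k)
    (sym (cong (dy j *ᴸ_) (X-vec _ _))))

  vecs-independent : ∀ {x y} → ¬ (x ≡ 0ᴸ × y ≡ 0ᴸ) → Independent (vec x y) (vec (θ *ᴸ x) (θ *ᴸ y))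
  vecs-independent {x} {y} ≢0 a b eq = case z⟨ a , b ⟩ ≟ 0ᴸ of λ where
      (yes z≡0) → free a b z≡0
      (no z≢0) → ⊥-elim (≢0 (FL.cancel z≢0 zx , FL.cancel z≢0 zy))
    where
    zx : z⟨ a , b ⟩ *ᴸ x ≡ 0ᴸ
    zx = trans (SL.solve 4 (λ a b θ x → (a :+ b :* θ) :* x := a :* x :+ b :* (θ :* x) given []) refl (ι a) (ι b) θ x)
      (trans (sym (trans (X-lin a b _ _) (cong₂ (λ s t → ι a *ᴸ s +ᴸ ι b *ᴸ t) (X-vec _ _) (X-vec _ _)))) (trans (cong X eq) X-0))
    zy : z⟨ a , b ⟩ *ᴸ y ≡ 0ᴸ
    zy = trans (SL.solve 4 (λ a b θ x → (a :+ b :* θ) :* x := a :* x :+ b :* (θ :* x) given []) refl (ι a) (ι b) θ y)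
      (trans (sym (trans (Y-lin a b _ _) (cong₂ (λ s t → ι a *ᴸ s +ᴸ ι b *ᴸ t) (Y-vec _ _) (Y-vec _ _)))) (trans (cong Y eq) Y-0))

  -- Over K, an L-line spanned by d has the basis d, θd.
  S-isLine : ∀ j → IsLineAtInf (S j)
  S-isLine j = u , w , vecs-independent (d≢0 j) , λ v → (λ Sv → spanned Sv (split (factor j v))) ,
      λ (a , b , eq) → subst (S j) (sym eq) (S-lin {j} a b
        (subst (S j) (cong₂ vec (FL.*-identityˡ _) (FL.*-identityˡ _)) (S-vec j 1ᴸ)) (S-vec j θ))
    where
    u = vec (dx j) (dy j)
    w = vec (θ *ᴸ dx j) (θ *ᴸ dy j)
    spanned : ∀ {v} → S j v → (∃[ a ] ∃[ b ] factor j v ≡ z⟨ a , b ⟩) → Span u w v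
    spanned {v} Sv (a , b , eq) = a , b , ext
      (trans (SL.solve 6 (λ X f a b θ d → X := a :* d :+ b :* (θ :* d) given
          (:- :1 ∙ f :* d := X) ∷ (d ∙ f := a :+ b :* θ) ∷ []) refl (X v) (factor j v) (ι a) (ι b) θ (dx j) (factor-X {j} Sv) eq)
        (sym (trans (X-lin a b u w) (cong₂ (λ s t → ι a *ᴸ s +ᴸ ι b *ᴸ t) (X-vec _ _) (X-vec _ _)))))
      (trans (SL.solve 6 (λ X f a b θ d → X := a :* d :+ b :* (θ :* d) given
          (:- :1 ∙ f :* d := X) ∷ (d ∙ f := a :+ b :* θ) ∷ []) refl (Y v) (factor j v) (ι a) (ι b) θ (dy j) (factor-Y {j} Sv) eq)
        (sym (trans (Y-lin a b u w) (cong₂ (λ s t → ι a *ᴸ s +ᴸ ι b *ᴸ t) (Y-vec _ _) (Y-vec _ _)))))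

  S-disjoint : ∀ i j → i ≢ j → ∀ x → S i x → S j x → x ≡ 0v
  S-disjoint i j i≢j v Si Sj = zero-vec
    (FL.cancel (det≢0 i≢j) (SL.solve 6 (λ x y x' y' X Y → (x :* y' :+ :- (y :* x')) :* X := :0 given
      (:- x ∙ x' :* Y := y' :* X) ∷ (x' ∙ x :* Y := y :* X) ∷ []) refl (dx i) (dy i) (dx j) (dy j) (X v) (Y v) Sj Si))
    (FL.cancel (det≢0 i≢j) (SL.solve 6 (λ x y x' y' X Y → (x :* y' :+ :- (y :* x')) :* Y := :0 given
      (y' ∙ x :* Y := y :* X) ∷ (:- y ∙ x' :* Y := y' :* X) ∷ []) refl (dx i) (dy i) (dx j) (dy j) (X v) (Y v) Si Sj))

  S-same : ∀ {i j v} → v ≢ 0v → S i v → S j v → i ≡ j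
  S-same {i} {j} {v} v≢0 Si Sj with i ≟ j
  ... | yes i≡j = i≡j
  ... | no i≢j = ⊥-elim (v≢0 (S-disjoint i j i≢j v Si Sj))

  S-covers : ∀ v → v ≢ 0v → ∃[ j ] S j v
  S-covers v v≢0 = direction (X v) (Y v) λ (x≡0 , y≡0) → v≢0 (zero-vec x≡0 y≡0)

  S-isSpread : IsSpread S
  S-isSpread = S-isLine , S-disjoint , S-covers

  -- A basis of `W` is an independent pair in `W′`, so it spans `W′` by `span₂`.
  line-⊂⇒≐ : ∀ {W W′} → IsLineAtInf W → IsLineAtInf W′ → (∀ v → W v → W′ v) → W ≐ W′
  line-⊂⇒≐ {W} {W′} (u , w , ind , W≐) (u′ , w′ , _ , W′≐) sub x = sub x , λ W′x → proj₂ (W≐ x)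
    (span₂ ind (proj₁ (W′≐ u) (sub u (proj₂ (W≐ u) (1# , 0# , vsolve 0 2 (λ u w → u :≈ :1 :· u :⊕ :0 :· w givenᵛ []) refl u w))))
               (proj₁ (W′≐ w) (sub w (proj₂ (W≐ w) (0# , 1# , vsolve 0 2 (λ u w → w :≈ :0 :· u :⊕ :1 :· w givenᵛ [])
                 refl u w)))) (proj₁ (W′≐ x) W′x))

  line-lin : ∀ {W u v} a b → IsLineAtInf W → W u → W v → W (a · u ⊕ b · v)
  line-lin {W} {u} {v} a b (r , s , _ , W≐) Wu Wv with proj₁ (W≐ u) Wu | proj₁ (W≐ v) Wv
  ... | u₁ , u₂ , eu | v₁ , v₂ , ev = proj₂ (W≐ _) (a * u₁ + b * v₁ , a * u₂ + b * v₂ ,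
    vsolve 6 4 (λ a b u₁ u₂ v₁ v₂ r s u v → a :· u :⊕ b :· v :≈ (a :* u₁ :+ b :* v₁) :· r :⊕ (a :* u₂ :+ b :* v₂) :· s givenᵛ
      (a ∙ᵛ u :≈ u₁ :· r :⊕ u₂ :· s) ∷ (b ∙ᵛ v :≈ v₁ :· r :⊕ v₂ :· s) ∷ []) refl a b u₁ u₂ v₁ v₂ r s u v eu ev)

  𝒞-ext : ∀ {x y} → 𝒞 x → 𝒞 y → X x ≡ X y → x ≡ y
  𝒞-ext {x} {y} 𝒞x 𝒞y eq = ext eq (SL.solve 10 (λ a b A B p P r R o Q →
    A := B given (:1 ∙ P := p :* p) ∷ (:- :1 ∙ R := r :* r) ∷
    (:- :1 ∙ P := A :+ :- Q) ∷ (:1 ∙ R := B :+ :- Q) ∷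
    (p :+ r ∙ p := a :+ :- o) ∷ (:- (p :+ r) ∙ r := b :+ :- o) ∷ (p :+ r ∙ a := b) ∷ [])
    refl (X x) (X y) (Y x) (Y y) (X (x ⊖ O)) (Y (x ⊖ O)) (X (y ⊖ O)) (Y (y ⊖ O)) (X O) (Y O) (𝒞⇒Y≡X² 𝒞x) (𝒞⇒Y≡X² 𝒞y) (Y-⊖ x O) (Y-⊖ y O) (X-⊖ x O) (X-⊖ y O) eq)

  -- The slope of a chord of Y = X² is the sum of the abscissas of its ends, measured from `O`. The
  -- form with `dx` and `dy` covers the infinite slope.
  chord : ∀ {j x y} → 𝒞 x → 𝒞 y → x ≢ y → S j (y ⊖ x) → dx j *ᴸ (X (x ⊖ O) +ᴸ X (y ⊖ O)) ≡ dy j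
  chord {j} {x} {y} 𝒞x 𝒞y x≢y Sj = FL.cancelˡ {X y +ᴸ -ᴸ X x} (λ eq → x≢y (sym (𝒞-ext 𝒞y 𝒞x (FL.x-y≡0⇒x≡y _ _ eq))))
    (SL.solve 14 (λ d e a b A B p P r R o Q u w →
    (b :+ :- a) :* (d :* (p :+ r)) := (b :+ :- a) :* e given (d ∙ P := p :* p) ∷ (:- d ∙ R := r :* r) ∷
    (:- d ∙ P := A :+ :- Q) ∷ (d ∙ R := B :+ :- Q) ∷
    (d :* (p :+ r) ∙ p := a :+ :- o) ∷ (:- (d :* (p :+ r)) ∙ r := b :+ :- o) ∷
    (:1 ∙ d :* w := e :* u) ∷ (e ∙ u := b :+ :- a) ∷ (:- d ∙ w := B :+ :- A) ∷ [])
    refl (dx j) (dy j) (X x) (X y) (Y x) (Y y) (X (x ⊖ O)) (Y (x ⊖ O)) (X (y ⊖ O)) (Y (y ⊖ O)) (X O) (Y O) (X (y ⊖ x)) (Y (y ⊖ x)) (𝒞⇒Y≡X² 𝒞x) (𝒞⇒Y≡X² 𝒞y) (Y-⊖ x O) (Y-⊖ y O) (X-⊖ x O) (X-⊖ y O) Sj (X-⊖ y x) (Y-⊖ y x))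

  S-difference : ∀ {j p x y} → Translate p (S j) x → Translate p (S j) y → S j (y ⊖ x)
  S-difference {j} {p} {x} {y} (w , Sw , ex) (w′ , Sw′ , ey) = subst (S j)
    (vsolve 0 5 (λ p x y w w' → :1 :· w' :⊕ :- :1 :· w :≈ y :⊖ x givenᵛ (:1 ∙ᵛ x :≈ p :⊕ w) ∷ (:- :1 ∙ᵛ y :≈ p :⊕ w') ∷ [])
      refl p x y w w′ ex ey) (S-lin {j} 1# (- 1#) Sw′ Sw)

  -- Two chords of one slope from the same point end at the same abscissa unless `dx` vanishes; but
  -- then `chord` makes `dy` vanish too.
  S-arc : ∀ x y z → 𝒞 x → 𝒞 y → 𝒞 z → Distinct3 x y z → ¬ BBCollinear S (inj₁ x) (inj₁ y) (inj₁ z)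
  S-arc x y z 𝒞x 𝒞y 𝒞z _ (ℓ∞ , () , _)
  S-arc x y z 𝒞x 𝒞y 𝒞z (x≢y , y≢z , x≢z) (aff p j , Ix , Iy , Iz) = d≢0 j (dx≡0 , dy≡0)
    where
    xy = chord {j} 𝒞x 𝒞y x≢y (S-difference {j} Ix Iy)
    xz = chord {j} 𝒞x 𝒞z x≢z (S-difference {j} Ix Iz)
    dx≡0 : dx j ≡ 0ᴸ
    dx≡0 = FL.cancel {X y +ᴸ -ᴸ X z} (λ eq → y≢z (𝒞-ext 𝒞y 𝒞z (FL.x-y≡0⇒x≡y _ _ eq)))
      (SL.solve 8 (λ d e b c p r s o → (b :+ :- c) :* d := :0 given
        (:1 ∙ d :* (p :+ r) := e) ∷ (:- :1 ∙ d :* (p :+ s) := e) ∷ (:- d ∙ r := b :+ :- o) ∷ (d ∙ s := c :+ :- o) ∷ [])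
        refl (dx j) (dy j) (X y) (X z) (X (x ⊖ O)) (X (y ⊖ O)) (X (z ⊖ O)) (X O) xy xz (X-⊖ y O) (X-⊖ z O))
    dy≡0 : dy j ≡ 0ᴸ
    dy≡0 = SL.solve 4 (λ d e p r → e := :0 given (:- :1 ∙ d :* (p :+ r) := e) ∷ (p :+ r ∙ d := :0) ∷ [])
      refl (dx j) (dy j) (X (x ⊖ O)) (X (y ⊖ O)) xy dx≡0

-- Homogeneous coordinates over L, and the conic

module Iso {n} (F : FiniteField n) {β : Fin n} (E : QuadraticExtension F β) {𝒞 : Subset (Geometry.Pt F)}
  (M : LinearModel F E 𝒞) (2≢0 : FieldLemmas.2# F ≢ FiniteField.0# F) where
  open FiniteField F
  open Vectors F
  open Geometry F
  open QuadraticExtension E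
  open LinearModel M
  open L using () renaming (_+_ to infixl 6 _+ᴸ_; _*_ to infixl 7 _*ᴸ_; -_ to infix 8 -ᴸ_; 0# to 0ᴸ; 1# to 1ᴸ)
  open Bruck F E M 2≢0
  open Projective L
  open Plane L

  φ : BBPt → V3
  φ (inj₁ p) = X (p ⊖ O) ∷ Y (p ⊖ O) ∷ 1ᴸ ∷ []
  φ (inj₂ j) = dx j ∷ dy j ∷ 0ᴸ ∷ []

  coords : ∀ {a b c d e f : E₀} → _≡_ {A = V3} (a ∷ b ∷ c ∷ []) (d ∷ e ∷ f ∷ []) → a ≡ d × b ≡ e × c ≡ f
  coords refl = refl , refl , refl

  φ-nonzero : ∀ a → φ a ≢ 0v3
  φ-nonzero (inj₁ p) eq = FL.1≢0 (proj₂ (proj₂ (coords eq)))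
  φ-nonzero (inj₂ j) eq = d≢0 j (proj₁ (coords eq) , proj₁ (proj₂ (coords eq)))

  φ-injective : ∀ a b → ProjEq (φ a) (φ b) → a ≡ b
  φ-injective (inj₁ p) (inj₁ r) (k , _ , eq) = cong inj₁ (ext
      (SL.solve 6 (λ a b o a' b' k → a := b given
        (:1 ∙ a' := k :* b') ∷ (:- :1 ∙ a' := a :+ :- o) ∷ (:1 ∙ b' := b :+ :- o) ∷
        (:- b' ∙ :1 := k :* :1) ∷ [])
        refl (X p) (X r) (X O) (X (p ⊖ O)) (X (r ⊖ O)) k (proj₁ (coords eq)) (X-⊖ p O) (X-⊖ r O) (proj₂ (proj₂ (coords eq))))
      (SL.solve 6 (λ a b o a' b' k → a := b given
        (:1 ∙ a' := k :* b') ∷ (:- :1 ∙ a' := a :+ :- o) ∷ (:1 ∙ b' := b :+ :- o) ∷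
        (:- b' ∙ :1 := k :* :1) ∷ [])
        refl (Y p) (Y r) (Y O) (Y (p ⊖ O)) (Y (r ⊖ O)) k (proj₁ (proj₂ (coords eq))) (Y-⊖ p O) (Y-⊖ r O) (proj₂ (proj₂ (coords eq)))))
  φ-injective (inj₁ p) (inj₂ j) (k , _ , eq) = ⊥-elim (FL.1≢0 (SL.solve 1 (λ k → :1 := :0 given (:1 ∙ :1 := k :* :0) ∷ [])
    refl k (proj₂ (proj₂ (coords eq)))))
  φ-injective (inj₂ i) (inj₁ r) (k , k≢0 , eq) = ⊥-elim (k≢0 (SL.solve 1 (λ k → k := :0 given (:- :1 ∙ :0 := k :* :1) ∷ [])
    refl k (proj₂ (proj₂ (coords eq)))))
  φ-injective (inj₂ i) (inj₂ j) (k , _ , eq) = cong inj₂ (direction-inj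
    (SL.solve 5 (λ x y x' y' k → x :* y' := y :* x' given
      (y' ∙ x := k :* x') ∷ (:- x' ∙ y := k :* y') ∷ [])
      refl (dx i) (dy i) (dx j) (dy j) k (proj₁ (coords eq)) (proj₁ (proj₂ (coords eq)))))

  ⊕⊖ : ∀ p u → (p ⊕ u) ⊖ p ≡ u
  ⊕⊖ p u = vsolve 0 2 (λ p u → p :⊕ u :⊖ p :≈ u givenᵛ []) refl p u

  φ-surjective : ∀ v → v ≢ 0v3 → ∃[ a ] ProjEq (φ a) v
  φ-surjective (x ∷ y ∷ z ∷ []) v≢0 with z ≟ 0ᴸ
  ... | no z≢0 = inj₁ (O ⊕ vec (i *ᴸ x) (i *ᴸ y)) , i , FL.inv≢0 z z≢0 ,
      cong₂ _∷_ (trans (cong X (⊕⊖ O _)) (X-vec _ _)) (cong₂ _∷_ (trans (cong Y (⊕⊖ O _)) (Y-vec _ _))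
        (cong (_∷ []) (SL.solve 2 (λ z i → :1 := i :* z given (:- :1 ∙ z :* i := :1) ∷ []) refl z i (FL.x*inv≡1 z z≢0))))
    where i = FL.inv z z≢0
  ... | yes refl with direction x y (λ (x≡0 , y≡0) → v≢0 (cong₂ (λ x y → x ∷ y ∷ 0ᴸ ∷ []) x≡0 y≡0))
  ...   | j , eq = inj₂ j , FL.inv k k≢0 , FL.inv≢0 k k≢0 ,
      cong₂ _∷_ (SL.solve 4 (λ d x k i → d := i :* x given (i ∙ k :* d := x) ∷ (:- d ∙ k :* i := :1) ∷ [])
        refl (dx j) x k i kx (FL.x*inv≡1 k k≢0))
        (cong₂ _∷_ (SL.solve 4 (λ d x k i → d := i :* x given (i ∙ k :* d := x) ∷ (:- d ∙ k :* i := :1) ∷ [])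
          refl (dy j) y k i ky (FL.x*inv≡1 k k≢0))
        (cong (_∷ []) (sym (FL.zeroʳ i))))
    where
    k : E₀
    k = px j *ᴸ x +ᴸ py j *ᴸ y
    kx : k *ᴸ dx j ≡ x
    kx = SL.solve 6 (λ x y p r X Y → (p :* X :+ r :* Y) :* x := X given
      (r ∙ x :* Y := y :* X) ∷ (X ∙ p :* x :+ r :* y := :1) ∷ []) refl (dx j) (dy j) (px j) (py j) x y eq (pd≡1 j)
    ky : k *ᴸ dy j ≡ y
    ky = SL.solve 6 (λ x y p r X Y → (p :* X :+ r :* Y) :* y := Y given
      (:- p ∙ x :* Y := y :* X) ∷ (Y ∙ p :* x :+ r :* y := :1) ∷ []) refl (dx j) (dy j) (px j) (py j) x y eq (pd≡1 j)
    k≢0 : k ≢ 0ᴸ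
    k≢0 k≡0 = v≢0 (cong₂ (λ x y → x ∷ y ∷ 0ᴸ ∷ []) (trans (sym kx) (trans (cong (_*ᴸ dx j) k≡0) (FL.zeroˡ _)))
      (trans (sym ky) (trans (cong (_*ᴸ dy j) k≡0) (FL.zeroˡ _))))
    i = FL.inv k k≢0

  -- For an affine line, the equation - dy (X - X p) + dx (Y - Y p) = 0, homogenised.
  lineCoords : BBLine → V3
  lineCoords ℓ∞ = 0ᴸ ∷ 0ᴸ ∷ 1ᴸ ∷ []
  lineCoords (aff p i) = -ᴸ dy i ∷ dx i ∷ dy i *ᴸ X (p ⊖ O) +ᴸ -ᴸ (dx i *ᴸ Y (p ⊖ O)) ∷ []

  lineCoords-nonzero : ∀ ℓ → lineCoords ℓ ≢ 0v3
  lineCoords-nonzero ℓ∞ eq = FL.1≢0 (proj₂ (proj₂ (coords eq)))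
  lineCoords-nonzero (aff p i) eq = d≢0 i (proj₁ (proj₂ (coords eq)) ,
    (SL.solve 1 (λ y → y := :0 given (:- :1 ∙ :- y := :0) ∷ []) refl (dy i) (proj₁ (coords eq))))

  Inc⇒dot : ∀ a ℓ → Inc S a ℓ → dot (lineCoords ℓ) (φ a) ≡ 0ᴸ
  Inc⇒dot (inj₁ x) ℓ∞ ()
  Inc⇒dot (inj₂ j) ℓ∞ _ = SL.solve 2 (λ x y → :0 :* x :+ :0 :* y :+ :1 :* :0 := :0 given []) refl (dx j) (dy j)
  Inc⇒dot (inj₁ x) (aff p i) (w , Sw , refl) =
    SL.solve 8 (λ d e a b A B u v →
      :- e :* A :+ d :* B :+ (e :* a :+ :- (d :* b)) :* :1 := :0 given (:1 ∙ d :* v := e :* u) ∷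
      (:- e ∙ A := a :+ u) ∷ (d ∙ B := b :+ v) ∷ [])
      refl (dx i) (dy i) (X (p ⊖ O)) (Y (p ⊖ O)) (X ((p ⊕ w) ⊖ O)) (Y ((p ⊕ w) ⊖ O)) (X w) (Y w) Sw (trans (cong X same) (X-⊕ (p ⊖ O) w)) (trans (cong Y same) (Y-⊕ (p ⊖ O) w))
    where
    same : (p ⊕ w) ⊖ O ≡ (p ⊖ O) ⊕ w
    same = vsolve 0 3 (λ p w o → p :⊕ w :⊖ o :≈ p :⊖ o :⊕ w givenᵛ []) refl p w O
  Inc⇒dot (inj₂ j) (aff p i) refl = SL.solve 3 (λ d e t → :- e :* d :+ d :* e :+ t :* :0 := :0 given [])
    refl (dx i) (dy i) (dy i *ᴸ X (p ⊖ O) +ᴸ -ᴸ (dx i *ᴸ Y (p ⊖ O)))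

  translate : ∀ {p i x} → S i (x ⊖ p) → Translate p (S i) x
  translate {p} {i} {x} Sd = x ⊖ p , Sd , vsolve 0 2 (λ p x → x :≈ p :⊕ (x :⊖ p) givenᵛ []) refl p x

  module _ {l₁ l₂ l₃ : E₀} (≢0 : l₁ ≢ 0ᴸ ⊎ l₂ ≢ 0ᴸ) {i} (slope≡ : dx i *ᴸ (-ᴸ l₁) ≡ dy i *ᴸ l₂) where

    -- `slope≡` says that the functional (l₁, l₂) vanishes on the direction i. As it is nonzero, its
    -- kernel is the L-line of that direction.
    normal-parallel : ∀ u w → l₁ *ᴸ u +ᴸ l₂ *ᴸ w ≡ 0ᴸ → dx i *ᴸ w ≡ dy i *ᴸ u
    normal-parallel u w eq = case ≢0 of λ where
      (inj₁ l₁≢0) → FL.cancelˡ l₁≢0 (SL.solve 6 (λ l₁ l₂ u w d e → l₁ :* (d :* w) := l₁ :* (e :* u) given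
        (:- w ∙ d :* :- l₁ := e :* l₂) ∷ (:- e ∙ l₁ :* u :+ l₂ :* w := :0) ∷ []) refl l₁ l₂ u w (dx i) (dy i) slope≡ eq)
      (inj₂ l₂≢0) → FL.cancelˡ l₂≢0 (SL.solve 6 (λ l₁ l₂ u w d e → l₂ :* (d :* w) := l₂ :* (e :* u) given
        (u ∙ d :* :- l₁ := e :* l₂) ∷ (d ∙ l₁ :* u :+ l₂ :* w := :0) ∷ []) refl l₁ l₂ u w (dx i) (dy i) slope≡ eq)

    dot⇒Inc : ∀ {p} → l₁ *ᴸ X (p ⊖ O) +ᴸ l₂ *ᴸ Y (p ⊖ O) +ᴸ l₃ *ᴸ 1ᴸ ≡ 0ᴸ →
              ∀ a → dot (l₁ ∷ l₂ ∷ l₃ ∷ []) (φ a) ≡ 0ᴸ → Inc S a (aff p i)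
    dot⇒Inc {p} on-p (inj₁ x) eq = translate {p} {i} (normal-parallel (X (x ⊖ p)) (Y (x ⊖ p))
      (SL.solve 9 (λ l₁ l₂ l₃ a b A B u v → l₁ :* u :+ l₂ :* v := :0 given
        (:1 ∙ l₁ :* A :+ l₂ :* B :+ l₃ :* :1 := :0) ∷ (:- :1 ∙ l₁ :* a :+ l₂ :* b :+ l₃ :* :1 := :0) ∷
        (l₁ ∙ u := A :+ :- a) ∷ (l₂ ∙ v := B :+ :- b) ∷ [])
        refl l₁ l₂ l₃ (X (p ⊖ O)) (Y (p ⊖ O)) (X (x ⊖ O)) (Y (x ⊖ O)) (X (x ⊖ p)) (Y (x ⊖ p)) eq on-p (trans (cong X same) (X-⊖ (x ⊖ O) (p ⊖ O))) (trans (cong Y same) (Y-⊖ (x ⊖ O) (p ⊖ O)))))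
      where
      same : x ⊖ p ≡ (x ⊖ O) ⊖ (p ⊖ O)
      same = vsolve 0 3 (λ p x o → x :⊖ p :≈ x :⊖ o :⊖ (p :⊖ o) givenᵛ []) refl p x O
    dot⇒Inc {p} on-p (inj₂ j) eq = sym (direction-inj (normal-parallel (dx j) (dy j)
      (SL.solve 5 (λ l₁ l₂ l₃ x y → l₁ :* x :+ l₂ :* y := :0 given (:1 ∙ l₁ :* x :+ l₂ :* y :+ l₃ :* :0 := :0) ∷ [])
        refl l₁ l₂ l₃ (dx j) (dy j) eq)))

    point-on : ∃[ p ] l₁ *ᴸ X (p ⊖ O) +ᴸ l₂ *ᴸ Y (p ⊖ O) +ᴸ l₃ *ᴸ 1ᴸ ≡ 0ᴸ
    point-on = case ≢0 of λ where
        (inj₁ l₁≢0) → at (-ᴸ (FL.inv l₁ l₁≢0 *ᴸ l₃)) 0ᴸ (SL.solve 4 (λ l₁ l₂ l₃ i →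
          l₁ :* :- (i :* l₃) :+ l₂ :* :0 :+ l₃ :* :1 := :0 given
          (:- l₃ ∙ l₁ :* i := :1) ∷ []) refl l₁ l₂ l₃ (FL.inv l₁ l₁≢0) (FL.x*inv≡1 l₁ l₁≢0))
        (inj₂ l₂≢0) → at 0ᴸ (-ᴸ (FL.inv l₂ l₂≢0 *ᴸ l₃)) (SL.solve 4 (λ l₁ l₂ l₃ i →
          l₁ :* :0 :+ l₂ :* :- (i :* l₃) :+ l₃ :* :1 := :0 given
          (:- l₃ ∙ l₂ :* i := :1) ∷ []) refl l₁ l₂ l₃ (FL.inv l₂ l₂≢0) (FL.x*inv≡1 l₂ l₂≢0))
      where
      at : ∀ x y → l₁ *ᴸ x +ᴸ l₂ *ᴸ y +ᴸ l₃ *ᴸ 1ᴸ ≡ 0ᴸ → ∃[ p ] l₁ *ᴸ X (p ⊖ O) +ᴸ l₂ *ᴸ Y (p ⊖ O) +ᴸ l₃ *ᴸ 1ᴸ ≡ 0ᴸ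
      at x y eq = O ⊕ vec x y , trans (cong₂ (λ s t → l₁ *ᴸ s +ᴸ l₂ *ᴸ t +ᴸ l₃ *ᴸ 1ᴸ)
        (trans (cong X (⊕⊖ O _)) (X-vec x y)) (trans (cong Y (⊕⊖ O _)) (Y-vec x y))) eq

  lineThrough : ∀ l → l ≢ 0v3 → ∃[ ℓ ] ∀ a → dot l (φ a) ≡ 0ᴸ → Inc S a ℓ
  lineThrough (l₁ ∷ l₂ ∷ l₃ ∷ []) l≢0 = case ≢0v3 l₁ l₂ l₃ l≢0 of λ where
      (inj₁ l₁≢0) → affine (inj₁ l₁≢0) (λ (_ , eq) → l₁≢0 (SL.solve 1 (λ l₁ → l₁ := :0 given (:- :1 ∙ :- l₁ := :0) ∷ [])
        refl l₁ eq))
      (inj₂ (inj₁ l₂≢0)) → affine (inj₂ l₂≢0) (λ (eq , _) → l₂≢0 eq)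
      (inj₂ (inj₂ l₃≢0)) → last l₃≢0
    where
    affine : l₁ ≢ 0ᴸ ⊎ l₂ ≢ 0ᴸ → ¬ (l₂ ≡ 0ᴸ × -ᴸ l₁ ≡ 0ᴸ) → ∃[ ℓ ] ∀ a → dot (l₁ ∷ l₂ ∷ l₃ ∷ []) (φ a) ≡ 0ᴸ → Inc S a ℓ
    affine ≢0 ≢0′ = let i , eq = direction l₂ (-ᴸ l₁) ≢0′ ; p , on-p = point-on {l₁} {l₂} {l₃} ≢0 eq
      in aff p i , dot⇒Inc {l₁} {l₂} {l₃} ≢0 eq on-p
    at-infinity : l₁ ≡ 0ᴸ → l₂ ≡ 0ᴸ → l₃ ≢ 0ᴸ → ∀ a → dot (l₁ ∷ l₂ ∷ l₃ ∷ []) (φ a) ≡ 0ᴸ → Inc S a ℓ∞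
    at-infinity l₁≡0 l₂≡0 l₃≢0 (inj₂ j) eq = tt
    at-infinity l₁≡0 l₂≡0 l₃≢0 (inj₁ x) eq = l₃≢0 (SL.solve 5 (λ l₁ l₂ l₃ a b → l₃ := :0 given
      (:1 ∙ l₁ :* a :+ l₂ :* b :+ l₃ :* :1 := :0) ∷ (:- a ∙ l₁ := :0) ∷ (:- b ∙ l₂ := :0) ∷ [])
      refl l₁ l₂ l₃ (X (x ⊖ O)) (Y (x ⊖ O)) eq l₁≡0 l₂≡0)
    last : l₃ ≢ 0ᴸ → ∃[ ℓ ] ∀ a → dot (l₁ ∷ l₂ ∷ l₃ ∷ []) (φ a) ≡ 0ᴸ → Inc S a ℓ
    last l₃≢0 = case (l₁ ≟ 0ᴸ) of λ where
      (no l₁≢0) → affine (inj₁ l₁≢0) (λ (_ , eq) → l₁≢0 (SL.solve 1 (λ l₁ → l₁ := :0 given (:- :1 ∙ :- l₁ := :0) ∷ [])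
        refl l₁ eq))
      (yes l₁≡0) → case (l₂ ≟ 0ᴸ) of λ where
        (no l₂≢0) → affine (inj₂ l₂≢0) (λ (eq , _) → l₂≢0 eq)
        (yes l₂≡0) → ℓ∞ , at-infinity l₁≡0 l₂≡0 l₃≢0

  iso : BBIso F S L
  iso = record
    { φ = φ ; nonzero = φ-nonzero ; injective = φ-injective ; surjective = φ-surjective
    ; collinear = λ a b c →
        (λ (ℓ , Ia , Ib , Ic) → concurrent⇒Det≡0 (lineCoords ℓ) (φ a) (φ b) (φ c) (lineCoords-nonzero ℓ)
          (Inc⇒dot a ℓ Ia , Inc⇒dot b ℓ Ib , Inc⇒dot c ℓ Ic)) ,
        λ det≡0 → let l , l≢0 , pa , pb , pc = Det≡0⇒concurrent (φ a) (φ b) (φ c) (φ-nonzero a) det≡0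
                      ℓ , on = lineThrough l l≢0
                  in ℓ , on a pa , on b pb , on c pc }

  -- The form x² - yz, which is Y = X² homogenised. Besides 𝒞 the conic has the point (0, 1, 0) at
  -- infinity, of infinite slope.
  conic : QForm
  conic = qform 1ᴸ 0ᴸ 0ᴸ 0ᴸ 0ᴸ (-ᴸ 1ᴸ)

  conic-nondegenerate : NonDegenerate conic
  conic-nondegenerate eq = 2ᴸ≢0 (SL.solve 0 (:1 :+ :1 := :0 given
    (:- :1 ∙ (:1 :+ :1) :* ((:0 :+ :0) :* (:0 :+ :0) :+ :- (:- :1 :* :- :1)) :+ :- (:0 :* (:0 :* (:0 :+ :0) :+ :- (:- :1 :* :0))) :+ :0 :* (:0 :* :- :1 :+ :- ((:0 :+ :0) :* :0)) := :0) ∷ []) refl eq)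

  on-conic : ∀ x → 𝒞 x → OnConic conic (φ (inj₁ x))
  on-conic x 𝒞x = SL.solve 2 (λ x y →
    :1 :* x :* x :+ :0 :* y :* y :+ :0 :* :1 :* :1 :+ :0 :* x :* y :+ :0 :* x :* :1 :+ :- :1 :* y :* :1 := :0 given
    (:- :1 ∙ y := x :* x) ∷ []) refl (X (x ⊖ O)) (Y (x ⊖ O)) (𝒞⇒Y≡X² 𝒞x)

  completesToConic : CompletesToConic F S 𝒞
  completesToConic = L , iso , conic , conic-nondegenerate , on-conic

-- Regularity of the spread of L-lines

module Spreads {n} (F : FiniteField n) {β : Fin n} (E : QuadraticExtension F β) {𝒞 : Subset (Geometry.Pt F)}
  (M : LinearModel F E 𝒞) (2≢0 : FieldLemmas.2# F ≢ FiniteField.0# F) where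
  open FiniteField F
  open FieldLemmas F
  open Vectors F
  open Geometry F
  open QuadraticExtension E
  open LinearModel M
  open L using () renaming (_+_ to infixl 6 _+ᴸ_; _*_ to infixl 7 _*ᴸ_; -_ to infix 8 -ᴸ_; 0# to 0ᴸ; 1# to 1ᴸ)
  open Bruck F E M 2≢0

  z≢0 : ∀ {x y} → ¬ (x ≡ 0# × y ≡ 0#) → z⟨ x , y ⟩ ≢ 0ᴸ
  z≢0 ≢0 eq = ≢0 (free _ _ eq)

  z-inj : ∀ {x y x′ y′} → z⟨ x , y ⟩ ≡ z⟨ x′ , y′ ⟩ → x ≡ x′ × y ≡ y′
  z-inj {x} {y} {x′} {y′} eq =
    let p , r = free (x + - x′) (y + - y′) (trans (cong₂ (λ s t → s +ᴸ t *ᴸ θ) (trans (ι-+ x (- x′)) (cong (ι x +ᴸ_) (ι-neg x′)))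
                  (trans (ι-+ y (- y′)) (cong (ι y +ᴸ_) (ι-neg y′))))
                  (SL.solve 5 (λ x y x' y' θ → x :+ :- x' :+ (y :+ :- y') :* θ := :0
                    given (:1 ∙ x :+ y :* θ := x' :+ y' :* θ) ∷ []) refl (ι x) (ι y) (ι x′) (ι y′) θ eq))
    in x-y≡0⇒x≡y _ _ p , x-y≡0⇒x≡y _ _ r

  X-lin-vec : ∀ a b x y x′ y′ → X (a · vec x y ⊕ b · vec x′ y′) ≡ ι a *ᴸ x +ᴸ ι b *ᴸ x′
  X-lin-vec a b x y x′ y′ = trans (X-lin a b _ _) (cong₂ (λ s t → ι a *ᴸ s +ᴸ ι b *ᴸ t) (X-vec x y) (X-vec x′ y′))
  Y-lin-vec : ∀ a b x y x′ y′ → Y (a · vec x y ⊕ b · vec x′ y′) ≡ ι a *ᴸ y +ᴸ ι b *ᴸ y′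
  Y-lin-vec a b x y x′ y′ = trans (Y-lin a b _ _) (cong₂ (λ s t → ι a *ᴸ s +ᴸ ι b *ᴸ t) (Y-vec x y) (Y-vec x′ y′))

  0v-parts : ∀ {v} → v ≡ 0v → X v ≡ 0ᴸ × Y v ≡ 0ᴸ
  0v-parts eq = trans (cong X eq) X-0 , trans (cong Y eq) Y-0

  -- The transversals of three spread lines L(a , a′), L(b , b′) and
  -- L(a + b , a′ + b′) are the planes spanned by λ(a , a′) and λ(b , b′).
  module Regulus {m : Subset Pt} (m-line : IsLineAtInf m) (a a′ b b′ : E₀) (G≢0 : a *ᴸ b′ +ᴸ -ᴸ (a′ *ᴸ b) ≢ 0ᴸ)
    (i j k : Fin N) (onᵢ : dx i *ᴸ a′ ≡ dy i *ᴸ a) (onⱼ : dx j *ᴸ b′ ≡ dy j *ᴸ b) (onₖ : dx k *ᴸ (a′ +ᴸ b′) ≡ dy k *ᴸ (a +ᴸ b))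
    (transversals : ∀ t → IsLineAtInf t → Meets t (S i) → Meets t (S j) → Meets t (S k) → Meets m t) where

    compare : ∀ {p r p′ r′} → p *ᴸ a +ᴸ r *ᴸ b ≡ p′ *ᴸ a +ᴸ r′ *ᴸ b → p *ᴸ a′ +ᴸ r *ᴸ b′ ≡ p′ *ᴸ a′ +ᴸ r′ *ᴸ b′ → p ≡ p′ × r ≡ r′
    compare {p} {r} {p′} {r′} ex ey =
      FL.cancelˡ G≢0 (SL.solve 8 (λ p r p' r' a b a' b' → (a :* b' :+ :- (a' :* b)) :* p := (a :* b' :+ :- (a' :* b)) :* p' given
        (b' ∙ p :* a :+ r :* b := p' :* a :+ r' :* b) ∷ (:- b ∙ p :* a' :+ r :* b' := p' :* a' :+ r' :* b') ∷ [])
        refl p r p′ r′ a b a′ b′ ex ey) ,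
      FL.cancelˡ G≢0 (SL.solve 8 (λ p r p' r' a b a' b' → (a :* b' :+ :- (a' :* b)) :* r := (a :* b' :+ :- (a' :* b)) :* r' given
        (:- a' ∙ p :* a :+ r :* b := p' :* a :+ r' :* b) ∷ (a ∙ p :* a' :+ r :* b' := p' :* a' :+ r' :* b') ∷ [])
        refl p r p′ r′ a b a′ b′ ex ey)

    module Transversal (l : E₀) (l≢0 : l ≢ 0ᴸ) where
      u w : Pt
      u = vec (l *ᴸ a) (l *ᴸ a′)
      w = vec (l *ᴸ b) (l *ᴸ b′)

      X-uw : ∀ x y → X (x · u ⊕ y · w) ≡ l *ᴸ (ι x *ᴸ a +ᴸ ι y *ᴸ b)
      X-uw x y = trans (X-lin-vec x y _ _ _ _) (SL.solve 5 (λ l a b x y →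
        x :* (l :* a) :+ y :* (l :* b) := l :* (x :* a :+ y :* b) given []) refl l a b (ι x) (ι y))
      Y-uw : ∀ x y → Y (x · u ⊕ y · w) ≡ l *ᴸ (ι x *ᴸ a′ +ᴸ ι y *ᴸ b′)
      Y-uw x y = trans (Y-lin-vec x y _ _ _ _) (SL.solve 5 (λ l a b x y →
        x :* (l :* a) :+ y :* (l :* b) := l :* (x :* a :+ y :* b) given []) refl l a′ b′ (ι x) (ι y))

      independent : Independent u w
      independent x y eq =
        let p , r = compare {ι x} {ι y} {0ᴸ} {0ᴸ}
              (trans (FL.cancel l≢0 (trans (sym (X-uw x y)) (proj₁ (0v-parts eq)))) (SL.solve 2 (λ a b →
                :0 := :0 :* a :+ :0 :* b given []) refl a b))
              (trans (FL.cancel l≢0 (trans (sym (Y-uw x y)) (proj₂ (0v-parts eq)))) (SL.solve 2 (λ a b →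
                :0 := :0 :* a :+ :0 :* b given []) refl a′ b′))
        in ι-zero x p , ι-zero y r
        where
        ι-zero : ∀ x → ι x ≡ 0ᴸ → x ≡ 0#
        ι-zero x eq = case x ≟ 0# of λ where
          (yes x≡0) → x≡0
          (no x≢0) → ⊥-elim (ι≢0 x≢0 eq)

      isLine : IsLineAtInf (Span u w)
      isLine = u , w , independent , λ x → (λ h → h) , (λ h → h)

      on-S : ∀ j x y → dx j *ᴸ y ≡ dy j *ᴸ x → ∀ {v} → X v ≡ l *ᴸ x → Y v ≡ l *ᴸ y → S j v
      on-S j x y eq {v} ex ey = SL.solve 7 (λ d e x y l X Y → d :* Y := e :* X given
        (l ∙ d :* y := e :* x) ∷ (:- e ∙ X := l :* x) ∷ (d ∙ Y := l :* y) ∷ []) refl (dx j) (dy j) x y l (X v) (Y v) eq ex ey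

      u∈ : Span u w u
      u∈ = 1# , 0# , vsolve 0 2 (λ u w → u :≈ :1 :· u :⊕ :0 :· w givenᵛ []) refl u w
      w∈ : Span u w w
      w∈ = 0# , 1# , vsolve 0 2 (λ u w → w :≈ :0 :· u :⊕ :1 :· w givenᵛ []) refl u w

      sum : Pt
      sum = 1# · u ⊕ 1# · w
      sum≢0 : sum ≢ 0v
      sum≢0 eq = 1≢0 (proj₁ (independent 1# 1# eq))
      ι1 : ∀ x y → l *ᴸ (ι 1# *ᴸ x +ᴸ ι 1# *ᴸ y) ≡ l *ᴸ (x +ᴸ y)
      ι1 x y = SL.solve 4 (λ l x y o → l :* (o :* x :+ o :* y) := l :* (x :+ y) given (l :* (x :+ y) ∙ o := :1) ∷ [])
        refl l x y (ι 1#) ι-1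

      meets : Meets m (Span u w)
      meets = transversals (Span u w) isLine
        (u , independent⇒≢0ˡ independent , u∈ , on-S i a a′ onᵢ (X-vec _ _) (Y-vec _ _))
        (w , independent⇒≢0ʳ independent , w∈ , on-S j b b′ onⱼ (X-vec _ _) (Y-vec _ _))
        (sum , sum≢0 , (1# , 1# , refl) , on-S k _ _ onₖ (trans (X-uw 1# 1#) (ι1 a b)) (trans (Y-uw 1# 1#) (ι1 a′ b′)))

      point : ∃[ x ] ∃[ y ] (¬ (x ≡ 0# × y ≡ 0#) × m (x · u ⊕ y · w))
      point = unpack meets
        where
        unpack : Meets m (Span u w) → ∃[ x ] ∃[ y ] (¬ (x ≡ 0# × y ≡ 0#) × m (x · u ⊕ y · w))
        unpack (p , p≢0 , mp , x , y , refl) = x , y , (λ { (refl , refl) → p≢0 (vsolve 0 2 (λ u w →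
          :0 :· u :⊕ :0 :· w :≈ :0v givenᵛ []) refl u w) }) , mp

    1ᴸ≢0 : 1ᴸ ≢ 0ᴸ
    1ᴸ≢0 = FL.1≢0
    θ≢0 : θ ≢ 0ᴸ
    θ≢0 eq = 1≢0 (proj₂ (free 0# 1# (SL.solve 3 (λ z o θ → z :+ o :* θ := :0 given (:1 ∙ z := :0) ∷ (o ∙ θ := :0) ∷ [])
      refl (ι 0#) (ι 1#) θ ι-0 eq)))
    1+θ≢0 : 1ᴸ +ᴸ θ ≢ 0ᴸ
    1+θ≢0 eq = 1≢0 (proj₁ (free 1# 1# (SL.solve 2 (λ o θ → o :+ o :* θ := :0 given (:1 :+ θ ∙ o := :1) ∷
      (:1 ∙ :1 :+ θ := :0) ∷ []) refl (ι 1#) θ ι-1 eq)))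

    module T₁ = Transversal 1ᴸ 1ᴸ≢0
    module T₂ = Transversal θ θ≢0
    module T₃ = Transversal (1ᴸ +ᴸ θ) 1+θ≢0

    -- The points of m on the transversals for λ = 1, θ, 1 + θ determine m.
    in-spread : (∃[ x ] ∃[ y ] (¬ (x ≡ 0# × y ≡ 0#) × m (x · T₁.u ⊕ y · T₁.w))) →
                (∃[ x ] ∃[ y ] (¬ (x ≡ 0# × y ≡ 0#) × m (x · T₂.u ⊕ y · T₂.w))) →
                (∃[ x ] ∃[ y ] (¬ (x ≡ 0# × y ≡ 0#) × m (x · T₃.u ⊕ y · T₃.w))) → ∃[ l ] m ≐ S l
    in-spread (x₁ , y₁ , ≢₁ , m₁) (x₂ , y₂ , ≢₂ , m₂) (x₃ , y₃ , ≢₃ , m₃) = go (in-span m₃) (S-covers p₁ p₁≢0)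
      where
      p₁ p₂ p₃ : Pt
      p₁ = x₁ · T₁.u ⊕ y₁ · T₁.w
      p₂ = x₂ · T₂.u ⊕ y₂ · T₂.w
      p₃ = x₃ · T₃.u ⊕ y₃ · T₃.w
      p₁≢0 : p₁ ≢ 0v
      p₁≢0 eq = ≢₁ (T₁.independent x₁ y₁ eq)

      coefficients : ∀ s t {v} →
        X v ≡ ι s *ᴸ X p₁ +ᴸ ι t *ᴸ X p₂ → Y v ≡ ι s *ᴸ Y p₁ +ᴸ ι t *ᴸ Y p₂ →
        X v ≡ z⟨ s * x₁ , t * x₂ ⟩ *ᴸ a +ᴸ z⟨ s * y₁ , t * y₂ ⟩ *ᴸ b × Y v ≡ z⟨ s * x₁ , t * x₂ ⟩ *ᴸ a′ +ᴸ z⟨ s * y₁ , t * y₂ ⟩ *ᴸ b′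
      coefficients s t {v} ex ey = side a b (X p₁) (X p₂) (X v) (T₁.X-uw x₁ y₁) (T₂.X-uw x₂ y₂) ex ,
                                        side a′ b′ (Y p₁) (Y p₂) (Y v) (T₁.Y-uw x₁ y₁) (T₂.Y-uw x₂ y₂) ey
        where
        side : ∀ a b P Q V → P ≡ 1ᴸ *ᴸ (ι x₁ *ᴸ a +ᴸ ι y₁ *ᴸ b) → Q ≡ θ *ᴸ (ι x₂ *ᴸ a +ᴸ ι y₂ *ᴸ b) → V ≡ ι s *ᴸ P +ᴸ ι t *ᴸ Q →
               V ≡ z⟨ s * x₁ , t * x₂ ⟩ *ᴸ a +ᴸ z⟨ s * y₁ , t * y₂ ⟩ *ᴸ b
        side a b P Q V eP eQ eV = SL.solve 16 (λ a b P Q V θ s t x₁ y₁ x₂ y₂ A B C D →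
          V := (A :+ B :* θ) :* a :+ (C :+ D :* θ) :* b given
          (:1 ∙ V := s :* P :+ t :* Q) ∷ (s ∙ P := :1 :* (x₁ :* a :+ y₁ :* b)) ∷ (t ∙ Q := θ :* (x₂ :* a :+ y₂ :* b)) ∷
          (:- a ∙ A := s :* x₁) ∷ (:- (θ :* a) ∙ B := t :* x₂) ∷ (:- b ∙ C := s :* y₁) ∷ (:- (θ :* b) ∙ D := t :* y₂) ∷ [])
          refl a b P Q V θ (ι s) (ι t) (ι x₁) (ι y₁) (ι x₂) (ι y₂) (ι (s * x₁)) (ι (t * x₂)) (ι (s * y₁)) (ι (t * y₂)) eV eP eQ (ι-* s x₁) (ι-* t x₂) (ι-* s y₁) (ι-* t y₂)

      nonzero-factor : ∀ {s x y} → ¬ (x ≡ 0# × y ≡ 0#) → s * x ≡ 0# → s * y ≡ 0# → s ≡ 0#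
      nonzero-factor {s} ≢0 ex ey = case s ≟ 0# of λ where
        (yes s≡0) → s≡0
        (no s≢0) → ⊥-elim (≢0 (cancel s≢0 ex , cancel s≢0 ey))

      p-independent : Independent p₁ p₂
      p-independent s t eq =
        let cx , cy = coefficients s t {s · p₁ ⊕ t · p₂} (X-lin s t p₁ p₂) (Y-lin s t p₁ p₂)
            za , zb = compare {p′ = 0ᴸ} {r′ = 0ᴸ}
              (trans (sym cx) (trans (proj₁ (0v-parts eq)) (SL.solve 2 (λ a b → :0 := :0 :* a :+ :0 :* b given []) refl a b)))
              (trans (sym cy) (trans (proj₂ (0v-parts eq)) (SL.solve 2 (λ a b → :0 := :0 :* a :+ :0 :* b given []) refl a′ b′)))
            sx , tx = free _ _ za ; sy , ty = free _ _ zb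
        in nonzero-factor ≢₁ sx sy , nonzero-factor ≢₂ tx ty

      in-span : ∀ {v} → m v → Span p₁ p₂ v
      in-span {v} mv = let r , s , _ , m≐ = m-line in span₂ {r} {s} p-independent (proj₁ (m≐ _) m₁) (proj₁ (m≐ _) m₂) (proj₁ (m≐ v) mv)

      go : Span p₁ p₂ p₃ → (∃[ l ] S l p₁) → ∃[ l ] m ≐ S l
      go (s , t , eq) (l , S₁) = l , line-⊂⇒≐ m-line (S-isLine l) λ v mv → let c , d , ev = in-span mv in
          subst (S l) (sym ev) (S-lin {l} c d S₁ S₂)
        where
        cs = coefficients s t {p₃} (trans (cong X eq) (X-lin s t p₁ p₂)) (trans (cong Y eq) (Y-lin s t p₁ p₂))
        expand : ∀ a b → (1ᴸ +ᴸ θ) *ᴸ (ι x₃ *ᴸ a +ᴸ ι y₃ *ᴸ b) ≡ z⟨ x₃ , x₃ ⟩ *ᴸ a +ᴸ z⟨ y₃ , y₃ ⟩ *ᴸ b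
        expand a b = SL.solve 5 (λ a b x y θ → (:1 :+ θ) :* (x :* a :+ y :* b) := (x :+ x :* θ) :* a :+ (y :+ y :* θ) :* b
          given []) refl a b (ι x₃) (ι y₃) θ
        -- Splitting (1 + θ)(x₃, y₃) = s(x₁, y₁) + tθ(x₂, y₂) into its parts for 1 and θ shows that
        -- s(x₁, y₁) and t(x₂, y₂) both equal (x₃, y₃). So p₂ is an L-multiple of p₁, and m is an
        -- L-line.
        zs = compare (trans (sym (trans (T₃.X-uw x₃ y₃) (expand a b))) (proj₁ cs)) (trans (sym (trans (T₃.Y-uw x₃ y₃) (expand a′ b′))) (proj₂ cs))
        ex = z-inj (proj₁ zs)
        ey = z-inj (proj₂ zs)
        t≢0 : t ≢ 0#
        t≢0 t≡0 = ≢₃ (vanish (proj₂ ex) , vanish (proj₂ ey))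
          where
          vanish : ∀ {x y} → x ≡ t * y → x ≡ 0#
          vanish {x} {y} e = solve 3 (λ x y t → x := :0 given (:1 ∙ x := t :* y) ∷ (y ∙ t := :0) ∷ []) refl x y t e t≡0
        S₂ : S l p₂
        S₂ = FL.cancelˡ (ι≢0 t≢0) (SL.solve 17 (λ d e s t θ a b a' b' x₁ y₁ x₂ y₂ P P' Q Q' →
          t :* (d :* Q') := t :* (e :* Q) given
          (t :* d ∙ Q' := θ :* (x₂ :* a' :+ y₂ :* b')) ∷ (:- (t :* e) ∙ Q := θ :* (x₂ :* a :+ y₂ :* b)) ∷
          (:- (s :* d :* θ) ∙ P' := :1 :* (x₁ :* a' :+ y₁ :* b')) ∷ (s :* e :* θ ∙ P := :1 :* (x₁ :* a :+ y₁ :* b)) ∷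
          (s :* θ ∙ d :* P' := e :* P) ∷
          (:- (θ :* (d :* a' :- e :* a)) ∙ s :* x₁ := t :* x₂) ∷
          (:- (θ :* (d :* b' :- e :* b)) ∙ s :* y₁ := t :* y₂) ∷ [])
          refl (dx l) (dy l) (ι s) (ι t) θ a b a′ b′ (ι x₁) (ι y₁) (ι x₂) (ι y₂) (X p₁) (Y p₁) (X p₂) (Y p₂) (T₂.Y-uw x₂ y₂) (T₂.X-uw x₂ y₂) (T₁.Y-uw x₁ y₁) (T₁.X-uw x₁ y₁) S₁ (image x₁ x₂ (trans (sym (proj₁ ex)) (proj₂ ex))) (image y₁ y₂ (trans (sym (proj₁ ey)) (proj₂ ey))))
          where
          image : ∀ x y → s * x ≡ t * y → ι s *ᴸ ι x ≡ ι t *ᴸ ι y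
          image x y e = trans (sym (ι-* s x)) (trans (cong ι e) (ι-* t y))

    regulus⇒spread : ∃[ l ] m ≐ S l
    regulus⇒spread = in-spread T₁.point T₂.point T₃.point

  S-regular : Regular S
  S-regular i j k i≢j j≢k i≢k m m-line transversals =
    Regulus.regulus⇒spread m-line (r *ᴸ dx i) (r *ᴸ dy i) (s *ᴸ dx j) (s *ᴸ dy j)
      (λ eq → FL.*-nonzero (FL.*-nonzero r≢0 s≢0) (det≢0 i≢j) (SL.solve 6 (λ r s x y x' y' →
        r :* s :* (x :* y' :+ :- (y :* x')) := :0 given (:1 ∙ r :* x :* (s :* y') :+ :- (r :* y :* (s :* x')) := :0) ∷ [])
        refl r s (dx i) (dy i) (dx j) (dy j) eq))
      i j k (SL.solve 3 (λ r x y → x :* (r :* y) := y :* (r :* x) given []) refl r (dx i) (dy i)) (SL.solve 3 (λ r x y →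
        x :* (r :* y) := y :* (r :* x) given []) refl s (dx j) (dy j))
      (SL.solve 6 (λ x y x' y' X Y →
        X :* ((X :* y' :+ :- (Y :* x')) :* y :+ (x :* Y :+ :- (y :* X)) :* y') := Y :* ((X :* y' :+ :- (Y :* x')) :* x :+ (x :* Y :+ :- (y :* X)) :* x') given []) refl (dx i) (dy i) (dx j) (dy j) (dx k) (dy k))
      transversals
    where
    -- By Cramer's rule r dᵢ + s dⱼ is a multiple of dₖ, so the chosen vectors on `S i` and `S j`
    -- have their sum on `S k`.
    r s : E₀
    r = dx k *ᴸ dy j +ᴸ -ᴸ (dy k *ᴸ dx j)
    s = dx i *ᴸ dy k +ᴸ -ᴸ (dy i *ᴸ dx k)
    r≢0 : r ≢ 0ᴸ
    r≢0 = det≢0 (λ eq → j≢k (sym eq))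
    s≢0 : s ≢ 0ᴸ
    s≢0 = det≢0 i≢k

-- Other spreads

module Unique {n} (F : FiniteField n) {β : Fin n} (E : QuadraticExtension F β) {𝒞 : Subset (Geometry.Pt F)}
  (M : LinearModel F E 𝒞) (2≢0 : FieldLemmas.2# F ≢ FiniteField.0# F)
  (7≤n : 7 ≤ n) (nonsquare : ∀ κ → FiniteField._*_ F κ κ ≢ β) where
  open FiniteField F
  open FieldLemmas F
  open Vectors F
  open Geometry F
  open QuadraticExtension E
  open LinearModel M
  open L using () renaming (_+_ to infixl 6 _+ᴸ_; _*_ to infixl 7 _*ᴸ_; -_ to infix 8 -ᴸ_; 0# to 0ᴸ; 1# to 1ᴸ)
  open Bruck F E M 2≢0
  open Spreads F E M 2≢0

  -- Without a dependence the K-linear map (a, b) ↦ ap + br from K² is injective, so it is onto L,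
  -- which has as many elements.
  dependent-or-spanning : ∀ p r → (∃[ a ] ∃[ b ] (¬ (a ≡ 0# × b ≡ 0#) × ι a *ᴸ p +ᴸ ι b *ᴸ r ≡ 0ᴸ))
                                ⊎ (∀ t → ∃[ a ] ∃[ b ] ι a *ᴸ p +ᴸ ι b *ᴸ r ≡ t)
  dependent-or-spanning p r = case any? (λ a → any? λ b → ¬? ((a ≟ 0#) ×-dec (b ≟ 0#)) ×-dec (value a b ≟ 0ᴸ)) of λ where
      (yes dependent) → inj₁ dependent
      (no none) → inj₂ λ t → let k , eq = inj⇒surj f (f-inj none) t in _ , _ , eq
    where
    value : K → K → E₀
    value a b = ι a *ᴸ p +ᴸ ι b *ᴸ r
    re im : E₀ → K
    re k = proj₁ (remQuot {n} n k)
    im k = proj₂ (remQuot {n} n k)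
    f : E₀ → E₀
    f k = value (re k) (im k)
    f-inj : ¬ (∃[ a ] ∃[ b ] (¬ (a ≡ 0# × b ≡ 0#) × value a b ≡ 0ᴸ)) → Inj f
    f-inj none {k} {l} eq = trans (sym (combine-remQuot {n} n k)) (trans (cong₂ combine (proj₁ same) (proj₂ same)) (combine-remQuot {n} n l))
      where
      value≡0 : value (re k + - re l) (im k + - im l) ≡ 0ᴸ
      value≡0 = trans (cong₂ (λ s t → s *ᴸ p +ᴸ t *ᴸ r) (trans (ι-+ _ _) (cong (ι (re k) +ᴸ_) (ι-neg _))) (trans (ι-+ _ _) (cong (ι (im k) +ᴸ_) (ι-neg _))))
        (SL.solve 6 (λ p r a b a' b' → (a :+ :- a') :* p :+ (b :+ :- b') :* r := :0
          given (:1 ∙ a :* p :+ b :* r := a' :* p :+ b' :* r) ∷ []) refl p r (ι (re k)) (ι (im k)) (ι (re l)) (ι (im l)) eq)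
      same : re k ≡ re l × im k ≡ im l
      same = decidable-stable ((re k ≟ re l) ×-dec (im k ≟ im l)) λ differ →
        none (_ , _ , (λ (p , r) → differ (x-y≡0⇒x≡y _ _ p , x-y≡0⇒x≡y _ _ r)) , value≡0)

  -- 2kp - g(k² + β) = - g((k - p/g)² - ((p/g)² - β)), so three values of k
  -- are enough for g ≢ 0.
  choose : ∀ p g → ¬ (p ≡ 0# × g ≡ 0#) →
           ∃[ k ] (g * k + - p ≢ 0# × g * (k * k + β) + - (k * p + k * p) ≢ 0#)
  choose p g ≢0 = case g ≟ 0# of λ where
      (yes g≡0) → let p≢0 = λ p≡0 → ≢0 (p≡0 , g≡0) in 1# ,
        (λ eq → p≢0 (solve 2 (λ p g → p := :0 given (:- :1 ∙ g :* :1 :+ :- p := :0) ∷ (:1 ∙ g := :0) ∷ []) refl p g eq g≡0)) ,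
        (λ eq → *-nonzero 2≢0 p≢0 (solve 3 (λ p g β → (:1 :+ :1) :* p := :0
          given (:- :1 ∙ g :* (:1 :* :1 :+ β) :+ :- (:1 :* p :+ :1 :* p) := :0) ∷ (:1 :+ β ∙ g := :0) ∷ []) refl p g β eq g≡0))
      (no g≢0) → shifted g≢0
    where
    module _ (g≢0 : g ≢ 0#) where
      i = inv g g≢0
      q = p * i
      at : ∀ h → h ≢ 0# → h * h ≢ q * q + - β →
           ∃[ k ] (g * k + - p ≢ 0# × g * (k * k + β) + - (k * p + k * p) ≢ 0#)
      at h h≢0 h²≢ = q + h ,
        (λ eq → *-nonzero g≢0 h≢0 (solve 4 (λ p g i h → g :* h := :0 given (:1 ∙ g :* (p :* i :+ h) :+ :- p := :0) ∷
          (:- p ∙ g :* i := :1) ∷ []) refl p g i h eq (x*inv≡1 g g≢0))) ,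
        (λ eq → *-nonzero g≢0 (x≢y⇒x-y≢0 h²≢) (solve 5 (λ p g i h β → g :* (h :* h :+ :- (p :* i :* (p :* i) :+ :- β)) := :0 given
          (:1 ∙ g :* ((p :* i :+ h) :* (p :* i :+ h) :+ β) :+ :- ((p :* i :+ h) :* p :+ (p :* i :+ h) :* p) := :0) ∷
          (:- (p :* h :+ p :* h :+ p :* (p :* i) :+ p :* (p :* i)) ∙ g :* i := :1) ∷ []) refl p g i h β eq (x*inv≡1 g g≢0)))
      shifted : ∃[ k ] (g * k + - p ≢ 0# × g * (k * k + β) + - (k * p + k * p) ≢ 0#)
      -- If h = 1 gives the forbidden square, only 1 and - 1 give it, and any h other than 0, 1 and
      -- - 1 will do.
      shifted = case 1# * 1# ≟ q * q + - β of λ where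
          (no ≢) → at 1# 1≢0 ≢
          (yes eq) → at h (av (here refl)) λ h² → *-nonzero (x≢y⇒x-y≢0 (av (there (here refl)))) (x≢y⇒x-y≢0 (av (there (there (here refl)))))
            (solve 2 (λ h q' → (h :+ :- :1) :* (h :+ :- (:- :1)) := :0 given (:1 ∙ h :* h := q') ∷
              (:- :1 ∙ :1 :* :1 := q') ∷ []) refl h (q * q + - β) h² eq)
        where
        other = avoid _≟_ (λ (x : K) → x) (λ eq → eq) 1 (0# ∷ 1# ∷ - 1# ∷ []) (ℕ.≤-trans (s≤s (s≤s (s≤s (s≤s z≤n)))) 7≤n)
        h = proj₁ other zero
        av = proj₂ (proj₂ other) zero

  module _ (S′ : Spread) (S′-spread : IsSpread S′) (S′-arc : IsBBArc S′ 𝒞 (n *ℕ n)) where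
    private
      isLine = proj₁ S′-spread
      covers = proj₂ (proj₂ S′-spread)

    S′-same : ∀ {i j v} → v ≢ 0v → S′ i v → S′ j v → i ≡ j
    S′-same {i} {j} {v} v≢0 Si Sj = decidable-stable (i ≟ j) λ i≢j → v≢0 (proj₁ (proj₂ S′-spread) i j i≢j v Si Sj)

    S′-lin : ∀ {j u v} a b → S′ j u → S′ j v → S′ j (a · u ⊕ b · v)
    S′-lin {j} a b = line-lin a b (isLine j)

    S′-· : ∀ {j v} a → S′ j v → S′ j (a · v)
    S′-· {j} {v} a Sv = subst (S′ j) (vsolve 1 1 (λ a v → a :· v :⊕ :0 :· v :≈ a :· v givenᵛ []) refl a v) (S′-lin {j} a 0# Sv Sv)

    S′-span : ∀ {j u v w} → Independent u v → S′ j u → S′ j v → S′ j w → Span u v w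
    S′-span {j} ind Su Sv Sw = let r , s , _ , S≐ = isLine j in span₂ {r} {s} ind (proj₁ (S≐ _) Su) (proj₁ (S≐ _) Sv) (proj₁ (S≐ _) Sw)

    pt : E₀ → Pt
    pt x = O ⊕ vec x (x *ᴸ x)

    X-pt : ∀ x → X (pt x ⊖ O) ≡ x
    X-pt x = trans (cong X (vsolve 0 2 (λ o v → o :⊕ v :⊖ o :≈ v givenᵛ []) refl O (vec x (x *ᴸ x)))) (X-vec _ _)

    -- The hypothesis is the condition for `v` to be a chord of Y = X² that starts at the abscissa
    -- x.
    pt-shift : ∀ x v → Y v ≡ X v *ᴸ (x +ᴸ x +ᴸ X v) → pt (x +ᴸ X v) ≡ pt x ⊕ v
    pt-shift x v eq = trans (cong (O ⊕_) (ext
        (trans (X-vec _ _) (sym (trans (X-⊕ _ v) (cong (_+ᴸ X v) (X-vec _ _)))))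
        (trans (Y-vec _ _) (trans (SL.solve 3 (λ x d e → (x :+ d) :* (x :+ d) := x :* x :+ e
          given (:- :1 ∙ e := d :* (x :+ x :+ d)) ∷ []) refl x (X v) (Y v) eq)
          (sym (trans (Y-⊕ _ v) (cong (_+ᴸ Y v) (Y-vec _ _))))))))
      (vsolve 0 3 (λ o p v → o :⊕ (p :⊕ v) :≈ o :⊕ p :⊕ v givenᵛ []) refl O (vec x (x *ᴸ x)) v)

    -- The start and the two ends would be collinear in the plane of `S′`. This is the form in which
    -- the arc hypothesis is used from here on.
    no-two-chords : ∀ j x v v′ → S′ j v → S′ j v′ → X v ≢ 0ᴸ → X v′ ≢ 0ᴸ → X v ≢ X v′ →
      Y v ≡ X v *ᴸ (x +ᴸ x +ᴸ X v) → Y v′ ≡ X v′ *ᴸ (x +ᴸ x +ᴸ X v′) → ⊥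
    no-two-chords j x v v′ Sv Sv′ d≢0 d′≢0 d≢d′ ev ev′ =
      proj₂ S′-arc (pt x) (pt (x +ᴸ X v)) (pt (x +ᴸ X v′)) (on-𝒞 _) (on-𝒞 _) (on-𝒞 _)
        ((λ eq → d≢0 (SL.solve 2 (λ x d → d := :0 given (:- :1 ∙ x := x :+ d) ∷ []) refl x (X v) (pt-inj eq))) ,
         (λ eq → d≢d′ (SL.solve 3 (λ x d e → d := e given (:1 ∙ x :+ d := x :+ e) ∷ []) refl x (X v) (X v′) (pt-inj eq))) ,
         (λ eq → d′≢0 (SL.solve 2 (λ x d → d := :0 given (:- :1 ∙ x := x :+ d) ∷ []) refl x (X v′) (pt-inj eq))))
        (aff (pt x) j , (0# · v , S′-· {j} 0# Sv , (vsolve 0 2 (λ p v → p :≈ p :⊕ :0 :· v givenᵛ [])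
          refl (pt x) v)) , (v , Sv , pt-shift x v ev) , (v′ , Sv′ , pt-shift x v′ ev′))
      where
      pt-inj : ∀ {x y} → pt x ≡ pt y → x ≡ y
      pt-inj {x} {y} eq = trans (sym (X-pt x)) (trans (cong (λ p → X (p ⊖ O)) eq) (X-pt y))

    -- X is a K-linear map from a spread line to L, both of dimension 2 over K: it is bijective or
    -- has a kernel.
    Graph Vertical : Fin N → Set
    Graph j = ∃[ u ] ∃[ w ] (S′ j u × S′ j w × X u ≡ 1ᴸ × X w ≡ θ)
    Vertical j = ∃[ w ] (S′ j w × w ≢ 0v × X w ≡ 0ᴸ)

    classify : ∀ j → Vertical j ⊎ Graph j
    classify j = go (isLine j)
      where
      go : IsLineAtInf (S′ j) → Vertical j ⊎ Graph j
      go (u , w , ind , S≐) = case dependent-or-spanning (X u) (X w) of λ where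
          (inj₁ (a , b , ≢0 , eq)) → inj₁ (a · u ⊕ b · w , in-S a b , (λ e → ≢0 (ind a b e)) , trans (X-lin a b u w) eq)
          (inj₂ span) → let a , b , e₁ = span 1ᴸ ; c , d , e₂ = span θ in
            inj₂ (_ , _ , in-S a b , in-S c d , trans (X-lin a b u w) e₁ , trans (X-lin c d u w) e₂)
        where
        in-S : ∀ a b → S′ j (a · u ⊕ b · w)
        in-S a b = proj₂ (S≐ _) (a , b , refl)

    module OnGraph {j} {u w} (Su : S′ j u) (Sw : S′ j w) (Xu : X u ≡ 1ᴸ) (Xw : X w ≡ θ) where
      -- The spread line is the graph of the K-linear map with 1 ↦ `Y u` and θ ↦ `Y w`; δ measures
      -- how far this map is from being L-linear.
      δ : E₀
      δ = Y w +ᴸ -ᴸ (θ *ᴸ Y u)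

      X-uw : ∀ a b → X (a · u ⊕ b · w) ≡ z⟨ a , b ⟩
      X-uw a b = trans (X-lin a b u w) (SL.solve 5 (λ a b θ U W → a :* U :+ b :* W := a :+ b :* θ given (a ∙ U := :1) ∷
        (b ∙ W := θ) ∷ []) refl (ι a) (ι b) θ (X u) (X w) Xu Xw)

      independent : Independent u w
      independent a b eq = free a b (trans (sym (X-uw a b)) (proj₁ (0v-parts eq)))

      -- For δ = p + gθ ≢ 0 the chords rv and r′(w + kv) start at one point.
      collide : ∀ p g → δ ≡ z⟨ p , g ⟩ → ¬ (p ≡ 0# × g ≡ 0#) → ⊥
      collide p g δ≡ ≢0 = go (choose p g ≢0)
        where
        go : ∃[ k ] (g * k + - p ≢ 0# × g * (k * k + β) + - (k * p + k * p) ≢ 0#) → ⊥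
        go (k , A≢0 , B≢0) = no-two-chords j x v v′ (S′-lin {j} r 0# Su Sw) (S′-lin {j} (r′ * k) r′ Su Sw)
            (λ eq → z≢0 (λ (r≡0 , _) → r≢0 r≡0) (trans (sym (X-uw r 0#)) eq))
            (λ eq → z≢0 (λ (_ , r′≡0) → r′≢0 r′≡0) (trans (sym (X-uw (r′ * k) r′)) eq))
            (λ eq → r′≢0 (sym (proj₂ (z-inj (trans (sym (X-uw r 0#)) (trans eq (X-uw (r′ * k) r′)))))))
            chord₁ chord₂
          where
          N≢0 : k * k + - β ≢ 0#
          N≢0 eq = nonsquare k (x-y≡0⇒x≡y _ _ eq)
          i = inv _ N≢0
          -- The chords start at the same abscissa x if Y u - r = 2x and Y u + δ/(k + θ) - r′(k + θ)
          -- = 2x, that is, if δ = r′(k + θ)² - r(k + θ). Comparing the parts for 1 and θ determines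
          -- r and r′; `choose` makes both nonzero.
          r r′ : K
          r′ = i * (g * k + - p)
          r = i * (g * (k * k + β) + - (k * p + k * p))
          r≢0 : r ≢ 0#
          r≢0 = *-nonzero (inv≢0 _ N≢0) B≢0
          r′≢0 : r′ ≢ 0#
          r′≢0 = *-nonzero (inv≢0 _ N≢0) A≢0
          g≡ : g ≡ r′ * k + r′ * k + - r
          g≡ = solve 5 (λ g p k i β →
            g := i :* (g :* k :+ :- p) :* k :+ i :* (g :* k :+ :- p) :* k :+ :- (i :* (g :* (k :* k :+ β) :+ :- (k :* p :+ k :* p))) given
            (:- g ∙ (k :* k :+ :- β) :* i := :1) ∷ []) refl g p k i β (x*inv≡1 _ N≢0)
          p≡ : p ≡ r′ * (k * k) + r′ * β + - (r * k)
          p≡ = solve 5 (λ g p k i β →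
            p := i :* (g :* k :+ :- p) :* (k :* k) :+ i :* (g :* k :+ :- p) :* β :+ :- (i :* (g :* (k :* k :+ β) :+ :- (k :* p :+ k :* p)) :* k) given
            (:- p ∙ (k :* k :+ :- β) :* i := :1) ∷ []) refl g p k i β (x*inv≡1 _ N≢0)
          ιg≡ : ι g ≡ ι r′ *ᴸ ι k +ᴸ ι r′ *ᴸ ι k +ᴸ -ᴸ ι r
          ιg≡ = trans (cong ι g≡) (trans (ι-+ _ _) (cong₂ _+ᴸ_ (trans (ι-+ _ _) (cong₂ _+ᴸ_ (ι-* _ _) (ι-* _ _))) (ι-neg _)))
          ιp≡ : ι p ≡ ι r′ *ᴸ (ι k *ᴸ ι k) +ᴸ ι r′ *ᴸ ι β +ᴸ -ᴸ (ι r *ᴸ ι k)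
          ιp≡ = trans (cong ι p≡) (trans (ι-+ _ _) (cong₂ _+ᴸ_ (trans (ι-+ _ _) (cong₂ _+ᴸ_ (trans (ι-* _ _) (cong (ι r′ *ᴸ_) (ι-* _ _))) (ι-* _ _)))
            (trans (ι-neg _) (cong -ᴸ_ (ι-* _ _)))))
          v v′ : Pt
          v = r · u ⊕ 0# · w
          v′ = (r′ * k) · u ⊕ r′ · w
          half : E₀
          half = FL.inv _ 2ᴸ≢0
          x : E₀
          x = half *ᴸ (Y u +ᴸ -ᴸ ι r)
          2x : x +ᴸ x ≡ Y u +ᴸ -ᴸ ι r
          2x = SL.solve 3 (λ h y r → h :* (y :+ :- r) :+ h :* (y :+ :- r) := y :+ :- r
            given (y :- r ∙ (:1 :+ :1) :* h := :1) ∷ []) refl half (Y u) (ι r) (FL.x*inv≡1 _ 2ᴸ≢0)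
          chord₁ : Y v ≡ X v *ᴸ (x +ᴸ x +ᴸ X v)
          chord₁ = SL.solve 8 (λ y y' d e x r z θ → e := d :* (x :+ x :+ d) given
            (:1 ∙ e := r :* y :+ z :* y') ∷ (:- (x :+ x :+ d :+ r) ∙ d := r :+ z :* θ) ∷
            (:- r ∙ x :+ x := y :+ :- r) ∷ (y' :- (x :+ x :+ d :+ r) :* θ ∙ z := :0) ∷ [])
            refl (Y u) (Y w) (X v) (Y v) x (ι r) (ι 0#) θ (Y-lin r 0# u w) (X-uw r 0#) 2x ι-0
          chord₂ : Y v′ ≡ X v′ *ᴸ (x +ᴸ x +ᴸ X v′)
          chord₂ = SL.solve 13 (λ y y' d e x r r' s k p g β θ → e := d :* (x :+ x :+ d) given
            (:1 ∙ e := s :* y :+ r' :* y') ∷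
            (:- (x :+ x :+ d :+ r' :* (k :+ θ)) ∙ d := s :+ r' :* θ) ∷
            (:- (r' :* (k :+ θ)) ∙ x :+ x := y :+ :- r) ∷
            (y :- (x :+ x :+ d :+ r' :* (k :+ θ)) ∙ s := r' :* k) ∷
            (r' ∙ y' :+ :- (θ :* y) := p :+ g :* θ) ∷
            (r' ∙ p := r' :* (k :* k) :+ r' :* β :+ :- (r :* k)) ∷
            (r' :* θ ∙ g := r' :* k :+ r' :* k :+ :- r) ∷
            (:- (r' :* r') ∙ θ :* θ := β) ∷ [])
            refl (Y u) (Y w) (X v′) (Y v′) x (ι r) (ι r′) (ι (r′ * k)) (ι k) (ι p) (ι g) (ι β) θ (Y-lin (r′ * k) r′ u w) (X-uw (r′ * k) r′) 2x (ι-* r′ k) δ≡ ιp≡ ιg≡ θ²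

      δ≡0 : δ ≡ 0ᴸ
      δ≡0 = decidable-stable (δ ≟ 0ᴸ) λ δ≢0 → let p , g , eq = split δ in
        collide p g eq λ (p≡0 , g≡0) → δ≢0 (trans eq (trans (cong₂ z⟨_,_⟩ p≡0 g≡0) (SL.solve 2 (λ z θ → z :+ z :* θ := :0
          given (:1 :+ θ ∙ z := :0) ∷ []) refl (ι 0#) θ ι-0)))

      graph⇒S : ∃[ i ] (dx i ≡ 1ᴸ × dy i ≡ Y u × S′ j ≐ S i)
      graph⇒S = let i , dx≡1 , dy≡ = slope-one (Y u) in i , dx≡1 , dy≡ , line-⊂⇒≐ (isLine j) (S-isLine i) λ v Sv →
        let a , b , eq = S′-span {j} independent Su Sw Sv in subst (S i) (sym eq) (S-lin {i} a b
          (SL.solve 4 (λ d e U y → d :* y := e :* U given (y ∙ d := :1) ∷ (:- U ∙ e := y) ∷ (:- y ∙ U := :1) ∷ [])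
            refl (dx i) (dy i) (X u) (Y u) dx≡1 dy≡ Xu)
          (SL.solve 6 (λ d e U y y' θ → d :* y' := e :* U given (y' ∙ d := :1) ∷ (:- U ∙ e := y) ∷
            (:- y ∙ U := θ) ∷ (:1 ∙ y' :+ :- (θ :* y) := :0) ∷ []) refl (dx i) (dy i) (X w) (Y u) (Y w) θ dx≡1 dy≡ Xw δ≡0))

    -- A counterexample of slope b: a spread line with a vertical vector that is not the line X = 0.
    Mixed : E₀ → Set
    Mixed b = ∃[ j ] (Vertical j × ∃[ u ] (S′ j u × X u ≢ 0ᴸ × Y u ≡ b *ᴸ X u))

    vec≢0 : ∀ {x y} → x ≢ 0ᴸ → vec x y ≢ 0v
    vec≢0 x≢0 eq = x≢0 (trans (sym (X-vec _ _)) (proj₁ (0v-parts eq)))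

    -- If some line of slope b is not L(1 , b), then none is.
    mixed-vertical : ∀ {b x j} → Mixed b → x ≢ 0ᴸ → S′ j (vec x (b *ᴸ x)) → Vertical j
    mixed-vertical {b} {x} {j} (j₀ , (w , Sw , w≢0 , Xw) , u , Su , Xu≢0 , Yu) x≢0 Sv = case classify j of λ where
        (inj₁ vertical) → vertical
        (inj₂ (u′ , w′ , Su′ , Sw′ , Xu′ , Xw′)) → ⊥-elim (go (OnGraph.graph⇒S {j} Su′ Sw′ Xu′ Xw′))
      where
      -- A graph is an L-line. Containing a vector of slope b, it contains `u`, so it is the mixed
      -- line; but an L-line of finite slope has no vertical vector.
      go : ∀ {a} → ∃[ i ] (dx i ≡ 1ᴸ × dy i ≡ a × S′ j ≐ S i) → ⊥
      go {a} (i , dx≡1 , dy≡a , S≐) = w≢0 (zero-vec Xw (SL.solve 4 (λ d e X Y → Y := :0 given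
          (:1 ∙ d :* Y := e :* X) ∷ (:- Y ∙ d := :1) ∷ (e ∙ X := :0) ∷ [])
          refl (dx i) (dy i) (X w) (Y w) (proj₁ (S≐ w) (subst (λ j → S′ j w) (sym j≡j₀) Sw)) dx≡1 Xw))
        where
        dy≡b : dy i ≡ b
        dy≡b = FL.cancelˡ x≢0 (SL.solve 6 (λ d e b x X Y → x :* e := x :* b given
          (:- :1 ∙ d :* Y := e :* X) ∷ (:- e ∙ X := x) ∷ (d ∙ Y := b :* x) ∷ (b :* x ∙ d := :1) ∷ [])
          refl (dx i) (dy i) b x (X (vec x (b *ᴸ x))) (Y (vec x (b *ᴸ x))) (proj₁ (S≐ _) Sv) (X-vec _ _) (Y-vec _ _) dx≡1)
        j≡j₀ : j ≡ j₀
        j≡j₀ = S′-same {v = u} (λ eq → Xu≢0 (proj₁ (0v-parts eq))) (proj₂ (S≐ u)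
          (SL.solve 5 (λ d e b X Y → d :* Y := e :* X given (Y ∙ d := :1) ∷ (:1 ∙ Y := b :* X) ∷ (:- X ∙ e := b) ∷ [])
            refl (dx i) (dy i) b (X u) (Y u) dx≡1 Yu dy≡b)) Su

    Y≢0 : ∀ {w} → w ≢ 0v → X w ≡ 0ᴸ → Y w ≢ 0ᴸ
    Y≢0 w≢0 Xw Yw = w≢0 (zero-vec Xw Yw)

    -- With (1 , b) and (0 , m) in one spread line, the line through
    -- (m , bm) contains (0 , m²): it has the direction of a C-plane.
    module Impossible {b} (mixed : Mixed b) where
      j₁ : Fin N
      j₁ = proj₁ (covers (vec 1ᴸ (b *ᴸ 1ᴸ)) (vec≢0 FL.1≢0))
      S₁ : S′ j₁ (vec 1ᴸ (b *ᴸ 1ᴸ))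
      S₁ = proj₂ (covers (vec 1ᴸ (b *ᴸ 1ᴸ)) (vec≢0 FL.1≢0))

      module WithFirst {w₁} (Sw₁ : S′ j₁ w₁) (w₁≢0 : w₁ ≢ 0v) (Xw₁ : X w₁ ≡ 0ᴸ) where
        m : E₀
        m = Y w₁
        m≢0 : m ≢ 0ᴸ
        m≢0 = Y≢0 w₁≢0 Xw₁
        j₂ : Fin N
        j₂ = proj₁ (covers (vec m (b *ᴸ m)) (vec≢0 m≢0))
        S₂ : S′ j₂ (vec m (b *ᴸ m))
        S₂ = proj₂ (covers (vec m (b *ᴸ m)) (vec≢0 m≢0))

        module WithSecond {w₂} (Sw₂ : S′ j₂ w₂) (w₂≢0 : w₂ ≢ 0v) (Xw₂ : X w₂ ≡ 0ᴸ) where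
          i = FL.inv m m≢0
          -- (m, bm) + (0, Y w₂) = (m, b′m), so the line j₂ shows that the slope b′ is mixed as
          -- well.
          g b′ : E₀
          g = Y w₂ *ᴸ i
          b′ = b +ᴸ g
          mixed′ : Mixed b′
          mixed′ = j₂ , (w₂ , Sw₂ , w₂≢0 , Xw₂) , u , S′-lin {j₂} 1# 1# S₂ Sw₂ , (λ eq → m≢0 (trans (sym Xu) eq)) , (
              SL.solve 8 (λ b m e i X V Y o → Y := (b :+ e :* i) :* X given
                (:1 ∙ Y := o :* V :+ o :* e) ∷ (V :+ e ∙ o := :1) ∷ (:1 ∙ V := b :* m) ∷
                (:- (b :+ e :* i) ∙ X := m) ∷ (:- e ∙ m :* i := :1) ∷ [])
                refl b m (Y w₂) i (X u) (Y (vec m (b *ᴸ m))) (Y u) (ι 1#) (Y-lin 1# 1# _ w₂) ι-1 (Y-vec _ _) Xu (FL.x*inv≡1 m m≢0))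
            where
            u : Pt
            u = 1# · vec m (b *ᴸ m) ⊕ 1# · w₂
            Xu : X u ≡ m
            Xu = SL.solve 5 (λ m o V W X → X := m given
              (:1 ∙ X := o :* V :+ o :* W) ∷ (V ∙ o := :1) ∷ (:1 ∙ V := m) ∷ (o ∙ W := :0) ∷ [])
              refl m (ι 1#) (X (vec m (b *ᴸ m))) (X w₂) (X u) (X-lin 1# 1# _ w₂) ι-1 (X-vec _ _) Xw₂
          j₃ : Fin N
          j₃ = proj₁ (covers (vec 1ᴸ (b′ *ᴸ 1ᴸ)) (vec≢0 FL.1≢0))
          S₃ : S′ j₃ (vec 1ᴸ (b′ *ᴸ 1ᴸ))
          S₃ = proj₂ (covers (vec 1ᴸ (b′ *ᴸ 1ᴸ)) (vec≢0 FL.1≢0))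

          module WithThird {w₃} (Sw₃ : S′ j₃ w₃) (w₃≢0 : w₃ ≢ 0v) (Xw₃ : X w₃ ≡ 0ᴸ) where
            dependent-case : ∀ a c → ¬ (a ≡ 0# × c ≡ 0#) → ι a *ᴸ Y w₁ +ᴸ ι c *ᴸ Y w₃ ≡ 0ᴸ → j₁ ≡ j₃
            dependent-case a c ≢0 eq = S′-same (·≢0 c≢0 w₃≢0) (subst (S′ j₁) (sym same) (S′-· {j₁} (- a) Sw₁)) (S′-· {j₃} c Sw₃)
              where
              both≡0 : a · w₁ ⊕ c · w₃ ≡ 0v
              both≡0 = zero-vec (SL.solve 5 (λ a c U W V → V := :0 given
                (:1 ∙ V := a :* U :+ c :* W) ∷ (a ∙ U := :0) ∷ (c ∙ W := :0) ∷ [])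
                refl (ι a) (ι c) (X w₁) (X w₃) (X (a · w₁ ⊕ c · w₃)) (X-lin a c w₁ w₃) Xw₁ Xw₃) (trans (Y-lin a c w₁ w₃) eq)
              same : c · w₃ ≡ (- a) · w₁
              same = vsolve 2 2 (λ a c u w → c :· w :≈ :- a :· u givenᵛ (:1 ∙ᵛ a :· u :⊕ c :· w :≈ :0v) ∷ [])
                refl a c w₁ w₃ both≡0
              c≢0 : c ≢ 0#
              c≢0 c≡0 = ≢0 (·-cancel w₁≢0 (vsolve 2 2 (λ a c u w → a :· u :≈ :0v givenᵛ (:1 ∙ᵛ a :· u :⊕ c :· w :≈ :0v) ∷
                (:0v :⊖ w ∙ˢ c := :0) ∷ []) refl a c w₁ w₃ both≡0 c≡0) , c≡0)

            spanning-case : ∀ a c → ι a *ᴸ Y w₁ +ᴸ ι c *ᴸ Y w₃ ≡ g → j₁ ≡ j₃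
            spanning-case a c eq = S′-same {v = v} v≢0 (S′-lin {j₁} 1# a S₁ Sw₁) (subst (S′ j₃) (sym same) (S′-lin {j₃} 1# (- c) S₃ Sw₃))
              where
              v v₃ : Pt
              v = 1# · vec 1ᴸ (b *ᴸ 1ᴸ) ⊕ a · w₁
              v₃ = 1# · vec 1ᴸ (b′ *ᴸ 1ᴸ) ⊕ (- c) · w₃
              X≡1 : ∀ {s y w} → X w ≡ 0ᴸ → X (1# · vec 1ᴸ y ⊕ s · w) ≡ 1ᴸ
              X≡1 {s} {y} {w} Xw = SL.solve 5 (λ s o V W X → X := :1 given
                (:1 ∙ X := o :* V :+ s :* W) ∷ (o ∙ V := :1) ∷ (:1 ∙ o := :1) ∷ (s ∙ W := :0) ∷ [])
                refl (ι s) (ι 1#) (X (vec 1ᴸ y)) (X w) (X (1# · vec 1ᴸ y ⊕ s · w)) (X-lin 1# s _ w) (X-vec _ _) ι-1 Xw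
              same : v ≡ v₃
              same = ext (trans (X≡1 Xw₁) (sym (X≡1 Xw₃)))
                (SL.solve 12 (λ b g a c c' o m f V V₃ P Q → P := Q given
                  (:1 ∙ P := o :* V :+ a :* m) ∷ (:- :1 ∙ Q := o :* V₃ :+ c' :* f) ∷
                  (o ∙ V := b :* :1) ∷ (:- o ∙ V₃ := (b :+ g) :* :1) ∷ (:- g ∙ o := :1) ∷
                  (:1 ∙ a :* m :+ c :* f := g) ∷ (:- f ∙ c' := :- c) ∷ [])
                  refl b g (ι a) (ι c) (ι (- c)) (ι 1#) (Y w₁) (Y w₃) (Y (vec 1ᴸ (b *ᴸ 1ᴸ))) (Y (vec 1ᴸ (b′ *ᴸ 1ᴸ))) (Y v) (Y v₃) (Y-lin 1# a _ w₁) (Y-lin 1# (- c) _ w₃) (Y-vec _ _) (Y-vec _ _) ι-1 eq (ι-neg c))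
              v≢0 : v ≢ 0v
              v≢0 eq = FL.1≢0 (trans (sym (X≡1 {a} {b *ᴸ 1ᴸ} Xw₁)) (proj₁ (0v-parts eq)))

            -- Let f be `Y w₃`. If m and f are dependent over K, the two lines have a vertical
            -- vector in common. Otherwise they span L, and (1, b) + a(0, m) = (1, b′) - c(0, f) for
            -- suitable a and c in K.
            j₁≡j₃ : j₁ ≡ j₃
            j₁≡j₃ = case dependent-or-spanning (Y w₁) (Y w₃) of λ where
              (inj₁ (a , c , ≢0 , eq)) → dependent-case a c ≢0 eq
              (inj₂ span) → let a , c , eq = span g in spanning-case a c eq

            h : Pt
            h = 1# · vec 1ᴸ (b′ *ᴸ 1ᴸ) ⊕ (- 1#) · vec 1ᴸ (b *ᴸ 1ᴸ)
            Sh : S′ j₁ h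
            Sh = S′-lin {j₁} 1# (- 1#) (subst (λ j → S′ j (vec 1ᴸ (b′ *ᴸ 1ᴸ))) (sym j₁≡j₃) S₃) S₁
            Xh : X h ≡ 0ᴸ
            Xh = SL.solve 3 (λ o n X → X := :0 given (:1 ∙ X := o :* :1 :+ n :* :1) ∷ (:1 ∙ n := :- o) ∷ [])
              refl (ι 1#) (ι (- 1#)) (X h) (X-lin-vec _ _ _ _ _ _) (ι-neg 1#)
            Yh : Y h ≡ g
            Yh = SL.solve 5 (λ b g o n Y → Y := g given (:1 ∙ Y := o :* ((b :+ g) :* :1) :+ n :* (b :* :1)) ∷
              (b ∙ n := :- o) ∷ (g ∙ o := :1) ∷ []) refl b g (ι 1#) (ι (- 1#)) (Y h) (Y-lin-vec _ _ _ _ _ _) (ι-neg 1#) ι-1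

            -- (0, g) = (1, b′) - (1, b) is on j₁, whose vertical vectors are the K-multiples of (0,
            -- m).
            proportional : ∃[ a ] g ≡ ι a *ᴸ m
            proportional = go (S′-span {j₁} ind S₁ Sw₁ Sh)
              where
              ind : Independent (vec 1ᴸ (b *ᴸ 1ᴸ)) w₁
              ind a c eq = a≡0 , ·-cancel w₁≢0 (vsolve 2 2 (λ a c V w → c :· w :≈ :0v
                givenᵛ (:1 ∙ᵛ a :· V :⊕ c :· w :≈ :0v) ∷ (:0v :⊖ V ∙ˢ a := :0) ∷ []) refl a c (vec 1ᴸ (b *ᴸ 1ᴸ)) w₁ eq a≡0)
                where
                a≡0 : a ≡ 0#
                a≡0 = decidable-stable (a ≟ 0#) λ a≢0 → ι≢0 a≢0 (SL.solve 5 (λ a c V W X → a := :0 given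
                  (:- a ∙ V := :1) ∷ (:- c ∙ W := :0) ∷ (:- :1 ∙ X := a :* V :+ c :* W) ∷ (:1 ∙ X := :0) ∷ [])
                  refl (ι a) (ι c) (X (vec 1ᴸ (b *ᴸ 1ᴸ))) (X w₁) (X (a · vec 1ᴸ (b *ᴸ 1ᴸ) ⊕ c · w₁)) (X-vec _ _) Xw₁ (X-lin a c _ w₁) (proj₁ (0v-parts eq)))
              go : Span (vec 1ᴸ (b *ᴸ 1ᴸ)) w₁ h → ∃[ a ] g ≡ ι a *ᴸ m
              go (c , a , eq) = a , (SL.solve 9 (λ a c m g V V' W Xh Yh → g := a :* m given
                (:- :1 ∙ Yh := g) ∷ (:1 ∙ Yh := c :* V' :+ a :* m) ∷
                (:- V' ∙ Xh := c :* V :+ a :* W) ∷ (V' ∙ Xh := :0) ∷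
                (:- (V' :* c) ∙ V := :1) ∷ (:- (V' :* a) ∙ W := :0) ∷ [])
                refl (ι a) (ι c) m g (X (vec 1ᴸ (b *ᴸ 1ᴸ))) (Y (vec 1ᴸ (b *ᴸ 1ᴸ))) (X w₁) (X h) (Y h) Yh (trans (cong Y eq) (Y-lin c a _ w₁)) (trans (cong X eq) (X-lin c a _ w₁)) Xh (X-vec _ _) Xw₁)

            contradictory : ⊥
            contradictory = finish proportional
              where
              finish : ∃[ a ] g ≡ ι a *ᴸ m → ⊥
              finish (a , eq) = no-two-chords j₂ x (v 1#) (v (- 1#)) (Sv 1#) (Sv (- 1#))
                  (λ e → m≢0 (SL.solve 3 (λ m o X → m := :0 given (:- :1 ∙ X := o :* m) ∷ (:1 ∙ X := :0) ∷
                    (:- m ∙ o := :1) ∷ []) refl m (ι 1#) (X (v 1#)) (Xv 1#) e ι-1))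
                  (λ e → m≢0 (SL.solve 4 (λ m o n X → m := :0 given (:1 ∙ X := n :* m) ∷ (:- :1 ∙ X := :0) ∷
                    (m ∙ n := :- o) ∷ (:- m ∙ o := :1) ∷ [])
                    refl m (ι 1#) (ι (- 1#)) (X (v (- 1#))) (Xv (- 1#)) e (ι-neg 1#) ι-1))
                  (λ e → FL.*-nonzero 2ᴸ≢0 m≢0 (SL.solve 5 (λ m o n X X' → (:1 :+ :1) :* m := :0 given (:- :1 ∙ X := o :* m) ∷
                    (:1 ∙ X' := n :* m) ∷ (:1 ∙ X := X') ∷ (m ∙ n := :- o) ∷ (:- (m :+ m) ∙ o := :1) ∷ [])
                    refl m (ι 1#) (ι (- 1#)) (X (v 1#)) (X (v (- 1#))) (Xv 1#) (Xv (- 1#)) e (ι-neg 1#) ι-1))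
                  (on-chord 1#) (on-chord (- 1#))
                where
                e≡ : Y w₂ ≡ ι a *ᴸ (m *ᴸ m)
                e≡ = SL.solve 4 (λ a m i e → e := a :* (m :* m) given (m ∙ e :* i := a :* m) ∷ (:- e ∙ m :* i := :1) ∷ [])
                  refl (ι a) m i (Y w₂) eq (FL.x*inv≡1 m m≢0)
                a≢0 : a ≢ 0#
                a≢0 a≡0 = Y≢0 w₂≢0 Xw₂ (trans e≡ (SL.solve 2 (λ z m → z :* (m :* m) := :0 given (m :* m ∙ z := :0) ∷ [])
                  refl (ι a) m (trans (cong ι a≡0) ι-0)))
                k : K
                k = inv a a≢0
                half : E₀
                half = FL.inv _ 2ᴸ≢0
                x : E₀
                x = half *ᴸ b
                -- Since Y w₂ = am² and k = 1/a, this is (tm, btm + t²m²), the chord from the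
                -- abscissa b/2 to b/2 + tm; t = 1 and t = - 1 give the two chords.
                v : K → Pt
                v t = t · vec m (b *ᴸ m) ⊕ (t * t * k) · w₂
                Sv : ∀ t → S′ j₂ (v t)
                Sv t = S′-lin {j₂} t (t * t * k) S₂ Sw₂
                Xv : ∀ t → X (v t) ≡ ι t *ᴸ m
                Xv t = SL.solve 6 (λ t s m V W X → X := t :* m given
                  (:1 ∙ X := t :* V :+ s :* W) ∷ (t ∙ V := m) ∷ (s ∙ W := :0) ∷ [])
                  refl (ι t) (ι (t * t * k)) m (X (vec m (b *ᴸ m))) (X w₂) (X (v t)) (X-lin t _ _ w₂) (X-vec _ _) Xw₂
                ιt²≡ : ∀ t → ι (t * t * k) *ᴸ ι a ≡ ι t *ᴸ ι t
                ιt²≡ t = trans (sym (ι-* _ a)) (trans (cong ι (solve 3 (λ t k a → t :* t :* k :* a := t :* t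
                  given (t :* t ∙ a :* k := :1) ∷ []) refl t k a (x*inv≡1 a a≢0))) (ι-* t t))
                on-chord : ∀ t → Y (v t) ≡ X (v t) *ᴸ (x +ᴸ x +ᴸ X (v t))
                on-chord t = SL.solve 10 (λ t s a m b h e V X Y → Y := X :* (h :* b :+ h :* b :+ X) given
                  (:1 ∙ Y := t :* V :+ s :* e) ∷ (t ∙ V := b :* m) ∷ (s ∙ e := a :* (m :* m)) ∷
                  (m :* m ∙ s :* a := t :* t) ∷ (:- (h :* b :+ h :* b :+ X :+ t :* m) ∙ X := t :* m) ∷
                  (:- (t :* m :* b) ∙ (:1 :+ :1) :* h := :1) ∷ [])
                  refl (ι t) (ι (t * t * k)) (ι a) m b half (Y w₂) (Y (vec m (b *ᴸ m))) (X (v t)) (Y (v t)) (Y-lin t _ _ w₂) (Y-vec _ _) e≡ (ιt²≡ t) (Xv t) (FL.x*inv≡1 _ 2ᴸ≢0)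

      impossible : ⊥
      impossible = first (mixed-vertical {b} {1ᴸ} mixed FL.1≢0 S₁)
        where
        first : Vertical j₁ → ⊥
        first (w₁ , Sw₁ , w₁≢0 , Xw₁) = second (mixed-vertical {b} {m} mixed m≢0 S₂)
          where
          open WithFirst Sw₁ w₁≢0 Xw₁
          second : Vertical j₂ → ⊥
          second (w₂ , Sw₂ , w₂≢0 , Xw₂) = third (mixed-vertical {b′} {1ᴸ} mixed′ FL.1≢0 S₃)
            where
            open WithSecond Sw₂ w₂≢0 Xw₂
            third : Vertical j₃ → ⊥
            third (w₃ , Sw₃ , w₃≢0 , Xw₃) = WithThird.contradictory Sw₃ w₃≢0 Xw₃

    S′⇒S : ∀ j → ∃[ i ] S′ j ≐ S i
    S′⇒S j = case classify j of λ where
        (inj₂ (u , w , Su , Sw , Xu , Xw)) → let i , _ , _ , e = OnGraph.graph⇒S {j} Su Sw Xu Xw in i , e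
        (inj₁ vertical) → on-vertical vertical (isLine j)
      where
      X≡0 : Vertical j → ∀ {u} → S′ j u → X u ≡ 0ᴸ
      X≡0 vertical {u} Su = decidable-stable (X u ≟ 0ᴸ) λ Xu≢0 → Impossible.impossible {Y u *ᴸ FL.inv _ Xu≢0}
        (j , vertical , u , Su , Xu≢0 , (SL.solve 3 (λ x y i → y := y :* i :* x given (:- y ∙ x :* i := :1) ∷ [])
          refl (X u) (Y u) (FL.inv _ Xu≢0) (FL.x*inv≡1 _ Xu≢0)))
      on-vertical : Vertical j → IsLineAtInf (S′ j) → ∃[ i ] S′ j ≐ S i
      on-vertical vertical line = let i , dx≡0 , _ = vertical′ in i , line-⊂⇒≐ line (S-isLine i) λ v Sv →
          SL.solve 4 (λ d e x y → d :* y := e :* x given (y ∙ d := :0) ∷ (:- e ∙ x := :0) ∷ [])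
            refl (dx i) (dy i) (X v) (Y v) dx≡0 (X≡0 vertical Sv)
        where vertical′ = Bruck.vertical F E M 2≢0

    sameSpread : SameSpread S S′
    sameSpread = (λ i → go i (covers (vec (1ᴸ *ᴸ dx i) (1ᴸ *ᴸ dy i)) (v≢0 i))) , S′⇒S
      where
      v≢0 : ∀ i → vec (1ᴸ *ᴸ dx i) (1ᴸ *ᴸ dy i) ≢ 0v
      v≢0 i eq = d≢0 i (trans (sym (FL.*-identityˡ _)) (trans (sym (X-vec _ _)) (proj₁ (0v-parts eq))) ,
                        trans (sym (FL.*-identityˡ _)) (trans (sym (Y-vec _ _)) (proj₂ (0v-parts eq))))
      -- The line of `S′` through a vector of `S i` is some `S i′`, and the common vector forces i′
      -- = i.
      go : ∀ i → (∃[ j ] S′ j (vec (1ᴸ *ᴸ dx i) (1ᴸ *ᴸ dy i))) → ∃[ j ] S i ≐ S′ j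
      go i (j , Sv) = let i′ , e = S′⇒S j in
        j , λ x → let e′ = subst (λ i → S′ j ≐ S i) (S-same (v≢0 i) (proj₁ (e _) Sv) (S-vec i 1ᴸ)) e in proj₂ (e′ x) , proj₁ (e′ x)

theorem1p2 : (q : ℕ) → 7 ≤ q → Odd q → IsPrimePower q →
    (F : FiniteField q) →
    (𝒞 : Subset (Geometry.Pt F)) → (𝒫 : SetOfSubsets (Geometry.Pt F)) →
    Geometry.CSystem F 𝒞 𝒫 →
    Conclusion F 𝒞
theorem1p2 (suc m) 7≤q odd _ F 𝒞 𝒫 sys =
  S , S-isSpread , (Geometry.CSystem.size sys , S-arc) , sameSpread , S-regular , completesToConic
  where
  2≢0 = FieldLemmas.odd⇒2≢0 F odd
  form = Configuration.normalForm F 7≤q 𝒞 𝒫 sys 2≢0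
  nonsquare = NormalForm.nonsquare form
  extension = Construction.quadraticExtension F (NormalForm.β form) nonsquare
  model = Linearise.linearModel F form 2≢0 extension
  open Bruck F extension model 2≢0
  open Iso F extension model 2≢0 using (completesToConic)
  open Spreads F extension model 2≢0 using (S-regular)
  open Unique F extension model 2≢0 7≤q nonsquare using (sameSpread)
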